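{- Let $r\ge1$ be an integer. The number of unitary factors of finite abelian groups of order at most $x$ whose conjugates have rank at most $r$ is asymptotic, as $x\to\infty$, to $K_r\,x\log x$, where $K_r$ is a constant that depends on $r$. That is, there is a constant $K_r$ with $$\sum_G t(G)\sim K_r\,x\log x\qquad(x\to\infty),$$ where $G$ runs over isomorphism classes of finite abelian groups of order at most $x$ whose conjugate $G'$ has rank at most $r$, and $t(G)$ is the number of unitary factors of $G$.
   Context: Groups are considered up to isomorphism. A finite abelian group $G$ has unitary factors $H$ and $K$ if $G\cong H\oplus K$ and $H$ and $K$ have no common non-trivial direct factor (up to isomorphism). The number $t(G)$ of unitary factors of $G$ is the number of isomorphism classes of groups $H$ for which such a $K$ exists. The rank of a finite abelian group is its minimal number of generators. Conjugate group: for a prime $p$ and a finite abelian $p$-group $G\cong \mathbb Z/p^{a_1}\mathbb Z\oplus\cdots\oplus\mathbb Z/p^{a_r}\mathbb Z$ with $0\le a_1\le\cdots\le a_r$, the type of $G$ is the partition $\lambda=(a_1,\dots,a_r)$, and the conjugate $G'$ is the finite abelian $p$-group whose type is the conjugate (transposed) partition $\lambda'$. For a general finite abelian group, $G'$ is the direct sum of the conjugates of its $p$-primary components. -}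

module Defs where

open import Algebra.Bundles using (AbelianGroup)
import Algebra.Construct.DirectProduct as DirectProduct
import Algebra.Construct.Terminal as Terminal
import Algebra.Definitions.RawMonoid as RawMonoidDefs
open import Algebra.Morphism.Structures using (module GroupMorphisms)
import Algebra.Properties.AbelianGroup as AbelianGroupProperties
import Algebra.Properties.CommutativeMonoid.Mult as Mult
open import Data.Fin.Base using (Fin)
import Data.Integer.Base as ℤ
import Data.Integer.Properties as ℤ
import Data.Integer.Divisibility.Signed as ℤ
import Data.Integer.Tactic.RingSolver as ℤ-Solver
open import Data.List.Base using (List; []; _∷_; map; foldr; filter; length; sum; upTo; downFrom)
open import Data.List.Relation.Binary.Pointwise.Base using (Pointwise)
open import Data.List.Relation.Unary.All using (All)
open import Data.List.Relation.Unary.AllPairs using (AllPairs)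
open import Data.List.Relation.Unary.Any using (Any)
open import Data.List.Relation.Unary.Linked using (Linked)
open import Data.Nat.Base as ℕ using (ℕ; zero; suc)
import Data.Nat.Properties as ℕ
import Data.Nat.Divisibility as ℕ
open import Data.Nat.Primality using (Prime; prime?)
open import Data.Product.Base using (Σ; ∃; _×_; _,_; proj₁; proj₂)
open import Data.Rational.Base as ℚ using (ℚ; 0ℚ; 1ℚ; ½)
import Data.Rational.Properties as ℚ
open import Data.Rational.Literals using (fromℤ)
import Data.Rational.Solver as ℚ-Solver
import Data.Rational.Unnormalised.Base as ℚᵘ
import Data.Rational.Unnormalised.Properties as ℚᵘ
open import Data.Sum.Base using (inj₁; inj₂)
open import Function.Bundles using (Inverse)
open import Level using (0ℓ)
open import Relation.Binary.PropositionalEquality as ≡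
  using (_≡_; refl; sym; trans; cong; cong₂; subst; subst₂)
open import Relation.Nullary using (¬_; _×-dec_)

------------------------------------------------------------------------
-- Auxiliary facts about rational numbers

module Rationals where
  open import Data.Rational.Base
  open ℚ.≤-Reasoning
  open ℚ-Solver.+-*-Solver

  p≤∣p∣ : ∀ p → p ≤ ∣ p ∣
  p≤∣p∣ p with ℚ.≤-total 0ℚ p
  ... | inj₁ 0≤p = ℚ.≤-reflexive (sym (ℚ.0≤p⇒∣p∣≡p 0≤p))
  ... | inj₂ p≤0 = ℚ.≤-trans p≤0 (ℚ.0≤∣p∣ p)

  ∣p∣≤q : ∀ {p q} → p ≤ q → - p ≤ q → ∣ p ∣ ≤ q
  ∣p∣≤q {p} {q} p≤q -p≤q with ℚ.∣p∣≡p∨∣p∣≡-p p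
  ... | inj₁ e = subst (_≤ q) (sym e) p≤q
  ... | inj₂ e = subst (_≤ q) (sym e) -p≤q

  neg-minus : ∀ p q → - (p - q) ≡ q - p
  neg-minus = solve 2 (λ p q → :- (p :- q) := q :- p) refl

  ∣p-q∣≡∣q-p∣ : ∀ p q → ∣ p - q ∣ ≡ ∣ q - p ∣
  ∣p-q∣≡∣q-p∣ p q = trans (sym (ℚ.∣-p∣≡∣p∣ (p - q))) (cong ∣_∣ (neg-minus p q))

  minus≤ : ∀ {p q r} → p ≤ q + r → p - q ≤ r
  minus≤ {p} {q} {r} le = begin
    p - q      ≤⟨ ℚ.+-monoˡ-≤ (- q) le ⟩
    q + r - q  ≡⟨ solve 2 (λ q r → q :+ r :- q := r) refl q r ⟩
    r          ∎

  ≤minus : ∀ p q → p ≤ q + ∣ p - q ∣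
  ≤minus p q = begin
    p              ≡⟨ solve 2 (λ p q → p := q :+ (p :- q)) refl p q ⟩
    q + (p - q)    ≤⟨ ℚ.+-monoʳ-≤ q (p≤∣p∣ (p - q)) ⟩
    q + ∣ p - q ∣  ∎

  -- If p ≤ q + d and q ≤ p + d then p and q are within d of each other.
  close : ∀ {p q d} → p ≤ q + d → q ≤ p + d → ∣ p - q ∣ ≤ d
  close {p} {q} p≤ q≤ =
    ∣p∣≤q (minus≤ p≤) (subst (_≤ _) (sym (neg-minus p q)) (minus≤ q≤))

  closeʳ : ∀ {p q d} → ∣ p - q ∣ ≤ d → q ≤ p + d
  closeʳ {p} {q} {d} le = ℚ.≤-trans (≤minus q p)
    (ℚ.+-monoʳ-≤ p (subst (_≤ d) (∣p-q∣≡∣q-p∣ p q) le))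

  ∣∣-∣∣-≤ : ∀ p q → ∣ ∣ p ∣ - ∣ q ∣ ∣ ≤ ∣ p - q ∣
  ∣∣-∣∣-≤ p q = close (half p q)
    (subst (λ d → ∣ q ∣ ≤ ∣ p ∣ + d) (∣p-q∣≡∣q-p∣ q p) (half q p))
    where
    half : ∀ p q → ∣ p ∣ ≤ ∣ q ∣ + ∣ p - q ∣
    half p q = begin
      ∣ p ∣              ≡⟨ cong ∣_∣ (solve 2 (λ p q → p := q :+ (p :- q)) refl p q) ⟩
      ∣ q + (p - q) ∣    ≤⟨ ℚ.∣p+q∣≤∣p∣+∣q∣ q (p - q) ⟩
      ∣ q ∣ + ∣ p - q ∣  ∎

  ⊔-contracts : ∀ p q → ∣ (0ℚ ⊔ p) - (0ℚ ⊔ q) ∣ ≤ ∣ p - q ∣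
  ⊔-contracts p q = close (half p q)
    (subst (λ d → 0ℚ ⊔ q ≤ (0ℚ ⊔ p) + d) (∣p-q∣≡∣q-p∣ q p) (half q p))
    where
    half : ∀ p q → 0ℚ ⊔ p ≤ (0ℚ ⊔ q) + ∣ p - q ∣
    half p q = ℚ.⊔-lub
      (ℚ.+-mono-≤ (ℚ.p≤p⊔q 0ℚ q) (ℚ.0≤∣p∣ (p - q)))
      (ℚ.≤-trans (≤minus p q) (ℚ.+-monoˡ-≤ ∣ p - q ∣ (ℚ.p≤q⊔p 0ℚ q)))

  triangle : ∀ p q r {d e} → ∣ p - q ∣ ≤ d → ∣ q - r ∣ ≤ e → ∣ p - r ∣ ≤ d + e
  triangle p q r {d} {e} p-q q-r = begin
    ∣ p - r ∣              ≡⟨ cong ∣_∣ (solve 3 (λ p q r → p :- r := (p :- q) :+ (q :- r)) refl p q r) ⟩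
    ∣ (p - q) + (q - r) ∣  ≤⟨ ℚ.∣p+q∣≤∣p∣+∣q∣ (p - q) (q - r) ⟩
    ∣ p - q ∣ + ∣ q - r ∣  ≤⟨ ℚ.+-mono-≤ p-q q-r ⟩
    d + e                  ∎

  mul-mono : ∀ {p q r s} → 0ℚ ≤ p → 0ℚ ≤ s → p ≤ q → r ≤ s → p * r ≤ q * s
  mul-mono {p} {q} {r} {s} 0≤p 0≤s p≤q r≤s = begin
    p * r  ≤⟨ ℚ.*-monoˡ-≤-nonNeg p {{ℚ.nonNegative 0≤p}} r≤s ⟩
    p * s  ≤⟨ ℚ.*-monoʳ-≤-nonNeg s {{ℚ.nonNegative 0≤s}} p≤q ⟩
    q * s  ∎

  0≤* : ∀ {p q} → 0ℚ ≤ p → 0ℚ ≤ q → 0ℚ ≤ p * q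
  0≤* {p} {q} 0≤p 0≤q = subst (_≤ p * q) (ℚ.*-zeroˡ 0ℚ) (mul-mono ℚ.≤-refl 0≤q 0≤p 0≤q)

  shrink : ∀ p q → 0ℚ ≤ p → q ≤ 1ℚ → p * q ≤ p
  shrink p q 0≤p q≤1 = subst (p * q ≤_) (ℚ.*-identityʳ p)
    (ℚ.*-monoˡ-≤-nonNeg p {{ℚ.nonNegative 0≤p}} q≤1)

  0≤+ : ∀ {p q} → 0ℚ ≤ p → 0ℚ ≤ q → 0ℚ ≤ p + q
  0≤+ = ℚ.+-mono-≤

  halve : ℚ → ℚ
  halve p = p * ½

  halve-+ : ∀ p → halve p + halve p ≡ p
  halve-+ p = trans (sym (ℚ.*-distribˡ-+ p ½ ½)) (ℚ.*-identityʳ p)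

  0<halve : ∀ {p} → 0ℚ < p → 0ℚ < halve p
  0<halve {p} 0<p = ℚ.positive⁻¹ (halve p) {{ℚ.pos*pos⇒pos p {{ℚ.positive 0<p}} ½}}

  fromℕ : ℕ → ℚ
  fromℕ n = fromℤ (ℤ.+ n)

  fromℕ-suc : ∀ n → fromℕ (suc n) ≡ 1ℚ + fromℕ n
  fromℕ-suc n = sym (ℚ.toℚᵘ-injective (ℚᵘ.≃-trans (ℚ.toℚᵘ-homo-+ 1ℚ (fromℕ n))
    (ℚᵘ.*≡* (cong (λ m → (ℤ.1ℤ ℤ.+ m) ℤ.* ℤ.1ℤ) (ℤ.*-identityʳ (ℤ.+ n))))))

  0≤fromℕ : ∀ n → 0ℚ ≤ fromℕ n
  0≤fromℕ n = ℚ.nonNegative⁻¹ (fromℕ n)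

  archimedes : ∀ p → ∃ λ n → p ≤ fromℕ n
  archimedes p@(mkℚ (ℤ.+ m) d _) =
    m , *≤* (ℤ.*-monoˡ-≤-nonNeg (ℤ.+ m) (ℤ.+≤+ (ℕ.s≤s (ℕ.z≤n {d}))))
  archimedes p@(mkℚ ℤ.-[1+ _ ] _ _) = 0 , ℚ.nonPositive⁻¹ p

  -- 2⁻ᵏ
  1/pow₂ : ℕ → ℚ
  1/pow₂ zero    = 1ℚ
  1/pow₂ (suc k) = halve (1/pow₂ k)

  0≤1/pow₂ : ∀ k → 0ℚ ≤ 1/pow₂ k
  0≤1/pow₂ zero    = 0≤fromℕ 1
  0≤1/pow₂ (suc k) = 0≤* (0≤1/pow₂ k) (ℚ.nonNegative⁻¹ ½)

  0<1/pow₂ : ∀ k → 0ℚ < 1/pow₂ k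
  0<1/pow₂ zero    = ℚ.positive⁻¹ 1ℚ
  0<1/pow₂ (suc k) = 0<halve (0<1/pow₂ k)

  1/pow₂≤1 : ∀ k → 1/pow₂ k ≤ 1ℚ
  1/pow₂≤1 zero    = ℚ.≤-refl
  1/pow₂≤1 (suc k) = mul-mono (0≤1/pow₂ k) (0≤fromℕ 1) (1/pow₂≤1 k) (ℚ.p≤p⊔q ½ 1ℚ)

  fromℕ*1/pow₂≤1 : ∀ k → fromℕ k * 1/pow₂ k ≤ 1ℚ
  fromℕ*1/pow₂≤1 zero    = subst (_≤ 1ℚ) (sym (ℚ.*-zeroˡ 1ℚ)) (0≤fromℕ 1)
  fromℕ*1/pow₂≤1 (suc k) = begin
    fromℕ (suc k) * (1/pow₂ k * ½)               ≡⟨ cong (_* (1/pow₂ k * ½)) (fromℕ-suc k) ⟩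
    (1ℚ + fromℕ k) * (1/pow₂ k * ½)              ≡⟨ solve 3 (λ n h p → (con 1ℚ :+ n) :* (p :* h) := p :* h :+ (n :* p) :* h) refl (fromℕ k) ½ (1/pow₂ k) ⟩
    halve (1/pow₂ k) + halve (fromℕ k * 1/pow₂ k) ≤⟨ ℚ.+-mono-≤ (ℚ.*-monoʳ-≤-nonNeg ½ (1/pow₂≤1 k)) (ℚ.*-monoʳ-≤-nonNeg ½ (fromℕ*1/pow₂≤1 k)) ⟩
    halve 1ℚ + halve 1ℚ                          ≡⟨ halve-+ 1ℚ ⟩
    1ℚ                                           ∎

  1/pow₂-small : ∀ p {ε} → 0ℚ < ε → ∃ λ k → 1/pow₂ k * p ≤ ε
  1/pow₂-small p {ε} 0<ε with archimedes (p * (1/ ε) {{>-nonZero 0<ε}})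
  ... | n , le = n , (begin
    1/pow₂ n * p              ≡⟨ cong (1/pow₂ n *_) (ℚ.*-identityʳ p) ⟨
    1/pow₂ n * (p * 1ℚ)       ≡⟨ cong (λ o → 1/pow₂ n * (p * o)) (ℚ.*-inverseˡ ε) ⟨
    1/pow₂ n * (p * (r * ε))  ≡⟨ solve 4 (λ q p r e → q :* (p :* (r :* e)) := q :* (p :* r) :* e) refl (1/pow₂ n) p r ε ⟩
    1/pow₂ n * (p * r) * ε    ≤⟨ ℚ.*-monoʳ-≤-nonNeg ε (ℚ.*-monoˡ-≤-nonNeg (1/pow₂ n) {{ℚ.nonNegative (0≤1/pow₂ n)}} le) ⟩
    1/pow₂ n * fromℕ n * ε    ≡⟨ cong (_* ε) (ℚ.*-comm (1/pow₂ n) (fromℕ n)) ⟩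
    fromℕ n * 1/pow₂ n * ε    ≤⟨ ℚ.*-monoʳ-≤-nonNeg ε (fromℕ*1/pow₂≤1 n) ⟩
    1ℚ * ε                    ≡⟨ ℚ.*-identityˡ ε ⟩
    ε                         ∎)
    where
    instance
      ε≢0 : NonZero ε
      ε≢0 = >-nonZero 0<ε
      ε≥0 : NonNegative ε
      ε≥0 = ℚ.nonNegative (ℚ.<⇒≤ 0<ε)
    r : ℚ
    r = 1/ ε

  sumBelow : ℕ → (ℕ → ℚ) → ℚ
  sumBelow zero    f = 0ℚ
  sumBelow (suc n) f = sumBelow n f + f n

  sumBelow-≤ : ∀ n {f g} → (∀ i → f i ≤ g i) → sumBelow n f ≤ sumBelow n g
  sumBelow-≤ zero    f≤g = ℚ.≤-refl
  sumBelow-≤ (suc n) f≤g = ℚ.+-mono-≤ (sumBelow-≤ n f≤g) (f≤g n)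

  sumBelow-+ : ∀ n f g → sumBelow n (λ i → f i + g i) ≡ sumBelow n f + sumBelow n g
  sumBelow-+ zero    f g = refl
  sumBelow-+ (suc n) f g = trans (cong (_+ (f n + g n)) (sumBelow-+ n f g))
    (solve 4 (λ a b c d → (a :+ b) :+ (c :+ d) := (a :+ c) :+ (b :+ d)) refl
      (sumBelow n f) (sumBelow n g) (f n) (g n))

  sumBelow-double : ∀ n f →
    sumBelow (n ℕ.+ n) f ≡ sumBelow n (λ i → f (i ℕ.+ i) + f (suc (i ℕ.+ i)))
  sumBelow-double zero    f = refl
  sumBelow-double (suc n) f rewrite ℕ.+-suc n n =
    trans (ℚ.+-assoc (sumBelow (n ℕ.+ n) f) (f (n ℕ.+ n)) (f (suc (n ℕ.+ n))))
          (cong (_+ (f (n ℕ.+ n) + f (suc (n ℕ.+ n)))) (sumBelow-double n f))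

  sumBelow-pow₂ : ∀ k f →
    sumBelow (2 ℕ.^ suc k) f ≡ sumBelow (2 ℕ.^ k) (λ i → f (i ℕ.+ i) + f (suc (i ℕ.+ i)))
  sumBelow-pow₂ k f rewrite ℕ.+-identityʳ (2 ℕ.^ k) = sumBelow-double (2 ℕ.^ k) f

  sumBelow-const : ∀ k p → sumBelow (2 ℕ.^ k) (λ _ → 1/pow₂ k * p) ≡ p
  sumBelow-const zero    p = solve 1 (λ p → con 0ℚ :+ con 1ℚ :* p := p) refl p
  sumBelow-const (suc k) p = trans (sumBelow-pow₂ k _)
    (trans (cong (λ c → sumBelow (2 ℕ.^ k) (λ _ → c))
             (trans (sym (ℚ.*-distribʳ-+ p (halve (1/pow₂ k)) (halve (1/pow₂ k))))
                    (cong (_* p) (halve-+ (1/pow₂ k)))))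
           (sumBelow-const k p))

  0<1+ : ∀ {p} → 0ℚ ≤ p → 0ℚ < 1ℚ + p
  0<1+ = ℚ.+-mono-<-≤ (ℚ.positive⁻¹ 1ℚ)

  recip : ∀ p → .(0ℚ ≤ p) → ℚ
  recip p 0≤p = (1/ (1ℚ + p)) {{>-nonZero (0<1+ 0≤p)}}

  recip-* : ∀ p .(0≤p : 0ℚ ≤ p) → recip p 0≤p * (1ℚ + p) ≡ 1ℚ
  recip-* p 0≤p = ℚ.*-inverseˡ (1ℚ + p) {{>-nonZero (0<1+ 0≤p)}}

  0≤recip : ∀ p (0≤p : 0ℚ ≤ p) → 0ℚ ≤ recip p 0≤p
  0≤recip p 0≤p = ℚ.<⇒≤ (ℚ.positive⁻¹ _ {{ℚ.1/pos⇒pos (1ℚ + p) {{ℚ.positive (0<1+ 0≤p)}}}})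

  recip≤1 : ∀ p (0≤p : 0ℚ ≤ p) → recip p 0≤p ≤ 1ℚ
  recip≤1 p 0≤p = begin
    r             ≡⟨ ℚ.+-identityʳ r ⟨
    r + 0ℚ        ≤⟨ ℚ.+-monoʳ-≤ r (0≤* (0≤recip p 0≤p) 0≤p) ⟩
    r + r * p     ≡⟨ solve 2 (λ r p → r :+ r :* p := r :* (con 1ℚ :+ p)) refl r p ⟩
    r * (1ℚ + p)  ≡⟨ recip-* p 0≤p ⟩
    1ℚ            ∎
    where r = recip p 0≤p

  0≤j* : ∀ j {h} → 0ℚ ≤ h → 0ℚ ≤ fromℕ j * h
  0≤j* j = 0≤* (0≤fromℕ j)

  term : ℕ → (h : ℚ) → .(0ℚ ≤ h) → ℚ
  term j h 0≤h = (h ÷ (1ℚ + fromℕ j * h)) {{>-nonZero (0<1+ (0≤j* j 0≤h))}}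

  term-contracts : ∀ j {h h′} (0≤h : 0ℚ ≤ h) (0≤h′ : 0ℚ ≤ h′) →
                   term j h 0≤h ≤ term j h′ 0≤h′ + ∣ h - h′ ∣
  term-contracts j {h} {h′} 0≤h 0≤h′ = begin
    h * r                                  ≡⟨ expand ⟩
    h′ * r′ + (h - h′) * (r * r′)          ≤⟨ ℚ.+-monoʳ-≤ (h′ * r′) (p≤∣p∣ _) ⟩
    h′ * r′ + ∣ (h - h′) * (r * r′) ∣      ≡⟨ cong (h′ * r′ +_) (ℚ.∣p*q∣≡∣p∣*∣q∣ (h - h′) (r * r′)) ⟩
    h′ * r′ + ∣ h - h′ ∣ * ∣ r * r′ ∣      ≡⟨ cong (λ x → h′ * r′ + ∣ h - h′ ∣ * x) (ℚ.0≤p⇒∣p∣≡p (0≤* 0≤r 0≤r′)) ⟩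
    h′ * r′ + ∣ h - h′ ∣ * (r * r′)        ≤⟨ ℚ.+-monoʳ-≤ (h′ * r′) (shrink ∣ h - h′ ∣ (r * r′) (ℚ.0≤∣p∣ (h - h′)) r*r′≤1) ⟩
    h′ * r′ + ∣ h - h′ ∣                   ∎
    where
    J = fromℕ j
    r = recip (J * h) (0≤j* j 0≤h)
    r′ = recip (J * h′) (0≤j* j 0≤h′)
    0≤r = 0≤recip (J * h) (0≤j* j 0≤h)
    0≤r′ = 0≤recip (J * h′) (0≤j* j 0≤h′)
    r*r′≤1 : r * r′ ≤ 1ℚ
    r*r′≤1 = ℚ.≤-trans (shrink r r′ 0≤r (recip≤1 (J * h′) (0≤j* j 0≤h′))) (recip≤1 (J * h) (0≤j* j 0≤h))
    expand : h * r ≡ h′ * r′ + (h - h′) * (r * r′)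
    expand = begin-equality
      h * r                                        ≡⟨ solve 4 (λ h r h′ r′ → h :* r := h :* r :* con 1ℚ :+ h′ :* r′ :* (con 1ℚ :- con 1ℚ)) refl h r h′ r′ ⟩
      h * r * 1ℚ + h′ * r′ * (1ℚ - 1ℚ)             ≡⟨ cong₂ (λ a b → h * r * a + h′ * r′ * (1ℚ - b)) (recip-* (J * h′) (0≤j* j 0≤h′)) (recip-* (J * h) (0≤j* j 0≤h)) ⟨
      h * r * (r′ * (1ℚ + J * h′)) + h′ * r′ * (1ℚ - r * (1ℚ + J * h))
        ≡⟨ solve 5 (λ h r h′ r′ J →
             h :* r :* (r′ :* (con 1ℚ :+ J :* h′)) :+ h′ :* r′ :* (con 1ℚ :- r :* (con 1ℚ :+ J :* h))
             := h′ :* r′ :+ (h :- h′) :* (r :* r′)) refl h r h′ r′ J ⟩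
      h′ * r′ + (h - h′) * (r * r′)                ∎

  fromℕ-+ : ∀ m n → fromℕ (m ℕ.+ n) ≡ fromℕ m + fromℕ n
  fromℕ-+ zero    n = sym (ℚ.+-identityˡ (fromℕ n))
  fromℕ-+ (suc m) n = trans (fromℕ-suc (m ℕ.+ n)) (trans (cong (1ℚ +_) (fromℕ-+ m n))
    (trans (sym (ℚ.+-assoc 1ℚ (fromℕ m) (fromℕ n))) (cong (_+ fromℕ n) (sym (fromℕ-suc m)))))

  recip-cong : ∀ {p q} .{0≤p : 0ℚ ≤ p} .{0≤q : 0ℚ ≤ q} → p ≡ q → recip p 0≤p ≡ recip q 0≤q
  recip-cong refl = refl

  -- Splitting a cell of width h + h in two changes its contribution by at most h².
  module _ (i : ℕ) (h : ℚ) (0≤h : 0ℚ ≤ h) (H : ℚ) (0≤H : 0ℚ ≤ H) (H≡ : H ≡ h + h) where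
    private
      a b r s : ℚ
      a = fromℕ (suc (i ℕ.+ i))
      b = fromℕ (suc (suc (i ℕ.+ i)))
      r = recip (a * h) (0≤j* (suc (i ℕ.+ i)) 0≤h)
      s = recip (b * h) (0≤j* (suc (suc (i ℕ.+ i))) 0≤h)

      coarse fine : ℚ
      coarse = term (suc i) H 0≤H
      fine = term (suc (i ℕ.+ i)) h 0≤h + term (suc (suc (i ℕ.+ i))) h 0≤h

      width : fromℕ (suc i) * H ≡ b * h
      width = begin-equality
        fromℕ (suc i) * H                        ≡⟨ cong (fromℕ (suc i) *_) H≡ ⟩
        fromℕ (suc i) * (h + h)                  ≡⟨ solve 2 (λ j h → j :* (h :+ h) := (j :+ j) :* h) refl (fromℕ (suc i)) h ⟩
        (fromℕ (suc i) + fromℕ (suc i)) * h      ≡⟨ cong (_* h) (fromℕ-+ (suc i) (suc i)) ⟨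
        fromℕ (suc i ℕ.+ suc i) * h              ≡⟨ cong (λ n → fromℕ (suc n) * h) (ℕ.+-suc i i) ⟩
        b * h                                    ∎

      gain : fine ≡ coarse + h * h * (r * s)
      gain = begin-equality
        h * r + h * s
          ≡⟨ solve 3 (λ h r s → h :* r :+ h :* s := h :* r :* con 1ℚ :+ h :* s :+ h :* s :* (con 1ℚ :- con 1ℚ)) refl h r s ⟩
        h * r * 1ℚ + h * s + h * s * (1ℚ - 1ℚ)
          ≡⟨ cong₂ (λ x y → h * r * x + h * s + h * s * (1ℚ - y))
               (trans (cong (λ c → s * (1ℚ + c * h)) (sym (fromℕ-suc (suc (i ℕ.+ i))))) (recip-* (b * h) (0≤j* (suc (suc (i ℕ.+ i))) 0≤h)))
               (recip-* (a * h) (0≤j* (suc (i ℕ.+ i)) 0≤h)) ⟨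
        h * r * (s * (1ℚ + (1ℚ + a) * h)) + h * s + h * s * (1ℚ - r * (1ℚ + a * h))
          ≡⟨ solve 4 (λ h r s a →
               h :* r :* (s :* (con 1ℚ :+ (con 1ℚ :+ a) :* h)) :+ h :* s :+ h :* s :* (con 1ℚ :- r :* (con 1ℚ :+ a :* h))
               := (h :+ h) :* s :+ h :* h :* (r :* s)) refl h r s a ⟩
        (h + h) * s + h * h * (r * s)
          ≡⟨ cong (_+ h * h * (r * s)) (cong₂ _*_ H≡ (recip-cong {0≤p = 0≤j* (suc i) 0≤H} {0≤q = 0≤j* (suc (suc (i ℕ.+ i))) 0≤h} width)) ⟨
        coarse + h * h * (r * s) ∎

      0≤r : 0ℚ ≤ r
      0≤r = 0≤recip (a * h) (0≤j* (suc (i ℕ.+ i)) 0≤h)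
      0≤s : 0ℚ ≤ s
      0≤s = 0≤recip (b * h) (0≤j* (suc (suc (i ℕ.+ i))) 0≤h)

      r*s≤1 : r * s ≤ 1ℚ
      r*s≤1 = ℚ.≤-trans (shrink r s 0≤r (recip≤1 (b * h) (0≤j* (suc (suc (i ℕ.+ i))) 0≤h)))
                        (recip≤1 (a * h) (0≤j* (suc (i ℕ.+ i)) 0≤h))

    refine-lower : coarse ≤ fine
    refine-lower = begin
      coarse                    ≡⟨ ℚ.+-identityʳ coarse ⟨
      coarse + 0ℚ               ≤⟨ ℚ.+-monoʳ-≤ coarse (0≤* (0≤* 0≤h 0≤h) (0≤* 0≤r 0≤s)) ⟩
      coarse + h * h * (r * s)  ≡⟨ gain ⟨
      fine                      ∎

    refine-upper : fine ≤ coarse + h * h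
    refine-upper = begin
      fine                      ≡⟨ gain ⟩
      coarse + h * h * (r * s)  ≤⟨ ℚ.+-monoʳ-≤ coarse (shrink (h * h) (r * s) (0≤* 0≤h 0≤h) r*s≤1) ⟩
      coarse + h * h            ∎

  mesh : ℕ → ℚ → ℚ
  mesh k u = 1/pow₂ k * u

  0≤mesh : ∀ k {u} → 0ℚ ≤ u → 0ℚ ≤ mesh k u
  0≤mesh k = 0≤* (0≤1/pow₂ k)

  -- The right Riemann sum of ∫ dt/t over [1, 1 + u] with 2ᵏ equal cells:
  -- the sum of h / (1 + i h) for i = 1, …, 2ᵏ, where h = u / 2ᵏ.
  riemann : ℕ → (u : ℚ) → .(0ℚ ≤ u) → ℚ
  riemann k u 0≤u = sumBelow (2 ℕ.^ k) λ i → term (suc i) (mesh k u) (0≤mesh k 0≤u)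

  riemann-contracts : ∀ k {u v} (0≤u : 0ℚ ≤ u) (0≤v : 0ℚ ≤ v) →
                      riemann k u 0≤u ≤ riemann k v 0≤v + ∣ u - v ∣
  riemann-contracts k {u} {v} 0≤u 0≤v = begin
    riemann k u 0≤u
      ≤⟨ sumBelow-≤ (2 ℕ.^ k) (λ i → term-contracts (suc i) (0≤mesh k 0≤u) (0≤mesh k 0≤v)) ⟩
    sumBelow (2 ℕ.^ k) (λ i → term (suc i) (mesh k v) (0≤mesh k 0≤v) + ∣ mesh k u - mesh k v ∣)
      ≡⟨ sumBelow-+ (2 ℕ.^ k) _ _ ⟩
    riemann k v 0≤v + sumBelow (2 ℕ.^ k) (λ i → ∣ mesh k u - mesh k v ∣)
      ≡⟨ cong (λ c → riemann k v 0≤v + sumBelow (2 ℕ.^ k) (λ i → c)) distance ⟩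
    riemann k v 0≤v + sumBelow (2 ℕ.^ k) (λ i → 1/pow₂ k * ∣ u - v ∣)
      ≡⟨ cong (riemann k v 0≤v +_) (sumBelow-const k ∣ u - v ∣) ⟩
    riemann k v 0≤v + ∣ u - v ∣ ∎
    where
    distance : ∣ mesh k u - mesh k v ∣ ≡ 1/pow₂ k * ∣ u - v ∣
    distance = begin-equality
      ∣ 1/pow₂ k * u - 1/pow₂ k * v ∣  ≡⟨ cong ∣_∣ (solve 3 (λ p u v → p :* u :- p :* v := p :* (u :- v)) refl (1/pow₂ k) u v) ⟩
      ∣ 1/pow₂ k * (u - v) ∣           ≡⟨ ℚ.∣p*q∣≡∣p∣*∣q∣ (1/pow₂ k) (u - v) ⟩
      ∣ 1/pow₂ k ∣ * ∣ u - v ∣         ≡⟨ cong (_* ∣ u - v ∣) (ℚ.0≤p⇒∣p∣≡p (0≤1/pow₂ k)) ⟩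
      1/pow₂ k * ∣ u - v ∣             ∎

  module _ (u : ℚ) (0≤u : 0ℚ ≤ u) where
    private
      A : ℕ → ℚ
      A k = riemann k u 0≤u

      mesh-suc : ∀ k → mesh k u ≡ mesh (suc k) u + mesh (suc k) u
      mesh-suc k = trans (cong (_* u) (sym (halve-+ (1/pow₂ k))))
                         (ℚ.*-distribʳ-+ u (halve (1/pow₂ k)) (halve (1/pow₂ k)))

      step-lower : ∀ k → A k ≤ A (suc k)
      step-lower k = begin
        A k  ≤⟨ sumBelow-≤ (2 ℕ.^ k) (λ i → refine-lower i (mesh (suc k) u) (0≤mesh (suc k) 0≤u) (mesh k u) (0≤mesh k 0≤u) (mesh-suc k)) ⟩
        _    ≡⟨ sumBelow-pow₂ k _ ⟨
        A (suc k) ∎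

      e : ℕ → ℚ
      e k = 1/pow₂ k * (u * u)

      step-upper : ∀ k → A (suc k) ≤ A k + e (suc k)
      step-upper k = begin
        A (suc k)
          ≡⟨ sumBelow-pow₂ k _ ⟩
        _ ≤⟨ sumBelow-≤ (2 ℕ.^ k) (λ i → refine-upper i (mesh (suc k) u) (0≤mesh (suc k) 0≤u) (mesh k u) (0≤mesh k 0≤u) (mesh-suc k)) ⟩
        _ ≡⟨ sumBelow-+ (2 ℕ.^ k) _ _ ⟩
        A k + sumBelow (2 ℕ.^ k) (λ _ → mesh (suc k) u * mesh (suc k) u)
          ≡⟨ cong (λ c → A k + sumBelow (2 ℕ.^ k) (λ _ → c))
               (solve 3 (λ p h u → (p :* h :* u) :* (p :* h :* u) := p :* (p :* h :* h :* (u :* u))) refl (1/pow₂ k) ½ u) ⟩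
        A k + sumBelow (2 ℕ.^ k) (λ _ → 1/pow₂ k * (1/pow₂ (suc k) * ½ * (u * u)))
          ≡⟨ cong (A k +_) (sumBelow-const k _) ⟩
        A k + 1/pow₂ (suc k) * ½ * (u * u)
          ≤⟨ ℚ.+-monoʳ-≤ (A k) (ℚ.*-monoʳ-≤-nonNeg (u * u) {{ℚ.nonNegative (0≤* 0≤u 0≤u)}}
               (shrink (1/pow₂ (suc k)) ½ (0≤1/pow₂ (suc k)) (ℚ.p≤p⊔q ½ 1ℚ))) ⟩
        A k + e (suc k) ∎

      e-suc : ∀ k → e (suc k) + e (suc k) ≡ e k
      e-suc k = trans (sym (ℚ.*-distribʳ-+ (u * u) (halve (1/pow₂ k)) (halve (1/pow₂ k))))
                      (cong (_* (u * u)) (halve-+ (1/pow₂ k)))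

      lower : ∀ {k m} → k ℕ.≤′ m → A k ≤ A m
      lower ℕ.≤′-refl = ℚ.≤-refl
      lower (ℕ.≤′-step {m} k≤m) = ℚ.≤-trans (lower k≤m) (step-lower m)

      upper : ∀ {k m} → k ℕ.≤′ m → A m + e m ≤ A k + e k
      upper ℕ.≤′-refl = ℚ.≤-refl
      upper {k} (ℕ.≤′-step {m} k≤m) = begin
        A (suc m) + e (suc m)          ≤⟨ ℚ.+-monoˡ-≤ (e (suc m)) (step-upper m) ⟩
        A m + e (suc m) + e (suc m)    ≡⟨ ℚ.+-assoc (A m) (e (suc m)) (e (suc m)) ⟩
        A m + (e (suc m) + e (suc m))  ≡⟨ cong (A m +_) (e-suc m) ⟩
        A m + e m                      ≤⟨ upper k≤m ⟩
        A k + e k                      ∎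

      upper′ : ∀ {k m} → k ℕ.≤ m → A m ≤ A k + e k
      upper′ {k} {m} k≤m = begin
        A m        ≡⟨ ℚ.+-identityʳ (A m) ⟨
        A m + 0ℚ   ≤⟨ ℚ.+-monoʳ-≤ (A m) (0≤* (0≤1/pow₂ m) (0≤* 0≤u 0≤u)) ⟩
        A m + e m  ≤⟨ upper (ℕ.≤⇒≤′ k≤m) ⟩
        A k + e k  ∎

    riemann-cauchy : ∀ {k m n} → k ℕ.≤ m → k ℕ.≤ n →
                     ∣ riemann m u 0≤u - riemann n u 0≤u ∣ ≤ 1/pow₂ k * (u * u)
    riemann-cauchy {k} {m} {n} k≤m k≤n = close
      (ℚ.≤-trans (upper′ k≤m) (ℚ.+-monoˡ-≤ (e k) (lower (ℕ.≤⇒≤′ k≤n))))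
      (ℚ.≤-trans (upper′ k≤n) (ℚ.+-monoˡ-≤ (e k) (lower (ℕ.≤⇒≤′ k≤m))))

------------------------------------------------------------------------
-- Real numbers

record ℝ : Set where
  field
    seq    : ℕ → ℚ
    cauchy : ∀ {ε} → 0ℚ ℚ.< ε → ∃ λ N → ∀ {m n} → N ℕ.≤ m → N ℕ.≤ n →
             ℚ.∣ seq m ℚ.- seq n ∣ ℚ.≤ ε

open ℝ public

fromℚ : ℚ → ℝ
fromℚ q = record
  { seq    = λ _ → q
  ; cauchy = λ 0<ε → 0 , λ _ _ →
      subst (λ d → ℚ.∣ d ∣ ℚ.≤ _) (sym (ℚ.+-inverseʳ q)) (ℚ.<⇒≤ 0<ε)
  }

fromℕ : ℕ → ℝ
fromℕ n = fromℚ (fromℤ (ℤ.+ n))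

infix  4 _≤_ _<_
infixl 6 _-_
infixl 7 _*_

_≤_ : ℝ → ℝ → Set
x ≤ y = ∀ {ε} → 0ℚ ℚ.< ε → ∃ λ N → ∀ {n} → N ℕ.≤ n → seq x n ℚ.≤ seq y n ℚ.+ ε

_<_ : ℝ → ℝ → Set
x < y = ∃ λ δ → 0ℚ ℚ.< δ × ∃ λ N → ∀ {n} → N ℕ.≤ n → seq x n ℚ.+ δ ℚ.≤ seq y n

∣_∣ : ℝ → ℝ
∣ x ∣ = record
  { seq    = λ n → ℚ.∣ seq x n ∣
  ; cauchy = λ 0<ε → let N , close = cauchy x 0<ε in
      N , λ {m} {n} N≤m N≤n → ℚ.≤-trans (Rationals.∣∣-∣∣-≤ (seq x m) (seq x n)) (close N≤m N≤n)
  }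

_-_ : ℝ → ℝ → ℝ
x - y = record
  { seq    = λ n → seq x n ℚ.- seq y n
  ; cauchy = λ {ε} 0<ε →
      let M , x-close = cauchy x (0<halve 0<ε)
          N , y-close = cauchy y (0<halve 0<ε)
      in M ℕ.⊔ N , λ {m} {n} m≥ n≥ →
        subst₂ (λ p q → ℚ.∣ p ∣ ℚ.≤ q)
          (regroup (seq x m) (seq x n) (seq y m) (seq y n)) (halve-+ ε)
          (ℚ.≤-trans (ℚ.∣p-q∣≤∣p∣+∣q∣ (seq x m ℚ.- seq x n) (seq y m ℚ.- seq y n))
            (ℚ.+-mono-≤
              (x-close (ℕ.≤-trans (ℕ.m≤m⊔n M N) m≥) (ℕ.≤-trans (ℕ.m≤m⊔n M N) n≥))
              (y-close (ℕ.≤-trans (ℕ.m≤n⊔m M N) m≥) (ℕ.≤-trans (ℕ.m≤n⊔m M N) n≥))))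
  }
  where
  open Rationals
  open ℚ-Solver.+-*-Solver
  regroup : ∀ a b c d → (a ℚ.- b) ℚ.- (c ℚ.- d) ≡ (a ℚ.- c) ℚ.- (b ℚ.- d)
  regroup = solve 4 (λ a b c d → (a :- b) :- (c :- d) := (a :- c) :- (b :- d)) refl

module Bounds (x : ℝ) where
  open Rationals
  N : ℕ
  N = proj₁ (cauchy x (ℚ.positive⁻¹ 1ℚ))

  bound : ℚ
  bound = ℚ.∣ seq x N ∣ ℚ.+ 1ℚ

  0≤bound : 0ℚ ℚ.≤ bound
  0≤bound = 0≤+ (ℚ.0≤∣p∣ (seq x N)) (0≤fromℕ 1)

  bounded : ∀ {n} → N ℕ.≤ n → ℚ.∣ seq x n ∣ ℚ.≤ bound
  bounded {n} N≤n = ℚ.≤-trans (≤minus ℚ.∣ seq x n ∣ ℚ.∣ seq x N ∣)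
    (ℚ.+-monoʳ-≤ ℚ.∣ seq x N ∣ (ℚ.≤-trans (∣∣-∣∣-≤ (seq x n) (seq x N))
      (proj₂ (cauchy x (ℚ.positive⁻¹ 1ℚ)) N≤n ℕ.≤-refl)))

_*_ : ℝ → ℝ → ℝ
x * y = record
  { seq    = λ n → seq x n ℚ.* seq y n
  ; cauchy = λ {ε} 0<ε →
      let δ , 0<δ , Cδ≤ = modulus 0<ε
          M , x-close = cauchy x 0<δ
          N , y-close = cauchy y 0<δ
          L = (X.N ℕ.⊔ Y.N) ℕ.⊔ (M ℕ.⊔ N)
          L₁ : X.N ℕ.≤ L
          L₁ = ℕ.≤-trans (ℕ.m≤m⊔n X.N Y.N) (ℕ.m≤m⊔n (X.N ℕ.⊔ Y.N) (M ℕ.⊔ N))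
          L₂ : Y.N ℕ.≤ L
          L₂ = ℕ.≤-trans (ℕ.m≤n⊔m X.N Y.N) (ℕ.m≤m⊔n (X.N ℕ.⊔ Y.N) (M ℕ.⊔ N))
          L₃ : M ℕ.≤ L
          L₃ = ℕ.≤-trans (ℕ.m≤m⊔n M N) (ℕ.m≤n⊔m (X.N ℕ.⊔ Y.N) (M ℕ.⊔ N))
          L₄ : N ℕ.≤ L
          L₄ = ℕ.≤-trans (ℕ.m≤n⊔m M N) (ℕ.m≤n⊔m (X.N ℕ.⊔ Y.N) (M ℕ.⊔ N))
      in L , λ {m} {n} m≥ n≥ →
        ℚ.≤-trans
          (product-close (seq x m) (seq x n) (seq y m) (seq y n)
            (X.bounded (ℕ.≤-trans L₁ m≥)) (Y.bounded (ℕ.≤-trans L₂ n≥))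
            (x-close (ℕ.≤-trans L₃ m≥) (ℕ.≤-trans L₃ n≥))
            (y-close (ℕ.≤-trans L₄ m≥) (ℕ.≤-trans L₄ n≥))
            (ℚ.<⇒≤ 0<δ))
          Cδ≤
  }
  where
  open Rationals
  open ℚ-Solver.+-*-Solver
  open ℚ.≤-Reasoning
  module X = Bounds x
  module Y = Bounds y

  C : ℚ
  C = X.bound ℚ.+ Y.bound

  -- A power of two serves as δ, so that no division by C is needed.
  modulus : ∀ {ε} → 0ℚ ℚ.< ε → ∃ λ δ → 0ℚ ℚ.< δ × δ ℚ.* C ℚ.≤ ε
  modulus {ε} 0<ε = let k , le = 1/pow₂-small C 0<ε in 1/pow₂ k , 0<1/pow₂ k , le

  product-close : ∀ a a′ b b′ {δ} →
    ℚ.∣ a ∣ ℚ.≤ X.bound → ℚ.∣ b′ ∣ ℚ.≤ Y.bound →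
    ℚ.∣ a ℚ.- a′ ∣ ℚ.≤ δ → ℚ.∣ b ℚ.- b′ ∣ ℚ.≤ δ → 0ℚ ℚ.≤ δ →
    ℚ.∣ a ℚ.* b ℚ.- a′ ℚ.* b′ ∣ ℚ.≤ δ ℚ.* C
  product-close a a′ b b′ {δ} a≤ b′≤ a-a′ b-b′ 0≤δ = begin
    ℚ.∣ a ℚ.* b ℚ.- a′ ℚ.* b′ ∣
      ≡⟨ cong ℚ.∣_∣ (solve 4 (λ a a′ b b′ → a :* b :- a′ :* b′ := a :* (b :- b′) :+ (a :- a′) :* b′) refl a a′ b b′) ⟩
    ℚ.∣ a ℚ.* (b ℚ.- b′) ℚ.+ (a ℚ.- a′) ℚ.* b′ ∣
      ≤⟨ ℚ.∣p+q∣≤∣p∣+∣q∣ (a ℚ.* (b ℚ.- b′)) ((a ℚ.- a′) ℚ.* b′) ⟩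
    ℚ.∣ a ℚ.* (b ℚ.- b′) ∣ ℚ.+ ℚ.∣ (a ℚ.- a′) ℚ.* b′ ∣
      ≡⟨ cong₂ ℚ._+_ (ℚ.∣p*q∣≡∣p∣*∣q∣ a (b ℚ.- b′)) (ℚ.∣p*q∣≡∣p∣*∣q∣ (a ℚ.- a′) b′) ⟩
    ℚ.∣ a ∣ ℚ.* ℚ.∣ b ℚ.- b′ ∣ ℚ.+ ℚ.∣ a ℚ.- a′ ∣ ℚ.* ℚ.∣ b′ ∣
      ≤⟨ ℚ.+-mono-≤ (mul-mono (ℚ.0≤∣p∣ a) 0≤δ a≤ b-b′) (mul-mono (ℚ.0≤∣p∣ (a ℚ.- a′)) Y.0≤bound a-a′ b′≤) ⟩
    X.bound ℚ.* δ ℚ.+ δ ℚ.* Y.bound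
      ≡⟨ solve 3 (λ p q d → p :* d :+ d :* q := d :* (p :+ q)) refl X.bound Y.bound δ ⟩
    δ ℚ.* C ∎

-- log⁺ x = log (max 1 x), that is, the integral of dt/t over [1, max 1 x];
-- it agrees with log x for x ≥ 1.
log⁺ : ℝ → ℝ
log⁺ x = record
  { seq    = λ n → riemann n (excess n) (0≤excess n)
  ; cauchy = λ {ε} 0<ε →
      let M , x-close = cauchy x (0<halve 0<ε)
          k , small = 1/pow₂-small (X.bound ℚ.* X.bound) (0<halve 0<ε)
          L = M ℕ.⊔ (X.N ℕ.⊔ k)
          L₁ : M ℕ.≤ L
          L₁ = ℕ.m≤m⊔n M (X.N ℕ.⊔ k)
          L₂ : X.N ℕ.≤ L
          L₂ = ℕ.≤-trans (ℕ.m≤m⊔n X.N k) (ℕ.m≤n⊔m M (X.N ℕ.⊔ k))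
          L₃ : k ℕ.≤ L
          L₃ = ℕ.≤-trans (ℕ.m≤n⊔m X.N k) (ℕ.m≤n⊔m M (X.N ℕ.⊔ k))
      in L , λ {m} {n} m≥ n≥ →
        subst (_ ℚ.≤_) (halve-+ ε)
          (triangle (riemann m (excess m) (0≤excess m)) (riemann m (excess n) (0≤excess n))
                    (riemann n (excess n) (0≤excess n))
            (ℚ.≤-trans (contracts m m n) (x-close (ℕ.≤-trans L₁ m≥) (ℕ.≤-trans L₁ n≥)))
            (ℚ.≤-trans
              (riemann-cauchy (excess n) (0≤excess n) (ℕ.≤-trans L₃ m≥) (ℕ.≤-trans L₃ n≥))
              (ℚ.≤-trans (excess²≤ k (ℕ.≤-trans L₂ n≥)) small)))
  }
  where
  open Rationals
  module X = Bounds x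

  excess : ℕ → ℚ
  excess n = 0ℚ ℚ.⊔ (seq x n ℚ.- 1ℚ)

  0≤excess : ∀ n → 0ℚ ℚ.≤ excess n
  0≤excess n = ℚ.p≤p⊔q 0ℚ (seq x n ℚ.- 1ℚ)

  excess-close : ∀ m n → ℚ.∣ excess m ℚ.- excess n ∣ ℚ.≤ ℚ.∣ seq x m ℚ.- seq x n ∣
  excess-close m n = subst (λ d → ℚ.∣ excess m ℚ.- excess n ∣ ℚ.≤ ℚ.∣ d ∣)
    (cancel (seq x m) (seq x n) 1ℚ) (⊔-contracts (seq x m ℚ.- 1ℚ) (seq x n ℚ.- 1ℚ))
    where
    open ℚ-Solver.+-*-Solver
    cancel : ∀ p q r → (p ℚ.- r) ℚ.- (q ℚ.- r) ≡ p ℚ.- q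
    cancel = solve 3 (λ p q r → (p :- r) :- (q :- r) := p :- q) refl

  contracts : ∀ k m n →
    ℚ.∣ riemann k (excess m) (0≤excess m) ℚ.- riemann k (excess n) (0≤excess n) ∣
      ℚ.≤ ℚ.∣ seq x m ℚ.- seq x n ∣
  contracts k m n = ℚ.≤-trans
    (close (riemann-contracts k (0≤excess m) (0≤excess n))
      (subst (λ d → riemann k (excess n) (0≤excess n) ℚ.≤ riemann k (excess m) (0≤excess m) ℚ.+ d)
        (∣p-q∣≡∣q-p∣ (excess n) (excess m)) (riemann-contracts k (0≤excess n) (0≤excess m))))
    (excess-close m n)

  excess≤ : ∀ {n} → X.N ℕ.≤ n → excess n ℚ.≤ X.bound
  excess≤ {n} N≤n = ℚ.⊔-lub X.0≤bound (ℚ.≤-trans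
    (ℚ.≤-trans (ℚ.+-monoʳ-≤ (seq x n) (ℚ.nonPositive⁻¹ (ℚ.- 1ℚ))) (ℚ.≤-reflexive (ℚ.+-identityʳ (seq x n))))
    (ℚ.≤-trans (p≤∣p∣ (seq x n)) (X.bounded N≤n)))

  excess²≤ : ∀ k {n} → X.N ℕ.≤ n →
    1/pow₂ k ℚ.* (excess n ℚ.* excess n) ℚ.≤ 1/pow₂ k ℚ.* (X.bound ℚ.* X.bound)
  excess²≤ k {n} N≤n = mul-mono (0≤1/pow₂ k) (0≤* X.0≤bound X.0≤bound) ℚ.≤-refl
    (mul-mono (0≤excess n) X.0≤bound (excess≤ N≤n) (excess≤ N≤n))

------------------------------------------------------------------------
-- Abelian groups

AbGroup : Set₁
AbGroup = AbelianGroup 0ℓ 0ℓ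

infix 4 _≅_

_≅_ : AbGroup → AbGroup → Set
G ≅ H = ∃ λ f → IsGroupIsomorphism f
  where open GroupMorphisms (AbelianGroup.rawGroup G) (AbelianGroup.rawGroup H)

infixr 6 _⊕_

_⊕_ : AbGroup → AbGroup → AbGroup
_⊕_ = DirectProduct.abelianGroup

⨁ : List AbGroup → AbGroup
⨁ = foldr _⊕_ Terminal.abelianGroup

Trivial : AbGroup → Set
Trivial G = ∀ x → x ≈ ε
  where open AbelianGroup G

-- ℤ/n: the integers with equality taken modulo n.
ℤ/_ : ℕ → AbGroup
ℤ/ n = record
  { Carrier = ℤ.ℤ
  ; _≈_ = λ a b → ℤ.+ n ℤ.∣ a ℤ.- b
  ; _∙_ = ℤ._+_
  ; ε = ℤ.0ℤ
  ; _⁻¹ = ℤ.-_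
  ; isAbelianGroup = record
    { isGroup = record
      { isMonoid = record
        { isSemigroup = record
          { isMagma = record
            { isEquivalence = record
              { refl = λ {a} → ≡⇒≈ {a} refl
              ; sym = λ {a} {b} a≈b →
                  subst (ℤ.+ n ℤ.∣_) (neg-minus a b) (ℤ.∣m⇒∣-m a≈b)
              ; trans = λ {a} {b} {c} a≈b b≈c →
                  subst (ℤ.+ n ℤ.∣_) (minus-trans a b c) (ℤ.∣m∣n⇒∣m+n a≈b b≈c)
              }
            ; ∙-cong = λ {a} {b} {c} {d} a≈b c≈d →
                subst (ℤ.+ n ℤ.∣_) (minus-+ a b c d) (ℤ.∣m∣n⇒∣m+n a≈b c≈d)
            }
          ; assoc = λ a b c → ≡⇒≈ (ℤ.+-assoc a b c)
          }
        ; identity = (λ a → ≡⇒≈ (ℤ.+-identityˡ a)) , (λ a → ≡⇒≈ (ℤ.+-identityʳ a))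
        }
      ; inverse = (λ a → ≡⇒≈ (ℤ.+-inverseˡ a)) , (λ a → ≡⇒≈ (ℤ.+-inverseʳ a))
      ; ⁻¹-cong = λ {a} {b} a≈b →
          subst (ℤ.+ n ℤ.∣_) (minus-neg a b) (ℤ.∣m⇒∣-m a≈b)
      }
    ; comm = λ a b → ≡⇒≈ (ℤ.+-comm a b)
    }
  }
  where
  ≡⇒≈ : ∀ {a b} → a ≡ b → ℤ.+ n ℤ.∣ a ℤ.- b
  ≡⇒≈ {a} refl = ℤ.divides ℤ.0ℤ (trans (ℤ.+-inverseʳ a) (sym (ℤ.*-zeroˡ (ℤ.+ n))))
  neg-minus : ∀ a b → ℤ.- (a ℤ.- b) ≡ b ℤ.- a
  neg-minus = ℤ-Solver.solve-∀
  minus-trans : ∀ a b c → (a ℤ.- b) ℤ.+ (b ℤ.- c) ≡ a ℤ.- c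
  minus-trans = ℤ-Solver.solve-∀
  minus-+ : ∀ a b c d → (a ℤ.- b) ℤ.+ (c ℤ.- d) ≡ (a ℤ.+ c) ℤ.- (b ℤ.+ d)
  minus-+ = ℤ-Solver.solve-∀
  minus-neg : ∀ a b → ℤ.- (a ℤ.- b) ≡ (ℤ.- a) ℤ.- (ℤ.- b)
  minus-neg = ℤ-Solver.solve-∀

-- The subgroup of elements whose order is a power of p.
primaryComponent : ℕ → AbGroup → AbGroup
primaryComponent p G = record
  { Carrier = ∃ λ g → ∃ λ k → (p ℕ.^ k) · g ≈ ε
  ; _≈_ = λ g h → proj₁ g ≈ proj₁ h
  ; _∙_ = λ (g , k , gᵏ) (h , l , hˡ) → g ∙ h , k ℕ.+ l , killed-∙ k l gᵏ hˡ
  ; ε = ε , 0 , identityʳ ε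
  ; _⁻¹ = λ (g , k , gᵏ) → g ⁻¹ , k , killed-⁻¹ (p ℕ.^ k) gᵏ
  ; isAbelianGroup = record
    { isGroup = record
      { isMonoid = record
        { isSemigroup = record
          { isMagma = record
            { isEquivalence = record
              { refl = G.refl ; sym = G.sym ; trans = G.trans }
            ; ∙-cong = ∙-cong
            }
          ; assoc = λ _ _ _ → assoc _ _ _
          }
        ; identity = (λ _ → identityˡ _) , (λ _ → identityʳ _)
        }
      ; inverse = (λ _ → inverseˡ _) , (λ _ → inverseʳ _)
      ; ⁻¹-cong = ⁻¹-cong
      }
    ; comm = λ _ _ → comm _ _
    }
  }
  where
  module G = AbelianGroup G
  open G hiding (refl; sym; trans)
  open RawMonoidDefs rawMonoid using () renaming (_×_ to _·_)
  open Mult commutativeMonoid using (×-congʳ; ×-congˡ; ×-distrib-+; ×-assocˡ)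
  open AbelianGroupProperties G using (⁻¹-∙-comm; ε⁻¹≈ε)

  ·-ε : ∀ n → n · ε ≈ ε
  ·-ε zero    = G.refl
  ·-ε (suc n) = G.trans (identityˡ _) (·-ε n)

  ·-⁻¹ : ∀ n g → n · (g ⁻¹) ≈ (n · g) ⁻¹
  ·-⁻¹ zero    g = G.sym ε⁻¹≈ε
  ·-⁻¹ (suc n) g = G.trans (∙-congˡ (·-⁻¹ n g)) (⁻¹-∙-comm g (n · g))

  killed-⁻¹ : ∀ n {g} → n · g ≈ ε → n · (g ⁻¹) ≈ ε
  killed-⁻¹ n {g} e = G.trans (·-⁻¹ n g) (G.trans (⁻¹-cong e) ε⁻¹≈ε)

  killed-* : ∀ m n {g} → n · g ≈ ε → (m ℕ.* n) · g ≈ ε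
  killed-* m n {g} e = G.trans (G.sym (×-assocˡ g m n)) (G.trans (×-congʳ m e) (·-ε m))

  killed-∙ : ∀ k l {g h} → (p ℕ.^ k) · g ≈ ε → (p ℕ.^ l) · h ≈ ε →
             (p ℕ.^ (k ℕ.+ l)) · (g ∙ h) ≈ ε
  killed-∙ k l {g} {h} gᵏ hˡ =
    G.trans (×-distrib-+ g h (p ℕ.^ (k ℕ.+ l)))
      (G.trans (∙-cong
        (G.trans (×-congˡ {x = g} (trans (ℕ.^-distribˡ-+-* p k l) (ℕ.*-comm (p ℕ.^ k) _)))
                 (killed-* (p ℕ.^ l) (p ℕ.^ k) gᵏ))
        (G.trans (×-congˡ {x = h} (ℕ.^-distribˡ-+-* p k l))
                 (killed-* (p ℕ.^ k) (p ℕ.^ l) hˡ)))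
      (identityˡ ε))

------------------------------------------------------------------------
-- Rank

module _ (G : AbGroup) where
  open AbelianGroup G

  data ⟨_⟩ {d : ℕ} (gens : Fin d → Carrier) : Carrier → Set where
    gen  : ∀ i → ⟨ gens ⟩ (gens i)
    unit : ⟨ gens ⟩ ε
    mul  : ∀ {x y} → ⟨ gens ⟩ x → ⟨ gens ⟩ y → ⟨ gens ⟩ (x ∙ y)
    inv  : ∀ {x} → ⟨ gens ⟩ x → ⟨ gens ⟩ (x ⁻¹)
    resp : ∀ {x y} → x ≈ y → ⟨ gens ⟩ x → ⟨ gens ⟩ y

  GeneratedBy : ℕ → Set
  GeneratedBy d = ∃ λ (gens : Fin d → Carrier) → ∀ x → ⟨ gens ⟩ x

  HasRank : ℕ → Set
  HasRank d = GeneratedBy d × (∀ e → GeneratedBy e → d ℕ.≤ e)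

------------------------------------------------------------------------
-- Finite abelian groups and unitary factors

record FiniteAbelianGroup : Set₁ where
  field
    group  : AbGroup
    order  : ℕ
    finite : Inverse (AbelianGroup.setoid group) (≡.setoid (Fin order))

open FiniteAbelianGroup public

_IsDirectFactorOf_ : FiniteAbelianGroup → FiniteAbelianGroup → Set₁
D IsDirectFactorOf H = ∃ λ E → group H ≅ group D ⊕ group E

HaveUnitaryFactors : (G H K : FiniteAbelianGroup) → Set₁
HaveUnitaryFactors G H K =
  group G ≅ group H ⊕ group K ×
  ¬ (∃ λ D → ¬ Trivial (group D) × D IsDirectFactorOf H × D IsDirectFactorOf K)

_IsUnitaryFactorOf_ : FiniteAbelianGroup → FiniteAbelianGroup → Set₁
H IsUnitaryFactorOf G = ∃ λ K → HaveUnitaryFactors G H K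

-- A system of representatives of the isomorphism classes of the finite
-- abelian groups satisfying P.
record Classes (P : FiniteAbelianGroup → Set₁) : Set₁ where
  field
    representatives : List FiniteAbelianGroup
    sound    : All P representatives
    distinct : AllPairs (λ G H → ¬ (group G ≅ group H)) representatives
    complete : ∀ G → P G → Any (λ H → group G ≅ group H) representatives

open Classes public

-- t(G) = n
HasUnitaryFactorCount : FiniteAbelianGroup → ℕ → Set₁
HasUnitaryFactorCount G n =
  Σ (Classes (_IsUnitaryFactorOf G)) λ C → length (representatives C) ≡ n

------------------------------------------------------------------------
-- Conjugate groups

-- A partition is an ascending list of parts; parts equal to 0 are allowed.
IsPartition : List ℕ → Set
IsPartition = Linked ℕ._≤_

-- For j = max a, …, 1, the number of parts of a that are at least j.
transpose : List ℕ → List ℕ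
transpose a = map (λ j → length (filter (suc j ℕ.≤?_) a)) (downFrom (foldr ℕ._⊔_ 0 a))

HasType : ℕ → AbGroup → List ℕ → Set
HasType p P a = IsPartition a × P ≅ ⨁ (map (λ e → ℤ/ (p ℕ.^ e)) a)

IsConjugateₚ : ℕ → AbGroup → AbGroup → Set
IsConjugateₚ p P P′ = ∃ λ a → HasType p P a × HasType p P′ (transpose a)

primeDivisors : ℕ → List ℕ
primeDivisors n = filter (λ p → prime? p ×-dec (p ℕ.∣? n)) (upTo (suc n))

IsConjugate : FiniteAbelianGroup → AbGroup → Set₁
IsConjugate G G′ = ∃ λ (Q : ℕ → AbGroup) →
  All (λ p → IsConjugateₚ p (primaryComponent p (group G)) (Q p)) (primeDivisors (order G)) ×
  G′ ≅ ⨁ (map Q (primeDivisors (order G)))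

ConjugateRank≤ : ℕ → FiniteAbelianGroup → Set₁
ConjugateRank≤ r G = ∃ λ G′ → IsConjugate G G′ × ∃ λ d → HasRank G′ d × d ℕ.≤ r

------------------------------------------------------------------------
-- Counting unitary factors

-- s is the sum of t(G) over the isomorphism classes of finite abelian groups
-- G of order at most x whose conjugate has rank at most r.
UnitaryFactorTotal : ℕ → ℝ → ℕ → Set₁
UnitaryFactorTotal r x s =
  Σ (Classes λ G → fromℕ (order G) ≤ x × ConjugateRank≤ r G) λ C →
  ∃ λ ts → Pointwise HasUnitaryFactorCount (representatives C) ts × sum ts ≡ s

infix 4 _∼_

-- f(x) ∼ g(x) as x → ∞, in the form f - g = o(g), for a function f given by
-- its graph F.  Existence of the value f(x) is stated up to double negation:
-- comparing a real x with natural numbers is undecidable, so for a function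
-- counting up to x the value cannot in general be computed from x.
_∼_ : (ℝ → ℕ → Set₁) → (ℝ → ℝ) → Set₁
F ∼ g = ∀ ε → fromℚ 0ℚ < ε → ∃ λ X → ∀ x → X ≤ x →
  ¬ ¬ (∃ λ s → F x s) ×
  (∀ s → F x s → ∣ fromℕ s - g x ∣ ≤ ε * ∣ g x ∣)

{-# OPTIONS --safe #-}

-- A finite abelian group is ⨁ ℤ/pᵉ, and its conjugate has rank at most r exactly when
-- all exponents e are at most r.  Collecting the primes of exponent i in a number nᵢ turns
-- isomorphism classes into tuples (n₁, …, nᵣ) with ∏ nᵢⁱ the order, and unitary factors
-- into componentwise factorisations nᵢ = dᵢ eᵢ with dᵢ and eᵢ coprime.  So the total is
-- Tᵣ(N), the number of tuples of coprime pairs with ∏ (dᵢ eᵢ)ⁱ ≤ N, where N = ⌊x⌋.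
--
-- Write Op_j f (n) = ∑ f(⌊n/kʲ⌋) over k ≥ 1.  Taking out the common divisors of pairs gives
-- Op_2i Tᵢ = Op_i (Op_i Tᵢ₋₁), and Op_1 (Op_1 T₀) is the divisor sum ∑ ⌊n/k⌋ = n H(n) + O(n).
-- For j ≥ 2, f has the form c n H(n) + O(n) if and only if Op_j f has, with c multiplied by
-- ζ(j): for the converse the error E satisfies |E(n)| ≤ O(n) + ∑ |E(⌊n/kʲ⌋)| over k ≥ 2,
-- and the sum of 1/kʲ over k ≥ 2 is at most 3/4.
--
-- Everything after the choice of K and of X is stable under double negation, which is why
-- the integer part of x may be used.

module Submission where

open import Algebra.Bundles using (AbelianGroup)
open import Data.Empty using (⊥-elim)
open import Data.Fin.Base as Fin using (Fin; toℕ; fromℕ<)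
import Data.Fin.Properties as Fin
open import Data.Integer.Base as ℤ using (ℤ; 0ℤ; 1ℤ)
import Data.Integer.DivMod as ℤ
import Data.Integer.Divisibility.Signed as ℤ
import Data.Integer.Properties as ℤ
open import Data.Integer.Tactic.RingSolver using (solve-∀)
open import Data.List.Base
  using (List; []; _∷_; map; _++_; filter; length; foldr; downFrom; upTo; cartesianProduct; cartesianProductWith)
import Data.List.Membership.DecPropositional as DecMembership
open import Data.List.Membership.Propositional using (_∈_)
open import Data.List.Membership.Propositional.Properties
  using (∈-map⁺; ∈-map⁻; ∈-++⁺ˡ; ∈-++⁺ʳ; ∈-++⁻; ∈-filter⁺; ∈-filter⁻; ∈-upTo⁺; ∈-∃++;
         ∈-cartesianProduct⁺; ∈-cartesianProduct⁻; ∈-cartesianProductWith⁺; ∈-cartesianProductWith⁻)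
open import Data.List.Membership.Propositional.Properties.WithK using (unique∧set⇒bag)
import Data.List.Properties as List
open import Data.List.Relation.Binary.BagAndSetEquality using (∼bag⇒↭)
open import Data.List.Relation.Binary.Permutation.Propositional as ↭
  using (_↭_; ↭-refl; ↭-sym; ↭-trans; ↭-reflexive)
open import Data.List.Relation.Binary.Permutation.Propositional.Properties as ↭
  using (All-resp-↭; ∈-resp-↭; filter-↭; ↭-length)
open import Data.List.Relation.Binary.Pointwise.Base using (Pointwise; []; _∷_)
open import Data.List.Relation.Unary.All as All using (All; []; _∷_)
import Data.List.Relation.Unary.All.Properties as All
open import Data.List.Relation.Unary.AllPairs using (AllPairs; []; _∷_)
open import Data.List.Relation.Unary.Any as Any using (Any; here; there)
import Data.List.Relation.Unary.Any.Properties as Any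
open import Data.List.Relation.Unary.Unique.Propositional using (Unique)
import Data.List.Relation.Unary.Unique.Propositional.Properties as Unique
open import Data.Nat.Base as ℕ using (ℕ; zero; suc)
open import Data.Nat.Coprimality as Coprimality using (Coprime; coprime?; coprime-Bézout)
import Data.Nat.Divisibility as ℕ
import Data.Nat.DivMod as ℕ
open import Data.Nat.GCD as GCD using (gcd; module Bézout)
open import Data.Nat.Induction using (<-rec)
open import Data.Nat.ListAction using (sum; product)
open import Data.Nat.ListAction.Properties using (sum-↭; sum-++; product-++; product-↭; ∈⇒∣product)
open import Data.Nat.Primality
  using (Prime; prime?; ¬prime[1]; prime⇒irreducible; prime⇒nonTrivial; prime⇒nonZero; euclidsLemma; productOfPrimes≥1)
open import Data.Nat.Primality.Factorisation
  using (PrimeFactorisation; factorise; factorisationUnique; factorisationHasAllPrimeFactors)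
import Data.Nat.Properties as ℕ
open import Data.Nat.Solver using (module +-*-Solver)
open import Data.Product.Base using (Σ; ∃; ∃₂; _×_; _,_; proj₁; proj₂; uncurry)
import Data.Product.Properties as Product
import Data.Rational.Properties as ℚ
import Data.Rational.Solver as ℚ-Solver
open import Data.Sum.Base using (_⊎_; inj₁; inj₂; [_,_])
open import Data.Unit.Polymorphic.Base using (tt)
open import Data.Vec.Base as Vec using (Vec; []; _∷_)
import Data.Vec.Properties as Vec
open import Data.Vec.Relation.Unary.All as VAll using ([]; _∷_)
open import Function.Base using (_∘_)
open import Function.Bundles using (Inverse; mk⇔)
open import Level using (0ℓ)
open import Relation.Binary.Bundles using (Setoid)
open import Relation.Binary.Definitions using (Decidable)
open import Relation.Binary.PropositionalEquality as ≡ using (_≡_; _≢_)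
open import Relation.Nullary using (¬_; Dec; yes; no; contradiction; _×-dec_)
open import Relation.Nullary.Decidable using (map′; decidable-stable)
import Relation.Unary as Unary
open import Defs using (module Rationals)
open import Defs using
  ( AbGroup; _≅_; _⊕_; ⨁; ℤ/_; Trivial; primaryComponent; GeneratedBy
  ; FiniteAbelianGroup; group; order; finite; _IsDirectFactorOf_; HaveUnitaryFactors; _IsUnitaryFactorOf_
  ; Classes; representatives; sound; distinct; complete; HasUnitaryFactorCount
  ; IsPartition; transpose; IsConjugateₚ; primeDivisors; ConjugateRank≤ )

-- In terms of Dirichlet series, `T r` belongs to the product of ζ(is)²/ζ(2is) over i ≤ r. Only i =
-- 1 has its pole, a double one, at s = 1; this is why exactly one logarithm appears for every r,
-- and the larger i only alter the constant, which is ζ(i)²/ζ(2i) multiplied over 2 ≤ i ≤ r and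
-- divided by ζ(2).
--
-- `K` has to be an actual real number, so it cannot come out of an argument by double negation, and
-- limits are best avoided until the end. Therefore log is replaced by `H` and ζ(j) by its partial
-- sum up to the current argument n. An error C/n in the constant changes c n H(n) by C H(n), which
-- O(n) absorbs, so all estimates up to the final comparison are inequalities between rationals.
--
-- Besides the integer part of x there is a second source of double negation: the rank of the
-- conjugate is the exact least number of generators, while the structure of the group gives only an
-- upper bound for it.

-- Harmonic numbers and sums of reciprocals over the rationals.

module Harmonic where
  open import Data.Rational.Base
  open ≡
  open Rationals
  open ℚ-Solver.+-*-Solver
  open ℚ.≤-Reasoning

  ≤-add : ∀ {p q} d → 0ℚ ≤ d → q ≡ p + d → p ≤ q
  ≤-add {p} {q} d 0≤d e = begin
    p       ≡⟨ ℚ.+-identityʳ p ⟨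
    p + 0ℚ  ≤⟨ ℚ.+-monoʳ-≤ p 0≤d ⟩
    p + d   ≡⟨ e ⟨
    q       ∎

  *-monoˡ : ∀ {p q r} → 0ℚ ≤ p → q ≤ r → p * q ≤ p * r
  *-monoˡ {p} 0≤p = ℚ.*-monoˡ-≤-nonNeg p {{nonNegative 0≤p}}

  *-monoʳ : ∀ {p q r} → 0ℚ ≤ p → q ≤ r → q * p ≤ r * p
  *-monoʳ {p} 0≤p = ℚ.*-monoʳ-≤-nonNeg p {{nonNegative 0≤p}}

  0≤1 : 0ℚ ≤ 1ℚ
  0≤1 = 0≤fromℕ 1

  fromℕ-* : ∀ m n → fromℕ (m ℕ.* n) ≡ fromℕ m * fromℕ n
  fromℕ-* zero    n = sym (ℚ.*-zeroˡ (fromℕ n))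
  fromℕ-* (suc m) n = begin-equality
    fromℕ (n ℕ.+ m ℕ.* n)       ≡⟨ fromℕ-+ n (m ℕ.* n) ⟩
    fromℕ n + fromℕ (m ℕ.* n)   ≡⟨ cong (fromℕ n +_) (fromℕ-* m n) ⟩
    fromℕ n + fromℕ m * fromℕ n ≡⟨ solve 2 (λ m n → n :+ m :* n := (con 1ℚ :+ m) :* n) refl (fromℕ m) (fromℕ n) ⟩
    (1ℚ + fromℕ m) * fromℕ n    ≡⟨ cong (_* fromℕ n) (fromℕ-suc m) ⟨
    fromℕ (suc m) * fromℕ n     ∎

  fromℕ-mono : ∀ {m n} → m ℕ.≤ n → fromℕ m ≤ fromℕ n
  fromℕ-mono {m} {n} m≤n = ≤-add (fromℕ (n ℕ.∸ m)) (0≤fromℕ _)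
    (trans (cong fromℕ (sym (ℕ.m+[n∸m]≡n m≤n))) (fromℕ-+ m (n ℕ.∸ m)))

  1≤fromℕ : ∀ {n} → 1 ℕ.≤ n → 1ℚ ≤ fromℕ n
  1≤fromℕ = fromℕ-mono

  -- The reciprocal, with value 0 at 0.
  inv : ℕ → ℚ
  inv zero    = 0ℚ
  inv (suc n) = 1/ fromℕ (suc n)

  *-inv : ∀ {n} → 1 ℕ.≤ n → fromℕ n * inv n ≡ 1ℚ
  *-inv {suc n} _ = ℚ.*-inverseʳ (fromℕ (suc n))

  0≤inv : ∀ n → 0ℚ ≤ inv n
  0≤inv zero    = ℚ.≤-refl
  0≤inv (suc n) = ℚ.nonNegative⁻¹ (inv (suc n))

  inv-cancel : ∀ n {p q} → 1 ℕ.≤ n → p * fromℕ n ≤ q * fromℕ n → p ≤ q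
  inv-cancel (suc n) _ = ℚ.*-cancelʳ-≤-pos (fromℕ (suc n))

  inv-antimono : ∀ {m n} → 1 ℕ.≤ m → m ℕ.≤ n → inv n ≤ inv m
  inv-antimono {m} {n} 1≤m m≤n = begin
    inv n                      ≡⟨ ℚ.*-identityˡ (inv n) ⟨
    1ℚ * inv n                 ≡⟨ cong (_* inv n) (*-inv 1≤m) ⟨
    fromℕ m * inv m * inv n    ≤⟨ *-monoʳ (0≤inv n) (*-monoʳ (0≤inv m) (fromℕ-mono m≤n)) ⟩
    fromℕ n * inv m * inv n    ≡⟨ solve 3 (λ n i j → n :* i :* j := i :* (n :* j)) refl (fromℕ n) (inv m) (inv n) ⟩
    inv m * (fromℕ n * inv n)  ≡⟨ cong (inv m *_) (*-inv (ℕ.≤-trans 1≤m m≤n)) ⟩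
    inv m * 1ℚ                 ≡⟨ ℚ.*-identityʳ (inv m) ⟩
    inv m                      ∎

  inv≤1 : ∀ n → inv n ≤ 1ℚ
  inv≤1 zero    = 0≤1
  inv≤1 (suc n) = inv-antimono {1} ℕ.z<s ℕ.z<s

  inv-* : ∀ m n → inv (m ℕ.* n) ≡ inv m * inv n
  inv-* zero    n = sym (ℚ.*-zeroˡ (inv n))
  inv-* (suc m) zero rewrite ℕ.*-zeroʳ m = sym (ℚ.*-zeroʳ (inv (suc m)))
  inv-* m@(suc _) n@(suc _) = begin-equality
    inv (m ℕ.* n)                                       ≡⟨ solve 1 (λ i → i := i :* (con 1ℚ :* con 1ℚ)) refl (inv (m ℕ.* n)) ⟩
    inv (m ℕ.* n) * (1ℚ * 1ℚ)                           ≡⟨ cong (inv (m ℕ.* n) *_) (cong₂ _*_ (*-inv {m} ℕ.z<s) (*-inv {n} ℕ.z<s)) ⟨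
    inv (m ℕ.* n) * ((fromℕ m * inv m) * (fromℕ n * inv n))
      ≡⟨ solve 5 (λ i a b c d → i :* ((a :* b) :* (c :* d)) := ((a :* c) :* i) :* (b :* d)) refl (inv (m ℕ.* n)) (fromℕ m) (inv m) (fromℕ n) (inv n) ⟩
    (fromℕ m * fromℕ n * inv (m ℕ.* n)) * (inv m * inv n) ≡⟨ cong (λ x → x * inv (m ℕ.* n) * (inv m * inv n)) (fromℕ-* m n) ⟨
    (fromℕ (m ℕ.* n) * inv (m ℕ.* n)) * (inv m * inv n) ≡⟨ cong (_* (inv m * inv n)) (*-inv {m ℕ.* n} ℕ.z<s) ⟩
    1ℚ * (inv m * inv n)                                ≡⟨ ℚ.*-identityˡ _ ⟩
    inv m * inv n                                       ∎

  ∑ : ℕ → (ℕ → ℚ) → ℚ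
  ∑ zero    f = 0ℚ
  ∑ (suc n) f = ∑ n f + f (suc n)

  ∑-mono : ∀ n {f g} → (∀ {k} → 1 ℕ.≤ k → k ℕ.≤ n → f k ≤ g k) → ∑ n f ≤ ∑ n g
  ∑-mono zero    f≤g = ℚ.≤-refl
  ∑-mono (suc n) f≤g = ℚ.+-mono-≤ (∑-mono n λ 1≤k k≤n → f≤g 1≤k (ℕ.m≤n⇒m≤1+n k≤n))
                                  (f≤g ℕ.z<s ℕ.≤-refl)

  ∑-cong : ∀ n {f g} → (∀ {k} → 1 ℕ.≤ k → k ℕ.≤ n → f k ≡ g k) → ∑ n f ≡ ∑ n g
  ∑-cong zero    f≡g = refl
  ∑-cong (suc n) f≡g = cong₂ _+_ (∑-cong n λ 1≤k k≤n → f≡g 1≤k (ℕ.m≤n⇒m≤1+n k≤n))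
                                 (f≡g ℕ.z<s ℕ.≤-refl)

  ∑-nonNeg : ∀ n {f} → (∀ k → 0ℚ ≤ f k) → 0ℚ ≤ ∑ n f
  ∑-nonNeg zero    0≤f = ℚ.≤-refl
  ∑-nonNeg (suc n) 0≤f = 0≤+ (∑-nonNeg n 0≤f) (0≤f (suc n))

  ∑-minus : ∀ n f g → ∑ n (λ k → f k - g k) ≡ ∑ n f - ∑ n g
  ∑-minus zero    f g = refl
  ∑-minus (suc n) f g = trans (cong (_+ (f (suc n) - g (suc n))) (∑-minus n f g))
    (solve 4 (λ a b c d → (a :- b) :+ (c :- d) := (a :+ c) :- (b :+ d)) refl
      (∑ n f) (∑ n g) (f (suc n)) (g (suc n)))

  ∑-*ˡ : ∀ n c f → ∑ n (λ k → c * f k) ≡ c * ∑ n f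
  ∑-*ˡ zero    c f = sym (ℚ.*-zeroʳ c)
  ∑-*ˡ (suc n) c f = trans (cong (_+ c * f (suc n)) (∑-*ˡ n c f)) (sym (ℚ.*-distribˡ-+ c (∑ n f) (f (suc n))))

  ∣∑∣≤∑∣∣ : ∀ n f → ∣ ∑ n f ∣ ≤ ∑ n (λ k → ∣ f k ∣)
  ∣∑∣≤∑∣∣ zero    f = ℚ.≤-refl
  ∣∑∣≤∑∣∣ (suc n) f = ℚ.≤-trans (ℚ.∣p+q∣≤∣p∣+∣q∣ (∑ n f) (f (suc n)))
                               (ℚ.+-monoˡ-≤ ∣ f (suc n) ∣ (∣∑∣≤∑∣∣ n f))

  H : ℕ → ℚ
  H n = ∑ n inv

  0≤H : ∀ n → 0ℚ ≤ H n
  0≤H n = ∑-nonNeg n 0≤inv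

  H-mono-+ : ∀ m b → H m ≤ H (b ℕ.+ m)
  H-mono-+ m zero    = ℚ.≤-refl
  H-mono-+ m (suc b) = ℚ.≤-trans (H-mono-+ m b) (≤-add (inv (suc (b ℕ.+ m))) (0≤inv (suc (b ℕ.+ m))) refl)

  H-mono : ∀ {m n} → m ℕ.≤ n → H m ≤ H n
  H-mono {m} {n} m≤n = subst (λ x → H m ≤ H x) (ℕ.m∸n+n≡m m≤n) (H-mono-+ m (n ℕ.∸ m))

  1≤H : ∀ {n} → 1 ℕ.≤ n → 1ℚ ≤ H n
  1≤H 1≤n = H-mono 1≤n

  H≤id : ∀ n → H n ≤ fromℕ n
  H≤id zero    = ℚ.≤-refl
  H≤id (suc n) = begin
    H n + inv (suc n) ≤⟨ ℚ.+-mono-≤ (H≤id n) (inv≤1 (suc n)) ⟩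
    fromℕ n + 1ℚ      ≡⟨ ℚ.+-comm (fromℕ n) 1ℚ ⟩
    1ℚ + fromℕ n      ≡⟨ fromℕ-suc n ⟨
    fromℕ (suc n)     ∎

  -- Each of the b terms that follow 1/m is at most 1/m.
  block-upper : ∀ {m} b → 1 ℕ.≤ m → H (b ℕ.+ m) ≤ H m + fromℕ b * inv m
  block-upper {m} zero    1≤m = ℚ.≤-reflexive (solve 2 (λ h i → h := h :+ con 0ℚ :* i) refl (H m) (inv m))
  block-upper {m} (suc b) 1≤m = begin
    H (b ℕ.+ m) + inv (suc (b ℕ.+ m))   ≤⟨ ℚ.+-mono-≤ (block-upper b 1≤m) (inv-antimono 1≤m (ℕ.m≤n+m m (suc b))) ⟩
    H m + fromℕ b * inv m + inv m       ≡⟨ solve 3 (λ h b i → h :+ b :* i :+ i := h :+ (con 1ℚ :+ b) :* i) refl (H m) (fromℕ b) (inv m) ⟩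
    H m + (1ℚ + fromℕ b) * inv m        ≡⟨ cong (λ x → H m + x * inv m) (fromℕ-suc b) ⟨
    H m + fromℕ (suc b) * inv m         ∎

  block-lower : ∀ {m n} b → b ℕ.+ m ℕ.≤ n → H m + fromℕ b * inv n ≤ H (b ℕ.+ m)
  block-lower {m} {n} zero    _ = ℚ.≤-reflexive (solve 2 (λ h i → h :+ con 0ℚ :* i := h) refl (H m) (inv n))
  block-lower {m} {n} (suc b) b+m≤n = begin
    H m + fromℕ (suc b) * inv n         ≡⟨ cong (λ x → H m + x * inv n) (fromℕ-suc b) ⟩
    H m + (1ℚ + fromℕ b) * inv n        ≡⟨ solve 3 (λ h b i → h :+ (con 1ℚ :+ b) :* i := h :+ b :* i :+ i) refl (H m) (fromℕ b) (inv n) ⟩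
    H m + fromℕ b * inv n + inv n       ≤⟨ ℚ.+-mono-≤ (block-lower b (ℕ.<⇒≤ b+m≤n)) (inv-antimono ℕ.z<s b+m≤n) ⟩
    H (b ℕ.+ m) + inv (suc (b ℕ.+ m))   ∎

  *-inv-* : ∀ {b} a → 1 ℕ.≤ b → fromℕ b * inv (a ℕ.* b) ≡ inv a
  *-inv-* {b} a 1≤b = begin-equality
    fromℕ b * inv (a ℕ.* b)    ≡⟨ cong (fromℕ b *_) (inv-* a b) ⟩
    fromℕ b * (inv a * inv b)  ≡⟨ solve 3 (λ b i j → b :* (i :* j) := i :* (b :* j)) refl (fromℕ b) (inv a) (inv b) ⟩
    inv a * (fromℕ b * inv b)  ≡⟨ cong (inv a *_) (*-inv 1≤b) ⟩
    inv a * 1ℚ                 ≡⟨ ℚ.*-identityʳ (inv a) ⟩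
    inv a                      ∎

  -- The block of b terms after index cb is at most b/(cb) = 1/c; the blocks c = 1, ..., a add up to
  -- `H a`. With `H-*-lower` this is the functional equation of the logarithm up to a bounded error.
  H-*-upper : ∀ a {b} → 1 ℕ.≤ b → H (suc a ℕ.* b) ≤ H b + H a
  H-*-upper zero {b} _ rewrite ℕ.+-identityʳ b = ℚ.≤-reflexive (sym (ℚ.+-identityʳ (H b)))
  H-*-upper (suc a) {b} 1≤b = begin
    H (b ℕ.+ suc a ℕ.* b)                              ≤⟨ block-upper b (ℕ.≤-trans 1≤b (ℕ.m≤m+n b (a ℕ.* b))) ⟩
    H (suc a ℕ.* b) + fromℕ b * inv (suc a ℕ.* b)      ≤⟨ ℚ.+-mono-≤ (H-*-upper a 1≤b) (ℚ.≤-reflexive (*-inv-* (suc a) 1≤b)) ⟩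
    H b + H a + inv (suc a)                            ≡⟨ ℚ.+-assoc (H b) (H a) (inv (suc a)) ⟩
    H b + (H a + inv (suc a))                          ∎

  -- The block of b terms that ends at index (c + 1)b is at least 1/(c + 1). The blocks give
  -- `H (suc a)` without its first term, whence the 1 on the right.
  H-*-lower : ∀ a {b} → 1 ℕ.≤ b → H b + H (suc a) ≤ H (suc a ℕ.* b) + 1ℚ
  H-*-lower zero {b} _ rewrite ℕ.+-identityʳ b = ℚ.≤-refl
  H-*-lower (suc a) {b} 1≤b = begin
    H b + (H (suc a) + inv (2 ℕ.+ a))                 ≡⟨ ℚ.+-assoc (H b) (H (suc a)) (inv (2 ℕ.+ a)) ⟨
    H b + H (suc a) + inv (2 ℕ.+ a)                   ≤⟨ ℚ.+-mono-≤ (H-*-lower a 1≤b) (ℚ.≤-reflexive (sym (*-inv-* (2 ℕ.+ a) 1≤b))) ⟩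
    H (suc a ℕ.* b) + 1ℚ + fromℕ b * inv ((2 ℕ.+ a) ℕ.* b)
      ≡⟨ solve 3 (λ h o x → h :+ o :+ x := h :+ x :+ o) refl (H (suc a ℕ.* b)) 1ℚ (fromℕ b * inv ((2 ℕ.+ a) ℕ.* b)) ⟩
    H (suc a ℕ.* b) + fromℕ b * inv ((2 ℕ.+ a) ℕ.* b) + 1ℚ
      ≤⟨ ℚ.+-monoˡ-≤ 1ℚ (block-lower b ℕ.≤-refl) ⟩
    H (b ℕ.+ suc a ℕ.* b) + 1ℚ ∎

  H-* : ∀ a {b} → 1 ℕ.≤ b → H (a ℕ.* b) ≤ H a + H b
  H-* zero {b} _ = 0≤+ ℚ.≤-refl (0≤H b)
  H-* (suc a) {b} 1≤b = begin
    H (suc a ℕ.* b)   ≤⟨ H-*-upper a 1≤b ⟩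
    H b + H a         ≤⟨ ℚ.+-monoʳ-≤ (H b) (H-mono (ℕ.n≤1+n a)) ⟩
    H b + H (suc a)   ≡⟨ ℚ.+-comm (H b) (H (suc a)) ⟩
    H (suc a) + H b   ∎

  1≤^ : ∀ {k} j → 1 ℕ.≤ k → 1 ℕ.≤ k ℕ.^ j
  1≤^ {k} j 1≤k = subst (ℕ._≤ k ℕ.^ j) (ℕ.^-zeroˡ j) (ℕ.^-monoˡ-≤ j 1≤k)

  H-^ : ∀ {k} j → 1 ℕ.≤ k → H (k ℕ.^ j) ≤ 1ℚ + fromℕ j * H k
  H-^ {k} zero    1≤k = ℚ.≤-reflexive (solve 1 (λ h → con 1ℚ := con 1ℚ :+ con 0ℚ :* h) refl (H k))
  H-^ {k} (suc j) 1≤k = begin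
    H (k ℕ.* k ℕ.^ j)                ≤⟨ H-* k (1≤^ j 1≤k) ⟩
    H k + H (k ℕ.^ j)                ≤⟨ ℚ.+-monoʳ-≤ (H k) (H-^ j 1≤k) ⟩
    H k + (1ℚ + fromℕ j * H k)       ≡⟨ solve 2 (λ h j → h :+ (con 1ℚ :+ j :* h) := con 1ℚ :+ (con 1ℚ :+ j) :* h) refl (H k) (fromℕ j) ⟩
    1ℚ + (1ℚ + fromℕ j) * H k        ≡⟨ cong (λ x → 1ℚ + x * H k) (fromℕ-suc j) ⟨
    1ℚ + fromℕ (suc j) * H k         ∎

  -- Integer division, with value 0 for the divisor 0.
  quot : ℕ → ℕ → ℕ
  quot n zero    = 0
  quot n (suc q) = n ℕ./ suc q

  quot-≤ : ∀ n q → quot n q ℕ.* q ℕ.≤ n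
  quot-≤ n zero    = ℕ.z≤n
  quot-≤ n (suc q) = ℕ.m/n*n≤m n (suc q)

  quot-> : ∀ n {q} → 1 ℕ.≤ q → n ℕ.≤ suc (quot n q) ℕ.* q
  quot-> n {suc q} _ = subst (ℕ._≤ suc (n ℕ./ suc q) ℕ.* suc q) (sym (ℕ.m≡m%n+[m/n]*n n (suc q)))
    (ℕ.+-monoˡ-≤ (n ℕ./ suc q ℕ.* suc q) (ℕ.<⇒≤ (ℕ.m%n<n n (suc q))))

  to-inv : ∀ m n {q} → 1 ℕ.≤ q → m ℕ.* q ℕ.≤ n → fromℕ m ≤ fromℕ n * inv q
  to-inv m n {q} 1≤q le = begin
    fromℕ m                      ≡⟨ ℚ.*-identityʳ (fromℕ m) ⟨
    fromℕ m * 1ℚ                 ≡⟨ cong (fromℕ m *_) (*-inv 1≤q) ⟨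
    fromℕ m * (fromℕ q * inv q)  ≡⟨ ℚ.*-assoc (fromℕ m) (fromℕ q) (inv q) ⟨
    fromℕ m * fromℕ q * inv q    ≡⟨ cong (_* inv q) (fromℕ-* m q) ⟨
    fromℕ (m ℕ.* q) * inv q      ≤⟨ *-monoʳ (0≤inv q) (fromℕ-mono le) ⟩
    fromℕ n * inv q              ∎

  from-inv : ∀ m n {q} → 1 ℕ.≤ q → n ℕ.≤ m ℕ.* q → fromℕ n * inv q ≤ fromℕ m
  from-inv m n {q} 1≤q le = begin
    fromℕ n * inv q              ≤⟨ *-monoʳ (0≤inv q) (fromℕ-mono le) ⟩
    fromℕ (m ℕ.* q) * inv q      ≡⟨ cong (_* inv q) (fromℕ-* m q) ⟩
    fromℕ m * fromℕ q * inv q    ≡⟨ ℚ.*-assoc (fromℕ m) (fromℕ q) (inv q) ⟩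
    fromℕ m * (fromℕ q * inv q)  ≡⟨ cong (fromℕ m *_) (*-inv 1≤q) ⟩
    fromℕ m * 1ℚ                 ≡⟨ ℚ.*-identityʳ (fromℕ m) ⟩
    fromℕ m                      ∎

  quot-lower : ∀ n {q} → 1 ℕ.≤ q → fromℕ (quot n q) ≤ fromℕ n * inv q
  quot-lower n {q} 1≤q = to-inv (quot n q) n 1≤q (quot-≤ n q)

  quot-upper : ∀ n {q} → 1 ℕ.≤ q → fromℕ n * inv q ≤ 1ℚ + fromℕ (quot n q)
  quot-upper n {q} 1≤q = ℚ.≤-trans (from-inv (suc (quot n q)) n 1≤q (quot-> n 1≤q))
                                   (ℚ.≤-reflexive (fromℕ-suc (quot n q)))

  H-quot : ∀ n {q} → 1 ℕ.≤ q → H n ≤ H q + H (quot n q)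
  H-quot n {q} 1≤q = ℚ.≤-trans (H-mono (quot-> n 1≤q)) (H-*-upper (quot n q) 1≤q)

  nH : ℕ → ℚ
  nH n = fromℕ n * H n

  0≤nH : ∀ n → 0ℚ ≤ nH n
  0≤nH n = 0≤* (0≤fromℕ n) (0≤H n)

  nH-quot-upper : ∀ n {q} → 1 ℕ.≤ q → nH (quot n q) ≤ inv q * nH n
  nH-quot-upper n {q} 1≤q = begin
    fromℕ (quot n q) * H (quot n q)  ≤⟨ mul-mono (0≤fromℕ _) (0≤H n) (quot-lower n 1≤q) (H-mono quot≤) ⟩
    fromℕ n * inv q * H n            ≡⟨ solve 3 (λ n i h → n :* i :* h := i :* (n :* h)) refl (fromℕ n) (inv q) (H n) ⟩
    inv q * nH n                     ∎
    where
    quot≤ : quot n q ℕ.≤ n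
    quot≤ = ℕ.≤-trans (subst (ℕ._≤ quot n q ℕ.* q) (ℕ.*-identityʳ (quot n q)) (ℕ.*-monoʳ-≤ (quot n q) 1≤q)) (quot-≤ n q)

  -- The loss has two sources, with m = ⌊n/q⌋: passing from `H n` to `H m` costs `H q`, and rounding
  -- n/q down to m costs at most `H m` ≤ m ≤ n/q.
  nH-quot-lower : ∀ n {q} → 1 ℕ.≤ q → inv q * nH n ≤ nH (quot n q) + fromℕ n * (inv q * (1ℚ + H q))
  nH-quot-lower n {q} 1≤q = begin
    inv q * (fromℕ n * H n)   ≡⟨ solve 3 (λ n i h → i :* (n :* h) := n :* i :* h) refl (fromℕ n) (inv q) (H n) ⟩
    x * H n                   ≤⟨ *-monoˡ 0≤x (H-quot n 1≤q) ⟩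
    x * (H q + H m)           ≡⟨ ℚ.*-distribˡ-+ x (H q) (H m) ⟩
    x * H q + x * H m         ≤⟨ ℚ.+-monoʳ-≤ (x * H q) (*-monoʳ (0≤H m) (quot-upper n 1≤q)) ⟩
    x * H q + (1ℚ + fromℕ m) * H m  ≡⟨ solve 4 (λ x hq m hm → x :* hq :+ (con 1ℚ :+ m) :* hm := m :* hm :+ x :* hq :+ hm) refl x (H q) (fromℕ m) (H m) ⟩
    nH m + x * H q + H m      ≤⟨ ℚ.+-monoʳ-≤ (nH m + x * H q) (ℚ.≤-trans (H≤id m) (quot-lower n 1≤q)) ⟩
    nH m + x * H q + x        ≡⟨ solve 4 (λ a n i h → a :+ n :* i :* h :+ n :* i := a :+ n :* (i :* (con 1ℚ :+ h))) refl (nH m) (fromℕ n) (inv q) (H q) ⟩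
    nH m + fromℕ n * (inv q * (1ℚ + H q)) ∎
    where
    m = quot n q
    x = fromℕ n * inv q
    0≤x : 0ℚ ≤ x
    0≤x = 0≤* (0≤fromℕ n) (0≤inv q)

  -- Partial sums of ζ(j) and of the logarithmically weighted series.

  Z : ℕ → ℕ → ℚ
  Z j n = ∑ n (λ k → inv (k ℕ.^ j))

  1≤Z : ∀ j {n} → 1 ℕ.≤ n → 1ℚ ≤ Z j n
  1≤Z j {suc zero}    _ rewrite ℕ.^-zeroˡ j = ℚ.≤-refl
  1≤Z j {suc (suc n)} _ = ℚ.≤-trans (1≤Z j {suc n} ℕ.z<s) (≤-add _ (0≤inv ((2 ℕ.+ n) ℕ.^ j)) refl)

  inv-^≤ : ∀ {j k} → 2 ℕ.≤ j → 1 ℕ.≤ k → inv (k ℕ.^ j) ≤ inv k * inv k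
  inv-^≤ {j} {suc k} 2≤j _ = begin
    inv (suc k ℕ.^ j)          ≤⟨ inv-antimono ℕ.z<s (ℕ.^-monoʳ-≤ (suc k) 2≤j) ⟩
    inv (suc k ℕ.^ 2)          ≡⟨ cong (λ m → inv (suc k ℕ.* m)) (ℕ.*-identityʳ (suc k)) ⟩
    inv (suc k ℕ.* suc k)      ≡⟨ inv-* (suc k) (suc k) ⟩
    inv (suc k) * inv (suc k)  ∎

  -- 1/(k+1)² ≤ 1/k − 1/(k+1), with the difference made explicit.
  inv-telescope : ∀ {k} → 1 ℕ.≤ k →
    inv k ≡ inv (suc k) + inv (suc k) * inv (suc k) + inv k * (inv (suc k) * inv (suc k))
  inv-telescope {k} 1≤k = begin-equality
    i                          ≡⟨ ℚ.*-identityʳ i ⟨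
    i * 1ℚ                     ≡⟨ cong (i *_) unit ⟨
    i * ((1ℚ + fromℕ k) * j)   ≡⟨ solve 3 (λ i k j → i :* ((con 1ℚ :+ k) :* j) := i :* j :+ (k :* i) :* j) refl i (fromℕ k) j ⟩
    i * j + fromℕ k * i * j    ≡⟨ cong (λ x → i * j + x * j) (*-inv 1≤k) ⟩
    i * j + 1ℚ * j             ≡⟨ cong (λ x → x * j + 1ℚ * j) (trans (sym (ℚ.*-identityʳ i)) (cong (i *_) (sym unit))) ⟩
    i * ((1ℚ + fromℕ k) * j) * j + 1ℚ * j
      ≡⟨ solve 3 (λ i k j → i :* ((con 1ℚ :+ k) :* j) :* j :+ con 1ℚ :* j := j :+ (k :* i) :* (j :* j) :+ i :* (j :* j)) refl i (fromℕ k) j ⟩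
    j + fromℕ k * i * (j * j) + i * (j * j)   ≡⟨ cong (λ x → j + x * (j * j) + i * (j * j)) (*-inv 1≤k) ⟩
    j + 1ℚ * (j * j) + i * (j * j)            ≡⟨ cong (λ x → j + x + i * (j * j)) (ℚ.*-identityˡ (j * j)) ⟩
    j + j * j + i * (j * j)    ∎
    where
    i = inv k
    j = inv (suc k)
    unit : (1ℚ + fromℕ k) * j ≡ 1ℚ
    unit = trans (cong (_* j) (sym (fromℕ-suc k))) (*-inv {suc k} ℕ.z<s)

  inv²≤ : ∀ {k} → 1 ℕ.≤ k → inv (suc k) * inv (suc k) + inv (suc k) ≤ inv k
  inv²≤ {k} 1≤k = ≤-add (inv k * (inv (suc k) * inv (suc k)))
    (0≤* (0≤inv k) (0≤* (0≤inv (suc k)) (0≤inv (suc k))))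
    (trans (inv-telescope 1≤k) (cong (_+ inv k * (inv (suc k) * inv (suc k))) (ℚ.+-comm (inv (suc k)) (inv (suc k) * inv (suc k)))))

  ¾ : ℚ
  ¾ = ½ + ½ * ½

  module _ {j : ℕ} (2≤j : 2 ℕ.≤ j) where

    -- The sum of `Z j n` and 1/n does not increase with n, by `inv²≤`; so 1/m bounds the tail of
    -- the series beyond m.
    Z-tail : ∀ {m} n → 1 ℕ.≤ m → Z j (n ℕ.+ m) + inv (n ℕ.+ m) ≤ Z j m + inv m
    Z-tail {m} zero    1≤m = ℚ.≤-refl
    Z-tail {m} (suc n) 1≤m = begin
      Z j (n ℕ.+ m) + inv (suc (n ℕ.+ m) ℕ.^ j) + inv (suc (n ℕ.+ m))
        ≤⟨ ℚ.+-monoˡ-≤ _ (ℚ.+-monoʳ-≤ (Z j (n ℕ.+ m)) (inv-^≤ {j} {suc (n ℕ.+ m)} 2≤j ℕ.z<s)) ⟩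
      Z j (n ℕ.+ m) + i * i + i     ≡⟨ ℚ.+-assoc (Z j (n ℕ.+ m)) (i * i) i ⟩
      Z j (n ℕ.+ m) + (i * i + i)   ≤⟨ ℚ.+-monoʳ-≤ (Z j (n ℕ.+ m)) (inv²≤ (ℕ.≤-trans 1≤m (ℕ.m≤n+m m n))) ⟩
      Z j (n ℕ.+ m) + inv (n ℕ.+ m) ≤⟨ Z-tail n 1≤m ⟩
      Z j m + inv m                 ∎
      where i = inv (suc (n ℕ.+ m))

    Z-close : ∀ {m n} → 1 ℕ.≤ m → m ℕ.≤ n → Z j n ≤ Z j m + inv m
    Z-close {m} {n} 1≤m m≤n = begin
      Z j n                                    ≤⟨ ≤-add (inv n) (0≤inv n) refl ⟩
      Z j n + inv n                            ≡⟨ cong (λ x → Z j x + inv x) (ℕ.m∸n+n≡m m≤n) ⟨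
      Z j (n ℕ.∸ m ℕ.+ m) + inv (n ℕ.∸ m ℕ.+ m)  ≤⟨ Z-tail (n ℕ.∸ m) 1≤m ⟩
      Z j m + inv m                            ∎

    Z-mono : ∀ {m n} → m ℕ.≤ n → Z j m ≤ Z j n
    Z-mono {m} {n} m≤n = subst (λ x → Z j m ≤ Z j x) (ℕ.m∸n+n≡m m≤n) (go (n ℕ.∸ m))
      where
      go : ∀ d → Z j m ≤ Z j (d ℕ.+ m)
      go zero    = ℚ.≤-refl
      go (suc d) = ℚ.≤-trans (go d) (≤-add _ (0≤inv (suc (d ℕ.+ m) ℕ.^ j)) refl)

    -- ζ(j) ≤ ζ(2) ≤ 1 + 1/4 + (1/6 + 1/12 + …) = 7/4: that the excess over 1 is
    -- less than 1 makes the inversion below a contraction.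
    Z≤ : ∀ n → Z j n ≤ 1ℚ + ¾
    Z≤ 0 = 0≤+ 0≤1 (ℚ.nonNegative⁻¹ ¾)
    Z≤ 1 rewrite ℕ.^-zeroˡ j = ≤-add ¾ (ℚ.nonNegative⁻¹ ¾) refl
    Z≤ (suc (suc n)) = begin
      Z j (2 ℕ.+ n)                 ≤⟨ Z-close {2} {2 ℕ.+ n} ℕ.z<s (ℕ.s≤s ℕ.z<s) ⟩
      Z j 2 + ½                     ≤⟨ ℚ.+-monoˡ-≤ ½ (ℚ.+-mono-≤ (ℚ.≤-reflexive (trans (ℚ.+-identityˡ _) (cong inv (ℕ.^-zeroˡ j)))) (inv-^≤ {j} {2} 2≤j ℕ.z<s)) ⟩
      1ℚ + ½ * ½ + ½                ≡⟨⟩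
      1ℚ + ¾                        ∎

    Z≤2 : ∀ n → Z j n ≤ 1ℚ + 1ℚ
    Z≤2 n = ℚ.≤-trans (Z≤ n) (≤-add (½ * ½) (ℚ.nonNegative⁻¹ (½ * ½)) refl)

    private
      T : ℕ → ℚ
      T n = ∑ n (λ k → inv k * inv k * H k)

      -- For the series of H(k)/k² the quantity (1 + H n)/n bounds the tail, as 1/n does for 1/k²:
      -- from n to n + 1 it drops by at least the new term.
      T-step : ∀ {n} → 1 ℕ.≤ n → inv (suc n) * inv (suc n) * H (suc n) + (1ℚ + H (suc n)) * inv (suc n) ≤ (1ℚ + H n) * inv n
      T-step {n} 1≤n = ≤-add ((1ℚ + h) * i * (j′ * j′) - j′ * (j′ * j′)) nonneg (begin-equality
        (1ℚ + h) * i   ≡⟨ cong ((1ℚ + h) *_) (inv-telescope 1≤n) ⟩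
        (1ℚ + h) * (j′ + j′ * j′ + i * (j′ * j′))
          ≡⟨ solve 3 (λ h i j → (con 1ℚ :+ h) :* (j :+ j :* j :+ i :* (j :* j))
               := j :* j :* (h :+ j) :+ (con 1ℚ :+ (h :+ j)) :* j :+ ((con 1ℚ :+ h) :* i :* (j :* j) :- j :* (j :* j))) refl h i j′ ⟩
        j′ * j′ * (h + j′) + (1ℚ + (h + j′)) * j′ + ((1ℚ + h) * i * (j′ * j′) - j′ * (j′ * j′)) ∎)
        where
        h = H n
        i = inv n
        j′ = inv (suc n)
        nonneg : 0ℚ ≤ (1ℚ + h) * i * (j′ * j′) - j′ * (j′ * j′)
        nonneg = subst (0ℚ ≤_) (solve 3 (λ h i j → (h :* i :+ (i :- j)) :* (j :* j) := (con 1ℚ :+ h) :* i :* (j :* j) :- j :* (j :* j)) refl h i j′)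
          (0≤* (0≤+ (0≤* (0≤H n) (0≤inv n)) (ℚ.≤-trans (ℚ.≤-reflexive (sym (ℚ.+-inverseʳ j′))) (ℚ.+-monoˡ-≤ (- j′) (inv-antimono 1≤n (ℕ.n≤1+n n)))))
               (0≤* (0≤inv (suc n)) (0≤inv (suc n))))

      T-bound : ∀ n → T (suc n) + (1ℚ + H (suc n)) * inv (suc n) ≤ fromℕ 3
      -- At index 1 the left side is 1 + (1 + 1) · 1 = 3, the origin of the constant.
      T-bound zero    = ℚ.≤-refl
      T-bound (suc n) = begin
        T (suc n) + t + u       ≡⟨ ℚ.+-assoc (T (suc n)) t u ⟩
        T (suc n) + (t + u)     ≤⟨ ℚ.+-monoʳ-≤ (T (suc n)) (T-step {suc n} ℕ.z<s) ⟩
        T (suc n) + (1ℚ + H (suc n)) * inv (suc n)  ≤⟨ T-bound n ⟩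
        fromℕ 3                 ∎
        where
        t = inv (2 ℕ.+ n) * inv (2 ℕ.+ n) * H (2 ℕ.+ n)
        u = (1ℚ + H (2 ℕ.+ n)) * inv (2 ℕ.+ n)

      T≤3 : ∀ n → T n ≤ fromℕ 3
      T≤3 zero    = 0≤fromℕ 3
      T≤3 (suc n) = ℚ.≤-trans (≤-add _ (0≤* (0≤+ 0≤1 (0≤H (suc n))) (0≤inv (suc n))) refl) (T-bound n)

    -- The factor j + 3 comes from 2 + H(kʲ) ≤ 3 + j H(k) ≤ (j + 3) H(k), where H(k) ≥ 1; the factor
    -- 3 is the bound for the sum of H(k)/k².
    logZ : ℚ
    logZ = (fromℕ j + fromℕ 3) * fromℕ 3

    0≤logZ : 0ℚ ≤ logZ
    0≤logZ = 0≤* (0≤+ (0≤fromℕ j) (0≤fromℕ 3)) (0≤fromℕ 3)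

    logZ-bound : ∀ n → ∑ n (λ k → inv (k ℕ.^ j) * (fromℕ 2 + H (k ℕ.^ j))) ≤ logZ
    logZ-bound n = begin
      ∑ n (λ k → inv (k ℕ.^ j) * (fromℕ 2 + H (k ℕ.^ j)))     ≤⟨ ∑-mono n term≤ ⟩
      ∑ n (λ k → (fromℕ j + fromℕ 3) * (inv k * inv k * H k)) ≡⟨ ∑-*ˡ n (fromℕ j + fromℕ 3) (λ k → inv k * inv k * H k) ⟩
      (fromℕ j + fromℕ 3) * T n                               ≤⟨ *-monoˡ (0≤+ (0≤fromℕ j) (0≤fromℕ 3)) (T≤3 n) ⟩
      logZ                                                    ∎
      where
      term≤ : ∀ {k} → 1 ℕ.≤ k → k ℕ.≤ n →
        inv (k ℕ.^ j) * (fromℕ 2 + H (k ℕ.^ j)) ≤ (fromℕ j + fromℕ 3) * (inv k * inv k * H k)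
      term≤ {k} 1≤k _ = begin
        inv (k ℕ.^ j) * (fromℕ 2 + H (k ℕ.^ j))      ≤⟨ mul-mono (0≤inv (k ℕ.^ j)) (0≤* (0≤+ (0≤fromℕ j) (0≤fromℕ 3)) (0≤H k)) (inv-^≤ {j} 2≤j 1≤k) weight ⟩
        inv k * inv k * ((fromℕ j + fromℕ 3) * H k)  ≡⟨ solve 3 (λ i j h → i :* (j :* h) := j :* (i :* h)) refl (inv k * inv k) (fromℕ j + fromℕ 3) (H k) ⟩
        (fromℕ j + fromℕ 3) * (inv k * inv k * H k)  ∎
        where
        weight : fromℕ 2 + H (k ℕ.^ j) ≤ (fromℕ j + fromℕ 3) * H k
        weight = begin
          fromℕ 2 + H (k ℕ.^ j)            ≤⟨ ℚ.+-monoʳ-≤ (fromℕ 2) (H-^ j 1≤k) ⟩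
          fromℕ 2 + (1ℚ + fromℕ j * H k)   ≡⟨ ℚ.+-assoc (fromℕ 2) 1ℚ (fromℕ j * H k) ⟨
          fromℕ 3 * 1ℚ + fromℕ j * H k     ≤⟨ ℚ.+-monoˡ-≤ (fromℕ j * H k) (*-monoˡ (0≤fromℕ 3) (1≤H 1≤k)) ⟩
          fromℕ 3 * H k + fromℕ j * H k    ≡⟨ solve 3 (λ t j h → t :* h :+ j :* h := (j :+ t) :* h) refl (fromℕ 3) (fromℕ j) (H k) ⟩
          (fromℕ j + fromℕ 3) * H k        ∎

-- Functions of the form c n H(n) + O(n), and the operators `Op`.

module Asymptotics where
  open import Data.Rational.Base
  open ≡
  open Rationals
  open Harmonic
  open ℚ-Solver.+-*-Solver hiding (Op)
  open ℚ.≤-Reasoning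

  -- A real constant c > 0, given by rational approximations cₙ with an error O(1/n).
  record IsConstant (c : ℕ → ℚ) : Set where
    field
      κ C   : ℚ
      0<κ   : 0ℚ < κ
      lower : ∀ {n} → 1 ℕ.≤ n → κ ≤ c n
      upper : ∀ {n} → 1 ℕ.≤ n → c n ≤ C
      rate  : ∀ {m n} → 1 ℕ.≤ m → m ℕ.≤ n → ∣ c m - c n ∣ ≤ C * inv m

    0≤c : ∀ {n} → 1 ℕ.≤ n → 0ℚ ≤ c n
    0≤c 1≤n = ℚ.≤-trans (ℚ.<⇒≤ 0<κ) (lower 1≤n)

    0≤C : 0ℚ ≤ C
    0≤C = ℚ.≤-trans (0≤c {1} ℕ.≤-refl) (upper {1} ℕ.≤-refl)

  main : (ℕ → ℚ) → ℕ → ℚ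
  main c n = c n * nH n

  main-0 : ∀ c → main c 0 ≡ 0ℚ
  main-0 c = ℚ.*-zeroʳ (c 0)

  -- The main term at n uses the approximation `c n`, not the limit of c. By `rate` the two differ
  -- by O(1/n), which changes the main term by O(H(n)) only.
  record Asymptotic (f : ℕ → ℚ) : Set where
    field
      c          : ℕ → ℚ
      isConstant : IsConstant c
      B          : ℚ
      0≤B        : 0ℚ ≤ B
      bound      : ∀ n → ∣ f n - main c n ∣ ≤ B * fromℕ n
    open IsConstant isConstant public

  Op : ℕ → (ℕ → ℚ) → ℕ → ℚ
  Op j f n = ∑ n (λ k → f (quot n (k ℕ.^ j)))

  Op-minus : ∀ j f g n → Op j (λ m → f m - g m) n ≡ Op j f n - Op j g n
  Op-minus j f g n = ∑-minus n (λ k → f (quot n (k ℕ.^ j))) (λ k → g (quot n (k ℕ.^ j)))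

  quot-≤ˡ : ∀ n {q} → 1 ℕ.≤ q → quot n q ℕ.≤ n
  quot-≤ˡ n {suc q} _ = ℕ.m/n≤m n (suc q)

  ∣1-q∣≤1 : ∀ x m → x ≤ 1ℚ + m → m ≤ x → ∣ m - x ∣ ≤ 1ℚ
  ∣1-q∣≤1 x m x≤ m≤ = close {m} {x} {1ℚ} (ℚ.≤-trans m≤ (≤-add 1ℚ 0≤1 refl))
    (ℚ.≤-trans x≤ (ℚ.≤-reflexive (ℚ.+-comm 1ℚ m)))

  divisorSum : ℕ → ℚ
  divisorSum n = ∑ n (λ k → fromℕ (quot n k))

  ∑-1 : ∀ n → ∑ n (λ _ → 1ℚ) ≡ fromℕ n
  ∑-1 zero    = refl
  ∑-1 (suc n) = trans (cong (_+ 1ℚ) (∑-1 n)) (trans (ℚ.+-comm (fromℕ n) 1ℚ) (sym (fromℕ-suc n)))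

  -- Dropping the floor in ⌊n/k⌋ costs at most 1 for each of the n terms, and an error of n is
  -- admissible.
  divisorSum-asymptotic : Asymptotic divisorSum
  divisorSum-asymptotic = record
    { c = λ _ → 1ℚ
    ; isConstant = record
      { κ = 1ℚ ; C = 1ℚ
      ; 0<κ = ℚ.positive⁻¹ 1ℚ
      ; lower = λ _ → ℚ.≤-refl
      ; upper = λ _ → ℚ.≤-refl
      ; rate = λ {m} _ _ → subst (0ℚ ≤_) (sym (ℚ.*-identityˡ (inv m))) (0≤inv m)
      }
    ; B = 1ℚ
    ; 0≤B = 0≤1
    ; bound = λ n → begin
        ∣ divisorSum n - 1ℚ * nH n ∣
          ≡⟨ cong (λ x → ∣ divisorSum n - x ∣) (trans (ℚ.*-identityˡ (nH n)) (sym (∑-*ˡ n (fromℕ n) inv))) ⟩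
        ∣ divisorSum n - ∑ n (λ k → fromℕ n * inv k) ∣
          ≡⟨ cong ∣_∣ (∑-minus n (λ k → fromℕ (quot n k)) (λ k → fromℕ n * inv k)) ⟨
        ∣ ∑ n (λ k → fromℕ (quot n k) - fromℕ n * inv k) ∣
          ≤⟨ ∣∑∣≤∑∣∣ n (λ k → fromℕ (quot n k) - fromℕ n * inv k) ⟩
        ∑ n (λ k → ∣ fromℕ (quot n k) - fromℕ n * inv k ∣)
          ≤⟨ ∑-mono n (λ {k} 1≤k _ → ∣1-q∣≤1 (fromℕ n * inv k) (fromℕ (quot n k)) (quot-upper n 1≤k) (quot-lower n 1≤k)) ⟩
        ∑ n (λ _ → 1ℚ)   ≡⟨ ∑-1 n ⟩
        fromℕ n          ≡⟨ ℚ.*-identityˡ (fromℕ n) ⟨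
        1ℚ * fromℕ n     ∎
    }

  ∣p*q-p′*q′∣≤ : ∀ p q p′ q′ → ∣ p * q - p′ * q′ ∣ ≤ ∣ p - p′ ∣ * ∣ q ∣ + ∣ p′ ∣ * ∣ q - q′ ∣
  ∣p*q-p′*q′∣≤ p q p′ q′ = begin
    ∣ p * q - p′ * q′ ∣
      ≡⟨ cong ∣_∣ (solve 4 (λ p q p′ q′ → p :* q :- p′ :* q′ := (p :- p′) :* q :+ p′ :* (q :- q′)) refl p q p′ q′) ⟩
    ∣ (p - p′) * q + p′ * (q - q′) ∣        ≤⟨ ℚ.∣p+q∣≤∣p∣+∣q∣ ((p - p′) * q) (p′ * (q - q′)) ⟩
    ∣ (p - p′) * q ∣ + ∣ p′ * (q - q′) ∣    ≡⟨ cong₂ _+_ (ℚ.∣p*q∣≡∣p∣*∣q∣ (p - p′) q) (ℚ.∣p*q∣≡∣p∣*∣q∣ p′ (q - q′)) ⟩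
    ∣ p - p′ ∣ * ∣ q ∣ + ∣ p′ ∣ * ∣ q - q′ ∣ ∎

  -- The factor d will be a partial sum of ζ(j), which lies between 1 and 2, or the reciprocal of
  -- one, between ½ and 1. In the rate, 3C = 2C + C: the change of c times d ≤ 2, plus c ≤ C times
  -- the change of d.
  constant-* : ∀ {c} → IsConstant c → (d : ℕ → ℚ) →
    (∀ {n} → 1 ℕ.≤ n → ½ ≤ d n) → (∀ {n} → 1 ℕ.≤ n → d n ≤ 1ℚ + 1ℚ) →
    (∀ {m n} → 1 ℕ.≤ m → m ℕ.≤ n → ∣ d m - d n ∣ ≤ inv m) →
    IsConstant (λ n → c n * d n)
  constant-* {c} isC d ½≤d d≤2 d-rate = record
    { κ = κ * ½
    ; C = fromℕ 3 * C
    ; 0<κ = 0<halve 0<κ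
    ; lower = λ 1≤n → mul-mono (ℚ.<⇒≤ 0<κ) (0≤d 1≤n) (lower 1≤n) (½≤d 1≤n)
    ; upper = λ {n} 1≤n → begin
        c n * d n          ≤⟨ mul-mono (0≤c 1≤n) (0≤+ 0≤1 0≤1) (upper 1≤n) (d≤2 1≤n) ⟩
        C * (1ℚ + 1ℚ)      ≤⟨ ≤-add C 0≤C (solve 1 (λ c → con (fromℕ 3) :* c := c :* (con 1ℚ :+ con 1ℚ) :+ c) refl C) ⟩
        fromℕ 3 * C        ∎
    ; rate = λ {m} {n} 1≤m m≤n → let 1≤n = ℕ.≤-trans 1≤m m≤n in begin
        ∣ c m * d m - c n * d n ∣                        ≤⟨ ∣p*q-p′*q′∣≤ (c m) (d m) (c n) (d n) ⟩
        ∣ c m - c n ∣ * ∣ d m ∣ + ∣ c n ∣ * ∣ d m - d n ∣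
          ≡⟨ cong₂ (λ x y → ∣ c m - c n ∣ * x + y * ∣ d m - d n ∣) (ℚ.0≤p⇒∣p∣≡p (0≤d 1≤m)) (ℚ.0≤p⇒∣p∣≡p (0≤c 1≤n)) ⟩
        ∣ c m - c n ∣ * d m + c n * ∣ d m - d n ∣
          ≤⟨ ℚ.+-mono-≤ (mul-mono (ℚ.0≤∣p∣ (c m - c n)) (0≤+ 0≤1 0≤1) (rate 1≤m m≤n) (d≤2 1≤m))
                        (mul-mono (0≤c 1≤n) (0≤inv m) (upper 1≤n) (d-rate 1≤m m≤n)) ⟩
        C * inv m * (1ℚ + 1ℚ) + C * inv m
          ≡⟨ solve 2 (λ c i → c :* i :* (con 1ℚ :+ con 1ℚ) :+ c :* i := con (fromℕ 3) :* c :* i) refl C (inv m) ⟩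
        fromℕ 3 * C * inv m ∎
    }
    where
    open IsConstant isC
    0≤d : ∀ {n} → 1 ℕ.≤ n → 0ℚ ≤ d n
    0≤d 1≤n = ℚ.≤-trans (ℚ.nonNegative⁻¹ ½) (½≤d 1≤n)

  module _ {c : ℕ → ℚ} (isC : IsConstant c) where
    open IsConstant isC

    -- The change of the constant is at most C/m, and C/m · m H(m) = C H(m) ≤ C m. This is what
    -- makes a rate of order 1/n sufficient.
    drift : ∀ {m n} → m ℕ.≤ n → 1 ℕ.≤ n → ∣ c m * nH m - c n * nH m ∣ ≤ C * fromℕ m
    drift {zero} {n} _ _ = ℚ.≤-reflexive
      (trans (cong ∣_∣ (solve 2 (λ a b → a :* con 0ℚ :- b :* con 0ℚ := con 0ℚ) refl (c 0) (c n))) (sym (ℚ.*-zeroʳ C)))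
    drift {m@(suc _)} {n} m≤n 1≤n = begin
      ∣ c m * nH m - c n * nH m ∣   ≡⟨ cong ∣_∣ (solve 3 (λ a b h → a :* h :- b :* h := (a :- b) :* h) refl (c m) (c n) (nH m)) ⟩
      ∣ (c m - c n) * nH m ∣        ≡⟨ ℚ.∣p*q∣≡∣p∣*∣q∣ (c m - c n) (nH m) ⟩
      ∣ c m - c n ∣ * ∣ nH m ∣      ≡⟨ cong (∣ c m - c n ∣ *_) (ℚ.0≤p⇒∣p∣≡p (0≤nH m)) ⟩
      ∣ c m - c n ∣ * nH m          ≤⟨ *-monoʳ (0≤nH m) (rate {m} ℕ.z<s m≤n) ⟩
      C * inv m * (fromℕ m * H m)   ≡⟨ solve 4 (λ c i m h → c :* i :* (m :* h) := c :* h :* (m :* i)) refl C (inv m) (fromℕ m) (H m) ⟩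
      C * H m * (fromℕ m * inv m)   ≡⟨ trans (cong (C * H m *_) (*-inv {m} ℕ.z<s)) (ℚ.*-identityʳ _) ⟩
      C * H m                       ≤⟨ *-monoˡ 0≤C (H≤id m) ⟩
      C * fromℕ m                   ∎

  module _ {j : ℕ} (2≤j : 2 ℕ.≤ j) where

    ∑-quot≤ : ∀ n → ∑ n (λ k → fromℕ (quot n (k ℕ.^ j))) ≤ fromℕ n * Z j n
    ∑-quot≤ n = begin
      ∑ n (λ k → fromℕ (quot n (k ℕ.^ j)))     ≤⟨ ∑-mono n (λ 1≤k _ → quot-lower n (1≤^ j 1≤k)) ⟩
      ∑ n (λ k → fromℕ n * inv (k ℕ.^ j))      ≡⟨ ∑-*ˡ n (fromℕ n) (λ k → inv (k ℕ.^ j)) ⟩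
      fromℕ n * Z j n                          ∎

    Z-rate : ∀ {m n} → 1 ℕ.≤ m → m ℕ.≤ n → ∣ Z j m - Z j n ∣ ≤ inv m
    Z-rate {m} {n} 1≤m m≤n = close {Z j m} {Z j n}
      (ℚ.≤-trans (Z-mono {j} 2≤j m≤n) (≤-add (inv m) (0≤inv m) refl)) (Z-close 2≤j 1≤m m≤n)

    module _ {c : ℕ → ℚ} (isC : IsConstant c) where
      open IsConstant isC

      private
        -- In 2 + H q, one unit pays for the change of the constant by `drift`, and 1 + H q for
        -- replacing `nH` of the quotient by a multiple of `nH n`.
        term-close : ∀ {n q} → 1 ℕ.≤ n → 1 ℕ.≤ q →
          ∣ main c (quot n q) - main c n * inv q ∣ ≤ C * fromℕ n * (inv q * (fromℕ 2 + H q))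
        term-close {n} {q} 1≤n 1≤q = begin
          ∣ c m * nH m - c n * nH n * inv q ∣
            ≤⟨ triangle (c m * nH m) (c n * nH m) (c n * nH n * inv q) (drift isC (quot-≤ˡ n 1≤q) 1≤n) scale ⟩
          C * fromℕ m + C * e           ≤⟨ ℚ.+-monoˡ-≤ (C * e) (*-monoˡ 0≤C (quot-lower n 1≤q)) ⟩
          C * (fromℕ n * inv q) + C * e
            ≡⟨ solve 4 (λ c n i h → c :* (n :* i) :+ c :* (n :* (i :* (con 1ℚ :+ h))) := c :* n :* (i :* (con (fromℕ 2) :+ h))) refl C (fromℕ n) (inv q) (H q) ⟩
          C * fromℕ n * (inv q * (fromℕ 2 + H q)) ∎
          where
          m = quot n q
          e = fromℕ n * (inv q * (1ℚ + H q))
          0≤e : 0ℚ ≤ e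
          0≤e = 0≤* (0≤fromℕ n) (0≤* (0≤inv q) (0≤+ 0≤1 (0≤H q)))
          scale : ∣ c n * nH m - c n * nH n * inv q ∣ ≤ C * e
          scale = begin
            ∣ c n * nH m - c n * nH n * inv q ∣
              ≡⟨ cong ∣_∣ (solve 4 (λ c a b i → c :* a :- c :* b :* i := c :* (a :- i :* b)) refl (c n) (nH m) (nH n) (inv q)) ⟩
            ∣ c n * (nH m - inv q * nH n) ∣     ≡⟨ ℚ.∣p*q∣≡∣p∣*∣q∣ (c n) (nH m - inv q * nH n) ⟩
            ∣ c n ∣ * ∣ nH m - inv q * nH n ∣   ≡⟨ cong (_* ∣ nH m - inv q * nH n ∣) (ℚ.0≤p⇒∣p∣≡p (0≤c 1≤n)) ⟩
            c n * ∣ nH m - inv q * nH n ∣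
              ≤⟨ mul-mono (0≤c 1≤n) 0≤e (upper 1≤n)
                   (close {nH m} {inv q * nH n} (ℚ.≤-trans (nH-quot-upper n 1≤q) (≤-add e 0≤e refl)) (nH-quot-lower n 1≤q)) ⟩
            C * e ∎

      Op-main : ∀ n → ∣ Op j (main c) n - main (λ m → c m * Z j m) n ∣ ≤ C * logZ {j} 2≤j * fromℕ n
      Op-main zero = ℚ.≤-reflexive (trans (cong (λ x → ∣ 0ℚ - x ∣) (main-0 (λ m → c m * Z j m))) (sym (ℚ.*-zeroʳ (C * logZ {j} 2≤j))))
      Op-main n@(suc _) = begin
        ∣ Op j (main c) n - c n * Z j n * nH n ∣
          ≡⟨ cong (λ x → ∣ Op j (main c) n - x ∣)
               (trans (solve 3 (λ c z h → c :* z :* h := c :* h :* z) refl (c n) (Z j n) (nH n)) (sym (∑-*ˡ n (main c n) _))) ⟩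
        ∣ Op j (main c) n - ∑ n (λ k → main c n * inv (k ℕ.^ j)) ∣
          ≡⟨ cong ∣_∣ (∑-minus n (λ k → main c (quot n (k ℕ.^ j))) (λ k → main c n * inv (k ℕ.^ j))) ⟨
        ∣ ∑ n (λ k → main c (quot n (k ℕ.^ j)) - main c n * inv (k ℕ.^ j)) ∣
          ≤⟨ ∣∑∣≤∑∣∣ n (λ k → main c (quot n (k ℕ.^ j)) - main c n * inv (k ℕ.^ j)) ⟩
        ∑ n (λ k → ∣ main c (quot n (k ℕ.^ j)) - main c n * inv (k ℕ.^ j) ∣)
          ≤⟨ ∑-mono n (λ 1≤k _ → term-close {n} ℕ.z<s (1≤^ j 1≤k)) ⟩
        ∑ n (λ k → C * fromℕ n * (inv (k ℕ.^ j) * (fromℕ 2 + H (k ℕ.^ j))))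
          ≡⟨ ∑-*ˡ n (C * fromℕ n) (λ k → inv (k ℕ.^ j) * (fromℕ 2 + H (k ℕ.^ j))) ⟩
        C * fromℕ n * ∑ n (λ k → inv (k ℕ.^ j) * (fromℕ 2 + H (k ℕ.^ j)))
          ≤⟨ *-monoˡ (0≤* 0≤C (0≤fromℕ n)) (logZ-bound {j} 2≤j n) ⟩
        C * fromℕ n * logZ {j} 2≤j
          ≡⟨ solve 3 (λ c n l → c :* n :* l := c :* l :* n) refl C (fromℕ n) (logZ {j} 2≤j) ⟩
        C * logZ {j} 2≤j * fromℕ n ∎

    Op-asymptotic : ∀ {f} → Asymptotic f → Asymptotic (Op j f)
    Op-asymptotic {f} F = record
      { c = λ n → c n * Z j n
      ; isConstant = constant-* isConstant (Z j)
          (λ 1≤n → ℚ.≤-trans (ℚ.p≤p⊔q ½ 1ℚ) (1≤Z j 1≤n)) (λ {n} _ → Z≤2 2≤j n) Z-rate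
      ; B = B * (1ℚ + 1ℚ) + C * logZ {j} 2≤j
      ; 0≤B = 0≤+ (0≤* 0≤B (0≤+ 0≤1 0≤1)) (0≤* 0≤C (0≤logZ {j} 2≤j))
      ; bound = λ n → ℚ.≤-trans
          (triangle (Op j f n) (Op j (main c) n) (main (λ m → c m * Z j m) n) (error n) (Op-main isConstant n))
          (ℚ.≤-reflexive (sym (ℚ.*-distribʳ-+ (fromℕ n) (B * (1ℚ + 1ℚ)) (C * logZ {j} 2≤j))))
      }
      where
      open Asymptotic F
      error : ∀ n → ∣ Op j f n - Op j (main c) n ∣ ≤ B * (1ℚ + 1ℚ) * fromℕ n
      error n = begin
        ∣ Op j f n - Op j (main c) n ∣          ≡⟨ cong ∣_∣ (Op-minus j f (main c) n) ⟨
        ∣ ∑ n (λ k → f (quot n (k ℕ.^ j)) - main c (quot n (k ℕ.^ j))) ∣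
          ≤⟨ ∣∑∣≤∑∣∣ n (λ k → f (quot n (k ℕ.^ j)) - main c (quot n (k ℕ.^ j))) ⟩
        ∑ n (λ k → ∣ f (quot n (k ℕ.^ j)) - main c (quot n (k ℕ.^ j)) ∣)
          ≤⟨ ∑-mono n (λ {k} _ _ → bound (quot n (k ℕ.^ j))) ⟩
        ∑ n (λ k → B * fromℕ (quot n (k ℕ.^ j)))  ≡⟨ ∑-*ˡ n B (λ k → fromℕ (quot n (k ℕ.^ j))) ⟩
        B * ∑ n (λ k → fromℕ (quot n (k ℕ.^ j)))  ≤⟨ *-monoˡ 0≤B (∑-quot≤ n) ⟩
        B * (fromℕ n * Z j n)                     ≤⟨ *-monoˡ 0≤B (*-monoˡ (0≤fromℕ n) (Z≤2 2≤j n)) ⟩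
        B * (fromℕ n * (1ℚ + 1ℚ))                 ≡⟨ solve 3 (λ b n t → b :* (n :* t) := b :* t :* n) refl B (fromℕ n) (1ℚ + 1ℚ) ⟩
        B * (1ℚ + 1ℚ) * fromℕ n                   ∎

    private
      0≤Z-1 : ∀ n → 0ℚ ≤ Z j (suc n) - 1ℚ
      0≤Z-1 n = ℚ.+-monoˡ-≤ (- 1ℚ) (1≤Z j {suc n} ℕ.z<s)

      -- `recip p` is 1/(1 + p), so Z enters as 1 + (Z - 1). The value at 0 is a default, since the
      -- empty sum `Z j 0` is 0.
      1/Z : ℕ → ℚ
      1/Z zero    = 0ℚ
      1/Z (suc n) = recip (Z j (suc n) - 1ℚ) (0≤Z-1 n)

      1/Z-*-Z : ∀ {n} → 1 ℕ.≤ n → 1/Z n * Z j n ≡ 1ℚ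
      1/Z-*-Z {suc n} _ = trans
        (cong (1/Z (suc n) *_) (solve 1 (λ z → z := con 1ℚ :+ (z :- con 1ℚ)) refl (Z j (suc n))))
        (recip-* (Z j (suc n) - 1ℚ) (0≤Z-1 n))

      0≤1/Z : ∀ n → 0ℚ ≤ 1/Z n
      0≤1/Z zero    = ℚ.≤-refl
      0≤1/Z (suc n) = 0≤recip (Z j (suc n) - 1ℚ) (0≤Z-1 n)

      1/Z≤1 : ∀ n → 1/Z n ≤ 1ℚ
      1/Z≤1 zero    = 0≤1
      1/Z≤1 (suc n) = recip≤1 (Z j (suc n) - 1ℚ) (0≤Z-1 n)

      ½≤1/Z : ∀ {n} → 1 ℕ.≤ n → ½ ≤ 1/Z n
      ½≤1/Z {n} 1≤n = begin
        ½                            ≡⟨⟩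
        1ℚ * ½                       ≡⟨ cong (_* ½) (1/Z-*-Z 1≤n) ⟨
        1/Z n * Z j n * ½            ≤⟨ *-monoʳ (ℚ.nonNegative⁻¹ ½) (*-monoˡ (0≤1/Z n) (Z≤2 2≤j n)) ⟩
        1/Z n * (1ℚ + 1ℚ) * ½        ≡⟨ solve 1 (λ z → z :* (con 1ℚ :+ con 1ℚ) :* con ½ := z) refl (1/Z n) ⟩
        1/Z n                        ∎

      1/Z-rate : ∀ {m n} → 1 ℕ.≤ m → m ℕ.≤ n → ∣ 1/Z m - 1/Z n ∣ ≤ inv m
      1/Z-rate {m} {n} 1≤m m≤n = begin
        ∣ r - s ∣                                ≡⟨ cong ∣_∣ (cong₂ _-_ (sym (ℚ.*-identityʳ r)) (sym (ℚ.*-identityʳ s))) ⟩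
        ∣ r * 1ℚ - s * 1ℚ ∣                      ≡⟨ cong ∣_∣ (cong₂ (λ x y → r * x - s * y) (sym (1/Z-*-Z (ℕ.≤-trans 1≤m m≤n))) (sym (1/Z-*-Z 1≤m))) ⟩
        ∣ r * (s * Z j n) - s * (r * Z j m) ∣    ≡⟨ cong ∣_∣ (solve 4 (λ r s a b → r :* (s :* a) :- s :* (r :* b) := (b :- a) :* (:- (r :* s))) refl r s (Z j n) (Z j m)) ⟩
        ∣ (Z j m - Z j n) * (- (r * s)) ∣        ≡⟨ ℚ.∣p*q∣≡∣p∣*∣q∣ (Z j m - Z j n) (- (r * s)) ⟩
        ∣ Z j m - Z j n ∣ * ∣ - (r * s) ∣        ≡⟨ cong (∣ Z j m - Z j n ∣ *_) (trans (ℚ.∣-p∣≡∣p∣ (r * s)) (ℚ.0≤p⇒∣p∣≡p (0≤* (0≤1/Z m) (0≤1/Z n)))) ⟩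
        ∣ Z j m - Z j n ∣ * (r * s)              ≤⟨ shrink ∣ Z j m - Z j n ∣ (r * s) (ℚ.0≤∣p∣ (Z j m - Z j n)) (ℚ.≤-trans (shrink r s (0≤1/Z m) (1/Z≤1 n)) (1/Z≤1 m)) ⟩
        ∣ Z j m - Z j n ∣                        ≤⟨ Z-rate 1≤m m≤n ⟩
        inv m                                    ∎
        where
        r = 1/Z m
        s = 1/Z n

    ∑-shift : ∀ n f → ∑ (suc n) f ≡ f 1 + ∑ n (f ∘ suc)
    ∑-shift zero    f = trans (ℚ.+-identityˡ (f 1)) (sym (ℚ.+-identityʳ (f 1)))
    ∑-shift (suc n) f = trans (cong (_+ f (2 ℕ.+ n)) (∑-shift n f)) (ℚ.+-assoc (f 1) (∑ n (f ∘ suc)) (f (2 ℕ.+ n)))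

    quot-1 : ∀ n → quot n 1 ≡ n
    quot-1 = ℕ.n/1≡n

    quot-< : ∀ n {q} → 1 ℕ.≤ n → 2 ℕ.≤ q → quot n q ℕ.< n
    quot-< n {suc q} 1≤n 2≤q = ℕ.m/n<m n (suc q) {{ℕ.>-nonZero 1≤n}} {{_}} 2≤q

    -- The k = 1 term of Op j (f − main) n is the error at n, and the other terms are
    -- errors at smaller arguments whose total is at most ¾ n.
    Op⁻¹-asymptotic : ∀ {f} → f 0 ≡ 0ℚ → Asymptotic (Op j f) → Asymptotic f
    Op⁻¹-asymptotic {f} f0 F = record
      { c = d
      ; isConstant = isD
      -- The factor 4 is the fixed point of the recursion: A + ¾ · 4A = 4A.
      ; B = fromℕ 4 * A
      ; 0≤B = 0≤* (0≤fromℕ 4) 0≤A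
      ; bound = <-rec _ step
      }
      where
      open Asymptotic F
      d : ℕ → ℚ
      d n = c n * 1/Z n
      isD : IsConstant d
      isD = constant-* isConstant 1/Z ½≤1/Z (λ {n} _ → ℚ.≤-trans (1/Z≤1 n) (≤-add 1ℚ 0≤1 refl)) 1/Z-rate
      module D = IsConstant isD
      A = B + D.C * logZ {j} 2≤j
      0≤A : 0ℚ ≤ A
      0≤A = 0≤+ 0≤B (0≤* D.0≤C (0≤logZ {j} 2≤j))

      e : ℕ → ℚ
      e n = f n - main d n

      main-d : ∀ n → main (λ m → d m * Z j m) n ≡ main c n
      -- The default `1/Z 0` does no harm, because at 0 the factor `nH 0` makes both main terms
      -- vanish.
      main-d zero = trans (main-0 (λ m → d m * Z j m)) (sym (main-0 c))
      main-d n@(suc _) = cong (_* nH n) (trans (ℚ.*-assoc (c n) (1/Z n) (Z j n))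
        (trans (cong (c n *_) (1/Z-*-Z {n} ℕ.z<s)) (ℚ.*-identityʳ (c n))))

      Op-e : ∀ n → ∣ Op j e n ∣ ≤ A * fromℕ n
      Op-e n = begin
        ∣ Op j e n ∣                       ≡⟨ cong ∣_∣ (Op-minus j f (main d) n) ⟩
        ∣ Op j f n - Op j (main d) n ∣
          ≤⟨ triangle (Op j f n) (main c n) (Op j (main d) n) (bound n)
               (subst (_≤ D.C * logZ {j} 2≤j * fromℕ n)
                 (trans (cong (λ x → ∣ Op j (main d) n - x ∣) (main-d n)) (∣p-q∣≡∣q-p∣ (Op j (main d) n) (main c n)))
                 (Op-main isD n)) ⟩
        B * fromℕ n + D.C * logZ {j} 2≤j * fromℕ n  ≡⟨ ℚ.*-distribʳ-+ (fromℕ n) B (D.C * logZ {j} 2≤j) ⟨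
        A * fromℕ n ∎

      step : ∀ n → (∀ {m} → m ℕ.< n → ∣ e m ∣ ≤ fromℕ 4 * A * fromℕ m) → ∣ e n ∣ ≤ fromℕ 4 * A * fromℕ n
      step zero _ = ℚ.≤-reflexive (trans (cong ∣_∣ (cong₂ _-_ f0 (main-0 d))) (sym (ℚ.*-zeroʳ (fromℕ 4 * A))))
      step n@(suc n-1) ih = begin
        ∣ e n ∣                              ≡⟨ cong ∣_∣ (solve 2 (λ e s → e := (e :+ s) :- s) refl (e n) rest) ⟩
        ∣ e n + rest - rest ∣                ≤⟨ ℚ.∣p-q∣≤∣p∣+∣q∣ (e n + rest) rest ⟩
        ∣ e n + rest ∣ + ∣ rest ∣            ≡⟨ cong (λ x → ∣ x ∣ + ∣ rest ∣) (sym split) ⟩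
        ∣ Op j e n ∣ + ∣ rest ∣              ≤⟨ ℚ.+-mono-≤ (Op-e n) (∣∑∣≤∑∣∣ n-1 g) ⟩
        A * fromℕ n + ∑ n-1 (λ k → ∣ g k ∣)  ≤⟨ ℚ.+-monoʳ-≤ (A * fromℕ n) (∑-mono n-1 (λ {k} 1≤k _ → g≤ k 1≤k)) ⟩
        A * fromℕ n + ∑ n-1 (λ k → fromℕ 4 * A * fromℕ n * inv (suc k ℕ.^ j))
          ≡⟨ cong (A * fromℕ n +_) (∑-*ˡ n-1 (fromℕ 4 * A * fromℕ n) (λ k → inv (suc k ℕ.^ j))) ⟩
        A * fromℕ n + fromℕ 4 * A * fromℕ n * z
          ≤⟨ ℚ.+-monoʳ-≤ (A * fromℕ n) (*-monoˡ (0≤* (0≤* (0≤fromℕ 4) 0≤A) (0≤fromℕ n)) z≤) ⟩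
        A * fromℕ n + fromℕ 4 * A * fromℕ n * ¾
          ≡⟨ solve 2 (λ a n → a :* n :+ con (fromℕ 4) :* a :* n :* con ¾ := con (fromℕ 4) :* a :* n) refl A (fromℕ n) ⟩
        fromℕ 4 * A * fromℕ n ∎
        where
        g : ℕ → ℚ
        g k = e (quot n (suc k ℕ.^ j))
        rest z : ℚ
        rest = ∑ n-1 g
        z = ∑ n-1 (λ k → inv (suc k ℕ.^ j))
        split : Op j e n ≡ e n + rest
        split = trans (∑-shift n-1 (λ k → e (quot n (k ℕ.^ j))))
          (cong (λ x → e x + rest) (trans (cong (quot n) (ℕ.^-zeroˡ j)) (quot-1 n)))
        z≤ : z ≤ ¾
        z≤ = begin
          z                 ≡⟨ solve 1 (λ z → z := (con 1ℚ :+ z) :- con 1ℚ) refl z ⟩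
          1ℚ + z - 1ℚ       ≡⟨ cong (_- 1ℚ) (trans (cong (λ x → inv x + z) (sym (ℕ.^-zeroˡ j))) (sym (∑-shift n-1 (λ k → inv (k ℕ.^ j))))) ⟩
          Z j n - 1ℚ        ≤⟨ minus≤ {Z j n} {1ℚ} (Z≤ {j} 2≤j n) ⟩
          ¾         ∎
        g≤ : ∀ k → 1 ℕ.≤ k → ∣ g k ∣ ≤ fromℕ 4 * A * fromℕ n * inv (suc k ℕ.^ j)
        g≤ k 1≤k = begin
          ∣ g k ∣                                              ≤⟨ ih (quot-< n ℕ.z<s 2≤q) ⟩
          fromℕ 4 * A * fromℕ (quot n (suc k ℕ.^ j))           ≤⟨ *-monoˡ (0≤* (0≤fromℕ 4) 0≤A) (quot-lower n (ℕ.≤-trans ℕ.z<s 2≤q)) ⟩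
          fromℕ 4 * A * (fromℕ n * inv (suc k ℕ.^ j))          ≡⟨ ℚ.*-assoc (fromℕ 4 * A) (fromℕ n) (inv (suc k ℕ.^ j)) ⟨
          fromℕ 4 * A * fromℕ n * inv (suc k ℕ.^ j)            ∎
          where
          2≤q : 2 ℕ.≤ suc k ℕ.^ j
          2≤q = ℕ.≤-trans (subst (2 ℕ.≤_) (sym (ℕ.*-identityʳ (suc k))) (ℕ.s≤s 1≤k))
                          (ℕ.^-monoʳ-≤ (suc k) (ℕ.≤-trans ℕ.z<s 2≤j))

-- Comparison of N H(N) with x log x.

module LogEstimate where
  open import Data.Rational.Base
  open ≡
  import Defs as ℝ
  open ℝ using (ℝ; seq; cauchy)
  open Rationals
  open Harmonic
  open Asymptotics
  open ℚ-Solver.+-*-Solver hiding (Op)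
  open ℚ.≤-Reasoning

  1/pow₂-* : ∀ k → 1/pow₂ k * fromℕ (2 ℕ.^ k) ≡ 1ℚ
  1/pow₂-* zero    = refl
  1/pow₂-* (suc k) = begin-equality
    1/pow₂ k * ½ * fromℕ (2 ℕ.* 2 ℕ.^ k)          ≡⟨ cong (1/pow₂ k * ½ *_) (fromℕ-* 2 (2 ℕ.^ k)) ⟩
    1/pow₂ k * ½ * (fromℕ 2 * fromℕ (2 ℕ.^ k))    ≡⟨ solve 2 (λ p q → p :* con ½ :* (con (fromℕ 2) :* q) := p :* q) refl (1/pow₂ k) (fromℕ (2 ℕ.^ k)) ⟩
    1/pow₂ k * fromℕ (2 ℕ.^ k)                    ≡⟨ 1/pow₂-* k ⟩
    1ℚ                                            ∎

  1≤2^ : ∀ k → 1 ℕ.≤ 2 ℕ.^ k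
  1≤2^ k = 1≤^ k ℕ.z<s

  n≤2^n : ∀ n → n ℕ.≤ 2 ℕ.^ n
  n≤2^n zero    = ℕ.z≤n
  n≤2^n (suc n) = ℕ.≤-trans (ℕ.+-mono-≤ (1≤2^ n) (n≤2^n n)) (ℕ.≤-reflexive (cong (2 ℕ.^ n ℕ.+_) (sym (ℕ.+-identityʳ (2 ℕ.^ n)))))

  sumBelow-cong : ∀ n {f g} → (∀ i → f i ≡ g i) → sumBelow n f ≡ sumBelow n g
  sumBelow-cong zero    f≡g = refl
  sumBelow-cong (suc n) f≡g = cong₂ _+_ (sumBelow-cong n f≡g) (f≡g n)

  -- With Q = 2ᵏ cells, the Riemann sum of ∫ dt/t over [1, 1 + n] is the sum of
  -- n / (Q + i n) for i = 1, …, Q, to be compared with the sum of 1/m for Q < m ≤ Q + Q n.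
  module _ (k n : ℕ) where
    private
      Q : ℕ
      Q = 2 ℕ.^ k

      point : ℕ → ℕ
      point i = i ℕ.* n ℕ.+ Q

      1≤point : ∀ i → 1 ℕ.≤ point i
      1≤point i = ℕ.≤-trans (1≤2^ k) (ℕ.m≤n+m Q (i ℕ.* n))

      next : ∀ i → point (suc i) ≡ n ℕ.+ point i
      next i = ℕ.+-assoc n (i ℕ.* n) Q

      h : ℚ
      h = mesh k (fromℕ n)

      0≤h : 0ℚ ≤ h
      0≤h = 0≤mesh k (0≤fromℕ n)

      recip-point : ∀ i → recip (fromℕ i * h) (0≤j* i 0≤h) ≡ fromℕ Q * inv (point i)
      recip-point i = begin-equality
        r                                               ≡⟨ ℚ.*-identityʳ r ⟨
        r * 1ℚ                                          ≡⟨ cong (r *_) (*-inv (1≤point i)) ⟨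
        r * (fromℕ (point i) * inv (point i))           ≡⟨ cong (λ x → r * (x * inv (point i))) point≡ ⟩
        r * ((1ℚ + fromℕ i * h) * fromℕ Q * inv (point i))
          ≡⟨ solve 4 (λ r w q p → r :* (w :* q :* p) := r :* w :* (q :* p)) refl r (1ℚ + fromℕ i * h) (fromℕ Q) (inv (point i)) ⟩
        r * (1ℚ + fromℕ i * h) * (fromℕ Q * inv (point i))
          ≡⟨ cong (_* (fromℕ Q * inv (point i))) (recip-* (fromℕ i * h) (0≤j* i 0≤h)) ⟩
        1ℚ * (fromℕ Q * inv (point i))                  ≡⟨ ℚ.*-identityˡ _ ⟩
        fromℕ Q * inv (point i)                         ∎
        where
        r = recip (fromℕ i * h) (0≤j* i 0≤h)
        point≡ : fromℕ (point i) ≡ (1ℚ + fromℕ i * h) * fromℕ Q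
        point≡ = begin-equality
          fromℕ (i ℕ.* n ℕ.+ Q)                      ≡⟨ trans (fromℕ-+ (i ℕ.* n) Q) (cong (_+ fromℕ Q) (fromℕ-* i n)) ⟩
          fromℕ i * fromℕ n + fromℕ Q                ≡⟨ cong (_+ fromℕ Q) (sym (ℚ.*-identityʳ (fromℕ i * fromℕ n))) ⟩
          fromℕ i * fromℕ n * 1ℚ + fromℕ Q           ≡⟨ cong (λ x → fromℕ i * fromℕ n * x + fromℕ Q) (1/pow₂-* k) ⟨
          fromℕ i * fromℕ n * (1/pow₂ k * fromℕ Q) + fromℕ Q
            ≡⟨ solve 4 (λ i n p q → i :* n :* (p :* q) :+ q := (con 1ℚ :+ i :* (p :* n)) :* q) refl (fromℕ i) (fromℕ n) (1/pow₂ k) (fromℕ Q) ⟩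
          (1ℚ + fromℕ i * h) * fromℕ Q               ∎

      cell : ℕ → ℚ
      cell i = fromℕ n * inv (point (suc i))

      term≡cell : ∀ i → term (suc i) h 0≤h ≡ cell i
      term≡cell i = begin-equality
        h * recip (fromℕ (suc i) * h) (0≤j* (suc i) 0≤h)  ≡⟨ cong (h *_) (recip-point (suc i)) ⟩
        1/pow₂ k * fromℕ n * (fromℕ Q * inv (point (suc i)))
          ≡⟨ solve 4 (λ p n q i → p :* n :* (q :* i) := n :* i :* (p :* q)) refl (1/pow₂ k) (fromℕ n) (fromℕ Q) (inv (point (suc i))) ⟩
        cell i * (1/pow₂ k * fromℕ Q)                     ≡⟨ cong (cell i *_) (1/pow₂-* k) ⟩
        cell i * 1ℚ                                       ≡⟨ ℚ.*-identityʳ (cell i) ⟩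
        cell i                                            ∎

      -- Cell i is n times the last, hence smallest, term of the block of H that runs from `point i`
      -- to `point (suc i)`.
      cells-upper : ∀ i → H Q + sumBelow i cell ≤ H (point i)
      cells-upper zero    = ℚ.≤-reflexive (ℚ.+-identityʳ (H Q))
      cells-upper (suc i) = begin
        H Q + (sumBelow i cell + cell i)   ≡⟨ ℚ.+-assoc (H Q) (sumBelow i cell) (cell i) ⟨
        H Q + sumBelow i cell + cell i     ≤⟨ ℚ.+-monoˡ-≤ (cell i) (cells-upper i) ⟩
        H (point i) + cell i               ≤⟨ block-lower n (ℕ.≤-reflexive (sym (next i))) ⟩
        H (n ℕ.+ point i)                  ≡⟨ cong H (next i) ⟨
        H (point (suc i))                  ∎

      -- The same cell i bounds from above the block that starts at `point (suc i)`. The comparison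
      -- is thus shifted by one block, and the block from Q to `point 1` remains uncovered.
      cells-lower : ∀ i → H (point (suc i)) ≤ H (point 1) + sumBelow i cell
      cells-lower zero    = ℚ.≤-reflexive (sym (ℚ.+-identityʳ (H (point 1))))
      cells-lower (suc i) = begin
        H (point (2 ℕ.+ i))                      ≡⟨ cong H (next (suc i)) ⟩
        H (n ℕ.+ point (suc i))                  ≤⟨ block-upper n (1≤point (suc i)) ⟩
        H (point (suc i)) + cell i               ≤⟨ ℚ.+-monoˡ-≤ (cell i) (cells-lower i) ⟩
        H (point 1) + sumBelow i cell + cell i   ≡⟨ ℚ.+-assoc (H (point 1)) (sumBelow i cell) (cell i) ⟩
        H (point 1) + (sumBelow i cell + cell i) ∎

      point-Q : point Q ≡ suc n ℕ.* Q
      point-Q = trans (cong (ℕ._+ Q) (ℕ.*-comm Q n)) (ℕ.+-comm (n ℕ.* Q) Q)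

      R : ℚ
      R = riemann k (fromℕ n) (0≤fromℕ n)

      R≡ : R ≡ sumBelow Q cell
      R≡ = sumBelow-cong Q term≡cell

    riemann-upper : R ≤ H n
    riemann-upper = begin
      R                          ≡⟨ R≡ ⟩
      sumBelow Q cell            ≡⟨ solve 2 (λ h s → s := h :+ s :- h) refl (H Q) (sumBelow Q cell) ⟩
      H Q + sumBelow Q cell - H Q  ≤⟨ ℚ.+-monoˡ-≤ (- H Q) (ℚ.≤-trans (cells-upper Q) (ℚ.≤-reflexive (cong H point-Q))) ⟩
      H (suc n ℕ.* Q) - H Q      ≤⟨ minus≤ {H (suc n ℕ.* Q)} {H Q} (H-*-upper n (1≤2^ k)) ⟩
      H n                        ∎

    -- One unit of the error is lost in `H-*-lower`, the other in the uncovered first block, which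
    -- for n ≤ Q ends at 2Q at the latest and so adds at most 1.
    riemann-lower : n ℕ.≤ Q → H n ≤ R + fromℕ 2
    riemann-lower n≤Q = begin
      H n                                    ≤⟨ H-mono (ℕ.n≤1+n n) ⟩
      H (suc n)                              ≡⟨ solve 2 (λ q h → h := q :+ h :- q) refl (H Q) (H (suc n)) ⟩
      H Q + H (suc n) - H Q                  ≤⟨ ℚ.+-monoˡ-≤ (- H Q) (H-*-lower n (1≤2^ k)) ⟩
      H (suc n ℕ.* Q) + 1ℚ - H Q             ≤⟨ ℚ.+-monoˡ-≤ (- H Q) (ℚ.+-monoˡ-≤ 1ℚ (ℚ.≤-trans (H-mono end≤) (cells-lower Q))) ⟩
      H (point 1) + sumBelow Q cell + 1ℚ - H Q
        ≤⟨ ℚ.+-monoˡ-≤ (- H Q) (ℚ.+-monoˡ-≤ 1ℚ (ℚ.+-monoˡ-≤ (sumBelow Q cell) (ℚ.≤-trans (H-mono start≤) (H-*-upper 1 (1≤2^ k))))) ⟩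
      H Q + 1ℚ + sumBelow Q cell + 1ℚ - H Q  ≡⟨ solve 2 (λ q s → q :+ con 1ℚ :+ s :+ con 1ℚ :- q := s :+ con (fromℕ 2)) refl (H Q) (sumBelow Q cell) ⟩
      sumBelow Q cell + fromℕ 2              ≡⟨ cong (_+ fromℕ 2) R≡ ⟨
      R + fromℕ 2                            ∎
      where
      end≤ : suc n ℕ.* Q ℕ.≤ point (suc Q)
      end≤ = ℕ.≤-trans (ℕ.≤-reflexive (sym point-Q)) (ℕ.+-monoˡ-≤ Q (ℕ.m≤n+m (Q ℕ.* n) n))
      start≤ : point 1 ℕ.≤ 2 ℕ.* Q
      start≤ = ℕ.≤-trans (ℕ.≤-reflexive (ℕ.+-comm (1 ℕ.* n) Q)) (ℕ.+-monoʳ-≤ Q (ℕ.+-monoˡ-≤ 0 n≤Q))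

  -- 4 is the least base with H(4) ≥ 2: each further factor gains H(4) - 1 ≥ 1 after the loss of 1
  -- in `H-*-lower`.
  H-4^ : ∀ p → 1ℚ + fromℕ p ≤ H (4 ℕ.^ p)
  H-4^ zero    = ℚ.≤-refl
  H-4^ (suc p) = begin
    1ℚ + fromℕ (suc p)          ≡⟨ cong (1ℚ +_) (fromℕ-suc p) ⟩
    1ℚ + (1ℚ + fromℕ p)         ≤⟨ ℚ.+-monoʳ-≤ 1ℚ (H-4^ p) ⟩
    1ℚ + H Q                    ≤⟨ ≤-add (H 4 - fromℕ 2) (ℚ.nonNegative⁻¹ (H 4 - fromℕ 2)) (solve 1 (λ q → q :+ con (H 4) :- con 1ℚ := con 1ℚ :+ q :+ con (H 4 - fromℕ 2)) refl (H Q)) ⟩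
    H Q + H 4 - 1ℚ              ≤⟨ ℚ.+-monoˡ-≤ (- 1ℚ) (H-*-lower 3 (1≤^ p ℕ.z<s)) ⟩
    H (4 ℕ.* Q) + 1ℚ - 1ℚ       ≡⟨ solve 1 (λ h → h :+ con 1ℚ :- con 1ℚ := h) refl (H (4 ℕ.* Q)) ⟩
    H (4 ℕ.* Q)                 ∎
    where Q = 4 ℕ.^ p

  small-inv : ∀ p {ε} → 0ℚ < ε → ∃ λ n → p * inv (suc n) ≤ ε
  small-inv p {ε} 0<ε with archimedes (p * (1/ ε) {{>-nonZero 0<ε}})
  ... | n , le = n , inv-cancel (suc n) ℕ.z<s (begin
    p * inv (suc n) * fromℕ (suc n)     ≡⟨ solve 3 (λ p i n → p :* i :* n := p :* (n :* i)) refl p (inv (suc n)) (fromℕ (suc n)) ⟩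
    p * (fromℕ (suc n) * inv (suc n))   ≡⟨ cong (p *_) (*-inv {suc n} ℕ.z<s) ⟩
    p * 1ℚ                              ≡⟨ cong (p *_) (ℚ.*-inverseˡ ε) ⟨
    p * (r * ε)                         ≡⟨ ℚ.*-assoc p r ε ⟨
    p * r * ε                           ≤⟨ *-monoʳ (ℚ.<⇒≤ 0<ε) (ℚ.≤-trans le (fromℕ-mono (ℕ.n≤1+n n))) ⟩
    fromℕ (suc n) * ε                   ≡⟨ ℚ.*-comm (fromℕ (suc n)) ε ⟩
    ε * fromℕ (suc n)                   ∎)
    where
    instance
      ε≢0 : NonZero ε
      ε≢0 = >-nonZero 0<ε
    r : ℚ
    r = 1/ ε

  -- Cauchy reals: the constant, stability of the order, and integer parts.

  constant : ∀ {c} → IsConstant c → ℝ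
  constant {c} isC = record
    { seq = c
    ; cauchy = λ {ε} 0<ε → let N , small = small-inv C (0<halve 0<ε) in
        suc N , λ {m} {n} N≤m N≤n → subst (∣ c m - c n ∣ ≤_) (halve-+ ε)
          (triangle (c m) (c (suc N)) (c n)
            (ℚ.≤-trans (subst (_≤ C * inv (suc N)) (∣p-q∣≡∣q-p∣ (c (suc N)) (c m)) (rate {suc N} ℕ.z<s N≤m)) small)
            (ℚ.≤-trans (rate {suc N} ℕ.z<s N≤n) small))
    }
    where open IsConstant isC

  -- For each ε a single comparison of rationals, at an index L beyond both moduli, decides the
  -- matter: a positive outcome gives the inequality up to ε on the whole tail, and a negative one
  -- refutes x ≤ y.
  ≤-stable : ∀ {x y} → ¬ ¬ (x ℝ.≤ y) → x ℝ.≤ y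
  ≤-stable {x} {y} ¬¬x≤y {ε} 0<ε = L , tail
    where
    -- With t = ε/8 the positive case needs ε/2 + 2t ≤ ε, the negative case 3t ≤ ε/2.
    t : ℚ
    t = halve (halve (halve ε))
    0<t : 0ℚ < t
    0<t = 0<halve (0<halve (0<halve 0<ε))
    L : ℕ
    L = proj₁ (cauchy x 0<t) ℕ.⊔ proj₁ (cauchy y 0<t)
    x-close : ∀ {m n} → L ℕ.≤ m → L ℕ.≤ n → seq x n ≤ seq x m + t
    x-close {m} {n} m≥ n≥ = closeʳ {seq x m} {seq x n} (proj₂ (cauchy x 0<t) (ℕ.≤-trans (ℕ.m≤m⊔n _ _) m≥) (ℕ.≤-trans (ℕ.m≤m⊔n _ _) n≥))
    y-close : ∀ {m n} → L ℕ.≤ m → L ℕ.≤ n → seq y n ≤ seq y m + t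
    y-close {m} {n} m≥ n≥ = closeʳ {seq y m} {seq y n} (proj₂ (cauchy y 0<t) (ℕ.≤-trans (ℕ.m≤n⊔m (proj₁ (cauchy x 0<t)) _) m≥) (ℕ.≤-trans (ℕ.m≤n⊔m (proj₁ (cauchy x 0<t)) _) n≥))
    tail : ∀ {n} → L ℕ.≤ n → seq x n ≤ seq y n + ε
    tail {n} L≤n = decide (seq x L ℚ.≤? (seq y L + halve ε))
      where
      decide : Dec (seq x L ≤ seq y L + halve ε) → seq x n ≤ seq y n + ε
      decide (yes le) = begin
        seq x n                             ≤⟨ x-close ℕ.≤-refl L≤n ⟩
        seq x L + t                         ≤⟨ ℚ.+-monoˡ-≤ t le ⟩
        seq y L + halve ε + t               ≤⟨ ℚ.+-monoˡ-≤ t (ℚ.+-monoˡ-≤ (halve ε) (y-close L≤n ℕ.≤-refl)) ⟩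
        seq y n + t + halve ε + t           ≤⟨ ≤-add (halve (halve ε)) (ℚ.<⇒≤ (0<halve (0<halve 0<ε)))
                                                (solve 2 (λ y e → y :+ e := y :+ e :* con ½ :* con ½ :* con ½ :+ e :* con ½ :+ e :* con ½ :* con ½ :* con ½ :+ e :* con ½ :* con ½) refl (seq y n) ε) ⟩
        seq y n + ε                         ∎
      decide (no ¬le) = ⊥-elim (¬¬x≤y λ x≤y →
        let N , le = x≤y 0<t
            m = N ℕ.⊔ L
            L≤m = ℕ.m≤n⊔m N L
        in ℚ.<-irrefl refl (ℚ.<-≤-trans (ℚ.≰⇒> ¬le) (begin
          seq x L                  ≤⟨ x-close L≤m ℕ.≤-refl ⟩
          seq x m + t              ≤⟨ ℚ.+-monoˡ-≤ t (le (ℕ.m≤m⊔n N L)) ⟩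
          seq y m + t + t          ≤⟨ ℚ.+-monoˡ-≤ t (ℚ.+-monoˡ-≤ t (y-close ℕ.≤-refl L≤m)) ⟩
          seq y L + t + t + t      ≤⟨ ≤-add t (ℚ.<⇒≤ 0<t) (solve 2 (λ y e → y :+ e :* con ½ := y :+ e :* con ½ :* con ½ :* con ½ :+ e :* con ½ :* con ½ :* con ½ :+ e :* con ½ :* con ½ :* con ½ :+ e :* con ½ :* con ½ :* con ½) refl (seq y L) ε) ⟩
          seq y L + halve ε        ∎)))

  fromℕ-cancel : ∀ {m n} → ℝ.fromℕ m ℝ.≤ ℝ.fromℕ n → m ℕ.≤ n
  fromℕ-cancel {m} {n} le with m ℕ.≤? n
  ... | yes m≤n = m≤n
  ... | no m≰n = ⊥-elim (ℚ.<-irrefl refl (ℚ.<-≤-trans (ℚ.positive⁻¹ ½) (begin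
    ½                                    ≡⟨ solve 1 (λ n → con ½ := con 1ℚ :+ n :- n :- con ½) refl (fromℕ n) ⟩
    1ℚ + fromℕ n - fromℕ n - ½           ≡⟨ cong (λ x → x - fromℕ n - ½) (fromℕ-suc n) ⟨
    fromℕ (suc n) - fromℕ n - ½          ≤⟨ ℚ.+-monoˡ-≤ (- ½) (ℚ.+-monoˡ-≤ (- fromℕ n) (ℚ.≤-trans (fromℕ-mono (ℕ.≰⇒> m≰n)) (proj₂ (le (ℚ.positive⁻¹ ½)) ℕ.≤-refl))) ⟩
    fromℕ n + ½ - fromℕ n - ½            ≡⟨ solve 1 (λ n → n :+ con ½ :- n :- con ½ := con 0ℚ) refl (fromℕ n) ⟩
    0ℚ                                   ∎)))

  ≤-transʳ : ∀ {x y z} → x ℝ.≤ y → y ℝ.≤ z → x ℝ.≤ z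
  ≤-transʳ {x} {y} {z} x≤y y≤z {ε} 0<ε =
    let M , xy = x≤y (0<halve 0<ε)
        N , yz = y≤z (0<halve 0<ε)
    in M ℕ.⊔ N , λ {n} n≥ → begin
      seq x n                        ≤⟨ xy (ℕ.≤-trans (ℕ.m≤m⊔n M N) n≥) ⟩
      seq y n + halve ε              ≤⟨ ℚ.+-monoˡ-≤ (halve ε) (yz (ℕ.≤-trans (ℕ.m≤n⊔m M N) n≥)) ⟩
      seq z n + halve ε + halve ε    ≡⟨ trans (ℚ.+-assoc (seq z n) (halve ε) (halve ε)) (cong (seq z n +_) (halve-+ ε)) ⟩
      seq z n + ε                    ∎

  fromℕ-monoʳ : ∀ {m n} → m ℕ.≤ n → ℝ.fromℕ m ℝ.≤ ℝ.fromℕ n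
  fromℕ-monoʳ m≤n {ε} 0<ε = 0 , λ _ → ℚ.≤-trans (fromℕ-mono m≤n) (≤-add ε (ℚ.<⇒≤ 0<ε) refl)

  -- A single late term of x above q + ε forces all late terms above q, and then q ≤ x.
  ≰⇒≥ʳ : ∀ {q x} → ¬ (ℝ.fromℚ q ℝ.≤ x) → x ℝ.≤ ℝ.fromℚ q
  ≰⇒≥ʳ {q} {x} q≰x {ε} 0<ε = M , λ {n} M≤n → decide M≤n (seq x n ℚ.≤? (q + ε))
    where
    M : ℕ
    M = proj₁ (cauchy x 0<ε)
    decide : ∀ {n} → M ℕ.≤ n → Dec (seq x n ≤ q + ε) → seq x n ≤ q + ε
    decide M≤n (yes le) = le
    decide {n} M≤n (no ≰) = ⊥-elim (q≰x λ {η} 0<η → M , λ {m} M≤m → begin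
      q                  ≡⟨ solve 2 (λ q e → q := q :+ e :- e) refl q ε ⟩
      q + ε - ε          ≤⟨ ℚ.+-monoˡ-≤ (- ε) (ℚ.<⇒≤ (ℚ.≰⇒> ≰)) ⟩
      seq x n - ε        ≤⟨ ℚ.+-monoˡ-≤ (- ε) (closeʳ {seq x m} {seq x n} (proj₂ (cauchy x 0<ε) M≤m M≤n)) ⟩
      seq x m + ε - ε    ≡⟨ solve 2 (λ q e → q :+ e :- e := q) refl (seq x m) ε ⟩
      seq x m            ≤⟨ ≤-add η (ℚ.<⇒≤ 0<η) refl ⟩
      seq x m + η        ∎)

  private
    last : ∀ {ℓ} (Q : ℕ → Set ℓ) b → Q 0 → ¬ Q b → ¬ ¬ (∃ λ n → Q n × ¬ Q (suc n))
    last Q zero    Q0 ¬Q0 k = ¬Q0 Q0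
    last Q (suc b) Q0 ¬Qb k = last Q b Q0 (λ Qb → k (b , Qb , ¬Qb)) k

  -- The upper bound for x is weak and serves the analysis. The maximality of n is a separate
  -- clause, which turns the condition that an order is at most x into the condition that it is at
  -- most n.
  integerPart : ∀ x → ℝ.fromℕ 0 ℝ.≤ x →
    ¬ ¬ (∃ λ n → ℝ.fromℕ n ℝ.≤ x × x ℝ.≤ ℝ.fromℕ (suc n) × (∀ {m} → ℝ.fromℕ m ℝ.≤ x → m ℕ.≤ n))
  integerPart x 0≤x k = last (λ n → ℝ.fromℕ n ℝ.≤ x) (suc b) 0≤x b≰x λ (n , n≤x , n+1≰x) →
    k (n , n≤x , ≰⇒≥ʳ {fromℕ (suc n)} {x} n+1≰x , λ {m} m≤x → ℕ.≮⇒≥ λ n<m →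
      n+1≰x (≤-transʳ {ℝ.fromℕ (suc n)} {ℝ.fromℕ m} {x} (fromℕ-monoʳ n<m) m≤x))
    where
    module X = ℝ.Bounds x
    b : ℕ
    b = proj₁ (archimedes X.bound)
    x≤b : x ℝ.≤ ℝ.fromℕ b
    x≤b {ε} 0<ε = X.N , λ {n} N≤n → begin
      seq x n         ≤⟨ p≤∣p∣ (seq x n) ⟩
      ∣ seq x n ∣     ≤⟨ X.bounded N≤n ⟩
      X.bound         ≤⟨ proj₂ (archimedes X.bound) ⟩
      fromℕ b         ≤⟨ ≤-add ε (ℚ.<⇒≤ 0<ε) refl ⟩
      fromℕ b + ε     ∎
    b≰x : ¬ (ℝ.fromℕ (suc b) ℝ.≤ x)
    b≰x le = ℕ.<-irrefl refl (fromℕ-cancel (≤-transʳ {ℝ.fromℕ (suc b)} {x} {ℝ.fromℕ b} le x≤b))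

  -- Replacing N H(N) by x log x, for N ≤ x ≤ N + 1, costs O(N).
  module _ {f : ℕ → ℚ} (F : Asymptotic f) where
    open Asymptotic F

    private
      A : ℚ
      -- 15 = 1 + 14, with 1 from `drift` and 14 = 2 · 1 + 3 · 4 from `main-error`: x is off N by at
      -- most 2 and H(N) ≤ N, while x is at most 3N and its logarithm is off H(N) by at most 4.
      A = B + fromℕ 15 * C

      0≤A : 0ℚ ≤ A
      0≤A = 0≤+ 0≤B (0≤* (0≤fromℕ 15) 0≤C)

      -- Here q is the n-th term of x, and `l` below is literally the n-th term of `log⁺ x`. The
      -- slack 1 in the hypotheses is the order of the reals read at ε = 1. N ≤ n ensures that the
      -- 2ⁿ cells of `l` are fine enough for `riemann-lower`.
      module Estimate {N n} (2≤N : 2 ℕ.≤ N) (N≤n : N ℕ.≤ n) {q : ℚ}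
        (q-lower : fromℕ N ≤ q + 1ℚ) (q-upper : q ≤ fromℕ (suc N) + 1ℚ) where
        private
          1≤N : 1 ℕ.≤ N
          1≤N = ℕ.<⇒≤ 2≤N
          1≤n : 1 ℕ.≤ n
          1≤n = ℕ.≤-trans 1≤N N≤n
          ν = fromℕ N
          0≤ν : 0ℚ ≤ ν
          0≤ν = 0≤fromℕ N
          u l : ℚ
          u = 0ℚ ⊔ (q - 1ℚ)
          0≤u : 0ℚ ≤ u
          0≤u = ℚ.p≤p⊔q 0ℚ (q - 1ℚ)
          l = riemann n u 0≤u

          q≤ : q ≤ ν + fromℕ 2
          q≤ = ℚ.≤-trans q-upper (ℚ.≤-reflexive (trans (cong (_+ 1ℚ) (fromℕ-suc N)) (solve 1 (λ n → con 1ℚ :+ n :+ con 1ℚ := n :+ con (fromℕ 2)) refl ν)))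

          q≥ : ν - 1ℚ ≤ q
          q≥ = minus≤ {ν} {1ℚ} (ℚ.≤-trans q-lower (ℚ.≤-reflexive (ℚ.+-comm q 1ℚ)))

          u≤ : u ≤ ν + fromℕ 2
          u≤ = ℚ.⊔-lub (0≤+ 0≤ν (0≤fromℕ 2)) (ℚ.≤-trans (≤-add {q - 1ℚ} {q} 1ℚ 0≤1 (solve 1 (λ q → q := q :- con 1ℚ :+ con 1ℚ) refl q)) q≤)

          u≥ : ν ≤ u + fromℕ 2
          u≥ = begin
            ν                    ≤⟨ q-lower ⟩
            q + 1ℚ               ≡⟨ solve 1 (λ q → q :+ con 1ℚ := q :- con 1ℚ :+ con (fromℕ 2)) refl q ⟩
            q - 1ℚ + fromℕ 2     ≤⟨ ℚ.+-monoˡ-≤ (fromℕ 2) (ℚ.p≤q⊔p 0ℚ (q - 1ℚ)) ⟩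
            u + fromℕ 2          ∎

          l≤ : l ≤ H N + fromℕ 2
          l≤ = ℚ.≤-trans (riemann-contracts n 0≤u 0≤ν)
            (ℚ.+-mono-≤ (riemann-upper n N) (close {u} {ν} u≤ u≥))

          l≥ : H N ≤ l + fromℕ 4
          l≥ = begin
            H N                                          ≤⟨ riemann-lower n N (ℕ.≤-trans (n≤2^n N) (ℕ.^-monoʳ-≤ 2 N≤n)) ⟩
            riemann n ν 0≤ν + fromℕ 2                    ≤⟨ ℚ.+-monoˡ-≤ (fromℕ 2) (riemann-contracts n 0≤ν 0≤u) ⟩
            l + ∣ ν - u ∣ + fromℕ 2                      ≤⟨ ℚ.+-monoˡ-≤ (fromℕ 2) (ℚ.+-monoʳ-≤ l (close {ν} {u} u≥ u≤)) ⟩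
            l + fromℕ 2 + fromℕ 2                        ≡⟨ ℚ.+-assoc l (fromℕ 2) (fromℕ 2) ⟩
            l + fromℕ 4                                  ∎

          ∣q∣≤ : ∣ q ∣ ≤ fromℕ 3 * ν
          ∣q∣≤ = begin
            ∣ q ∣              ≡⟨ ℚ.0≤p⇒∣p∣≡p (ℚ.≤-trans (ℚ.+-monoˡ-≤ (- 1ℚ) (1≤fromℕ 1≤N)) q≥) ⟩
            q                  ≤⟨ q≤ ⟩
            ν + fromℕ 2 * 1ℚ   ≤⟨ ℚ.+-monoʳ-≤ ν (*-monoˡ (0≤fromℕ 2) (1≤fromℕ 1≤N)) ⟩
            ν + fromℕ 2 * ν    ≡⟨ solve 1 (λ n → n :+ con (fromℕ 2) :* n := con (fromℕ 3) :* n) refl ν ⟩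
            fromℕ 3 * ν        ∎

          main-error : ∣ nH N - q * l ∣ ≤ fromℕ 14 * ν
          main-error = begin
            ∣ ν * H N - q * l ∣                         ≤⟨ ∣p*q-p′*q′∣≤ ν (H N) q l ⟩
            ∣ ν - q ∣ * ∣ H N ∣ + ∣ q ∣ * ∣ H N - l ∣
              ≤⟨ ℚ.+-mono-≤
                   (mul-mono (ℚ.0≤∣p∣ (ν - q)) 0≤ν
                     (close {ν} {q} (ℚ.≤-trans q-lower (ℚ.+-monoʳ-≤ q (fromℕ-mono {1} {2} ℕ.z<s))) q≤)
                     (ℚ.≤-trans (ℚ.≤-reflexive (ℚ.0≤p⇒∣p∣≡p (0≤H N))) (H≤id N)))
                   (mul-mono (ℚ.0≤∣p∣ q) (0≤fromℕ 4) ∣q∣≤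
                     (close {H N} {l} l≥ (ℚ.≤-trans l≤ (ℚ.+-monoʳ-≤ (H N) (fromℕ-mono {2} {4} (ℕ.s≤s ℕ.z<s)))))) ⟩
            fromℕ 2 * ν + fromℕ 3 * ν * fromℕ 4         ≡⟨ solve 1 (λ n → con (fromℕ 2) :* n :+ con (fromℕ 3) :* n :* con (fromℕ 4) := con (fromℕ 14) :* n) refl ν ⟩
            fromℕ 14 * ν                                ∎

        error : ∣ f N - c n * (q * l) ∣ ≤ A * ν
        error = begin
          ∣ f N - c n * (q * l) ∣
            ≤⟨ triangle (f N) (main c N) (c n * (q * l)) (bound N)
                 (triangle (main c N) (c n * nH N) (c n * (q * l)) (drift isConstant N≤n 1≤n) step) ⟩
          B * ν + (C * ν + C * (fromℕ 14 * ν))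
            ≡⟨ solve 3 (λ b c n → b :* n :+ (c :* n :+ c :* (con (fromℕ 14) :* n)) := (b :+ con (fromℕ 15) :* c) :* n) refl B C ν ⟩
          A * ν ∎
          where
          step : ∣ c n * nH N - c n * (q * l) ∣ ≤ C * (fromℕ 14 * ν)
          step = begin
            ∣ c n * nH N - c n * (q * l) ∣   ≡⟨ cong ∣_∣ (solve 3 (λ c a b → c :* a :- c :* b := c :* (a :- b)) refl (c n) (nH N) (q * l)) ⟩
            ∣ c n * (nH N - q * l) ∣         ≡⟨ trans (ℚ.∣p*q∣≡∣p∣*∣q∣ (c n) (nH N - q * l)) (cong (_* ∣ nH N - q * l ∣) (ℚ.0≤p⇒∣p∣≡p (0≤c 1≤n))) ⟩
            c n * ∣ nH N - q * l ∣           ≤⟨ mul-mono (0≤c 1≤n) (0≤* (0≤fromℕ 14) 0≤ν) (upper 1≤n) main-error ⟩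
            C * (fromℕ 14 * ν)               ∎

        -- It makes the error A N relatively small: the main term is at least an arbitrary multiple
        -- p of N, up to a fixed factor, as soon as H(N) ≥ p + 4, because c ≥ κ, q ≥ N/2 and l ≥ p.
        growth : ∀ p → fromℕ p + fromℕ 4 ≤ H N → κ * ½ * fromℕ p * ν ≤ c n * (q * l)
        growth p p≤ = begin
          κ * ½ * fromℕ p * ν             ≡⟨ solve 3 (λ k p n → k :* con ½ :* p :* n := k :* (n :* con ½ :* p)) refl κ (fromℕ p) ν ⟩
          κ * (ν * ½ * fromℕ p)           ≤⟨ mul-mono (ℚ.<⇒≤ 0<κ) 0≤ql (lower 1≤n) (mul-mono 0≤ν½ 0≤l ν½≤q p≤l) ⟩
          c n * (q * l)                   ∎
          where
          0≤ν½ : 0ℚ ≤ ν * ½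
          0≤ν½ = 0≤* 0≤ν (ℚ.nonNegative⁻¹ ½)
          ν½≤q : ν * ½ ≤ q
          ν½≤q = begin
            ν * ½                    ≡⟨ solve 1 (λ n → n :* con ½ := n :- n :* con ½) refl ν ⟩
            ν - ν * ½                ≤⟨ ℚ.+-monoʳ-≤ ν (ℚ.neg-antimono-≤ (*-monoʳ (ℚ.nonNegative⁻¹ ½) (fromℕ-mono 2≤N))) ⟩
            ν - 1ℚ                   ≤⟨ q≥ ⟩
            q                        ∎
          p≤l : fromℕ p ≤ l
          p≤l = begin
            fromℕ p                       ≡⟨ solve 1 (λ p → p := p :+ con (fromℕ 4) :- con (fromℕ 4)) refl (fromℕ p) ⟩
            fromℕ p + fromℕ 4 - fromℕ 4   ≤⟨ ℚ.+-monoˡ-≤ (- fromℕ 4) (ℚ.≤-trans p≤ l≥) ⟩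
            l + fromℕ 4 - fromℕ 4         ≡⟨ solve 1 (λ p → p :+ con (fromℕ 4) :- con (fromℕ 4) := p) refl l ⟩
            l                             ∎
          0≤l : 0ℚ ≤ l
          0≤l = ℚ.≤-trans (0≤fromℕ p) p≤l
          0≤ql : 0ℚ ≤ q * l
          0≤ql = 0≤* (ℚ.≤-trans 0≤ν½ ν½≤q) 0≤l

    asymptotic-∼ : ∀ ε → ℝ.fromℚ 0ℚ ℝ.< ε → ∃ λ X → ∀ x → ℝ.fromℕ X ℝ.≤ x →
      ∀ N → ℝ.fromℕ N ℝ.≤ x → x ℝ.≤ ℝ.fromℕ (suc N) →
      let g = constant isConstant ℝ.* (x ℝ.* ℝ.log⁺ x) in
      ℝ.∣ ℝ.fromℚ (f N) ℝ.- g ∣ ℝ.≤ ε ℝ.* ℝ.∣ g ∣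
    -- From X ≤ x ≤ N + 1 follows N ≥ 4^(3 + p), and then H(N) ≥ 1 + 3 + p by `H-4^`, as `growth`
    -- demands.
    asymptotic-∼ ε (δ , 0<δ , L , δ≤ε) = suc (4 ℕ.^ (3 ℕ.+ p)) ,
      λ x X≤x N N≤x x≤1+N 0<η →
        let N₁ , lo = N≤x (ℚ.positive⁻¹ 1ℚ)
            N₂ , hi = x≤1+N (ℚ.positive⁻¹ 1ℚ)
            large : 4 ℕ.^ (3 ℕ.+ p) ℕ.≤ N
            large = ℕ.s≤s⁻¹ (fromℕ-cancel (≤-transʳ {ℝ.fromℕ (suc (4 ℕ.^ (3 ℕ.+ p)))} {x} {ℝ.fromℕ (suc N)} X≤x x≤1+N))
        in (N ℕ.⊔ L) ℕ.⊔ (N₁ ℕ.⊔ N₂) , λ {n} n≥ →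
          let N≤n = ℕ.m⊔n≤o⇒m≤o N L (ℕ.m⊔n≤o⇒m≤o (N ℕ.⊔ L) (N₁ ℕ.⊔ N₂) n≥)
              L≤n = ℕ.m⊔n≤o⇒n≤o N L (ℕ.m⊔n≤o⇒m≤o (N ℕ.⊔ L) (N₁ ℕ.⊔ N₂) n≥)
              N₁≤n = ℕ.m⊔n≤o⇒m≤o N₁ N₂ (ℕ.m⊔n≤o⇒n≤o (N ℕ.⊔ L) (N₁ ℕ.⊔ N₂) n≥)
              N₂≤n = ℕ.m⊔n≤o⇒n≤o N₁ N₂ (ℕ.m⊔n≤o⇒n≤o (N ℕ.⊔ L) (N₁ ℕ.⊔ N₂) n≥)
              2≤N = ℕ.≤-trans (ℕ.≤-trans (ℕ.s≤s ℕ.z<s) (ℕ.^-monoʳ-≤ 4 {1} {3 ℕ.+ p} ℕ.z<s)) large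
              open Estimate {N} {n} 2≤N N≤n (lo N₁≤n) (hi N₂≤n)
              y = c n * (seq x n * seq (ℝ.log⁺ x) n)
          in ℚ.≤-trans (begin
            ∣ f N - y ∣                           ≤⟨ error ⟩
            A * fromℕ N                           ≤⟨ *-monoʳ (0≤fromℕ N) A≤ ⟩
            δ * (κ * ½ * fromℕ p) * fromℕ N       ≡⟨ ℚ.*-assoc δ (κ * ½ * fromℕ p) (fromℕ N) ⟩
            δ * (κ * ½ * fromℕ p * fromℕ N)       ≤⟨ *-monoˡ (ℚ.<⇒≤ 0<δ) (growth p (ℚ.≤-trans p≤H (H-mono large))) ⟩
            δ * y                                 ≤⟨ *-monoˡ (ℚ.<⇒≤ 0<δ) (p≤∣p∣ y) ⟩
            δ * ∣ y ∣                             ≤⟨ *-monoʳ (ℚ.0≤∣p∣ y) (ℚ.≤-trans (ℚ.≤-reflexive (sym (ℚ.+-identityˡ δ))) (δ≤ε L≤n)) ⟩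
            seq ε n * ∣ y ∣                       ∎)
            (≤-add _ (ℚ.<⇒≤ 0<η) refl)
      where
      0<δκ½ : 0ℚ < δ * (κ * ½)
      0<δκ½ = ℚ.positive⁻¹ _ {{ℚ.pos*pos⇒pos δ {{positive 0<δ}} (κ * ½) {{positive (0<halve 0<κ)}}}}
      -- Chosen with A ≤ δ (κ/2) p, so that the error A N is at most δ times the lower bound in
      -- `growth`.
      p : ℕ
      p = suc (proj₁ (small-inv A 0<δκ½))
      A≤ : A ≤ δ * (κ * ½ * fromℕ p)
      A≤ = begin
        A                          ≡⟨ ℚ.*-identityʳ A ⟨
        A * 1ℚ                     ≡⟨ cong (A *_) (*-inv {p} ℕ.z<s) ⟨
        A * (fromℕ p * inv p)      ≡⟨ solve 3 (λ a p i → a :* (p :* i) := a :* i :* p) refl A (fromℕ p) (inv p) ⟩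
        A * inv p * fromℕ p        ≤⟨ *-monoʳ (0≤fromℕ p) (proj₂ (small-inv A 0<δκ½)) ⟩
        δ * (κ * ½) * fromℕ p      ≡⟨ ℚ.*-assoc δ (κ * ½) (fromℕ p) ⟩
        δ * (κ * ½ * fromℕ p)      ∎
      p≤H : fromℕ p + fromℕ 4 ≤ H (4 ℕ.^ (3 ℕ.+ p))
      p≤H = ℚ.≤-trans (ℚ.≤-reflexive (trans (ℚ.+-comm (fromℕ p) (fromℕ 4)) (trans (ℚ.+-assoc 1ℚ (fromℕ 3) (fromℕ p)) (cong (1ℚ +_) (sym (fromℕ-+ 3 p)))))) (H-4^ (3 ℕ.+ p))

-- Integer multiples, homomorphisms and isomorphisms of abelian groups.

module GroupBasics where
  import Algebra.Properties.AbelianGroup as AbelianGroupProperties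
  import Algebra.Properties.CommutativeMonoid.Mult as Mult
  open import Data.Integer.Base using (+_; -[1+_])

  module Multiples (G : AbGroup) where
    open AbelianGroup G public using
      ( Carrier; _≈_; _∙_; ε; _⁻¹; refl; sym; trans; reflexive; setoid; rawGroup
      ; assoc; comm; identityˡ; identityʳ; inverseˡ; inverseʳ; ∙-cong; ∙-congˡ; ∙-congʳ; ⁻¹-cong )
    open AbelianGroup G using (commutativeMonoid)
    open AbelianGroupProperties G public using (⁻¹-∙-comm; ε⁻¹≈ε; ⁻¹-involutive; x∙y⁻¹≈ε⇒x≈y; x≈y⇒x∙y⁻¹≈ε; inverseˡ-unique)
    open Mult commutativeMonoid public using (×-congʳ; ×-homo-+; ×-distrib-+) renaming (_×_ to _×ₙ_)
    open import Relation.Binary.Reasoning.Setoid setoid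

    infixr 8 _•_

    _•_ : ℤ → Carrier → Carrier
    (+ n)      • g = n ×ₙ g
    (-[1+ n ]) • g = (suc n ×ₙ g) ⁻¹

    interchange : ∀ a b c d → (a ∙ b) ∙ (c ∙ d) ≈ (a ∙ c) ∙ (b ∙ d)
    interchange a b c d = begin
      (a ∙ b) ∙ (c ∙ d)  ≈⟨ assoc a b (c ∙ d) ⟩
      a ∙ (b ∙ (c ∙ d))  ≈⟨ ∙-congˡ (sym (assoc b c d)) ⟩
      a ∙ ((b ∙ c) ∙ d)  ≈⟨ ∙-congˡ (∙-congʳ (comm b c)) ⟩
      a ∙ ((c ∙ b) ∙ d)  ≈⟨ ∙-congˡ (assoc c b d) ⟩
      a ∙ (c ∙ (b ∙ d))  ≈⟨ sym (assoc a c (b ∙ d)) ⟩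
      (a ∙ c) ∙ (b ∙ d)  ∎

    •-congˡ : ∀ {y z g} → y ≡ z → y • g ≈ z • g
    •-congˡ ≡.refl = refl

    •-congʳ : ∀ z {g h} → g ≈ h → z • g ≈ z • h
    •-congʳ (+ n)      e = ×-congʳ n e
    •-congʳ (-[1+ n ]) e = ⁻¹-cong (×-congʳ (suc n) e)

    •-neg : ∀ z g → (ℤ.- z) • g ≈ (z • g) ⁻¹
    •-neg (+ zero)    g = sym ε⁻¹≈ε
    •-neg (+ suc n)   g = refl
    •-neg (-[1+ n ])  g = sym (⁻¹-involutive _)

    •-⊖ : ∀ m n g → (m ℤ.⊖ n) • g ≈ (m ×ₙ g) ∙ (n ×ₙ g) ⁻¹
    •-⊖ m zero g = sym (trans (∙-congˡ ε⁻¹≈ε) (identityʳ _))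
    •-⊖ zero (suc n) g = sym (identityˡ _)
    •-⊖ (suc m) (suc n) g = begin
      (suc m ℤ.⊖ suc n) • g                          ≈⟨ •-congˡ (ℤ.[1+m]⊖[1+n]≡m⊖n m n) ⟩
      (m ℤ.⊖ n) • g                                  ≈⟨ •-⊖ m n g ⟩
      a ∙ b ⁻¹                                       ≈⟨ sym (identityˡ _) ⟩
      ε ∙ (a ∙ b ⁻¹)                                 ≈⟨ ∙-congʳ (sym (inverseʳ g)) ⟩
      (g ∙ g ⁻¹) ∙ (a ∙ b ⁻¹)                        ≈⟨ interchange g (g ⁻¹) a (b ⁻¹) ⟩
      (g ∙ a) ∙ (g ⁻¹ ∙ b ⁻¹)                        ≈⟨ ∙-congˡ (⁻¹-∙-comm g b) ⟩
      (g ∙ a) ∙ (g ∙ b) ⁻¹                           ∎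
      where
      a = m ×ₙ g
      b = n ×ₙ g

    •-+ : ∀ y z g → (y ℤ.+ z) • g ≈ y • g ∙ z • g
    •-+ (+ m)      (+ n)      g = ×-homo-+ g m n
    •-+ (+ m)      (-[1+ n ]) g = •-⊖ m (suc n) g
    •-+ (-[1+ m ]) (+ n)      g = trans (•-⊖ n (suc m) g) (comm _ _)
    •-+ (-[1+ m ]) (-[1+ n ]) g = begin
      (suc (suc (m ℕ.+ n)) ×ₙ g) ⁻¹       ≡⟨ ≡.cong (λ k → (k ×ₙ g) ⁻¹) (≡.cong suc (ℕ.+-suc m n)) ⟨
      ((suc m ℕ.+ suc n) ×ₙ g) ⁻¹         ≈⟨ ⁻¹-cong (×-homo-+ g (suc m) (suc n)) ⟩
      (suc m ×ₙ g ∙ suc n ×ₙ g) ⁻¹        ≈⟨ sym (⁻¹-∙-comm _ _) ⟩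
      (suc m ×ₙ g) ⁻¹ ∙ (suc n ×ₙ g) ⁻¹   ∎

    •-∙ : ∀ z g h → z • (g ∙ h) ≈ z • g ∙ z • h
    •-∙ (+ n)      g h = ×-distrib-+ g h n
    •-∙ (-[1+ n ]) g h = trans (⁻¹-cong (×-distrib-+ g h (suc n))) (sym (⁻¹-∙-comm _ _))

    ×-ε : ∀ n → n ×ₙ ε ≈ ε
    ×-ε zero    = refl
    ×-ε (suc n) = trans (identityˡ _) (×-ε n)

    •-ε : ∀ z → z • ε ≈ ε
    •-ε (+ n)      = ×-ε n
    •-ε (-[1+ n ]) = trans (⁻¹-cong (×-ε (suc n))) ε⁻¹≈ε

    •-killed : ∀ z {g} → g ≈ ε → z • g ≈ ε
    •-killed z e = trans (•-congʳ z e) (•-ε z)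

    ×-* : ∀ n z g → (+ n ℤ.* z) • g ≈ n ×ₙ (z • g)
    ×-* zero    z g = •-congˡ {g = g} (ℤ.*-zeroˡ z)
    ×-* (suc n) z g = begin
      (+ suc n ℤ.* z) • g             ≡⟨ ≡.cong (_• g) (ℤ.suc-* (+ n) z) ⟩
      (z ℤ.+ + n ℤ.* z) • g           ≈⟨ •-+ z (+ n ℤ.* z) g ⟩
      z • g ∙ (+ n ℤ.* z) • g         ≈⟨ ∙-congˡ (×-* n z g) ⟩
      z • g ∙ n ×ₙ (z • g)            ∎

    •-* : ∀ y z g → (y ℤ.* z) • g ≈ y • z • g
    •-* (+ n)      z g = ×-* n z g
    •-* (-[1+ n ]) z g = begin
      (-[1+ n ] ℤ.* z) • g            ≡⟨ ≡.cong (_• g) (ℤ.neg-distribˡ-* (+ suc n) z) ⟨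
      (ℤ.- (+ suc n ℤ.* z)) • g       ≈⟨ •-neg (+ suc n ℤ.* z) g ⟩
      ((+ suc n ℤ.* z) • g) ⁻¹        ≈⟨ ⁻¹-cong (×-* (suc n) z g) ⟩
      (suc n ×ₙ (z • g)) ⁻¹           ∎

    •-1 : ∀ g → (+ 1) • g ≈ g
    •-1 g = identityʳ g

    •-comm : ∀ y z g → y • z • g ≈ z • y • g
    •-comm y z g = trans (sym (•-* y z g)) (trans (•-congˡ (ℤ.*-comm y z)) (•-* z y g))

    •-⁻¹ : ∀ z g → z • (g ⁻¹) ≈ (z • g) ⁻¹
    •-⁻¹ z g = inverseˡ-unique _ _ (begin
      z • (g ⁻¹) ∙ z • g   ≈⟨ sym (•-∙ z (g ⁻¹) g) ⟩
      z • (g ⁻¹ ∙ g)     ≈⟨ •-killed z (inverseˡ g) ⟩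
      ε                  ∎)

    •-minus : ∀ y z g → (y ℤ.- z) • g ≈ y • g ∙ (z • g) ⁻¹
    •-minus y z g = trans (•-+ y (ℤ.- z) g) (∙-congˡ (•-neg z g))

    •-*-killed : ∀ y z {g} → z • g ≈ ε → (y ℤ.* z) • g ≈ ε
    •-*-killed y z {g} e = trans (•-* y z g) (•-killed y e)

  record Hom (G H : AbGroup) : Set where
    private
      module G = Multiples G
      module H = Multiples H
    field
      ⟦_⟧  : G.Carrier → H.Carrier
      cong : ∀ {x y} → x G.≈ y → ⟦ x ⟧ H.≈ ⟦ y ⟧
      homo : ∀ x y → ⟦ x G.∙ y ⟧ H.≈ ⟦ x ⟧ H.∙ ⟦ y ⟧

    homo-ε : ⟦ G.ε ⟧ H.≈ H.ε
    homo-ε = begin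
      f ε                              ≈⟨ H.sym (H.identityʳ (f ε)) ⟩
      f ε H.∙ H.ε                      ≈⟨ H.∙-congˡ (H.sym (H.inverseʳ (f ε))) ⟩
      f ε H.∙ (f ε H.∙ f ε H.⁻¹)       ≈⟨ H.sym (H.assoc _ _ _) ⟩
      (f ε H.∙ f ε) H.∙ f ε H.⁻¹       ≈⟨ H.∙-congʳ (H.sym (homo ε ε)) ⟩
      f (ε G.∙ ε) H.∙ f ε H.⁻¹         ≈⟨ H.∙-congʳ (cong (G.identityʳ ε)) ⟩
      f ε H.∙ f ε H.⁻¹                 ≈⟨ H.inverseʳ (f ε) ⟩
      H.ε                              ∎
      where
      open import Relation.Binary.Reasoning.Setoid H.setoid
      f = ⟦_⟧
      ε = G.ε

    homo-⁻¹ : ∀ x → ⟦ x G.⁻¹ ⟧ H.≈ ⟦ x ⟧ H.⁻¹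
    homo-⁻¹ x = H.inverseˡ-unique _ _
      (H.trans (H.sym (homo (x G.⁻¹) x)) (H.trans (cong (G.inverseˡ x)) homo-ε))

    homo-× : ∀ n x → ⟦ n G.×ₙ x ⟧ H.≈ n H.×ₙ ⟦ x ⟧
    homo-× zero    x = homo-ε
    homo-× (suc n) x = H.trans (homo x _) (H.∙-congˡ (homo-× n x))

    homo-• : ∀ z x → ⟦ z G.• x ⟧ H.≈ z H.• ⟦ x ⟧
    homo-• (+ n)      x = homo-× n x
    homo-• (-[1+ n ]) x = H.trans (homo-⁻¹ _) (H.⁻¹-cong (homo-× (suc n) x))

  open Hom

  idHom : ∀ {G} → Hom G G
  idHom {G} = record { ⟦_⟧ = λ x → x ; cong = λ e → e ; homo = λ _ _ → AbelianGroup.refl G }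

  infixr 9 _∘ʰ_

  _∘ʰ_ : ∀ {G H K} → Hom H K → Hom G H → Hom G K
  _∘ʰ_ {K = K} f g = record
    { ⟦_⟧  = λ x → ⟦ f ⟧ (⟦ g ⟧ x)
    ; cong = λ e → cong f (cong g e)
    ; homo = λ x y → AbelianGroup.trans K (cong f (homo g x y)) (homo f _ _)
    }

  proj₁ʰ : ∀ {G H} → Hom (G ⊕ H) G
  proj₁ʰ {G} = record { ⟦_⟧ = proj₁ ; cong = proj₁ ; homo = λ _ _ → AbelianGroup.refl G }

  proj₂ʰ : ∀ {G H} → Hom (G ⊕ H) H
  proj₂ʰ {G} {H} = record { ⟦_⟧ = proj₂ ; cong = proj₂ ; homo = λ _ _ → AbelianGroup.refl H }

  inj₁ʰ : ∀ {G H} → Hom G (G ⊕ H)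
  inj₁ʰ {G} {H} = record
    { ⟦_⟧  = λ x → x , H.ε
    ; cong = λ e → e , H.refl
    ; homo = λ _ _ → AbelianGroup.refl G , H.sym (H.identityʳ H.ε)
    }
    where module H = AbelianGroup H

  inj₂ʰ : ∀ {G H} → Hom H (G ⊕ H)
  inj₂ʰ {G} {H} = record
    { ⟦_⟧  = λ x → G.ε , x
    ; cong = λ e → G.refl , e
    ; homo = λ _ _ → G.sym (G.identityʳ G.ε) , AbelianGroup.refl H
    }
    where module G = AbelianGroup G

  [_,_]ʰ : ∀ {G H K} → Hom G K → Hom H K → Hom (G ⊕ H) K
  [_,_]ʰ {K = K} f g = record
    { ⟦_⟧  = λ (x , y) → ⟦ f ⟧ x K.∙ ⟦ g ⟧ y
    ; cong = λ (e , e′) → K.∙-cong (cong f e) (cong g e′)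
    ; homo = λ (x , y) (x′ , y′) → K.trans (K.∙-cong (homo f x x′) (homo g y y′)) (K.interchange _ _ _ _)
    }
    where module K = Multiples K

  module _ {G H : AbGroup} where
    private
      module G = Multiples G
      module H = Multiples H

    mk≅ : (f : Hom G H) → (∀ {x} → ⟦ f ⟧ x H.≈ H.ε → x G.≈ G.ε) →
          (∀ y → ∃ λ x → ⟦ f ⟧ x H.≈ y) → G ≅ H
    mk≅ f kernel surjective = ⟦ f ⟧ , record
      { isGroupMonomorphism = record
        { isGroupHomomorphism = record
          { isMonoidHomomorphism = record
            { isMagmaHomomorphism = record
              { isRelHomomorphism = record { cong = cong f }
              ; homo = homo f
              }
            ; ε-homo = homo-ε f
            }
          ; ⁻¹-homo = homo-⁻¹ f
          }
        ; injective = λ {x} {y} e → G.x∙y⁻¹≈ε⇒x≈y x y (kernel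
            (H.trans (homo f x (y G.⁻¹)) (H.trans (H.∙-congˡ (homo-⁻¹ f y)) (H.x≈y⇒x∙y⁻¹≈ε e))))
        }
      ; surjective = λ y → let x , e = surjective y in x , λ z≈x → H.trans (cong f z≈x) e
      }

    module Iso (i : G ≅ H) where
      private
        open import Algebra.Morphism.Structures using (module GroupMorphisms)
        module I = GroupMorphisms.IsGroupIsomorphism {G₁ = G.rawGroup} {G₂ = H.rawGroup} (proj₂ i)

      to : Hom G H
      to = record { ⟦_⟧ = proj₁ i ; cong = I.⟦⟧-cong ; homo = I.∙-homo }

      injective : ∀ {x y} → ⟦ to ⟧ x H.≈ ⟦ to ⟧ y → x G.≈ y
      injective = I.injective

      from-fun : H.Carrier → G.Carrier
      from-fun y = proj₁ (I.surjective y)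

      to-from : ∀ y → ⟦ to ⟧ (from-fun y) H.≈ y
      to-from y = proj₂ (I.surjective y) G.refl

      from : Hom H G
      from = record
        { ⟦_⟧  = from-fun
        ; cong = λ e → injective (H.trans (to-from _) (H.trans e (H.sym (to-from _))))
        ; homo = λ x y → injective (H.trans (to-from _)
            (H.sym (H.trans (homo to _ _) (H.∙-cong (to-from x) (to-from y)))))
        }

      from-to : ∀ x → from-fun (⟦ to ⟧ x) G.≈ x
      from-to x = injective (to-from (⟦ to ⟧ x))

      kernel : ∀ {x} → ⟦ to ⟧ x H.≈ H.ε → x G.≈ G.ε
      kernel e = injective (H.trans e (H.sym (homo-ε to)))

  ≅-refl : ∀ {G} → G ≅ G
  ≅-refl {G} = mk≅ {G} {G} idHom (λ e → e) (λ y → y , AbelianGroup.refl G)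

  ≅-sym : ∀ {G H} → G ≅ H → H ≅ G
  ≅-sym {G} {H} i = mk≅ {H} {G} I.from
    (λ {y} e → H.trans (H.sym (I.to-from y)) (H.trans (cong I.to e) (homo-ε I.to)))
    (λ x → ⟦ I.to ⟧ x , I.from-to x)
    where
    module I = Iso {G} {H} i
    module H = AbelianGroup H

  ≅-trans : ∀ {G H K} → G ≅ H → H ≅ K → G ≅ K
  ≅-trans {G} {H} {K} i j = mk≅ {G} {K} (J.to ∘ʰ I.to)
    (λ e → I.kernel (J.kernel e))
    (λ y → ⟦ I.from ⟧ (⟦ J.from ⟧ y) , AbelianGroup.trans K (cong J.to (I.to-from _)) (J.to-from y))
    where
    module I = Iso {G} {H} i
    module J = Iso {H} {K} j

  ⊕-cong : ∀ {G G′ H H′} → G ≅ G′ → H ≅ H′ → G ⊕ H ≅ G′ ⊕ H′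
  ⊕-cong {G} {G′} {H} {H′} i j = mk≅ {G ⊕ H} {G′ ⊕ H′}
    (record
      { ⟦_⟧  = λ (x , y) → ⟦ I.to ⟧ x , ⟦ J.to ⟧ y
      ; cong = λ (e , e′) → cong I.to e , cong J.to e′
      ; homo = λ (x , y) (x′ , y′) → homo I.to x x′ , homo J.to y y′
      })
    (λ (e , e′) → I.kernel e , J.kernel e′)
    (λ (x , y) → (⟦ I.from ⟧ x , ⟦ J.from ⟧ y) , I.to-from x , J.to-from y)
    where
    module I = Iso {G} {G′} i
    module J = Iso {H} {H′} j

  ⊕-comm : ∀ {G H} → G ⊕ H ≅ H ⊕ G
  ⊕-comm {G} {H} = mk≅ {G ⊕ H} {H ⊕ G}
    (record
      { ⟦_⟧  = λ (x , y) → y , x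
      ; cong = λ (e , e′) → e′ , e
      ; homo = λ _ _ → AbelianGroup.refl H , AbelianGroup.refl G
      })
    (λ (e , e′) → e′ , e)
    (λ (x , y) → (y , x) , AbelianGroup.refl H , AbelianGroup.refl G)

  ⊕-assoc : ∀ {G H K} → (G ⊕ H) ⊕ K ≅ G ⊕ (H ⊕ K)
  ⊕-assoc {G} {H} {K} = mk≅ {(G ⊕ H) ⊕ K} {G ⊕ (H ⊕ K)}
    (record
      { ⟦_⟧  = λ ((x , y) , z) → x , y , z
      ; cong = λ ((e , e′) , e″) → e , e′ , e″
      ; homo = λ _ _ → AbelianGroup.refl G , AbelianGroup.refl H , AbelianGroup.refl K
      })
    (λ (e , e′ , e″) → (e , e′) , e″)
    (λ (x , y , z) → ((x , y) , z) , AbelianGroup.refl G , AbelianGroup.refl H , AbelianGroup.refl K)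

-- Bézout identities, cyclic groups and torsion elements.

module Structure where
  open import Data.Integer.Base using (+_; -[1+_])
  open GroupBasics
  open Hom

  -- Bézout coefficients

  -- Coprimality with its coefficients, since they are used later as multipliers that act on group
  -- elements.
  Bezout : ℤ → ℤ → Set
  Bezout a b = ∃₂ λ s t → s ℤ.* a ℤ.+ t ℤ.* b ≡ 1ℤ

  Bezout-sym : ∀ {a b} → Bezout a b → Bezout b a
  Bezout-sym {a} {b} (s , t , e) = t , s , ≡.trans (ℤ.+-comm (t ℤ.* b) (s ℤ.* a)) e

  Bezout-1 : ∀ b → Bezout 1ℤ b
  Bezout-1 b = 1ℤ , 0ℤ , ≡.cong (ℤ._+_ 1ℤ) (ℤ.*-zeroˡ b)

  -- Multiply the two identities and collect the terms that contain c.
  Bezout-* : ∀ {a b c} → Bezout a c → Bezout b c → Bezout (a ℤ.* b) c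
  Bezout-* {a} {b} {c} (s , t , e) (u , v , f) =
    s ℤ.* u , s ℤ.* a ℤ.* v ℤ.+ t ℤ.* u ℤ.* b ℤ.+ t ℤ.* v ℤ.* c ,
    ≡.trans (expand s u a b t v c) (≡.cong₂ ℤ._*_ e f)
    where
    expand : ∀ s u a b t v c →
      s ℤ.* u ℤ.* (a ℤ.* b) ℤ.+ (s ℤ.* a ℤ.* v ℤ.+ t ℤ.* u ℤ.* b ℤ.+ t ℤ.* v ℤ.* c) ℤ.* c
        ≡ (s ℤ.* a ℤ.+ t ℤ.* c) ℤ.* (u ℤ.* b ℤ.+ v ℤ.* c)
    expand = solve-∀

  +-homo-^ : ∀ m n k → + (m ℕ.^ (k ℕ.+ n)) ≡ + (m ℕ.^ k) ℤ.* + (m ℕ.^ n)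
  +-homo-^ m n k = ≡.trans (≡.cong +_ (ℕ.^-distribˡ-+-* m k n)) (ℤ.pos-* (m ℕ.^ k) (m ℕ.^ n))

  Bezout-^ : ∀ {p b} k → Bezout (+ p) b → Bezout (+ (p ℕ.^ k)) b
  Bezout-^ {p} {b} zero    _ = Bezout-1 b
  Bezout-^ {p} {b} (suc k) e = ≡.subst (λ a → Bezout a b) (≡.sym (ℤ.pos-* p (p ℕ.^ k))) (Bezout-* e (Bezout-^ k e))

  coprime⇒Bezout : ∀ {m n} → Coprimality.Coprime m n → Bezout (+ m) (+ n)
  coprime⇒Bezout {m} {n} c with coprime-Bézout c
  ... | Bézout.+- x y e = + x , ℤ.- + y , ≡.trans
    (≡.cong₂ ℤ._+_ (≡.trans (≡.sym (ℤ.pos-* x m)) (≡.trans (≡.cong +_ (≡.sym e)) (≡.cong (ℤ._+_ 1ℤ) (ℤ.pos-* y n)))) ≡.refl)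
    (cancel (+ y) (+ n))
    where
    cancel : ∀ y n → (1ℤ ℤ.+ y ℤ.* n) ℤ.+ (ℤ.- y) ℤ.* n ≡ 1ℤ
    cancel = solve-∀
  ... | Bézout.-+ x y e = ℤ.- + x , + y , ≡.trans
    (≡.cong (λ z → (ℤ.- + x) ℤ.* + m ℤ.+ z) (≡.trans (≡.sym (ℤ.pos-* y n)) (≡.trans (≡.cong +_ (≡.sym e)) (≡.cong (ℤ._+_ 1ℤ) (ℤ.pos-* x m)))))
    (cancel (+ x) (+ m))
    where
    cancel : ∀ y n → (ℤ.- y) ℤ.* n ℤ.+ (1ℤ ℤ.+ y ℤ.* n) ≡ 1ℤ
    cancel = solve-∀

  ∤⇒Bezout : ∀ {p m} → Prime p → ¬ p ℕ.∣ m → Bezout (+ p) (+ m)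
  ∤⇒Bezout {p} {m} pr p∤m = coprime⇒Bezout λ {d} (d∣p , d∣m) → go d∣m (prime⇒irreducible pr d∣p)
    where
    go : ∀ {d} → d ℕ.∣ m → _ → d ≡ 1
    go d∣m (inj₁ d≡1) = d≡1
    go d∣m (inj₂ ≡.refl) = contradiction d∣m p∤m

  prime∤1 : ∀ {p} → Prime p → ¬ p ℕ.∣ 1
  prime∤1 pr p∣1 = contradiction (ℕ.∣1⇒≡1 p∣1) λ { ≡.refl → ¬prime[1] pr }

  prime∣^ : ∀ {p q} → Prime p → Prime q → ∀ k → p ℕ.∣ q ℕ.^ k → p ≡ q
  prime∣^ {p} {q} pp pq zero    p∣ = contradiction p∣ (prime∤1 pp)
  prime∣^ {p} {q} pp pq (suc k) p∣ with euclidsLemma q (q ℕ.^ k) pp p∣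
  ... | inj₂ p∣q^k = prime∣^ pp pq k p∣q^k
  ... | inj₁ p∣q with prime⇒irreducible pq p∣q
  ...   | inj₁ ≡.refl = contradiction pp ¬prime[1]
  ...   | inj₂ p≡q = p≡q

  prime-≢⇒Bezout : ∀ {p q} → Prime p → Prime q → p ≢ q → ∀ j k → Bezout (+ (p ℕ.^ j)) (+ (q ℕ.^ k))
  prime-≢⇒Bezout pp pq p≢q j k = Bezout-^ j (∤⇒Bezout pp λ p∣ → p≢q (prime∣^ pp pq k p∣))

  1<prime : ∀ {p} → Prime p → 1 ℕ.< p
  1<prime pr = ℕ.nonTrivial⇒n>1 _ {{prime⇒nonTrivial pr}}

  prime^-nonZero : ∀ {p} → Prime p → ∀ k → ℕ.NonZero (p ℕ.^ k)
  prime^-nonZero {p} pr k = ℕ.m^n≢0 p k {{prime⇒nonZero pr}}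

  -- Cyclic groups

  •≡* : ∀ n z w → let open Multiples (ℤ/ n) in z • w ≡ z ℤ.* w
  •≡* n z w = go z
    where
    open Multiples (ℤ/ n)
    goℕ : ∀ k → k ×ₙ w ≡ + k ℤ.* w
    goℕ zero    = ≡.sym (ℤ.*-zeroˡ w)
    goℕ (suc k) = ≡.trans (≡.cong (ℤ._+_ w) (goℕ k)) (≡.sym (ℤ.suc-* (+ k) w))
    go : ∀ z → z • w ≡ z ℤ.* w
    go (+ k)      = goℕ k
    go (-[1+ k ]) = ≡.trans (≡.cong ℤ.-_ (goℕ (suc k))) (ℤ.neg-distribˡ-* (+ suc k) w)

  ℤ/-≈ε : ∀ {n z} → + n ℤ.∣ z → AbelianGroup._≈_ (ℤ/ n) z 0ℤ
  ℤ/-≈ε {n} {z} = ≡.subst (+ n ℤ.∣_) (≡.sym (ℤ.+-identityʳ z))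

  ℤ/-∣ : ∀ {n z} → AbelianGroup._≈_ (ℤ/ n) z 0ℤ → + n ℤ.∣ z
  ℤ/-∣ {n} {z} = ≡.subst (+ n ℤ.∣_) (ℤ.+-identityʳ z)

  module _ (G : AbGroup) where
    open Multiples G

    cyclicHom : ∀ {n} b → (+ n) • b ≈ ε → Hom (ℤ/ n) G
    cyclicHom {n} b nb = record
      { ⟦_⟧  = _• b
      ; cong = λ {x} {y} (ℤ.divides q e) → x∙y⁻¹≈ε⇒x≈y (x • b) (y • b)
          (trans (sym (•-minus x y b)) (trans (•-congˡ {g = b} e) (•-*-killed q (+ n) nb)))
      ; homo = λ x y → •-+ x y b
      }

  Type : Set
  Type = List (ℕ × ℕ)

  M : Type → AbGroup
  M L = ⨁ (map (λ (p , e) → ℤ/ (p ℕ.^ e)) L)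

  IsType : Type → Set
  IsType = All λ (p , e) → Prime p × 1 ℕ.≤ e

  -- Generation by lists of elements

  module Generation (G : AbGroup) where
    open Multiples G
    open import Relation.Binary.Reasoning.Setoid setoid

    Span : List Carrier → Carrier → Set
    Span []       x = x ≈ ε
    Span (g ∷ gs) x = ∃₂ λ z y → Span gs y × x ≈ z • g ∙ y

    span-resp : ∀ gs {x y} → x ≈ y → Span gs x → Span gs y
    span-resp []       e s           = trans (sym e) s
    span-resp (g ∷ gs) e (z , y , s , f) = z , y , s , trans (sym e) f

    span-skip : ∀ g gs {x} → Span gs x → Span (g ∷ gs) x
    span-skip g gs {x} s = 0ℤ , x , s , sym (identityˡ x)

    span-++ˡ : ∀ gs hs {x} → Span gs x → Span (gs ++ hs) x
    span-++ˡ []       hs e = span-resp hs (sym e) (zeros hs)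
      where
      zeros : ∀ hs → Span hs ε
      zeros []       = refl
      zeros (h ∷ hs) = span-skip h hs (zeros hs)
    span-++ˡ (g ∷ gs) hs (z , y , s , e) = z , y , span-++ˡ gs hs s , e

    span-++ʳ : ∀ gs hs {x} → Span hs x → Span (gs ++ hs) x
    span-++ʳ []       hs s = s
    span-++ʳ (g ∷ gs) hs s = span-skip g (gs ++ hs) (span-++ʳ gs hs s)

    span-↭ : ∀ {gs hs x} → gs ↭ hs → Span gs x → Span hs x
    span-↭ ↭.refl s = s
    span-↭ (↭.prep g p) (z , y , s , e) = z , y , span-↭ p s , e
    span-↭ {x = x} (↭.swap g h p) (z , y , (w , y′ , s , f) , e) =
      w , z • g ∙ y′ , (z , y′ , span-↭ p s , refl) , (begin
        x                          ≈⟨ e ⟩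
        z • g ∙ y                  ≈⟨ ∙-congˡ f ⟩
        z • g ∙ (w • h ∙ y′)       ≈⟨ sym (assoc _ _ _) ⟩
        z • g ∙ w • h ∙ y′         ≈⟨ ∙-congʳ (comm _ _) ⟩
        w • h ∙ z • g ∙ y′         ≈⟨ assoc _ _ _ ⟩
        w • h ∙ (z • g ∙ y′)       ∎)
    span-↭ (↭.trans p q) s = span-↭ q (span-↭ p s)

    span-killed : ∀ n {gs x} → All (λ g → n • g ≈ ε) gs → Span gs x → n • x ≈ ε
    span-killed n [] e = •-killed n e
    span-killed n {g ∷ gs} {x} (k ∷ ks) (z , y , s , e) = begin
      n • x                  ≈⟨ •-congʳ n e ⟩
      n • (z • g ∙ y)        ≈⟨ •-∙ n (z • g) y ⟩
      n • z • g ∙ n • y      ≈⟨ ∙-cong (trans (•-comm n z g) (•-killed z k)) (span-killed n ks s) ⟩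
      ε ∙ ε                  ≈⟨ identityˡ ε ⟩
      ε                      ∎

    -- An element with a prime p and an exponent k. `Valid` asks that pᵏ kill the element, not that
    -- pᵏ be its exact order; the exponent is corrected during the recursion.
    Generator : Set
    Generator = Carrier × ℕ × ℕ

    Valid : Generator → Set
    Valid (g , p , k) = Prime p × (+ (p ℕ.^ k)) • g ≈ ε

    Generates : List Generator → Set
    Generates gs = ∀ x → Span (map proj₁ gs) x

  span-map : ∀ {G H} (f : Hom G H) gs {x} → Generation.Span G gs x → Generation.Span H (map ⟦ f ⟧ gs) (⟦ f ⟧ x)
  span-map {G} {H} f []       e = H.trans (cong f e) (homo-ε f)
    where module H = Multiples H
  span-map {G} {H} f (g ∷ gs) (z , y , s , e) = z , ⟦ f ⟧ y , span-map f gs s ,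
    H.trans (cong f e) (H.trans (homo f _ _) (H.∙-congʳ (homo-• f z g)))
    where module H = Multiples H

  p-part : ∀ p → Prime p → ∀ m → 1 ℕ.≤ m → ∃₂ λ k m′ → m ≡ p ℕ.^ k ℕ.* m′ × ¬ p ℕ.∣ m′
  p-part p pr = <-rec _ step
    where
    step : ∀ m → (∀ {n} → n ℕ.< m → 1 ℕ.≤ n → ∃₂ λ k m′ → n ≡ p ℕ.^ k ℕ.* m′ × ¬ p ℕ.∣ m′) →
           1 ℕ.≤ m → ∃₂ λ k m′ → m ≡ p ℕ.^ k ℕ.* m′ × ¬ p ℕ.∣ m′
    step m ih 1≤m with p ℕ.∣? m
    ... | no p∤m = 0 , m , ≡.sym (ℕ.+-identityʳ m) , p∤m
    ... | yes (ℕ.divides q ≡.refl) =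
      let 1≤q = 1≤factor q 1≤m
          k , m′ , e , p∤m′ = ih (ℕ.m<m*n q p {{ℕ.>-nonZero 1≤q}} (1<prime pr)) 1≤q
      in suc k , m′ , ≡.trans (≡.cong (ℕ._* p) e)
           (≡.trans (ℕ.*-comm (p ℕ.^ k ℕ.* m′) p) (≡.sym (ℕ.*-assoc p (p ℕ.^ k) m′))) , p∤m′
      where
      1≤factor : ∀ q → 1 ℕ.≤ q ℕ.* p → 1 ℕ.≤ q
      1≤factor zero ()
      1≤factor (suc q) _ = ℕ.z<s

  prime-factor : ∀ m → 1 ℕ.< m → ∃ λ p → Prime p × p ℕ.∣ m
  prime-factor m 1<m = go (factorise m {{ℕ.>-nonZero (ℕ.<⇒≤ 1<m)}})
    where
    go : PrimeFactorisation m → ∃ λ p → Prime p × p ℕ.∣ m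
    go record { factors = [] ; isFactorisation = e } = contradiction 1<m (ℕ.<-irrefl (≡.sym e))
    go record { factors = p ∷ ps ; isFactorisation = e ; factorsPrime = pr ∷ _ } =
      p , pr , ≡.subst (p ℕ.∣_) (≡.sym e) (ℕ.m∣m*n (product ps))

  module _ (G : AbGroup) where
    open Multiples G
    open Generation G
    open import Relation.Binary.Reasoning.Setoid setoid

    -- Write m = P m′ with P the full power of a prime p in m, and 1 = s P + t m′. Then g is the sum
    -- of t m′ g, which P kills, and s P g, which the smaller number m′ kills.
    torsion-split : ∀ m → 1 ℕ.≤ m → ∀ g → (+ m) • g ≈ ε →
      ∃ λ gs → All Valid gs × Span (map proj₁ gs) g
    torsion-split = <-rec _ step
      where
      P : ℕ → Set
      P m = 1 ℕ.≤ m → ∀ g → (+ m) • g ≈ ε → ∃ λ gs → All Valid gs × Span (map proj₁ gs) g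
      step : ∀ m → (∀ {n} → n ℕ.< m → P n) → P m
      step 1 _ _ g e = [] , [] , trans (sym (•-1 g)) e
      step m@(suc (suc _)) ih 1≤m g mg with prime-factor m (ℕ.s≤s ℕ.z<s)
      ... | p , pr , p∣m with p-part p pr m 1≤m
      ...   | zero , m′ , e , p∤m′ = contradiction (≡.subst (p ℕ.∣_) (≡.trans e (ℕ.+-identityʳ m′)) p∣m) p∤m′
      ...   | suc k , m′ , e , p∤m′ =
        let s , t , st = Bezout-^ (suc k) (∤⇒Bezout pr p∤m′)
            P = + (p ℕ.^ suc k)
            Pm′ = ≡.trans (≡.cong +_ e) (ℤ.pos-* (p ℕ.^ suc k) m′)
            killed = trans (•-congˡ {g = g} (≡.sym Pm′)) mg
            h = (t ℤ.* + m′) • g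
            y = (s ℤ.* P) • g
            Ph = begin
              P • h                       ≈⟨ sym (•-* P (t ℤ.* + m′) g) ⟩
              (P ℤ.* (t ℤ.* + m′)) • g    ≡⟨ ≡.cong (_• g) (swap-* P t (+ m′)) ⟩
              (t ℤ.* (P ℤ.* + m′)) • g    ≈⟨ •-*-killed t (P ℤ.* + m′) killed ⟩
              ε                           ∎
            my = begin
              (+ m′) • y                    ≈⟨ sym (•-* (+ m′) (s ℤ.* P) g) ⟩
              (+ m′ ℤ.* (s ℤ.* P)) • g    ≡⟨ ≡.cong (_• g) (≡.trans (swap-* (+ m′) s P) (≡.cong (ℤ._*_ s) (ℤ.*-comm (+ m′) P))) ⟩
              (s ℤ.* (P ℤ.* + m′)) • g    ≈⟨ •-*-killed s (P ℤ.* + m′) killed ⟩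
              ε                           ∎
            1≤m′ = 1≤right (p ℕ.^ suc k) m′ (≡.subst (1 ℕ.≤_) e 1≤m)
            gs , valid , span = ih (≡.subst (m′ ℕ.<_) (≡.trans (ℕ.*-comm m′ (p ℕ.^ suc k)) (≡.sym e))
              (ℕ.m<m*n m′ (p ℕ.^ suc k) {{ℕ.>-nonZero 1≤m′}} (1<^ k))) 1≤m′ y my
        in (h , p , suc k) ∷ gs , (pr , Ph) ∷ valid , 1ℤ , y , span , (begin
              g                      ≈⟨ sym (•-1 g) ⟩
              1ℤ • g                 ≡⟨ ≡.cong (_• g) (≡.trans (≡.sym st) (ℤ.+-comm (s ℤ.* P) (t ℤ.* + m′))) ⟩
              (t ℤ.* + m′ ℤ.+ s ℤ.* P) • g    ≈⟨ •-+ (t ℤ.* + m′) (s ℤ.* P) g ⟩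
              h ∙ y                  ≈⟨ ∙-congʳ (sym (•-1 h)) ⟩
              1ℤ • h ∙ y             ∎)
        where
        swap-* : ∀ a b c → a ℤ.* (b ℤ.* c) ≡ b ℤ.* (a ℤ.* c)
        swap-* = solve-∀
        1≤right : ∀ a b → 1 ℕ.≤ a ℕ.* b → 1 ℕ.≤ b
        1≤right a zero    le = contradiction (≡.subst (1 ℕ.≤_) (ℕ.*-zeroʳ a) le) λ ()
        1≤right a (suc b) _  = ℕ.z<s
        1<^ : ∀ k → 1 ℕ.< p ℕ.^ suc k
        1<^ k = ℕ.≤-trans (1<prime pr) (ℕ.m≤m*n p (p ℕ.^ k) {{prime^-nonZero pr k}})

-- Decomposition into cyclic groups of prime power order.

module StructureTheorem where
  open import Data.Integer.Base using (+_)
  open import Data.List.Relation.Binary.Permutation.Propositional using (prep; swap)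
  open import Data.List.Relation.Binary.Permutation.Propositional.Properties using (map⁺)
  open GroupBasics
  open Structure
  open Hom

  ∤⇒Bezoutℤ : ∀ {p w} → Prime p → ¬ (+ p) ℤ.∣ w → Bezout (+ p) w
  ∤⇒Bezoutℤ {p} {w} pr p∤w with ∤⇒Bezout {p} {ℤ.∣ w ∣} pr (p∤w ∘ ℤ.∣ᵤ⇒∣)
  ... | s , t , e with ℤ.+∣i∣≡i⊎+∣i∣≡-i w
  ...   | inj₁ f = s , t , ≡.trans (≡.cong (λ x → s ℤ.* + p ℤ.+ t ℤ.* x) (≡.sym f)) e
  ...   | inj₂ f = s , ℤ.- t , ≡.trans (negate s t (+ p) w) (≡.trans (≡.cong (λ x → s ℤ.* + p ℤ.+ t ℤ.* x) (≡.sym f)) e)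
    where
    negate : ∀ s t p w → s ℤ.* p ℤ.+ (ℤ.- t) ℤ.* w ≡ s ℤ.* p ℤ.+ t ℤ.* (ℤ.- w)
    negate = solve-∀

  -- The quotient by the subgroup generated by a: same operations, coarser equality.
  module Quotient (G : AbGroup) (a : AbelianGroup.Carrier G) where
    open Multiples G
    open import Relation.Binary.Reasoning.Setoid setoid

    infix 4 _~_
    _~_ : Carrier → Carrier → Set
    x ~ y = ∃ λ w → x ≈ y ∙ w • a

    ≈⇒~ : ∀ {x y} → x ≈ y → x ~ y
    ≈⇒~ {x} {y} e = 0ℤ , trans e (sym (identityʳ y))

    ~-sym : ∀ {x y} → x ~ y → y ~ x
    ~-sym {x} {y} (w , e) = ℤ.- w , (begin
      y                             ≈⟨ sym (identityʳ y) ⟩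
      y ∙ ε                         ≈⟨ ∙-congˡ (sym (inverseʳ (w • a))) ⟩
      y ∙ (w • a ∙ (w • a) ⁻¹)      ≈⟨ sym (assoc _ _ _) ⟩
      y ∙ w • a ∙ (w • a) ⁻¹        ≈⟨ ∙-cong (sym e) (sym (•-neg w a)) ⟩
      x ∙ (ℤ.- w) • a               ∎)

    ~-trans : ∀ {x y z} → x ~ y → y ~ z → x ~ z
    ~-trans {x} {y} {z} (w , e) (w′ , e′) = w′ ℤ.+ w , (begin
      x                      ≈⟨ e ⟩
      y ∙ w • a              ≈⟨ ∙-congʳ e′ ⟩
      z ∙ w′ • a ∙ w • a     ≈⟨ assoc _ _ _ ⟩
      z ∙ (w′ • a ∙ w • a)   ≈⟨ ∙-congˡ (sym (•-+ w′ w a)) ⟩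
      z ∙ (w′ ℤ.+ w) • a     ∎)

    ~-∙ : ∀ {x y u v} → x ~ y → u ~ v → x ∙ u ~ y ∙ v
    ~-∙ {x} {y} {u} {v} (w , e) (w′ , e′) = w ℤ.+ w′ , (begin
      x ∙ u                             ≈⟨ ∙-cong e e′ ⟩
      (y ∙ w • a) ∙ (v ∙ w′ • a)        ≈⟨ interchange _ _ _ _ ⟩
      (y ∙ v) ∙ (w • a ∙ w′ • a)        ≈⟨ ∙-congˡ (sym (•-+ w w′ a)) ⟩
      (y ∙ v) ∙ (w ℤ.+ w′) • a          ∎)

    ~-⁻¹ : ∀ {x y} → x ~ y → x ⁻¹ ~ y ⁻¹
    ~-⁻¹ {x} {y} (w , e) = ℤ.- w , (begin
      x ⁻¹                       ≈⟨ ⁻¹-cong e ⟩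
      (y ∙ w • a) ⁻¹             ≈⟨ sym (⁻¹-∙-comm _ _) ⟩
      y ⁻¹ ∙ (w • a) ⁻¹          ≈⟨ ∙-congˡ (sym (•-neg w a)) ⟩
      y ⁻¹ ∙ (ℤ.- w) • a         ∎)

    quotient : AbGroup
    quotient = record
      { Carrier = Carrier ; _≈_ = _~_ ; _∙_ = _∙_ ; ε = ε ; _⁻¹ = _⁻¹
      ; isAbelianGroup = record
        { isGroup = record
          { isMonoid = record
            { isSemigroup = record
              { isMagma = record
                { isEquivalence = record { refl = ≈⇒~ refl ; sym = ~-sym ; trans = ~-trans }
                ; ∙-cong = ~-∙
                }
              ; assoc = λ x y z → ≈⇒~ (assoc x y z)
              }
            ; identity = (λ x → ≈⇒~ (identityˡ x)) , (λ x → ≈⇒~ (identityʳ x))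
            }
          ; inverse = (λ x → ≈⇒~ (inverseˡ x)) , (λ x → ≈⇒~ (inverseʳ x))
          ; ⁻¹-cong = ~-⁻¹
          }
        ; comm = λ x y → ≈⇒~ (comm x y)
        }
      }

    project : Hom G quotient
    project = record { ⟦_⟧ = λ x → x ; cong = ≈⇒~ ; homo = λ _ _ → ≈⇒~ refl }

    -- As n kills a, the multiple w a depends only on w modulo n, and a search through n residues
    -- suffices.
    ~-dec : Decidable _≈_ → ∀ n → .{{_ : ℕ.NonZero n}} → (+ n) • a ≈ ε → Decidable _~_
    ~-dec _≟_ n na x y = map′
      (λ (i , e) → + toℕ i , e)
      (λ (w , e) → fromℕ< (ℤ.n%ℕd<d w n) , trans e (∙-congˡ (reduce w)))
      (Fin.any? λ i → x ≟ (y ∙ (+ toℕ i) • a))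
      where
      reduce : ∀ w → w • a ≈ (+ toℕ (fromℕ< (ℤ.n%ℕd<d w n))) • a
      reduce w = begin
        w • a                                               ≡⟨ ≡.cong (_• a) (ℤ.a≡a%ℕn+[a/ℕn]*n w n) ⟩
        (+ (w ℤ.%ℕ n) ℤ.+ (w ℤ./ℕ n) ℤ.* + n) • a           ≈⟨ •-+ (+ (w ℤ.%ℕ n)) ((w ℤ./ℕ n) ℤ.* + n) a ⟩
        (+ (w ℤ.%ℕ n)) • a ∙ ((w ℤ./ℕ n) ℤ.* + n) • a       ≈⟨ ∙-congˡ (•-*-killed (w ℤ./ℕ n) (+ n) na) ⟩
        (+ (w ℤ.%ℕ n)) • a ∙ ε                              ≈⟨ identityʳ _ ⟩
        (+ (w ℤ.%ℕ n)) • a                                  ≡⟨ ≡.cong (λ i → (+ i) • a) (Fin.toℕ-fromℕ< (ℤ.n%ℕd<d w n)) ⟨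
        (+ toℕ (fromℕ< (ℤ.n%ℕd<d w n))) • a                 ∎

  -- An element a of order exactly pᵏ⁺¹, where pᵏ⁺¹ kills the p-torsion of G, splits off.
  module Split (G : AbGroup) {p : ℕ} (pr : Prime p) (k : ℕ) (a : AbelianGroup.Carrier G) where

    open Multiples G
    open Quotient G a

    module Lift (Pa : (+ (p ℕ.^ suc k)) • a ≈ ε) (exact : ¬ (+ (p ℕ.^ k)) • a ≈ ε)
      {m : ℕ} (p∤m : ¬ p ℕ.∣ m) (exponent : ∀ x → (+ (p ℕ.^ suc k) ℤ.* + m) • x ≈ ε) where

      open import Relation.Binary.Reasoning.Setoid setoid

      private
        P : ℤ
        P = + (p ℕ.^ suc k)

        instance
          P-nonZero : ∀ {j} → ℕ.NonZero (p ℕ.^ j)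
          P-nonZero {j} = prime^-nonZero pr j

      -- Raise the power of p that divides z step by step. If z = w pʲ with j ≤ k and p does not
      -- divide w, then s p + t w = 1 exhibits pᵏ as a combination of P and z, so pᵏ would kill a.
      order-∣ : ∀ z → z • a ≈ ε → P ℤ.∣ z
      order-∣ z za = go (suc k) ℕ.≤-refl
        where
        go : ∀ j → j ℕ.≤ suc k → + (p ℕ.^ j) ℤ.∣ z
        go zero    _ = ℤ.divides z (≡.sym (ℤ.*-identityʳ z))
        go (suc j) (ℕ.s≤s j≤k) with go j (ℕ.m≤n⇒m≤1+n j≤k)
        ... | ℤ.divides w e with + p ℤ.∣? w
        ...   | yes (ℤ.divides q f) = ℤ.divides q (≡.trans e (≡.trans (≡.cong (ℤ._* + (p ℕ.^ j)) f)
                (≡.trans (ℤ.*-assoc q (+ p) (+ (p ℕ.^ j))) (≡.cong (ℤ._*_ q) (≡.sym (ℤ.pos-* p (p ℕ.^ j)))))))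
        ...   | no p∤w with ∤⇒Bezoutℤ pr p∤w
        ...     | s , t , st = contradiction (begin
                  (+ (p ℕ.^ k)) • a                        ≡⟨ ≡.cong (_• a) expand ⟩
                  (s ℤ.* P ℤ.+ u ℤ.* z) • a                ≈⟨ •-+ (s ℤ.* P) (u ℤ.* z) a ⟩
                  (s ℤ.* P) • a ∙ (u ℤ.* z) • a            ≈⟨ ∙-cong (•-*-killed s P Pa) (•-*-killed u z za) ⟩
                  ε ∙ ε                                    ≈⟨ identityˡ ε ⟩
                  ε                                        ∎) exact
          where
          d = + (p ℕ.^ (k ℕ.∸ j))
          u = t ℤ.* d
          rearrange : ∀ d c s t p w → d ℤ.* c ℤ.* (s ℤ.* p ℤ.+ t ℤ.* w) ≡ s ℤ.* (p ℤ.* (d ℤ.* c)) ℤ.+ t ℤ.* d ℤ.* (w ℤ.* c)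
          rearrange = solve-∀
          p^k : + (p ℕ.^ k) ≡ d ℤ.* + (p ℕ.^ j)
          p^k = ≡.trans (≡.cong (λ i → + (p ℕ.^ i)) (≡.sym (ℕ.m∸n+n≡m j≤k))) (+-homo-^ p j (k ℕ.∸ j))
          expand : + (p ℕ.^ k) ≡ s ℤ.* P ℤ.+ u ℤ.* z
          expand = ≡.trans (≡.sym (ℤ.*-identityʳ (+ (p ℕ.^ k))))
            (≡.trans (≡.cong₂ ℤ._*_ p^k (≡.sym st))
            (≡.trans (rearrange d (+ (p ℕ.^ j)) s t (+ p) w)
            (≡.cong₂ (λ x y → s ℤ.* x ℤ.+ u ℤ.* y)
              (≡.trans (≡.cong (ℤ._*_ (+ p)) (≡.sym p^k)) (≡.sym (ℤ.pos-* p (p ℕ.^ k)))) (≡.sym e))))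

      private
        subtract : ∀ n b c u → n • b ≈ c • a → c • a ≈ n • u • a →
          ∃₂ λ b′ w → n • b′ ≈ ε × b′ ≈ b ∙ w • a
        subtract n b c u nb cu = b ∙ (ℤ.- u) • a , ℤ.- u , (begin
          n • (b ∙ (ℤ.- u) • a)          ≈⟨ •-∙ n b _ ⟩
          n • b ∙ n • (ℤ.- u) • a        ≈⟨ ∙-cong (trans nb cu) (trans (•-congʳ n (•-neg u a)) (•-⁻¹ n (u • a))) ⟩
          n • u • a ∙ (n • u • a) ⁻¹     ≈⟨ inverseʳ _ ⟩
          ε                              ∎) , refl

      -- For q ≠ p the power of q is invertible modulo the order of a, which yields the correction
      -- at once. For q = p the hypothesis `exponent` enters: it bounds the p-part of the order of b
      -- by that of a, and then either qˡ kills b already or qˡ divides c.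
      lift-element : ∀ {q} → Prime q → ∀ l b c → (+ (q ℕ.^ l)) • b ≈ c • a →
        ∃₂ λ b′ w → (+ (q ℕ.^ l)) • b′ ≈ ε × b′ ≈ b ∙ w • a
      lift-element {q} pq l b c e with p ℕ.≟ q
      ... | no p≢q =
        let s , t , st = prime-≢⇒Bezout pq pr (p≢q ∘ ≡.sym) l (suc k)
            Q = + (q ℕ.^ l)
        in subtract Q b c (c ℤ.* s) e (begin
          c • a                                        ≡⟨ ≡.cong (_• a) (≡.trans (≡.sym (ℤ.*-identityʳ c)) (≡.cong (ℤ._*_ c) (≡.sym st))) ⟩
          (c ℤ.* (s ℤ.* Q ℤ.+ t ℤ.* P)) • a            ≡⟨ ≡.cong (_• a) (rearrange c s Q t P) ⟩
          (Q ℤ.* (c ℤ.* s) ℤ.+ c ℤ.* t ℤ.* P) • a      ≈⟨ •-+ (Q ℤ.* (c ℤ.* s)) (c ℤ.* t ℤ.* P) a ⟩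
          (Q ℤ.* (c ℤ.* s)) • a ∙ (c ℤ.* t ℤ.* P) • a  ≈⟨ ∙-cong (•-* Q (c ℤ.* s) a) (•-*-killed (c ℤ.* t) P Pa) ⟩
          Q • (c ℤ.* s) • a ∙ ε                        ≈⟨ identityʳ _ ⟩
          Q • (c ℤ.* s) • a                            ∎)
        where
        rearrange : ∀ c s q t p → c ℤ.* (s ℤ.* q ℤ.+ t ℤ.* p) ≡ q ℤ.* (c ℤ.* s) ℤ.+ c ℤ.* t ℤ.* p
        rearrange = solve-∀
      ... | yes ≡.refl = by-size (ℕ.≤-total l (suc k))
        where
        Q = + (p ℕ.^ l)
        PQb : (P ℤ.* Q) • b ≈ ε
        PQb = begin
          (P ℤ.* Q) • b   ≈⟨ •-* P Q b ⟩
          P • Q • b       ≈⟨ •-congʳ P e ⟩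
          P • c • a       ≈⟨ •-comm P c a ⟩
          c • P • a       ≈⟨ •-killed c Pa ⟩
          ε               ∎
        rearrange : ∀ P s q t m → P ℤ.* (s ℤ.* q ℤ.+ t ℤ.* m) ≡ s ℤ.* (P ℤ.* q) ℤ.+ t ℤ.* (P ℤ.* m)
        rearrange = solve-∀
        -- Both P Q and P m kill b, and Q is coprime to m.
        Pb : P • b ≈ ε
        Pb with Bezout-^ l (∤⇒Bezout pr p∤m)
        ... | s , t , st = begin
          P • b                                          ≡⟨ ≡.cong (_• b) (≡.trans (≡.sym (ℤ.*-identityʳ P)) (≡.cong (ℤ._*_ P) (≡.sym st))) ⟩
          (P ℤ.* (s ℤ.* Q ℤ.+ t ℤ.* + m)) • b            ≡⟨ ≡.cong (_• b) (rearrange P s Q t (+ m)) ⟩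
          (s ℤ.* (P ℤ.* Q) ℤ.+ t ℤ.* (P ℤ.* + m)) • b    ≈⟨ •-+ (s ℤ.* (P ℤ.* Q)) (t ℤ.* (P ℤ.* + m)) b ⟩
          (s ℤ.* (P ℤ.* Q)) • b ∙ (t ℤ.* (P ℤ.* + m)) • b ≈⟨ ∙-cong (•-*-killed s (P ℤ.* Q) PQb) (•-*-killed t (P ℤ.* + m) (exponent b)) ⟩
          ε ∙ ε                                          ≈⟨ identityˡ ε ⟩
          ε                                              ∎
        split-power : ∀ {i j} → i ℕ.≤ j → + (p ℕ.^ j) ≡ + (p ℕ.^ (j ℕ.∸ i)) ℤ.* + (p ℕ.^ i)
        split-power {i} {j} i≤j = ≡.trans (≡.cong (λ x → + (p ℕ.^ x)) (≡.sym (ℕ.m∸n+n≡m i≤j))) (+-homo-^ p i (j ℕ.∸ i))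
        by-size : l ℕ.≤ suc k ⊎ suc k ℕ.≤ l → ∃₂ λ b′ w → Q • b′ ≈ ε × b′ ≈ b ∙ w • a
        by-size (inj₂ k<l) = b , 0ℤ ,
          trans (•-congˡ {g = b} (split-power k<l)) (•-*-killed (+ (p ℕ.^ (l ℕ.∸ suc k))) P Pb) ,
          sym (identityʳ b)
        -- With P = d Q, the element d c a = d Q b = P b vanishes, so d Q divides d c and Q divides
        -- c.
        by-size (inj₁ l≤k) = finish (ℤ.*-cancelˡ-∣ d {{P-nonZero {suc k ℕ.∸ l}}} (≡.subst (ℤ._∣ d ℤ.* c) (split-power l≤k) (order-∣ (d ℤ.* c) (begin
          (d ℤ.* c) • a    ≈⟨ •-* d c a ⟩
          d • c • a        ≈⟨ •-congʳ d (sym e) ⟩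
          d • Q • b        ≈⟨ sym (•-* d Q b) ⟩
          (d ℤ.* Q) • b    ≡⟨ ≡.cong (_• b) (split-power l≤k) ⟨
          P • b            ≈⟨ Pb ⟩
          ε                ∎))))
          where
          d = + (p ℕ.^ (suc k ℕ.∸ l))
          finish : Q ℤ.∣ c → ∃₂ λ b′ w → Q • b′ ≈ ε × b′ ≈ b ∙ w • a
          finish (ℤ.divides u f) = subtract Q b c u e
            (trans (•-congˡ {g = a} (≡.trans f (ℤ.*-comm u Q))) (•-* Q u a))

      -- A homomorphism out of a sum of cyclic groups is given by the images of the generators, so
      -- it is enough to lift each of these without enlarging the power that kills it.
      lift : ∀ {L} → IsType L → (f : Hom (M L) quotient) →
        ∃ λ (ψ : Hom (M L) G) → ∀ c → ⟦ ψ ⟧ c ~ ⟦ f ⟧ c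
      lift [] f =
        record { ⟦_⟧ = λ _ → ε ; cong = λ _ → refl ; homo = λ _ _ → sym (identityˡ ε) } ,
        λ _ → ~-sym (homo-ε f)
      lift {(q , l) ∷ L} ((pq , _) ∷ t) f = [ ψ₁ , ψ₂ ]ʰ , agrees
        where
        module C = Multiples (ℤ/ (q ℕ.^ l))
        module Q = Multiples quotient
        f₁ : Hom (ℤ/ (q ℕ.^ l)) quotient
        f₁ = f ∘ʰ inj₁ʰ
        f₂ : Hom (M L) quotient
        f₂ = f ∘ʰ inj₂ʰ {ℤ/ (q ℕ.^ l)}
        b = ⟦ f₁ ⟧ 1ℤ
        n = + (q ℕ.^ l)
        killed : n • b ~ ε
        killed = ~-trans (homo-• project n b) (~-trans (~-sym (homo-• f₁ n 1ℤ)) (~-trans (cong f₁ n≈0) (homo-ε f₁)))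
          where
          n≈0 : n C.• 1ℤ C.≈ 0ℤ
          n≈0 = ≡.subst (C._≈ 0ℤ) (≡.sym (•≡* (q ℕ.^ l) n 1ℤ)) (ℤ/-≈ε (ℤ.∣m⇒∣m*n 1ℤ ℤ.∣-refl))
        lifted : ∃₂ λ b′ w → n • b′ ≈ ε × b′ ≈ b ∙ w • a
        lifted = lift-element pq l b (proj₁ killed) (trans (proj₂ killed) (identityˡ _))
        b′ = proj₁ lifted
        ψ₁ : Hom (ℤ/ (q ℕ.^ l)) G
        ψ₁ = cyclicHom G b′ (proj₁ (proj₂ (proj₂ lifted)))
        ψ₂ : Hom (M L) G
        ψ₂ = proj₁ (lift t f₂)
        ψ₁~ : ∀ z → z • b′ ~ ⟦ f₁ ⟧ z
        ψ₁~ z = ~-trans (homo-• project z b′) (~-trans (Q.•-congʳ z (proj₁ (proj₂ lifted) , proj₂ (proj₂ (proj₂ lifted))))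
          (~-trans (~-sym (homo-• f₁ z 1ℤ)) (cong f₁ (C.reflexive (≡.trans (•≡* (q ℕ.^ l) z 1ℤ) (ℤ.*-identityʳ z))))))
        agrees : ∀ c → ⟦ ψ₁ ⟧ (proj₁ c) ∙ ⟦ ψ₂ ⟧ (proj₂ c) ~ ⟦ f ⟧ c
        agrees (z , c) = ~-trans (~-∙ (ψ₁~ z) (proj₂ (lift t f₂) c))
          (~-trans (~-sym (homo f _ _)) (cong f (C.identityʳ z , AbelianGroup.identityˡ (M L) c)))

      -- The lift is a section of the projection to the quotient. If z a + ψ(c) = 0, then c vanishes
      -- in the quotient and hence in `M L`; so z a = 0, and `order-∣` applies.
      splits : ∀ {L} → IsType L → M L ≅ quotient → M ((p , suc k) ∷ L) ≅ G
      splits {L} t i = mk≅ {M ((p , suc k) ∷ L)} {G} [ cyclicHom G a Pa , ψ ]ʰ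
        (λ {(z , c)} e → kernel z c e)
        (λ x → let w , f = ~-sym (~-trans (ψ~ (⟦ I.from ⟧ x)) (I.to-from x))
               in (w , ⟦ I.from ⟧ x) , trans (comm _ _) (sym f))
        where
        module I = Iso {M L} {quotient} i
        ψ : Hom (M L) G
        ψ = proj₁ (lift t I.to)
        ψ~ : ∀ c → ⟦ ψ ⟧ c ~ ⟦ I.to ⟧ c
        ψ~ = proj₂ (lift t I.to)
        kernel : ∀ z c → z • a ∙ ⟦ ψ ⟧ c ≈ ε → AbelianGroup._≈_ (ℤ/ (p ℕ.^ suc k)) z 0ℤ × AbelianGroup._≈_ (M L) c (AbelianGroup.ε (M L))
        kernel z c e = ℤ/-≈ε (order-∣ z za≈ε) , c≈ε
          where
          ψc~ε : ⟦ ψ ⟧ c ~ ε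
          ψc~ε = ~-sym (z , sym (trans (comm _ _) e))
          c≈ε = I.kernel (~-trans (~-sym (ψ~ c)) ψc~ε)
          za≈ε : z • a ≈ ε
          za≈ε = begin
            z • a               ≈⟨ sym (identityʳ _) ⟩
            z • a ∙ ε           ≈⟨ ∙-congˡ (sym (trans (cong ψ c≈ε) (homo-ε ψ))) ⟩
            z • a ∙ ⟦ ψ ⟧ c     ≈⟨ e ⟩
            ε                   ∎

  module _ (G : AbGroup) where
    open Multiples G
    open Generation G

    select : ∀ g gs → ∃₂ λ (a : Generator) rest →
      g ∷ gs ↭ a ∷ rest × All (λ h → proj₂ (proj₂ h) ℕ.≤ proj₂ (proj₂ a)) rest
    select g [] = g , [] , ↭-refl , []
    select g (h ∷ gs) with select h gs
    ... | a , rest , p , max with ℕ.≤-total (proj₂ (proj₂ g)) (proj₂ (proj₂ a))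
    ...   | inj₁ g≤a = a , g ∷ rest , ↭-trans (prep g p) (swap g a ↭-refl) , g≤a ∷ max
    ...   | inj₂ a≤g = g , a ∷ rest , prep g p , a≤g ∷ All.map (λ x → ℕ.≤-trans x a≤g) max

    killed-≤ : ∀ {p g i j} → i ℕ.≤ j → (+ (p ℕ.^ i)) • g ≈ ε → (+ (p ℕ.^ j)) • g ≈ ε
    killed-≤ {p} {g} {i} {j} i≤j e = trans
      (•-congˡ {g = g} (≡.trans (≡.cong (λ x → + (p ℕ.^ x)) (≡.sym (ℕ.m∸n+n≡m i≤j))) (+-homo-^ p i (j ℕ.∸ i))))
      (•-*-killed (+ (p ℕ.^ (j ℕ.∸ i))) (+ (p ℕ.^ i)) e)

    -- pᵏ m kills the generators, where m is the product of the orders for the other primes.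
    exponent-off : ∀ {p} k → Prime p → ∀ {gs} → All Valid gs → All (λ h → proj₂ (proj₂ h) ℕ.≤ k) gs →
      ∃ λ m → ¬ p ℕ.∣ m × All (λ g → (+ (p ℕ.^ k) ℤ.* + m) • g ≈ ε) (map proj₁ gs)
    exponent-off k pr [] [] = 1 , prime∤1 pr , []
    exponent-off {p} k pr {(g , q , l) ∷ gs} ((pq , e) ∷ vs) (l≤k ∷ ms) with exponent-off k pr vs ms
    ... | m , p∤m , ks with p ℕ.≟ q
    ...   | yes ≡.refl = m , p∤m ,
            trans (•-congˡ {g = g} (ℤ.*-comm (+ (p ℕ.^ k)) (+ m))) (•-*-killed (+ m) (+ (p ℕ.^ k)) (killed-≤ l≤k e)) ∷ ks
    ...   | no p≢q = q ℕ.^ l ℕ.* m ,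
            (λ p∣ → [ (λ p∣q → p≢q (prime∣^ pr pq l p∣q)) , p∤m ] (euclidsLemma (q ℕ.^ l) m pr p∣)) ,
            trans (•-congˡ {g = g} (≡.trans (≡.cong (ℤ._*_ P) (ℤ.pos-* (q ℕ.^ l) m)) (rearrange₁ P (+ (q ℕ.^ l)) (+ m)))) (•-*-killed (P ℤ.* + m) (+ (q ℕ.^ l)) e)
            ∷ All.map (λ {h} f → trans (•-congˡ {g = h} (≡.trans (≡.cong (ℤ._*_ P) (ℤ.pos-* (q ℕ.^ l) m)) (rearrange₂ P (+ (q ℕ.^ l)) (+ m)))) (•-*-killed (+ (q ℕ.^ l)) (P ℤ.* + m) f)) ks
      where
      P = + (p ℕ.^ k)
      rearrange₁ : ∀ P Q m → P ℤ.* (Q ℤ.* m) ≡ P ℤ.* m ℤ.* Q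
      rearrange₁ = solve-∀
      rearrange₂ : ∀ P Q m → P ℤ.* (Q ℤ.* m) ≡ Q ℤ.* (P ℤ.* m)
      rearrange₂ = solve-∀

  module _ where
    open Generation

    private
      -- The termination measure. Because of the successor it drops also when a generator of
      -- exponent 0 is discarded.
      weight : ∀ {A : Set} → A × ℕ × ℕ → ℕ
      weight (_ , _ , k) = suc k

    -- Take a generator of largest exponent. If a smaller power of its prime kills it, lower the
    -- exponent and choose again; otherwise the exponent is exact and maximal, so the generator
    -- splits off and the recursion continues in the quotient. There equality must be decidable
    -- again.
    structure : ∀ n G → Decidable (AbelianGroup._≈_ G) → ∀ gs → All (Valid G) gs →
      sum (map weight gs) ℕ.≤ n → Generates G gs → ∃ λ L → IsType L × M L ≅ G
    structure n G _≟_ [] _ _ gen = [] , [] ,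
      mk≅ {M []} {G} (record { ⟦_⟧ = λ _ → ε ; cong = λ _ → refl ; homo = λ _ _ → sym (identityˡ ε) })
        (λ _ → tt) (λ y → tt , sym (gen y))
      where open Multiples G
    structure zero G _≟_ (g ∷ gs) _ () _
    structure (suc n) G _≟_ (g ∷ gs) valid size≤ gen with select G g gs
    ... | (a , p , k) , rest , perm , max = go k max valid′ (ℕ.s≤s⁻¹ (≡.subst (ℕ._≤ suc n) (sum-↭ (map⁺ weight perm)) size≤))
      where
      open Multiples G
      valid′ = All-resp-↭ perm valid
      gen′ : ∀ x → Span G (a ∷ map proj₁ rest) x
      gen′ x = span-↭ G (map⁺ proj₁ perm) (gen x)
      go : ∀ k → All (λ h → proj₂ (proj₂ h) ℕ.≤ k) rest → All (Valid G) ((a , p , k) ∷ rest) →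
           k ℕ.+ sum (map weight rest) ℕ.≤ n → ∃ λ L → IsType L × M L ≅ G
      go zero _ ((_ , e) ∷ vs) le = structure n G _≟_ rest vs le λ x →
        let z , y , s , f = gen′ x
        in span-resp G (map proj₁ rest) (sym (trans f (trans (∙-congʳ (•-killed z (trans (sym (•-1 a)) e))) (identityˡ y)))) s
      go (suc k) max ((pr , e) ∷ vs) le with ((+ (p ℕ.^ k)) • a) ≟ ε
      ... | yes e′ = structure n G _≟_ ((a , p , k) ∷ rest) ((pr , e′) ∷ vs) le gen′
      ... | no exact with exponent-off G (suc k) pr ((pr , e) ∷ vs) (ℕ.≤-refl ∷ max)
      ...   | m , p∤m , ks =
        let L , t , i = structure n quotient (~-dec _≟_ (p ℕ.^ suc k) {{prime^-nonZero pr (suc k)}} e) rest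
              (All.map (λ {(h , q , l)} (pq , f) → pq , ~-trans (~-sym (homo-• project (+ (q ℕ.^ l)) h)) (≈⇒~ f)) vs)
              (ℕ.≤-trans (ℕ.m≤n+m _ (suc k)) le)
              (λ x → let z , y , s , f = gen′ x in
                 span-resp quotient (map proj₁ rest) (~-sym (z , trans f (comm _ _)))
                   (≡.subst (λ hs → Span quotient hs y) (List.map-id (map proj₁ rest)) (span-map project (map proj₁ rest) s)))
        in (p , suc k) ∷ L , (pr , ℕ.z<s) ∷ t , splits t i
        where
        open Quotient G a
        exponent : ∀ x → (+ (p ℕ.^ suc k) ℤ.* + m) • x ≈ ε
        exponent x = span-killed G (+ (p ℕ.^ suc k) ℤ.* + m) ks (gen′ x)
        open Split.Lift G pr k a e exact p∤m exponent

-- Orders of the standard groups, and a type for every finite group.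

module Models where
  open import Data.Integer.Base using (+_)
  open import Data.Fin.Base using (zero; suc; combine; remQuot)
  open GroupBasics
  open Structure
  open StructureTheorem
  open Hom

  -- Residues

  residue-unique : ∀ {n r r′} → r ℕ.< n → r′ ℕ.< n → + n ℤ.∣ + r ℤ.- + r′ → r ≡ r′
  residue-unique {n} {r} {r′} r<n r′<n d = ℤ.+-injective (ℤ.i-j≡0⇒i≡j (+ r) (+ r′)
    (ℤ.∣i∣≡0⇒i≡0 (zero-or-large ℤ.∣ + r ℤ.- + r′ ∣ (ℤ.∣⇒∣ᵤ d) small)))
    where
    small : ℤ.∣ + r ℤ.- + r′ ∣ ℕ.< n
    small = ℕ.≤-<-trans (≡.subst (ℕ._≤ r ℕ.⊔ r′) (≡.cong ℤ.∣_∣ (≡.sym (ℤ.m-n≡m⊖n r r′))) (ℤ.∣m⊝n∣≤m⊔n r r′))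
                        (ℕ.⊔-lub r<n r′<n)
    zero-or-large : ∀ k → n ℕ.∣ k → k ℕ.< n → k ≡ 0
    zero-or-large zero    _ _   = ≡.refl
    zero-or-large (suc k) d k<n = contradiction (ℕ.∣⇒≤ d) (ℕ.<⇒≱ k<n)

  module _ (n : ℕ) .{{_ : ℕ.NonZero n}} where

    residue : ℤ → Fin n
    residue z = fromℕ< (ℤ.n%ℕd<d z n)

    residue-∣ : ∀ z → + n ℤ.∣ z ℤ.- + toℕ (residue z)
    residue-∣ z = ℤ.divides (z ℤ./ℕ n) (≡.trans
      (≡.cong₂ (λ x y → x ℤ.- + y) (ℤ.a≡a%ℕn+[a/ℕn]*n z n) (Fin.toℕ-fromℕ< (ℤ.n%ℕd<d z n)))
      (cancel (+ (z ℤ.%ℕ n)) ((z ℤ./ℕ n) ℤ.* + n)))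
      where
      cancel : ∀ r q → r ℤ.+ q ℤ.- r ≡ q
      cancel = solve-∀

    residue-cong : ∀ {x y} → + n ℤ.∣ x ℤ.- y → residue x ≡ residue y
    residue-cong {x} {y} d = Fin.toℕ-injective (residue-unique (Fin.toℕ<n (residue x)) (Fin.toℕ<n (residue y))
      (≡.subst (+ n ℤ.∣_) (rearrange x y (+ toℕ (residue x)) (+ toℕ (residue y)))
        (ℤ.∣m∣n⇒∣m+n (ℤ.∣m∣n⇒∣m-n d (residue-∣ x)) (residue-∣ y))))
      where
      rearrange : ∀ x y r s → (x ℤ.- y) ℤ.- (x ℤ.- r) ℤ.+ (y ℤ.- s) ≡ r ℤ.- s
      rearrange = solve-∀

    residue-injective : ∀ {x y} → residue x ≡ residue y → + n ℤ.∣ x ℤ.- y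
    residue-injective {x} {y} e = ≡.subst (+ n ℤ.∣_) (rearrange x y (+ toℕ (residue y)))
      (ℤ.∣m∣n⇒∣m-n (≡.subst (λ r → + n ℤ.∣ x ℤ.- + toℕ r) e (residue-∣ x)) (residue-∣ y))
      where
      rearrange : ∀ x y r → (x ℤ.- r) ℤ.- (y ℤ.- r) ≡ x ℤ.- y
      rearrange = solve-∀

    residue-toℕ : ∀ i → residue (+ toℕ i) ≡ i
    residue-toℕ i = Fin.toℕ-injective (≡.sym (residue-unique (Fin.toℕ<n i) (Fin.toℕ<n (residue (+ toℕ i))) (residue-∣ (+ toℕ i))))

  -- Finiteness and order

  module _ {S : Setoid 0ℓ 0ℓ} {n : ℕ} where
    open Setoid S

    mkFinite : (to : Carrier → Fin n) (from : Fin n → Carrier) → (∀ {x y} → x ≈ y → to x ≡ to y) →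
      (∀ i → to (from i) ≡ i) → (∀ x → from (to x) ≈ x) → Inverse S (≡.setoid (Fin n))
    mkFinite to from to-cong to-from from-to = record
      { to = to ; from = from ; to-cong = to-cong ; from-cong = λ { ≡.refl → refl }
      ; inverse = (λ {i} e → ≡.trans (to-cong e) (to-from i)) , (λ {x} e → ≡.subst (λ i → from i ≈ x) (≡.sym e) (from-to x))
      }

  ord : Type → ℕ
  ord L = product (map (λ (p , e) → p ℕ.^ e) L)

  finite-M : ∀ {L} → IsType L → Inverse (AbelianGroup.setoid (M L)) (≡.setoid (Fin (ord L)))
  finite-M [] = mkFinite (λ _ → zero) (λ _ → tt) (λ _ → ≡.refl) (λ { zero → ≡.refl }) (λ _ → tt)
  finite-M {(p , e) ∷ L} ((pr , _) ∷ t) = mkFinite {AbelianGroup.setoid (M ((p , e) ∷ L))}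
    (λ (z , x) → combine (residue n z) (R.to x))
    (λ i → let j , k = remQuot {n} (ord L) i in + toℕ j , R.from k)
    (λ {(x , _)} {(y , _)} (e , f) → ≡.cong₂ combine (residue-cong n {x} {y} e) (R.to-cong f))
    (λ i → ≡.trans (≡.cong₂ combine (residue-toℕ n _) (R.strictlyInverseˡ _)) (Fin.combine-remQuot {n} (ord L) i))
    (λ (z , x) → ≡.subst (λ jk → (+ toℕ (proj₁ jk) , R.from (proj₂ jk)) ≈ (z , x))
      (≡.sym (Fin.remQuot-combine (residue n z) (R.to x)))
      (AbelianGroup.sym (ℤ/ n) {z} {+ toℕ (residue n z)} (residue-∣ n z) , R.strictlyInverseʳ x))
    where
    n = p ℕ.^ e
    instance
      n≢0 : ℕ.NonZero n
      n≢0 = prime^-nonZero pr e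
    module R = Inverse (finite-M t)
    open AbelianGroup (M ((p , e) ∷ L)) using (_≈_)

  finiteM : ∀ {L} → IsType L → FiniteAbelianGroup
  finiteM {L} t = record { group = M L ; order = ord L ; finite = finite-M t }

  module Finite (G : FiniteAbelianGroup) where
    open Inverse (finite G) public using (to; from; to-cong; strictlyInverseˡ; strictlyInverseʳ)
    open AbelianGroup (group G)

    to-injective : ∀ {x y} → to x ≡ to y → x ≈ y
    to-injective {x} {y} e = trans (sym (strictlyInverseʳ x)) (trans (reflexive (≡.cong from e)) (strictlyInverseʳ y))

    _≟_ : Decidable _≈_
    x ≟ y = map′ to-injective to-cong (to x Fin.≟ to y)

  order-≤ : ∀ (G H : FiniteAbelianGroup) → group G ≅ group H → order G ℕ.≤ order H
  order-≤ G H i = Fin.injective⇒≤ {f = λ j → H′.to (⟦ I.to ⟧ (G′.from j))}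
    (λ {x} {y} e → ≡.trans (≡.sym (G′.strictlyInverseˡ x)) (≡.trans (G′.to-cong (I.injective (H′.to-injective e))) (G′.strictlyInverseˡ y)))
    where
    module G′ = Finite G
    module H′ = Finite H
    module I = Iso {group G} {group H} i

  order-unique : ∀ (G H : FiniteAbelianGroup) → group G ≅ group H → order G ≡ order H
  order-unique G H i = ℕ.≤-antisym (order-≤ G H i) (order-≤ H G (≅-sym {group G} {group H} i))

  1≤order : ∀ (G : FiniteAbelianGroup) → 1 ℕ.≤ order G
  1≤order G = ℕ.≤-trans ℕ.z<s (Fin.toℕ<n (Finite.to G (AbelianGroup.ε (group G))))

  module _ (G : FiniteAbelianGroup) where
    open Multiples (group G)
    open Generation (group G)
    open Finite G

    -- Two of the multiples 0g, ..., |G|g coincide by the pigeonhole principle, and their difference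
    -- is a positive multiple that vanishes.
    torsion : ∀ g → ∃ λ m → 1 ℕ.≤ m × (+ m) • g ≈ ε
    torsion g with Fin.pigeonhole (ℕ.n<1+n (order G)) (λ i → to (toℕ i ×ₙ g))
    ... | i , j , i<j , e = d , ℕ.m<n⇒0<n∸m i<j , (begin
      d ×ₙ g                                     ≈⟨ sym (identityʳ _) ⟩
      d ×ₙ g ∙ ε                                 ≈⟨ ∙-congˡ (sym (inverseʳ (toℕ i ×ₙ g))) ⟩
      d ×ₙ g ∙ (toℕ i ×ₙ g ∙ (toℕ i ×ₙ g) ⁻¹)    ≈⟨ sym (assoc _ _ _) ⟩
      d ×ₙ g ∙ toℕ i ×ₙ g ∙ (toℕ i ×ₙ g) ⁻¹      ≈⟨ ∙-congʳ (sym (×-homo-+ g d (toℕ i))) ⟩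
      (d ℕ.+ toℕ i) ×ₙ g ∙ (toℕ i ×ₙ g) ⁻¹       ≡⟨ ≡.cong (λ k → k ×ₙ g ∙ (toℕ i ×ₙ g) ⁻¹) (ℕ.m∸n+n≡m (ℕ.<⇒≤ i<j)) ⟩
      toℕ j ×ₙ g ∙ (toℕ i ×ₙ g) ⁻¹               ≈⟨ ∙-congʳ (sym (to-injective e)) ⟩
      toℕ i ×ₙ g ∙ (toℕ i ×ₙ g) ⁻¹               ≈⟨ inverseʳ _ ⟩
      ε                                          ∎)
      where
      open import Relation.Binary.Reasoning.Setoid setoid
      d = toℕ j ℕ.∸ toℕ i

    private
      collect : ∀ n (e : Fin n → Carrier) →
        ∃ λ gs → All Valid gs × ∀ i → Span (map proj₁ gs) (e i)
      collect zero    e = [] , [] , λ ()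
      collect (suc n) e =
        let m , 1≤m , me = torsion (e zero)
            gs , vs , s = torsion-split (group G) m 1≤m (e zero) me
            hs , ws , ss = collect n (λ i → e (suc i))
        in gs ++ hs , All.++⁺ vs ws , λ
          { zero    → ≡.subst (λ ks → Span ks (e zero)) (≡.sym (List.map-++ proj₁ gs hs)) (span-++ˡ (map proj₁ gs) (map proj₁ hs) s)
          ; (suc i) → ≡.subst (λ ks → Span ks (e (suc i))) (≡.sym (List.map-++ proj₁ gs hs)) (span-++ʳ (map proj₁ gs) (map proj₁ hs) (ss i))
          }

    abstract
      -- The initial generators are the parts of prime power order of all elements of G. The result
      -- is opaque: what follows relies on the two stated properties of the type and not on how it
      -- was found.
      finite-structure : ∃ λ L → IsType L × M L ≅ group G
      finite-structure =
        let gs , vs , s = collect (order G) from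
        in structure _ (group G) _≟_ gs vs ℕ.≤-refl (λ x → span-resp (map proj₁ gs) (strictlyInverseʳ x) (s (to x)))

  -- Direct sums

  M-++ : ∀ L L′ → M (L ++ L′) ≅ M L ⊕ M L′
  M-++ [] L′ = mk≅ {M L′} {M [] ⊕ M L′} (inj₂ʰ {M []}) proj₂ (λ (_ , y) → y , tt , AbelianGroup.refl (M L′))
  M-++ ((p , e) ∷ L) L′ = ≅-trans {C ⊕ M (L ++ L′)} {C ⊕ (M L ⊕ M L′)} {(C ⊕ M L) ⊕ M L′}
    (⊕-cong {C} {C} {M (L ++ L′)} {M L ⊕ M L′} (≅-refl {C}) (M-++ L L′))
    (≅-sym {(C ⊕ M L) ⊕ M L′} {C ⊕ (M L ⊕ M L′)} (⊕-assoc {C} {M L} {M L′}))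
    where C = ℤ/ (p ℕ.^ e)

  M-↭ : ∀ {L L′} → L ↭ L′ → M L ≅ M L′
  M-↭ {L} ↭.refl = ≅-refl {M L}
  M-↭ (↭.prep {L} {L′} (p , e) π) = ⊕-cong {C} {C} {M L} {M L′} (≅-refl {C}) (M-↭ π)
    where C = ℤ/ (p ℕ.^ e)
  M-↭ (↭.swap {L} {L′} (p , e) (q , f) π) =
    ≅-trans {C ⊕ (D ⊕ M L)} {(C ⊕ D) ⊕ M L} {D ⊕ (C ⊕ M L′)}
      (≅-sym {(C ⊕ D) ⊕ M L} {C ⊕ (D ⊕ M L)} (⊕-assoc {C} {D} {M L}))
      (≅-trans {(C ⊕ D) ⊕ M L} {(D ⊕ C) ⊕ M L′} {D ⊕ (C ⊕ M L′)}
        (⊕-cong {C ⊕ D} {D ⊕ C} {M L} {M L′} (⊕-comm {C} {D}) (M-↭ π))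
        (⊕-assoc {D} {C} {M L′}))
    where
    C = ℤ/ (p ℕ.^ e)
    D = ℤ/ (q ℕ.^ f)
  M-↭ (↭.trans {L} {L′} {L″} π ρ) = ≅-trans {M L} {M L′} {M L″} (M-↭ π) (M-↭ ρ)

  ord-↭ : ∀ {L L′} → L ↭ L′ → ord L ≡ ord L′
  ord-↭ π = product-↭ (↭.map⁺ (λ (p , e) → p ℕ.^ e) π)

-- Uniqueness of the type, by dimensions over ℤ/p.

module Invariants where
  open import Algebra.Properties.CommutativeSemigroup ℕ.+-commutativeSemigroup using () renaming (interchange to +-interchange)
  open import Defs using (⟨_⟩; gen; unit; mul; inv; resp)
  open import Data.Integer.Base using (+_)
  open import Data.Fin.Base using (zero; suc; combine; finToFun; funToFin)
  open import Data.List.Relation.Binary.Permutation.Propositional using (prep)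
  open import Data.List.Relation.Binary.Permutation.Propositional.Properties using (shift)
  open GroupBasics
  open Structure
  open Models
  open Hom

  -- Linear algebra modulo p

  dot : ∀ n → (Fin n → ℤ) → (Fin n → ℤ) → ℤ
  dot zero    c a = 0ℤ
  dot (suc n) c a = c zero ℤ.* a zero ℤ.+ dot n (c ∘ suc) (a ∘ suc)

  dot-minus : ∀ n b c a → dot n (λ i → b i ℤ.- c i) a ≡ dot n b a ℤ.- dot n c a
  dot-minus zero    b c a = ≡.refl
  dot-minus (suc n) b c a = ≡.trans
    (≡.cong (ℤ._+_ ((b zero ℤ.- c zero) ℤ.* a zero)) (dot-minus n (b ∘ suc) (c ∘ suc) (a ∘ suc)))
    (rearrange (b zero) (c zero) (a zero) (dot n (b ∘ suc) (a ∘ suc)) (dot n (c ∘ suc) (a ∘ suc)))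
    where
    rearrange : ∀ b c a s t → (b ℤ.- c) ℤ.* a ℤ.+ (s ℤ.- t) ≡ (b ℤ.* a ℤ.+ s) ℤ.- (c ℤ.* a ℤ.+ t)
    rearrange = solve-∀

  funToFin-cong : ∀ {m n} {f g : Fin m → Fin n} → (∀ i → f i ≡ g i) → funToFin f ≡ funToFin g
  funToFin-cong {zero}  e = ≡.refl
  funToFin-cong {suc m} e = ≡.cong₂ combine (e zero) (funToFin-cong (e ∘ suc))

  -- An n × d matrix whose rows are independent modulo p embeds (ℤ/p)ⁿ in (ℤ/p)ᵈ.
  independent⇒≤ : ∀ {p} → 1 ℕ.< p → ∀ n d (A : Fin n → Fin d → ℤ) →
    (∀ c → (∀ j → + p ℤ.∣ dot n c (λ i → A i j)) → ∀ i → + p ℤ.∣ c i) → n ℕ.≤ d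
  independent⇒≤ {p} 1<p n d A independent = ℕ.≮⇒≥ λ d<n →
    ℕ.<⇒≱ (ℕ.^-monoʳ-< p 1<p d<n) (Fin.injective⇒≤ {f = φ} φ-injective)
    where
    instance
      p≢0 : ℕ.NonZero p
      p≢0 = ℕ.>-nonZero (ℕ.<⇒≤ 1<p)
    coeffs : Fin (p ℕ.^ n) → Fin n → ℤ
    coeffs x i = + toℕ (finToFun {p} {n} x i)
    image : Fin (p ℕ.^ n) → Fin d → ℤ
    image x j = dot n (coeffs x) (λ i → A i j)
    φ : Fin (p ℕ.^ n) → Fin (p ℕ.^ d)
    φ x = funToFin (λ j → residue p (image x j))
    φ-injective : ∀ {x y} → φ x ≡ φ y → x ≡ y
    φ-injective {x} {y} e = ≡.trans (≡.sym (Fin.funToFin-finToFin {n} {p} x))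
      (≡.trans (funToFin-cong {n} {p} (λ i → Fin.toℕ-injective (residue-unique (Fin.toℕ<n _) (Fin.toℕ<n _) (difference i))))
               (Fin.funToFin-finToFin {n} {p} y))
      where
      same : ∀ j → residue p (image x j) ≡ residue p (image y j)
      same j = ≡.trans (≡.sym (Fin.finToFun-funToFin (λ j → residue p (image x j)) j))
        (≡.trans (≡.cong (λ z → finToFun {p} {d} z j) e) (Fin.finToFun-funToFin (λ j → residue p (image y j)) j))
      difference : ∀ i → + p ℤ.∣ coeffs x i ℤ.- coeffs y i
      difference = independent (λ i → coeffs x i ℤ.- coeffs y i) λ j →
        ≡.subst (+ p ℤ.∣_) (≡.sym (dot-minus n (coeffs x) (coeffs y) (λ i → A i j)))
          (residue-injective p {image x j} {image y j} (same j))

  module Linear (G : AbGroup) where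
    open Multiples G
    open import Relation.Binary.Reasoning.Setoid setoid

    lin : ∀ n → (Fin n → ℤ) → (Fin n → Carrier) → Carrier
    lin zero    c g = ε
    lin (suc n) c g = c zero • g zero ∙ lin n (c ∘ suc) (g ∘ suc)

    lin-congˡ : ∀ n {c c′} g → (∀ i → c i ≡ c′ i) → lin n c g ≈ lin n c′ g
    lin-congˡ zero    g e = refl
    lin-congˡ (suc n) g e = ∙-cong (•-congˡ {g = g zero} (e zero)) (lin-congˡ n (g ∘ suc) (e ∘ suc))

    lin-congʳ : ∀ n c {g g′} → (∀ i → g i ≈ g′ i) → lin n c g ≈ lin n c g′
    lin-congʳ zero    c e = refl
    lin-congʳ (suc n) c e = ∙-cong (•-congʳ (c zero) (e zero)) (lin-congʳ n (c ∘ suc) (e ∘ suc))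

    lin-∙ : ∀ n c g h → lin n c (λ i → g i ∙ h i) ≈ lin n c g ∙ lin n c h
    lin-∙ zero    c g h = sym (identityˡ ε)
    lin-∙ (suc n) c g h = trans (∙-cong (•-∙ (c zero) (g zero) (h zero)) (lin-∙ n (c ∘ suc) (g ∘ suc) (h ∘ suc)))
                                (interchange _ _ _ _)

    lin-+ : ∀ n b c g → lin n (λ i → b i ℤ.+ c i) g ≈ lin n b g ∙ lin n c g
    lin-+ zero    b c g = sym (identityˡ ε)
    lin-+ (suc n) b c g = trans (∙-cong (•-+ (b zero) (c zero) (g zero)) (lin-+ n (b ∘ suc) (c ∘ suc) (g ∘ suc)))
                                (interchange _ _ _ _)

    lin-• : ∀ n z c g → z • lin n c g ≈ lin n c (λ i → z • g i)
    lin-• zero    z c g = •-ε z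
    lin-• (suc n) z c g = trans (•-∙ z _ _) (∙-cong (•-comm z (c zero) (g zero)) (lin-• n z (c ∘ suc) (g ∘ suc)))

    lin-* : ∀ n z c g → lin n (λ i → z ℤ.* c i) g ≈ z • lin n c g
    lin-* zero    z c g = sym (•-ε z)
    lin-* (suc n) z c g = trans (∙-cong (•-* z (c zero) (g zero)) (lin-* n z (c ∘ suc) (g ∘ suc))) (sym (•-∙ z _ _))

    lin-ε : ∀ n c → lin n c (λ _ → ε) ≈ ε
    lin-ε zero    c = refl
    lin-ε (suc n) c = trans (∙-cong (•-ε (c zero)) (lin-ε n (c ∘ suc))) (identityˡ ε)

    lin-0 : ∀ n g → lin n (λ _ → 0ℤ) g ≈ ε
    lin-0 zero    g = refl
    lin-0 (suc n) g = trans (identityˡ _) (lin-0 n (g ∘ suc))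

    lin-lin : ∀ n d c (A : Fin n → Fin d → ℤ) u → lin n c (λ i → lin d (A i) u) ≈ lin d (λ j → dot n c (λ i → A i j)) u
    lin-lin zero    d c A u = sym (lin-0 d u)
    lin-lin (suc n) d c A u = trans
      (∙-cong (sym (lin-* d (c zero) (A zero) u)) (lin-lin n d (c ∘ suc) (A ∘ suc) u))
      (sym (lin-+ d (λ j → c zero ℤ.* A zero j) (λ j → dot n (c ∘ suc) (λ i → A (suc i) j)) u))

    lin-unit : ∀ n g (i : Fin n) → ∃ λ c → g i ≈ lin n c g
    lin-unit (suc n) g zero = (λ { zero → 1ℤ ; (suc _) → 0ℤ }) ,
      sym (trans (∙-cong (•-1 (g zero)) (lin-0 n (g ∘ suc))) (identityʳ _))
    lin-unit (suc n) g (suc i) with lin-unit n (g ∘ suc) i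
    ... | c , e = (λ { zero → 0ℤ ; (suc j) → c j }) , trans e (sym (identityˡ _))

  hom-lin : ∀ {G H} (f : Hom G H) n c g → let module H = Multiples H in
    ⟦ f ⟧ (Linear.lin G n c g) H.≈ Linear.lin H n c (⟦ f ⟧ ∘ g)
  hom-lin {H = H} f zero    c g = homo-ε f
  hom-lin {H = H} f (suc n) c g = H.trans (homo f _ _) (H.∙-cong (homo-• f (c zero) (g zero)) (hom-lin f n (c ∘ suc) (g ∘ suc)))
    where module H = Multiples H

  Kills : ℤ → AbGroup → Set
  Kills n G = ∀ x → n • x ≈ ε
    where open Multiples G

  cyclic-killed : ∀ n → Kills (+ n) (ℤ/ n)
  cyclic-killed n x = ≡.subst (_≈ 0ℤ) (≡.sym (•≡* n (+ n) x)) (ℤ/-≈ε (ℤ.∣m⇒∣m*n x ℤ.∣-refl))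
    where open Multiples (ℤ/ n)

  -- The dimension of pᵏG / pᵏ⁺¹G over ℤ/p, bounded below by independent families
  -- and above by spanning families.
  module Dimension (p : ℕ) (P P′ : ℤ) (P′≡ : P′ ≡ P ℤ.* + p) where

    module _ (G : AbGroup) where
      open Multiples G
      open Linear G

      Independent : ℕ → Set
      Independent n = ∃ λ (h : Fin n → Carrier) → ∀ c y → P • lin n c h ≈ P′ • y → ∀ i → + p ℤ.∣ c i

      Spanned : ℕ → Set
      Spanned d = ∃ λ (u : Fin d → Carrier) → ∀ x → ∃₂ λ c y → P • x ≈ P • lin d c u ∙ P′ • y

      private
        collapse : ∀ π → P′ ≡ P ℤ.* π → ∀ d t u → P • lin d (λ j → t j ℤ.* π) u ≈ P′ • lin d t u
        collapse π e d t u = begin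
          P • lin d (λ j → t j ℤ.* π) u   ≈⟨ •-congʳ P (trans (lin-congˡ d u (λ j → ℤ.*-comm (t j) π)) (lin-* d π t u)) ⟩
          P • π • lin d t u               ≈⟨ sym (•-* P π (lin d t u)) ⟩
          (P ℤ.* π) • lin d t u           ≡⟨ ≡.cong (_• lin d t u) e ⟨
          P′ • lin d t u                  ∎
          where open import Relation.Binary.Reasoning.Setoid setoid

      -- Expanding P hᵢ in the spanning family gives an n × d matrix. If a combination of its rows
      -- with coefficients c vanishes modulo p, then P ∑ cᵢ hᵢ lies in P′G, so p divides every cᵢ;
      -- hence the rows are independent.
      independent≤spanned : 1 ℕ.< p → ∀ {n d} → Independent n → Spanned d → n ℕ.≤ d
      independent≤spanned 1<p {n} {d} (h , indep) (u , span) = independent⇒≤ 1<p n d A λ c divides →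
        let t : Fin d → ℤ
            t j = ℤ.quotient (divides j)
        in indep c (lin d t u ∙ lin n c y) (begin
          P • lin n c h                                          ≈⟨ lin-• n P c h ⟩
          lin n c (λ i → P • h i)                                ≈⟨ lin-congʳ n c (λ i → proj₂ (proj₂ (span (h i)))) ⟩
          lin n c (λ i → P • lin d (A i) u ∙ P′ • y i)           ≈⟨ lin-∙ n c (λ i → P • lin d (A i) u) (λ i → P′ • y i) ⟩
          lin n c (λ i → P • lin d (A i) u) ∙ lin n c (λ i → P′ • y i)
            ≈⟨ ∙-cong (sym (lin-• n P c (λ i → lin d (A i) u))) (sym (lin-• n P′ c y)) ⟩
          P • lin n c (λ i → lin d (A i) u) ∙ P′ • lin n c y     ≈⟨ ∙-congʳ (•-congʳ P (lin-lin n d c A u)) ⟩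
          P • lin d (λ j → dot n c (λ i → A i j)) u ∙ P′ • lin n c y
            ≈⟨ ∙-congʳ (•-congʳ P (lin-congˡ d u (λ j → ℤ._∣_.equality (divides j)))) ⟩
          P • lin d (λ j → t j ℤ.* + p) u ∙ P′ • lin n c y       ≈⟨ ∙-congʳ (collapse (+ p) P′≡ d t u) ⟩
          P′ • lin d t u ∙ P′ • lin n c y                        ≈⟨ sym (•-∙ P′ (lin d t u) (lin n c y)) ⟩
          P′ • (lin d t u ∙ lin n c y)                           ∎)
        where
        open import Relation.Binary.Reasoning.Setoid setoid
        A : Fin n → Fin d → ℤ
        A i = proj₁ (span (h i))
        y : Fin n → Carrier
        y i = proj₁ (proj₂ (span (h i)))

    module _ {G H : AbGroup} (i : G ≅ H) where
      private
        module G = Multiples G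
        module H = Multiples H
        module I = Iso {G} {H} i

      independent-≅ : ∀ {n} → Independent G n → Independent H n
      independent-≅ {n} (h , indep) = ⟦ I.to ⟧ ∘ h , λ c y e → indep c (⟦ I.from ⟧ y) (I.injective
        (H.trans (homo-• I.to P _) (H.trans (H.•-congʳ P (hom-lin I.to n c h)) (H.trans e
          (H.sym (H.trans (homo-• I.to P′ _) (H.•-congʳ P′ (I.to-from y))))))))

    module _ (A G : AbGroup) where
      private
        module A = Multiples A
        module G = Multiples G
        module AG = Multiples (A ⊕ G)
        module LA = Linear A
        module LG = Linear G
        module LAG = Linear (A ⊕ G)
        π₁ : Hom (A ⊕ G) A
        π₁ = proj₁ʰ {A} {G}
        π₂ : Hom (A ⊕ G) G
        π₂ = proj₂ʰ {A} {G}

        π₁-lin : ∀ n z c (h : Fin n → AG.Carrier) → proj₁ (z AG.• LAG.lin n c h) A.≈ z A.• LA.lin n c (proj₁ ∘ h)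
        π₁-lin n z c h = A.trans (homo-• π₁ z _) (A.•-congʳ z (hom-lin π₁ n c h))

        π₂-lin : ∀ n z c (h : Fin n → AG.Carrier) → proj₂ (z AG.• LAG.lin n c h) G.≈ z G.• LG.lin n c (proj₂ ∘ h)
        π₂-lin n z c h = G.trans (homo-• π₂ z _) (G.•-congʳ z (hom-lin π₂ n c h))

      independent-skip : ∀ {n} → Independent G n → Independent (A ⊕ G) n
      independent-skip {n} (h , indep) = (λ i → A.ε , h i) , λ c (_ , y) (_ , e) →
        indep c y (G.trans (G.sym (π₂-lin n P c _)) (G.trans e (homo-• π₂ P′ _)))

      spanned-skip : (∀ x → ∃ λ y → P A.• x A.≈ P′ A.• y) → ∀ {d} → Spanned G d → Spanned (A ⊕ G) d
      spanned-skip dense {d} (u , span) = (λ j → A.ε , u j) , λ (a , g) →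
        let b , e = dense a
            c , y , f = span g
        in c , (b , y) ,
          (A.trans (homo-• π₁ P _) (A.trans e (A.sym (A.trans
             (A.∙-cong (A.trans (π₁-lin d P c _) (A.•-killed P (LA.lin-ε d c))) (homo-• π₁ P′ _)) (A.identityˡ _))))
          , G.trans (homo-• π₂ P _) (G.trans f (G.sym (G.∙-cong (π₂-lin d P c _) (homo-• π₂ P′ _)))))

      private
        extend : ∀ {n} → A.Carrier → (Fin n → G.Carrier) → Fin (suc n) → AG.Carrier
        extend b h zero    = b , G.ε
        extend b h (suc i) = A.ε , h i

        extend₁ : ∀ {n} b h (c : Fin (suc n) → ℤ) → LA.lin (suc n) c (proj₁ ∘ extend b h) A.≈ c zero A.• b
        extend₁ {n} b h c = A.trans (A.∙-congˡ (LA.lin-ε n (c ∘ suc))) (A.identityʳ _)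

        extend₂ : ∀ {n} b h (c : Fin (suc n) → ℤ) → LG.lin (suc n) c (proj₂ ∘ extend b h) G.≈ LG.lin n (c ∘ suc) h
        extend₂ b h c = G.trans (G.∙-congʳ (G.•-ε (c zero))) (G.identityˡ _)

      independent-add : ∀ b → (∀ z y → P A.• z A.• b A.≈ P′ A.• y → + p ℤ.∣ z) →
        ∀ {n} → Independent G n → Independent (A ⊕ G) (suc n)
      independent-add b indep-b {n} (h , indep) = extend b h , λ c (x , y) (e , f) → λ
        { zero    → indep-b (c zero) x (A.trans (A.sym (A.trans (π₁-lin (suc n) P c (extend b h)) (A.•-congʳ P (extend₁ b h c))))
                      (A.trans e (homo-• π₁ P′ _)))
        ; (suc i) → indep (c ∘ suc) y (G.trans (G.sym (G.trans (π₂-lin (suc n) P c (extend b h)) (G.•-congʳ P (extend₂ b h c))))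
                      (G.trans f (homo-• π₂ P′ _))) i
        }

      spanned-add : ∀ b → (∀ x → ∃ λ z → x A.≈ z A.• b) → ∀ {d} → Spanned G d → Spanned (A ⊕ G) (suc d)
      spanned-add b gen-b {d} (u , span) = extend b u , λ (a , g) →
        let z , e = gen-b a
            c , y , f = span g
            c′ = λ { zero → z ; (suc j) → c j }
        in c′ , (A.ε , y) ,
          (A.trans (homo-• π₁ P _) (A.trans (A.•-congʳ P e) (A.sym (A.trans
             (A.∙-cong (A.trans (π₁-lin (suc d) P c′ (extend b u)) (A.•-congʳ P (extend₁ b u c′)))
                       (A.trans (homo-• π₁ P′ _) (A.•-ε P′))) (A.identityʳ _))))
          , G.trans (homo-• π₂ P _) (G.trans f (G.sym (G.∙-cong
             (G.trans (π₂-lin (suc d) P c′ (extend b u)) (G.•-congʳ P (extend₂ b u c′))) (homo-• π₂ P′ _)))))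

    -- PA is contained in P′A, so a summand A adds nothing to the dimension.
    Dense : AbGroup → Set
    Dense A = ∀ x → ∃ λ y → P • x ≈ P′ • y
      where open Multiples A

    module _ (n : ℕ) where
      open Multiples (ℤ/ n)
      open import Relation.Binary.Reasoning.Setoid setoid

      -- Since P′ divides n, the congruence holds modulo P′ as well; hence P′ = P p divides P z, and
      -- P cancels.
      cyclic-independent : ∀ D → .{{_ : ℤ.NonZero P}} → + n ≡ D ℤ.* P′ → ∀ z y → P • z • 1ℤ ≈ P′ • y → + p ℤ.∣ z
      cyclic-independent D n≡ z y (ℤ.divides q f) = ℤ.*-cancelˡ-∣ P
        (≡.subst (ℤ._∣ P ℤ.* z) P′≡ (ℤ.divides (y ℤ.+ q ℤ.* D) (≡.trans
          (isolate (P ℤ.* z) (P′ ℤ.* y)) (≡.trans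
          (≡.cong (ℤ._+ P′ ℤ.* y) (≡.trans (≡.sym (≡.cong₂ ℤ._-_
               (≡.trans (•≡* n P (z • 1ℤ)) (≡.cong (ℤ._*_ P) (≡.trans (•≡* n z 1ℤ) (ℤ.*-identityʳ z)))) (•≡* n P′ y)))
             (≡.trans f (≡.cong (ℤ._*_ q) n≡)))) (collect q D P′ y)))))
        where
        isolate : ∀ a b → a ≡ a ℤ.- b ℤ.+ b
        isolate = solve-∀
        collect : ∀ q d p y → q ℤ.* (d ℤ.* p) ℤ.+ p ℤ.* y ≡ (y ℤ.+ q ℤ.* d) ℤ.* p
        collect = solve-∀

      cyclic-generated : ∀ x → ∃ λ z → x ≈ z • 1ℤ
      cyclic-generated x = x , reflexive (≡.sym (≡.trans (•≡* n x 1ℤ) (ℤ.*-identityʳ x)))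

    module _ (A : AbGroup) (n : ℤ) (killed : Kills n A) where
      open Multiples A
      open import Relation.Binary.Reasoning.Setoid setoid

      dense-multiple : ∀ c → P ≡ c ℤ.* n → Dense A
      dense-multiple c e x = ε , trans (trans (•-congˡ {g = x} e) (•-*-killed c n (killed x))) (sym (•-ε P′))

      -- Multiply s p + t n = 1 by P: the first term becomes P′ s, and the second kills A.
      dense-coprime : Bezout (+ p) n → Dense A
      dense-coprime (s , t , st) x = s • x , (begin
        P • x                                      ≡⟨ ≡.cong (_• x) (≡.trans (≡.sym (ℤ.*-identityʳ P)) (≡.trans (≡.cong (ℤ._*_ P) (≡.sym st))
                                                       (≡.trans (rearrange P s (+ p) t n) (≡.cong (λ a → a ℤ.* s ℤ.+ P ℤ.* t ℤ.* n) (≡.sym P′≡))))) ⟩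
        (P′ ℤ.* s ℤ.+ P ℤ.* t ℤ.* n) • x           ≈⟨ •-+ (P′ ℤ.* s) (P ℤ.* t ℤ.* n) x ⟩
        (P′ ℤ.* s) • x ∙ (P ℤ.* t ℤ.* n) • x       ≈⟨ ∙-cong (•-* P′ s x) (•-*-killed (P ℤ.* t) n (killed x)) ⟩
        P′ • s • x ∙ ε                             ≈⟨ identityʳ _ ⟩
        P′ • s • x                                 ∎)
        where
        rearrange : ∀ P s p t n → P ℤ.* (s ℤ.* p ℤ.+ t ℤ.* n) ≡ P ℤ.* p ℤ.* s ℤ.+ P ℤ.* t ℤ.* n
        rearrange = solve-∀

  module Rank (p k : ℕ) where

    P P′ : ℤ
    P  = + (p ℕ.^ k)
    P′ = + (p ℕ.^ suc k)

    P′≡ : P′ ≡ P ℤ.* + p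
    P′≡ = ≡.trans (ℤ.pos-* p (p ℕ.^ k)) (ℤ.*-comm (+ p) P)

    open Dimension p P P′ P′≡ public

    -- The summands ℤ/qᵉ that contribute one dimension to pᵏG / pᵏ⁺¹G; all others are `Dense`.
    InRank : ℕ × ℕ → Set
    InRank (q , e) = q ≡ p × k ℕ.< e

    inRank? : Unary.Decidable InRank
    inRank? (q , e) = q ℕ.≟ p ×-dec k ℕ.<? e

    rank : Type → ℕ
    rank L = length (filter inRank? L)

    module _ (pr : Prime p) where

      private
        power-∸ : ∀ {i j} → i ℕ.≤ j → + (p ℕ.^ j) ≡ + (p ℕ.^ (j ℕ.∸ i)) ℤ.* + (p ℕ.^ i)
        power-∸ {i} {j} i≤j = ≡.trans (≡.cong (λ l → + (p ℕ.^ l)) (≡.sym (ℕ.m∸n+n≡m i≤j))) (+-homo-^ p i (j ℕ.∸ i))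

        dense : ∀ {q e} → Prime q → ¬ InRank (q , e) → Dense (ℤ/ (q ℕ.^ e))
        dense {q} {e} pq out with q ℕ.≟ p
        ... | yes ≡.refl = dense-multiple (ℤ/ (q ℕ.^ e)) (+ (q ℕ.^ e)) (cyclic-killed (q ℕ.^ e)) (+ (p ℕ.^ (k ℕ.∸ e))) (power-∸ {e} {k} (ℕ.≮⇒≥ λ k<e → out (≡.refl , k<e)))
        ... | no q≢p = dense-coprime (ℤ/ (q ℕ.^ e)) (+ (q ℕ.^ e)) (cyclic-killed (q ℕ.^ e)) (≡.subst (λ x → Bezout (+ x) (+ (q ℕ.^ e))) (ℕ.*-identityʳ p) (prime-≢⇒Bezout pr pq (q≢p ∘ ≡.sym) 1 e))

      independent-M : ∀ {L} → IsType L → Independent (M L) (rank L)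
      independent-M [] = (λ ()) , λ _ _ _ ()
      independent-M {(q , e) ∷ L} ((pq , _) ∷ t) with inRank? (q , e)
      ... | yes in-rank@(≡.refl , k<e) = ≡.subst (Independent (M ((q , e) ∷ L))) (≡.cong length (≡.sym (List.filter-accept inRank? in-rank)))
              (independent-add (ℤ/ (q ℕ.^ e)) (M L) 1ℤ (cyclic-independent (q ℕ.^ e) (+ (p ℕ.^ (e ℕ.∸ suc k))) {{prime^-nonZero pr k}} (power-∸ {suc k} {e} k<e)) (independent-M t))
      ... | no out = ≡.subst (Independent (M ((q , e) ∷ L))) (≡.cong length (≡.sym (List.filter-reject inRank? out)))
              (independent-skip (ℤ/ (q ℕ.^ e)) (M L) (independent-M t))

      spanned-M : ∀ {L} → IsType L → Spanned (M L) (rank L)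
      spanned-M [] = (λ ()) , λ _ → (λ ()) , tt , tt
      spanned-M {(q , e) ∷ L} ((pq , _) ∷ t) with inRank? (q , e)
      ... | yes in-rank@(≡.refl , _) = ≡.subst (Spanned (M ((q , e) ∷ L))) (≡.cong length (≡.sym (List.filter-accept inRank? in-rank)))
              (spanned-add (ℤ/ (q ℕ.^ e)) (M L) 1ℤ (cyclic-generated (q ℕ.^ e)) (spanned-M t))
      ... | no out = ≡.subst (Spanned (M ((q , e) ∷ L))) (≡.cong length (≡.sym (List.filter-reject inRank? out)))
              (spanned-skip (ℤ/ (q ℕ.^ e)) (M L) (dense pq out) (spanned-M t))

      rank-≤ : ∀ {L L′} → IsType L → IsType L′ → M L ≅ M L′ → rank L ℕ.≤ rank L′
      rank-≤ {L} {L′} t t′ i = independent≤spanned (M L′) (1<prime pr)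
        (independent-≅ {M L} {M L′} i (independent-M t)) (spanned-M t′)

  -- The case k = 0, that is G/pG: generators of G span it, so its dimension bounds the number of
  -- generators from below.
  generated⇒spanned : ∀ p G {d} → GeneratedBy G d → Rank.Spanned p 0 G d
  generated⇒spanned p G {d} (gens , generate) = gens , λ x → let c , e = combination (generate x) in
    c , ε , trans (•-congʳ 1ℤ e) (sym (trans (∙-congˡ (•-ε (Rank.P′ p 0))) (identityʳ _)))
    where
    open Multiples G
    open Linear G
    combination : ∀ {x} → ⟨ G ⟩ gens x → ∃ λ c → x ≈ lin d c gens
    combination (gen i) = lin-unit d gens i
    combination unit = (λ _ → 0ℤ) , sym (lin-0 d gens)
    combination (mul s t) = let b , e = combination s ; c , f = combination t in
      (λ i → b i ℤ.+ c i) , trans (∙-cong e f) (sym (lin-+ d b c gens))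
    combination (inv s) = let c , e = combination s in
      (λ i → ℤ.-1ℤ ℤ.* c i) , trans (⁻¹-cong e) (sym (trans (lin-* d ℤ.-1ℤ c gens) (⁻¹-cong (•-1 (lin d c gens)))))
    combination (resp x≈y s) = let c , e = combination s in c , trans (sym x≈y) e

  indicator : ∀ {A : Set} → Dec A → ℕ
  indicator (yes _) = 1
  indicator (no _)  = 0

  length-filter-∷ : ∀ {A : Set} {P : A → Set} (P? : Unary.Decidable P) x xs →
    length (filter P? (x ∷ xs)) ≡ indicator (P? x) ℕ.+ length (filter P? xs)
  length-filter-∷ P? x xs with P? x
  ... | yes _ = ≡.refl
  ... | no _  = ≡.refl

  -- A type is determined, up to order, by its ranks.

  module _ where
    private
      _≟_ = Product.≡-dec ℕ._≟_ ℕ._≟_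

      count : ℕ × ℕ → Type → ℕ
      count x L = length (filter (_≟ x) L)

    private
      indicators : ∀ p k x (a : Dec (x ≡ (p , suc k))) (b : Dec (Rank.InRank p (suc k) x)) (c : Dec (Rank.InRank p k x)) →
        indicator a ℕ.+ indicator b ≡ indicator c
      indicators p k x (yes ≡.refl) (yes (_ , k<k)) c = contradiction k<k (ℕ.<-irrefl ≡.refl)
      indicators p k x (yes ≡.refl) (no _) (yes _) = ≡.refl
      indicators p k x (yes ≡.refl) (no _) (no ¬r) = contradiction (≡.refl , ℕ.n<1+n k) ¬r
      indicators p k x (no _) (yes _) (yes _) = ≡.refl
      indicators p k x (no _) (yes (≡.refl , k<e)) (no ¬r) = contradiction (≡.refl , ℕ.<⇒≤ k<e) ¬r
      indicators p k x (no ≢) (no ¬r) (yes (≡.refl , k<e)) =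
        contradiction (≡.cong (p ,_) (ℕ.≤-antisym (ℕ.≮⇒≥ λ k<e → ¬r (≡.refl , k<e)) k<e)) ≢
      indicators p k x (no _) (no _) (no _) = ≡.refl

    -- An exponent exceeds k without exceeding k + 1 only if it equals k + 1; multiplicities are
    -- thereby differences of invariants.
    count-rank : ∀ p k L → count (p , suc k) L ℕ.+ Rank.rank p (suc k) L ≡ Rank.rank p k L
    count-rank p k [] = ≡.refl
    count-rank p k (x ∷ L) = begin
      count (p , suc k) (x ∷ L) ℕ.+ Rank.rank p (suc k) (x ∷ L)
        ≡⟨ ≡.cong₂ ℕ._+_ (length-filter-∷ (_≟ (p , suc k)) x L) (length-filter-∷ (Rank.inRank? p (suc k)) x L) ⟩
      (a ℕ.+ count (p , suc k) L) ℕ.+ (b ℕ.+ Rank.rank p (suc k) L)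
        ≡⟨ +-interchange a (count (p , suc k) L) b (Rank.rank p (suc k) L) ⟩
      (a ℕ.+ b) ℕ.+ (count (p , suc k) L ℕ.+ Rank.rank p (suc k) L)
        ≡⟨ ≡.cong₂ ℕ._+_ (indicators p k x (x ≟ (p , suc k)) (Rank.inRank? p (suc k) x) (Rank.inRank? p k x)) (count-rank p k L) ⟩
      indicator (Rank.inRank? p k x) ℕ.+ Rank.rank p k L
        ≡⟨ length-filter-∷ (Rank.inRank? p k) x L ⟨
      Rank.rank p k (x ∷ L) ∎
      where
      open ≡.≡-Reasoning
      a = indicator (x ≟ (p , suc k))
      b = indicator (Rank.inRank? p (suc k) x)

    count⇒∈ : ∀ x L → 1 ℕ.≤ count x L → x ∈ L
    count⇒∈ x (y ∷ L) le = decide (y ≟ x) (≡.subst (1 ℕ.≤_) (length-filter-∷ (_≟ x) y L) le)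
      where
      decide : (d : Dec (y ≡ x)) → 1 ℕ.≤ indicator d ℕ.+ count x L → x ∈ y ∷ L
      decide (yes ≡.refl) _  = here ≡.refl
      decide (no _)       le = there (count⇒∈ x L le)

    count⇒↭ : ∀ {L L′} → IsType L → IsType L′ → (∀ p k → Prime p → count (p , suc k) L ≡ count (p , suc k) L′) → L ↭ L′
    count⇒↭ {[]} {[]} _ _ _ = ↭-refl
    count⇒↭ {[]} {(p , zero) ∷ L′} _ ((_ , ()) ∷ _) _
    count⇒↭ {[]} {(p , suc k) ∷ L′} _ ((pr , _) ∷ _) same =
      contradiction (≡.trans (same p k pr) (≡.cong length (List.filter-accept (_≟ (p , suc k)) {p , suc k} {L′} ≡.refl))) λ ()
    count⇒↭ {(p , zero) ∷ L} ((_ , ()) ∷ _) _ _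
    count⇒↭ {(p , suc k) ∷ L} {L′} ((pr , _) ∷ t) t′ same with ∈-∃++ (count⇒∈ (p , suc k) L′
        (≡.subst (1 ℕ.≤_) (≡.trans (≡.cong length (≡.sym (List.filter-accept (_≟ (p , suc k)) {p , suc k} {L} ≡.refl))) (same p k pr)) ℕ.z<s))
    ... | as , bs , ≡.refl = ↭-trans (prep (p , suc k) (count⇒↭ t (All.tail (All-resp-↭ π t′)) rest)) (↭-sym π)
      where
      open Data.List.Base using (_++_)
      π : as ++ (p , suc k) ∷ bs ↭ (p , suc k) ∷ as ++ bs
      π = shift (p , suc k) as bs
      rest : ∀ q j → Prime q → count (q , suc j) L ≡ count (q , suc j) (as ++ bs)
      rest q j prq = cancel (≡.trans (same q j prq) (↭-length (filter-↭ (_≟ (q , suc j)) π)))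
        where
        cancel : count (q , suc j) ((p , suc k) ∷ L) ≡ count (q , suc j) ((p , suc k) ∷ as ++ bs) →
                 count (q , suc j) L ≡ count (q , suc j) (as ++ bs)
        cancel e = ℕ.+-cancelˡ-≡ (indicator ((p , suc k) ≟ (q , suc j))) _ _
          (≡.trans (≡.sym (length-filter-∷ (_≟ (q , suc j)) (p , suc k) L)) (≡.trans e (length-filter-∷ (_≟ (q , suc j)) (p , suc k) (as ++ bs))))

    type-unique : ∀ {L L′} → IsType L → IsType L′ → M L ≅ M L′ → L ↭ L′
    type-unique {L} {L′} t t′ i = count⇒↭ t t′ λ p k pr → ℕ.+-cancelʳ-≡ (Rank.rank p (suc k) L) _ _
      (≡.trans (count-rank p k L) (≡.trans (ranks k pr) (≡.trans (≡.sym (count-rank p k L′)) (≡.cong (ℕ._+_ (count (p , suc k) L′)) (≡.sym (ranks (suc k) pr))))))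
      where
      ranks : ∀ {p} k → Prime p → Rank.rank p k L ≡ Rank.rank p k L′
      ranks {p} k pr = ℕ.≤-antisym (Rank.rank-≤ p k pr t t′ i) (Rank.rank-≤ p k pr t′ t (≅-sym {M L} {M L′} i))

-- Conjugate groups: the bound on the rank as a bound on exponents.

module Conjugate where
  open import Data.List.Relation.Unary.Linked using ([]; [-]; _∷_)
  open import Data.List.Sort ℕ.≤-decTotalOrder using (sort; sort-↭; sort-↗)
  open import Defs using (⟨_⟩; gen; unit; mul; inv; resp)
  open import Data.Integer.Base using (+_; -[1+_])
  open import Data.Fin.Base using (zero; suc)
  open import Data.List.Relation.Binary.Permutation.Propositional.Properties using (map⁺)
  open GroupBasics
  open Structure
  open StructureTheorem using (killed-≤)
  open Models
  open Invariants
  open Hom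

  -- The p-primary component of a sum of cyclic groups

  exponents : ℕ → Type → List ℕ
  exponents p [] = []
  exponents p ((q , e) ∷ L) with q ℕ.≟ p
  ... | yes _ = e ∷ exponents p L
  ... | no _  = exponents p L

  homogeneous : ℕ → List ℕ → Type
  homogeneous p = map (p ,_)

  homogeneous-M : ∀ p a → M (homogeneous p a) ≡ ⨁ (map (λ e → ℤ/ (p ℕ.^ e)) a)
  homogeneous-M p a = ≡.cong ⨁ (≡.sym (List.map-∘ a))

  Torsion : ℕ → (G : AbGroup) → AbelianGroup.Carrier G → Set
  Torsion p G x = ∃ λ k → (+ (p ℕ.^ k)) • x ≈ ε
    where open Multiples G

  module _ (G H : AbGroup) where
    private
      module G = Multiples G
      module H = Multiples H
      module GH = Multiples (G ⊕ H)
      π₁ : Hom (G ⊕ H) G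
      π₁ = proj₁ʰ {G} {H}
      π₂ : Hom (G ⊕ H) H
      π₂ = proj₂ʰ {G} {H}

    ⊕-killed : ∀ z {x y} → z G.• x G.≈ G.ε → z H.• y H.≈ H.ε → z GH.• (x , y) GH.≈ GH.ε
    ⊕-killed z {x} {y} e f = G.trans (homo-• π₁ z (x , y)) e , H.trans (homo-• π₂ z (x , y)) f

    killed₁ : ∀ z {x y} → z GH.• (x , y) GH.≈ GH.ε → z G.• x G.≈ G.ε
    killed₁ z {x} {y} (e , _) = G.trans (G.sym (homo-• π₁ z (x , y))) e

    killed₂ : ∀ z {x y} → z GH.• (x , y) GH.≈ GH.ε → z H.• y H.≈ H.ε
    killed₂ z {x} {y} (_ , f) = H.trans (H.sym (homo-• π₂ z (x , y))) f

  ⊕-torsion : ∀ p G H {x y} → Torsion p G x → Torsion p H y → Torsion p (G ⊕ H) (x , y)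
  ⊕-torsion p G H (k , e) (l , f) = k ℕ.+ l ,
    ⊕-killed G H (+ (p ℕ.^ (k ℕ.+ l))) (killed-≤ G (ℕ.m≤m+n k l) e) (killed-≤ H (ℕ.m≤n+m l k) f)

  hom-torsion : ∀ {p G H} (f : Hom G H) {x} → Torsion p G x → Torsion p H (⟦ f ⟧ x)
  hom-torsion {p} {G} {H} f {x} (k , e) = k , H.trans (H.sym (homo-• f (+ (p ℕ.^ k)) x)) (H.trans (cong f e) (homo-ε f))
    where module H = Multiples H

  coprime-killed : ∀ G {m n x} → let open Multiples G in Bezout m n → m • x ≈ ε → n • x ≈ ε → x ≈ ε
  coprime-killed G {m} {n} {x} (s , t , st) e f = begin
    x                              ≈⟨ sym (•-1 x) ⟩
    1ℤ • x                         ≡⟨ ≡.cong (_• x) st ⟨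
    (s ℤ.* m ℤ.+ t ℤ.* n) • x      ≈⟨ •-+ (s ℤ.* m) (t ℤ.* n) x ⟩
    (s ℤ.* m) • x ∙ (t ℤ.* n) • x  ≈⟨ ∙-cong (•-*-killed s m e) (•-*-killed t n f) ⟩
    ε ∙ ε                          ≈⟨ identityˡ ε ⟩
    ε                              ∎
    where
    open Multiples G
    open import Relation.Binary.Reasoning.Setoid setoid

  module _ {p : ℕ} (pr : Prime p) where

    -- It says that `restrict` maps the p-torsion of G isomorphically onto H. Stated for elements of
    -- G together with their torsion, it can be proved summand by summand.
    record PrimarySplit (G H : AbGroup) : Set where
      private
        module G = AbelianGroup G
        module H = AbelianGroup H
      field
        restrict   : Hom G H
        surjective : ∀ y → ∃ λ x → Torsion p G x × ⟦ restrict ⟧ x H.≈ y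
        kernel     : ∀ {x} → Torsion p G x → ⟦ restrict ⟧ x H.≈ H.ε → x G.≈ G.ε

    open PrimarySplit

    primary-split : ∀ {L} → IsType L → PrimarySplit (M L) (M (homogeneous p (exponents p L)))
    primary-split [] = record
      { restrict = idHom {M []} ; surjective = λ _ → tt , (0 , tt) , tt ; kernel = λ _ _ → tt }
    primary-split {(q , e) ∷ L} ((pq , _) ∷ t) with q ℕ.≟ p
    ... | yes ≡.refl = record
      { restrict = record
        { ⟦_⟧  = λ (a , x) → a , ⟦ restrict S ⟧ x
        ; cong = λ (f , g) → f , cong (restrict S) g
        ; homo = λ (a , x) (b , y) → C.refl {a ℤ.+ b} , homo (restrict S) x y
        }
      ; surjective = λ (a , y) → let x , τ , f = surjective S y in
          (a , x) , ⊕-torsion p (ℤ/ (p ℕ.^ e)) (M L) (e , cyclic-killed (p ℕ.^ e) a) τ , C.refl {a} , f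
      ; kernel = λ τ (f , g) → f , kernel S (hom-torsion (proj₂ʰ {ℤ/ (p ℕ.^ e)} {M L}) τ) g
      }
      where
      S = primary-split t
      module C = Multiples (ℤ/ (q ℕ.^ e))
    ... | no q≢p = record
      { restrict = restrict S ∘ʰ proj₂ʰ {ℤ/ (q ℕ.^ e)} {M L}
      ; surjective = λ y → let x , τ , f = surjective S y in
          (0ℤ , x) , ⊕-torsion p (ℤ/ (q ℕ.^ e)) (M L) (0 , C.identityʳ 0ℤ) τ , f
      ; kernel = λ {(a , x)} τ g →
          (let k , f = hom-torsion (proj₁ʰ {ℤ/ (q ℕ.^ e)} {M L}) τ in
           coprime-killed (ℤ/ (q ℕ.^ e)) (prime-≢⇒Bezout pr pq (q≢p ∘ ≡.sym) k e) f (cyclic-killed (q ℕ.^ e) a)) ,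
          kernel S (hom-torsion (proj₂ʰ {ℤ/ (q ℕ.^ e)} {M L}) τ) g
      }
      where
      S = primary-split t
      module C = Multiples (ℤ/ (q ℕ.^ e))

    include : ∀ G → Hom (primaryComponent p G) G
    include G = record { ⟦_⟧ = proj₁ ; cong = λ e → e ; homo = λ _ _ → AbelianGroup.refl G }

    split⇒≅ : ∀ {G H} → PrimarySplit G H → primaryComponent p G ≅ H
    split⇒≅ {G} {H} S = mk≅ {primaryComponent p G} {H} (restrict S ∘ʰ include G)
      (λ {(_ , τ)} e → kernel S τ e)
      (λ y → let x , τ , e = surjective S y in (x , τ) , e)

    primary-M : ∀ {L} → IsType L → primaryComponent p (M L) ≅ ⨁ (map (λ e → ℤ/ (p ℕ.^ e)) (sort (exponents p L)))
    primary-M {L} t = ≡.subst (primaryComponent p (M L) ≅_) (homogeneous-M p (sort (exponents p L)))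
      (≅-trans {primaryComponent p (M L)} {M (homogeneous p (exponents p L))} {M (homogeneous p (sort (exponents p L)))}
        (split⇒≅ (primary-split t))
        (M-↭ (map⁺ (p ,_) (↭-sym (sort-↭ (exponents p L))))))

  -- Transposed partitions

  maximum : List ℕ → ℕ
  maximum = foldr ℕ._⊔_ 0

  ≤-maximum : ∀ {e a} → e ∈ a → e ℕ.≤ maximum a
  ≤-maximum (here ≡.refl) = ℕ.m≤m⊔n _ _
  ≤-maximum (there {x = x} e∈a) = ℕ.≤-trans (≤-maximum e∈a) (ℕ.m≤n⊔m x _)

  maximum-≤ : ∀ {r a} → All (ℕ._≤ r) a → maximum a ℕ.≤ r
  maximum-≤ []        = ℕ.z≤n
  maximum-≤ (le ∷ les) = ℕ.⊔-lub le (maximum-≤ les)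

  private
    above : List ℕ → ℕ → ℕ
    above a j = length (filter (suc j ℕ.≤?_) a)

  above-antitone : ∀ a j → above a (suc j) ℕ.≤ above a j
  above-antitone [] j = ℕ.z≤n
  above-antitone (x ∷ a) j = ≡.subst₂ ℕ._≤_
    (≡.sym (length-filter-∷ (suc (suc j) ℕ.≤?_) x a)) (≡.sym (length-filter-∷ (suc j ℕ.≤?_) x a))
    (ℕ.+-mono-≤ (mono (suc (suc j) ℕ.≤? x) (suc j ℕ.≤? x)) (above-antitone a j))
    where
    mono : (d : Dec (suc j ℕ.< x)) (d′ : Dec (j ℕ.< x)) → indicator d ℕ.≤ indicator d′
    mono (yes _)   (yes _)  = ℕ.≤-refl
    mono (yes j<x) (no j≮x) = contradiction (ℕ.<⇒≤ j<x) j≮x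
    mono (no _)    _        = ℕ.z≤n

  above-positive : ∀ a j → j ℕ.< maximum a → 1 ℕ.≤ above a j
  above-positive (x ∷ a) j j<max = ≡.subst (1 ℕ.≤_) (≡.sym (length-filter-∷ (suc j ℕ.≤?_) x a)) (decide (suc j ℕ.≤? x))
    where
    decide : (d : Dec (j ℕ.< x)) → 1 ℕ.≤ indicator d ℕ.+ above a j
    decide (yes _)  = ℕ.z<s
    decide (no j≮x) with ℕ.⊔-sel x (maximum a)
    ... | inj₁ e = contradiction (≡.subst (j ℕ.<_) e j<max) j≮x
    ... | inj₂ e = above-positive a j (≡.subst (j ℕ.<_) e j<max)

  transpose-partition : ∀ a → IsPartition (transpose a)
  transpose-partition a = go (maximum a)
    where
    go : ∀ n → IsPartition (map (above a) (downFrom n))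
    go 0 = []
    go 1 = [-]
    go (suc (suc n)) = above-antitone a n ∷ go (suc n)

  transpose-positive : ∀ a → All (1 ℕ.≤_) (transpose a)
  transpose-positive a = go (maximum a) ℕ.≤-refl
    where
    go : ∀ n → n ℕ.≤ maximum a → All (1 ℕ.≤_) (map (above a) (downFrom n))
    go zero    _ = []
    go (suc n) n<max = above-positive a n n<max ∷ go n (ℕ.<⇒≤ n<max)

  -- The bridge between the two conditions: the number of cyclic summands in the p-part of the
  -- conjugate is the largest exponent of p in the group.
  length-transpose : ∀ a → length (transpose a) ≡ maximum a
  length-transpose a = ≡.trans (List.length-map (above a) (downFrom (maximum a))) (List.length-downFrom (maximum a))

  -- Generating sets

  ⟨⟩-map : ∀ {G H d} (f : Hom G H) {gens : Fin d → AbelianGroup.Carrier G} {x} →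
    ⟨ G ⟩ gens x → ⟨ H ⟩ (⟦ f ⟧ ∘ gens) (⟦ f ⟧ x)
  ⟨⟩-map f (gen i) = gen i
  ⟨⟩-map {H = H} f unit = resp (AbelianGroup.sym H (homo-ε f)) unit
  ⟨⟩-map {H = H} f (mul s t) = resp (AbelianGroup.sym H (homo f _ _)) (mul (⟨⟩-map f s) (⟨⟩-map f t))
  ⟨⟩-map {H = H} f (inv s) = resp (AbelianGroup.sym H (homo-⁻¹ f _)) (inv (⟨⟩-map f s))
  ⟨⟩-map f (resp e s) = resp (cong f e) (⟨⟩-map f s)

  Surjective : ∀ {G H} → Hom G H → Set
  Surjective {G} {H} f = ∀ y → ∃ λ x → AbelianGroup._≈_ H (⟦ f ⟧ x) y

  generatedBy-map : ∀ {G H d} (f : Hom G H) → Surjective f → GeneratedBy G d → GeneratedBy H d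
  generatedBy-map f surj (gens , g) = ⟦ f ⟧ ∘ gens , λ y → let x , e = surj y in resp e (⟨⟩-map f (g x))

  generatedBy-≅ : ∀ {G H d} → G ≅ H → GeneratedBy G d → GeneratedBy H d
  generatedBy-≅ {G} {H} i = generatedBy-map {G} {H} I.to (λ y → I.from-fun y , I.to-from y)
    where module I = Iso {G} {H} i

  module _ (G : AbGroup) {d : ℕ} {gens : Fin d → AbelianGroup.Carrier G} where
    open Multiples G

    ⟨⟩-× : ∀ n {x} → ⟨ G ⟩ gens x → ⟨ G ⟩ gens (n ×ₙ x)
    ⟨⟩-× zero    s = unit
    ⟨⟩-× (suc n) s = mul s (⟨⟩-× n s)

    ⟨⟩-• : ∀ z {x} → ⟨ G ⟩ gens x → ⟨ G ⟩ gens (z • x)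
    ⟨⟩-• (+ n)      s = ⟨⟩-× n s
    ⟨⟩-• (-[1+ n ]) s = inv (⟨⟩-× (suc n) s)

  ⊕-kills : ∀ {m n G H} → Kills m G → Kills n H → Kills (m ℤ.* n) (G ⊕ H)
  ⊕-kills {m} {n} {G} {H} kG kH (x , y) = ⊕-killed G H (m ℤ.* n)
    (G.trans (G.•-congˡ {g = x} (ℤ.*-comm m n)) (G.•-*-killed n m (kG x))) (H.•-*-killed m n (kH y))
    where
    module G = Multiples G
    module H = Multiples H

  -- For coprime exponents the pairs of generators generate the direct sum.
  generatedBy-⊕ : ∀ {G H m n d} → Bezout m n → Kills m G → Kills n H →
    GeneratedBy G d → GeneratedBy H d → GeneratedBy (G ⊕ H) d
  generatedBy-⊕ {G} {H} {m} {n} {d} (s , t , st) kG kH (g , generateG) (h , generateH) = gens , λ (x , y) →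
    resp (G.identityʳ x , H.identityˡ y) (mul (left (generateG x)) (right (generateH y)))
    where
    module G = Multiples G
    module H = Multiples H
    GH = G ⊕ H
    module GH = Multiples GH
    gens : Fin d → GH.Carrier
    gens i = g i , h i
    keep : ∀ K a b {k} → let open Multiples K in a ℤ.+ b ≡ 1ℤ → b • k ≈ ε → a • k ≈ k
    keep K a b {k} e f = trans (sym (identityʳ (a • k))) (trans (∙-congˡ (sym f)) (trans (sym (•-+ a b k)) (trans (•-congˡ {g = k} e) (•-1 k))))
      where open Multiples K
    left : ∀ {x} → ⟨ G ⟩ g x → ⟨ GH ⟩ gens (x , H.ε)
    -- t n annihilates H and acts on G as 1 - s m, that is as the identity; so it sends the pair to
    -- its first component.
    left (gen i) = resp
      ( G.trans (homo-• (proj₁ʰ {G} {H}) (t ℤ.* n) (gens i)) (keep G (t ℤ.* n) (s ℤ.* m) {g i} (≡.trans (ℤ.+-comm (t ℤ.* n) (s ℤ.* m)) st) (G.•-*-killed s m (kG (g i))))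
      , H.trans (homo-• (proj₂ʰ {G} {H}) (t ℤ.* n) (gens i)) (H.•-*-killed t n (kH (h i))))
      (⟨⟩-• GH (t ℤ.* n) (gen i))
    left unit = unit
    left (mul a b) = resp (G.refl , H.identityʳ H.ε) (mul (left a) (left b))
    left (inv a) = resp (G.refl , H.ε⁻¹≈ε) (inv (left a))
    left (resp e a) = resp (e , H.refl) (left a)
    right : ∀ {y} → ⟨ H ⟩ h y → ⟨ GH ⟩ gens (G.ε , y)
    right (gen i) = resp
      ( G.trans (homo-• (proj₁ʰ {G} {H}) (s ℤ.* m) (gens i)) (G.•-*-killed s m (kG (g i)))
      , H.trans (homo-• (proj₂ʰ {G} {H}) (s ℤ.* m) (gens i)) (keep H (s ℤ.* m) (t ℤ.* n) {h i} st (H.•-*-killed t n (kH (h i)))))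
      (⟨⟩-• GH (s ℤ.* m) (gen i))
    right unit = unit
    right (mul a b) = resp (G.identityʳ G.ε , H.refl) (mul (right a) (right b))
    right (inv a) = resp (G.ε⁻¹≈ε , H.refl) (inv (right a))
    right (resp e a) = resp (G.refl , e) (right a)

  generatedBy-cyclic : ∀ {C G r} b → (let open Multiples C) → (∀ x → ∃ λ z → z • b ≈ x) →
    GeneratedBy G r → GeneratedBy (C ⊕ G) (suc r)
  generatedBy-cyclic {C} {G} {r} b cyclic (gs , generate) = gens , λ (a , x) → let z , e = cyclic a in resp
      ( C.trans (C.identityʳ _) (C.trans (homo-• (proj₁ʰ {C} {G}) z (b , G.ε)) e)
      , G.trans (G.∙-congʳ (G.trans (homo-• (proj₂ʰ {C} {G}) z (b , G.ε)) (G.•-ε z))) (G.identityˡ x))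
      (mul (⟨⟩-• (C ⊕ G) z (gen zero)) (shift (generate x)))
    where
    module C = Multiples C
    module G = Multiples G
    gens : Fin (suc r) → AbelianGroup.Carrier (C ⊕ G)
    gens zero    = b , G.ε
    gens (suc i) = C.ε , gs i
    shift : ∀ {x} → ⟨ G ⟩ gs x → ⟨ C ⊕ G ⟩ gens (C.ε , x)
    shift (gen i) = gen (suc i)
    shift unit = unit
    shift (mul a b) = resp (C.identityʳ C.ε , G.refl) (mul (shift a) (shift b))
    shift (inv a) = resp (C.ε⁻¹≈ε , G.refl) (inv (shift a))
    shift (resp e a) = resp (C.refl , e) (shift a)

  generatedBy-M : ∀ L {r} → length L ℕ.≤ r → GeneratedBy (M L) r
  generatedBy-M [] _ = (λ _ → tt) , λ _ → unit
  generatedBy-M ((p , e) ∷ L) {suc r} (ℕ.s≤s le) = generatedBy-cyclic {ℤ/ (p ℕ.^ e)} {M L} 1ℤ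
    (λ x → x , AbelianGroup.reflexive (ℤ/ (p ℕ.^ e)) (≡.trans (•≡* (p ℕ.^ e) x 1ℤ) (ℤ.*-identityʳ x)))
    (generatedBy-M L le)

  homogeneous-killed : ∀ p a → ∃ λ k → Kills (+ (p ℕ.^ k)) (M (homogeneous p a))
  homogeneous-killed p [] = 0 , λ _ → tt
  homogeneous-killed p (e ∷ a) with homogeneous-killed p a
  ... | k , kills = e ℕ.+ k , ≡.subst (λ n → Kills n (M (homogeneous p (e ∷ a)))) (≡.sym (+-homo-^ p k e))
    (⊕-kills {+ (p ℕ.^ e)} {+ (p ℕ.^ k)} {ℤ/ (p ℕ.^ e)} {M (homogeneous p a)} (cyclic-killed (p ℕ.^ e)) kills)

  generatedBy-homogeneous-sum : ∀ (B : ℕ → List ℕ) {r} → (∀ p → length (B p) ℕ.≤ r) → ∀ {ps} → All Prime ps → Unique ps →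
    GeneratedBy (⨁ (map (λ p → M (homogeneous p (B p))) ps)) r
  generatedBy-homogeneous-sum B {r} le prs uniq = proj₁ (go prs uniq)
    where
    S : List ℕ → AbGroup
    S ps = ⨁ (map (λ p → M (homogeneous p (B p))) ps)
    -- The induction also carries an annihilator n of the sum that is coprime to the powers of every
    -- prime outside the list, as `generatedBy-⊕` needs for the next prime.
    go : ∀ {ps} → All Prime ps → Unique ps → GeneratedBy (S ps) r ×
      ∃ λ n → Kills n (S ps) × (∀ {q} k → Prime q → All (q ≢_) ps → Bezout (+ (q ℕ.^ k)) n)
    go [] [] = ((λ _ → tt) , λ _ → unit) , 1ℤ , (λ _ → tt) , λ _ _ _ → Bezout-sym (Bezout-1 _)
    go {p ∷ ps} (pr ∷ prs) (p∉ps ∷ uniq) =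
      let g , n , kills , coprime = go prs uniq
          k , kills′ = homogeneous-killed p (B p)
      in generatedBy-⊕ {A} {S ps} (coprime k pr p∉ps) kills′ kills
           (generatedBy-M (homogeneous p (B p)) (≡.subst (ℕ._≤ r) (≡.sym (List.length-map (p ,_) (B p))) (le p))) g ,
         + (p ℕ.^ k) ℤ.* n , ⊕-kills {+ (p ℕ.^ k)} {n} {A} {S ps} kills′ kills ,
         λ { {q} j prq (q≢p ∷ q∉ps) → Bezout-sym (Bezout-* (Bezout-sym (prime-≢⇒Bezout prq pr q≢p j k)) (Bezout-sym (coprime j prq q∉ps))) }
      where A = M (homogeneous p (B p))

  -- The condition on the conjugate bounds the exponents

  ∈-primeDivisors : ∀ {p n} → 1 ℕ.≤ n → Prime p → p ℕ.∣ n → p ∈ primeDivisors n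
  ∈-primeDivisors {p} {n} 1≤n pr p∣n = ∈-filter⁺ (λ p → prime? p ×-dec (p ℕ.∣? n))
    (∈-upTo⁺ (ℕ.s≤s (ℕ.∣⇒≤ {{ℕ.>-nonZero 1≤n}} p∣n))) (pr , p∣n)

  primeDivisors-prime : ∀ n → All Prime (primeDivisors n)
  primeDivisors-prime n = All.map proj₁ (All.all-filter (λ p → prime? p ×-dec (p ℕ.∣? n)) (upTo (suc n)))

  primeDivisors-unique : ∀ n → Unique (primeDivisors n)
  primeDivisors-unique n = Unique.filter⁺ (λ p → prime? p ×-dec (p ℕ.∣? n)) (Unique.upTo⁺ (suc n))

  -- `HasRank` demands the minimal number of generators, but only some number of generators is known
  -- and generation is not decided. Up to double negation a least number exists by strong induction.
  least : ∀ {ℓ} (P : ℕ → Set ℓ) n → P n → ¬ ¬ (∃ λ d → d ℕ.≤ n × P d × (∀ e → P e → d ℕ.≤ e))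
  least P = <-rec _ λ n ih Pn k → k (n , ℕ.≤-refl , Pn , λ e Pe → ℕ.≮⇒≥ λ e<n →
    ih e<n Pe λ (d , d≤e , rest) → k (d , ℕ.≤-trans d≤e (ℕ.<⇒≤ e<n) , rest))

  exponents-≤ : ∀ p {L r} → All (λ (_ , e) → e ℕ.≤ r) L → All (ℕ._≤ r) (exponents p L)
  exponents-≤ p [] = []
  exponents-≤ p {(q , e) ∷ L} (le ∷ les) with q ℕ.≟ p
  ... | yes _ = le ∷ exponents-≤ p les
  ... | no _  = exponents-≤ p les

  -- The p-part of the conjugate has as many parts as the largest exponent of p, hence at most r
  -- generators, and the parts for different primes can share theirs.
  bounded⇒conjugateRank : ∀ {r L} (t : IsType L) → All (λ (_ , e) → e ℕ.≤ r) L → ¬ ¬ ConjugateRank≤ r (finiteM t)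
  bounded⇒conjugateRank {r} {L} t le k = least (GeneratedBy G′) r generated λ (d , d≤r , g , minimal) →
    k (G′ , (Q , All.map conjugate (primeDivisors-prime (ord L)) , ≅-refl {G′}) , d , (g , minimal) , d≤r)
    where
    parts : ℕ → List ℕ
    parts p = sort (exponents p L)
    Q : ℕ → AbGroup
    Q p = ⨁ (map (λ e → ℤ/ (p ℕ.^ e)) (transpose (parts p)))
    G′ : AbGroup
    G′ = ⨁ (map Q (primeDivisors (ord L)))
    conjugate : ∀ {p} → Prime p → IsConjugateₚ p (primaryComponent p (M L)) (Q p)
    conjugate {p} pr = parts p , (sort-↗ (exponents p L) , primary-M pr t) , (transpose-partition (parts p) , ≅-refl {Q p})
    short : ∀ p → length (transpose (parts p)) ℕ.≤ r
    short p = ≡.subst (ℕ._≤ r) (≡.sym (length-transpose (parts p)))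
      (maximum-≤ (All-resp-↭ (↭-sym (sort-↭ (exponents p L))) (exponents-≤ p le)))
    generated : GeneratedBy G′ r
    generated = ≡.subst (λ Gs → GeneratedBy (⨁ Gs) r) (List.map-cong (λ p → homogeneous-M p (transpose (parts p))) (primeDivisors (ord L)))
      (generatedBy-homogeneous-sum (transpose ∘ parts) short (primeDivisors-prime (ord L)) (primeDivisors-unique (ord L)))

  element-of-order : ∀ {p e L} → IsType L → (p , e) ∈ L → let open Multiples (M L) in
    ∃ λ x → (+ (p ℕ.^ e)) • x ≈ ε × (∀ j → (+ (p ℕ.^ j)) • x ≈ ε → e ℕ.≤ j)
  element-of-order {p} {e} {_ ∷ L} ((pr , _) ∷ t) (here ≡.refl) = (1ℤ , L.ε) ,
    ⊕-killed C (M L) (+ n) (cyclic-killed n 1ℤ) (L.•-ε (+ n)) ,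
    λ j f → ℕ.≮⇒≥ λ j<e → ℕ.<⇒≱ (ℕ.^-monoʳ-< p (1<prime pr) j<e)
      (ℕ.∣⇒≤ {{prime^-nonZero pr j}} (ℤ.∣⇒∣ᵤ (≡.subst (+ n ℤ.∣_) (≡.trans (•≡* n (+ (p ℕ.^ j)) 1ℤ) (ℤ.*-identityʳ (+ (p ℕ.^ j))))
        (ℤ/-∣ {n} (killed₁ C (M L) (+ (p ℕ.^ j)) {1ℤ} {L.ε} f)))))
    where
    n = p ℕ.^ e
    C = ℤ/ n
    module L = Multiples (M L)
  element-of-order {p} {e} {(q , f) ∷ L} (_ ∷ t) (there i) with element-of-order t i
  ... | x , killed , exact = (0ℤ , x) ,
    ⊕-killed C (M L) (+ (p ℕ.^ e)) (Multiples.•-ε C (+ (p ℕ.^ e))) killed ,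
    λ j g → exact j (killed₂ C (M L) (+ (p ℕ.^ j)) {0ℤ} {x} g)
    where
    C = ℤ/ (q ℕ.^ f)

  maximum-kills : ∀ p {a m} → All (ℕ._≤ m) a → Kills (+ (p ℕ.^ m)) (⨁ (map (λ e → ℤ/ (p ℕ.^ e)) a))
  maximum-kills p [] _ = tt
  maximum-kills p {e ∷ a} {m} (le ∷ les) (x , y) =
    ⊕-killed (ℤ/ (p ℕ.^ e)) (⨁ (map (λ e → ℤ/ (p ℕ.^ e)) a)) (+ (p ℕ.^ m))
      (killed-≤ (ℤ/ (p ℕ.^ e)) {p} {x} le (cyclic-killed (p ℕ.^ e) x)) (maximum-kills p les y)

  project-⨁ : ∀ (Q : ℕ → AbGroup) {p ps} → p ∈ ps → ∃ λ (f : Hom (⨁ (map Q ps)) (Q p)) → Surjective f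
  project-⨁ Q {p} {_ ∷ ps} (here ≡.refl) = proj₁ʰ {Q p} {⨁ (map Q ps)} ,
    λ y → (y , AbelianGroup.ε (⨁ (map Q ps))) , AbelianGroup.refl (Q p)
  project-⨁ Q {p} {q ∷ ps} (there i) with project-⨁ Q i
  ... | f , surj = f ∘ʰ proj₂ʰ {Q q} {⨁ (map Q ps)} , λ y → let x , e = surj y in (AbelianGroup.ε (Q q) , x) , e

  rank-homogeneous : ∀ p {b} → All (1 ℕ.≤_) b → Rank.rank p 0 (homogeneous p b) ≡ length b
  rank-homogeneous p {b} pos = ≡.trans
    (≡.cong length (List.filter-all (Rank.inRank? p 0) (All.map⁺ (All.map (λ 1≤e → ≡.refl , 1≤e) pos))))
    (List.length-map (p ,_) b)

  -- Each positive part adds one dimension to the group modulo p, and d generators span at most d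
  -- dimensions.
  homogeneous-length : ∀ {p b d} → Prime p → All (1 ℕ.≤_) b → GeneratedBy (⨁ (map (λ e → ℤ/ (p ℕ.^ e)) b)) d → length b ℕ.≤ d
  homogeneous-length {p} {b} {d} pr pos g = ≡.subst (ℕ._≤ d) (rank-homogeneous p pos)
    (Rank.independent≤spanned p 0 (M (homogeneous p b)) (1<prime pr)
      (Rank.independent-M p 0 pr (All.map⁺ (All.map (pr ,_) pos)))
      (generated⇒spanned p (M (homogeneous p b)) (≡.subst (λ G → GeneratedBy G d) (≡.sym (homogeneous-M p b)) g)))

  ∈⇒∣ord : ∀ {p e L} → 1 ℕ.≤ e → (p , e) ∈ L → p ℕ.∣ ord L
  ∈⇒∣ord {p} {suc e} _ i = ℕ.∣-trans (ℕ.m∣m*n (p ℕ.^ e)) (∈⇒∣product (∈-map⁺ (λ (p , e) → p ℕ.^ e) i))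

  primary-killed : ∀ {p X G A} → Prime p → X ≅ G → primaryComponent p G ≅ A → ∀ n → Kills n A →
    ∀ {x} → Torsion p X x → let open Multiples X in n • x ≈ ε
  primary-killed {p} {X} {G} {A} pr i j n kills {x} τ = I.kernel (G.trans (homo-• I.to n x)
    (G.trans (G.sym (homo-• (include pr G) n y)) (J.kernel (A.trans (homo-• J.to n y) (kills (⟦ J.to ⟧ y))))))
    where
    module G = Multiples G
    module A = Multiples A
    module I = Iso {X} {G} i
    module J = Iso {primaryComponent p G} {A} j
    y : AbelianGroup.Carrier (primaryComponent p G)
    y = ⟦ I.to ⟧ x , hom-torsion I.to τ

  -- The p-part of the conjugate has `maximum a` parts, so `maximum a` ≤ d ≤ r. On the other side p
  -- to the power `maximum a` kills the p-primary component, in which a summand ℤ/pᵉ supplies an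
  -- element of order pᵉ. Thus the given partition `a` need not be matched with L.
  conjugateRank⇒bounded : ∀ {r L} (G : FiniteAbelianGroup) → IsType L → M L ≅ group G →
    ConjugateRank≤ r G → All (λ (_ , e) → e ℕ.≤ r) L
  conjugateRank⇒bounded {r} {L} G t i (G′ , (Q , conjugates , j) , d , (g , _) , d≤r) = All.tabulate λ {(p , e)} → bound p e
    where
    ps : List ℕ
    ps = primeDivisors (order G)
    bound : ∀ p e → (p , e) ∈ L → e ℕ.≤ r
    bound p e in-L = from-conjugate (All.lookup conjugates p∈)
      where
      pr : Prime p
      pr = proj₁ (All.lookup t in-L)
      p∈ : p ∈ ps
      p∈ = ∈-primeDivisors (1≤order G) pr
        (≡.subst (p ℕ.∣_) (order-unique (finiteM t) G i) (∈⇒∣ord (proj₂ (All.lookup t in-L)) in-L))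
      generated : GeneratedBy (Q p) d
      generated = let f , surj = project-⨁ Q p∈ in
        generatedBy-map {⨁ (map Q ps)} {Q p} f surj (generatedBy-≅ {G′} {⨁ (map Q ps)} j g)
      from-conjugate : IsConjugateₚ p (primaryComponent p (group G)) (Q p) → e ℕ.≤ r
      from-conjugate (a , (_ , primary≅) , (_ , Q≅)) =
        let x , killed , exact = element-of-order t in-L
        in ℕ.≤-trans (exact (maximum a) (primary-killed {p} {M L} {group G} {A} pr i primary≅ (+ (p ℕ.^ maximum a))
             (maximum-kills p {a} (All.tabulate ≤-maximum)) (e , killed)))
           (ℕ.≤-trans (≡.subst (ℕ._≤ d) (length-transpose a)
             (homogeneous-length pr (transpose-positive a) (generatedBy-≅ {Q p} {A′} Q≅ generated))) d≤r)
        where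
        A A′ : AbGroup
        A  = ⨁ (map (λ e → ℤ/ (p ℕ.^ e)) a)
        A′ = ⨁ (map (λ e → ℤ/ (p ℕ.^ e)) (transpose a))

-- Counting tuples of coprime pairs.

module Counting where
  open import Data.Rational.Base as ℚ using (ℚ; 0ℚ)
  open ≡ hiding ([_])
  open import Data.Nat.Base using (_*_; _^_; _≤_)
  open import Data.List.Base using ([_])
  open Rationals using (fromℕ; fromℕ-+)
  open Harmonic
  open Asymptotics

  unique-↭ : ∀ {A : Set} {xs ys : List A} → Unique xs → Unique ys →
    (∀ {x} → x ∈ xs → x ∈ ys) → (∀ {x} → x ∈ ys → x ∈ xs) → xs ↭ ys
  unique-↭ xs! ys! to from = ∼bag⇒↭ (unique∧set⇒bag xs! ys! (mk⇔ to from))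

  module _ {A : Set} where

    module _ {B : Set} (f : A → B) where

      map-unique : ∀ {xs} → (∀ {x y} → x ∈ xs → y ∈ xs → f x ≡ f y → x ≡ y) → Unique xs → Unique (map f xs)
      map-unique {[]} inj [] = []
      map-unique {x ∷ xs} inj (x∉xs ∷ xs!) =
        All.map⁺ (All.tabulate λ y∈xs e → All.lookup x∉xs y∈xs (inj (here refl) (there y∈xs) e)) ∷
        map-unique (λ x∈ y∈ → inj (there x∈) (there y∈)) xs!

      bijection-length : ∀ {xs ys} → Unique xs → Unique ys →
        (∀ {x y} → x ∈ xs → y ∈ xs → f x ≡ f y → x ≡ y) →
        (∀ {x} → x ∈ xs → f x ∈ ys) → (∀ {y} → y ∈ ys → ∃ λ x → x ∈ xs × y ≡ f x) →
        length xs ≡ length ys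
      bijection-length {xs} {ys} xs! ys! inj to from = trans (sym (List.length-map f xs))
        (↭-length (unique-↭ (map-unique inj xs!) ys!
          (λ y∈ → let x , x∈ , e = ∈-map⁻ f y∈ in subst (_∈ ys) (sym e) (to x∈))
          (λ y∈ → let x , x∈ , e = from y∈ in subst (_∈ map f xs) (sym e) (∈-map⁺ f x∈))))

    module _ {B : Set} where

      pairs : List A → (A → List B) → List (A × B)
      pairs []       F = []
      pairs (x ∷ xs) F = map (x ,_) (F x) ++ pairs xs F

      ∈-pairs⁺ : ∀ {xs} F {a b} → a ∈ xs → b ∈ F a → (a , b) ∈ pairs xs F
      ∈-pairs⁺ F (here refl) b∈ = ∈-++⁺ˡ (∈-map⁺ (_ ,_) b∈)
      ∈-pairs⁺ {x ∷ xs} F (there a∈) b∈ = ∈-++⁺ʳ (map (x ,_) (F x)) (∈-pairs⁺ F a∈ b∈)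

      ∈-pairs⁻ : ∀ xs F {a b} → (a , b) ∈ pairs xs F → a ∈ xs × b ∈ F a
      ∈-pairs⁻ (x ∷ xs) F ab∈ with ∈-++⁻ (map (x ,_) (F x)) ab∈
      ... | inj₂ ab∈′ = let a∈ , b∈ = ∈-pairs⁻ xs F ab∈′ in there a∈ , b∈
      ... | inj₁ ab∈′ with ∈-map⁻ (x ,_) ab∈′
      ...   | _ , b∈ , refl = here refl , b∈

      pairs-unique : ∀ {xs F} → Unique xs → (∀ a → Unique (F a)) → Unique (pairs xs F)
      pairs-unique {[]} [] F! = []
      pairs-unique {x ∷ xs} {F} (x∉xs ∷ xs!) F! = Unique.++⁺ (Unique.map⁺ (cong proj₂) (F! x)) (pairs-unique xs! F!)
        λ (p∈ , q∈) → disjoint p∈ q∈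
        where
        disjoint : ∀ {p} → p ∈ map (x ,_) (F x) → p ∈ pairs xs F → _
        disjoint p∈ q∈ with ∈-map⁻ (x ,_) p∈
        ... | _ , _ , refl = All.lookup x∉xs (proj₁ (∈-pairs⁻ xs F q∈)) refl

      length-pairs : ∀ xs F → length (pairs xs F) ≡ sum (map (length ∘ F) xs)
      length-pairs [] F = refl
      length-pairs (x ∷ xs) F = trans (List.length-++ (map (x ,_) (F x)))
        (cong₂ ℕ._+_ (List.length-map (x ,_) (F x)) (length-pairs xs F))

  range : ℕ → List ℕ
  range zero    = []
  range (suc n) = range n ++ [ suc n ]

  ∈-range⁺ : ∀ {k n} → 1 ≤ k → k ≤ n → k ∈ range n
  ∈-range⁺ {k} {zero} 1≤k k≤0 = contradiction (ℕ.≤-trans 1≤k k≤0) λ ()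
  ∈-range⁺ {k} {suc n} 1≤k k≤n with ℕ.m≤n⇒m<n∨m≡n k≤n
  ... | inj₁ k<n = ∈-++⁺ˡ (∈-range⁺ 1≤k (ℕ.s≤s⁻¹ k<n))
  ... | inj₂ refl = ∈-++⁺ʳ (range n) (here refl)

  ∈-range⁻ : ∀ {k} n → k ∈ range n → 1 ≤ k × k ≤ n
  ∈-range⁻ (suc n) k∈ with ∈-++⁻ (range n) k∈
  ... | inj₁ k∈′ = let 1≤k , k≤n = ∈-range⁻ n k∈′ in 1≤k , ℕ.m≤n⇒m≤1+n k≤n
  ... | inj₂ (here refl) = ℕ.z<s , ℕ.≤-refl

  range-unique : ∀ n → Unique (range n)
  range-unique zero    = []
  range-unique (suc n) = Unique.++⁺ (range-unique n) ([] ∷ []) λ { (k∈ , here refl) → ℕ.<-irrefl refl (proj₂ (∈-range⁻ n k∈)) }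

  fromℕ-sum-range : ∀ n h → fromℕ (sum (map h (range n))) ≡ ∑ n (fromℕ ∘ h)
  fromℕ-sum-range zero    h = refl
  fromℕ-sum-range (suc n) h = begin
    fromℕ (sum (map h (range n ++ [ suc n ])))              ≡⟨ cong (fromℕ ∘ sum) (List.map-++ h (range n) [ suc n ]) ⟩
    fromℕ (sum (map h (range n) ++ [ h (suc n) ]))          ≡⟨ cong fromℕ (sum-++ (map h (range n)) [ h (suc n) ]) ⟩
    fromℕ (sum (map h (range n)) ℕ.+ (h (suc n) ℕ.+ 0))     ≡⟨ cong (λ x → fromℕ (sum (map h (range n)) ℕ.+ x)) (ℕ.+-identityʳ (h (suc n))) ⟩
    fromℕ (sum (map h (range n)) ℕ.+ h (suc n))             ≡⟨ fromℕ-+ (sum (map h (range n))) (h (suc n)) ⟩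
    fromℕ (sum (map h (range n))) ℚ.+ fromℕ (h (suc n))     ≡⟨ cong (ℚ._+ fromℕ (h (suc n))) (fromℕ-sum-range n h) ⟩
    ∑ n (fromℕ ∘ h) ℚ.+ fromℕ (h (suc n))                   ∎
    where open ≡-Reasoning

  *-^ : ∀ k m n → (m * n) ^ k ≡ m ^ k * n ^ k
  *-^ zero    m n = refl
  *-^ (suc k) m n = trans (cong (m * n *_) (*-^ k m n)) (ℕ.[m*n]*[o*p]≡[m*o]*[n*p] m n (m ^ k) (n ^ k))

  *≤⇒≤quot : ∀ m {n q} → 1 ≤ q → q * m ≤ n → m ≤ quot n q
  *≤⇒≤quot m {n} {suc q} _ le = subst (_≤ quot n (suc q)) (trans (cong (ℕ._/ suc q) (ℕ.*-comm (suc q) m)) (ℕ.m*n/n≡m m (suc q)))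
    (ℕ./-monoˡ-≤ (suc q) le)

  ≤quot⇒*≤ : ∀ m {n} q → m ≤ quot n q → q * m ≤ n
  ≤quot⇒*≤ m {n} q le = ℕ.≤-trans (ℕ.≤-trans (ℕ.*-monoʳ-≤ q le) (ℕ.≤-reflexive (ℕ.*-comm q (quot n q)))) (quot-≤ n q)

  -- Tuples of coprime pairs, the first of which has the largest exponent

  Good : ∀ {r} → Vec (ℕ × ℕ) r → Set
  Good = VAll.All λ (d , e) → 1 ≤ d × 1 ≤ e × Coprime d e

  weight₂ : ∀ {r} → Vec (ℕ × ℕ) r → ℕ
  weight₂ [] = 1
  weight₂ {suc r} ((d , e) ∷ t) = (d * e) ^ suc r * weight₂ t

  1≤weight₂ : ∀ {r} {t : Vec (ℕ × ℕ) r} → Good t → 1 ≤ weight₂ t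
  1≤weight₂ VAll.[] = ℕ.≤-refl
  1≤weight₂ {suc r} ((1≤d , 1≤e , _) VAll.∷ g) = ℕ.*-mono-≤ (1≤^ (suc r) (ℕ.*-mono-≤ 1≤d 1≤e)) (1≤weight₂ g)

  coprimePairs : ℕ → List (ℕ × ℕ)
  coprimePairs n = filter (uncurry coprime?) (cartesianProduct (range n) (range n))

  tuples : ∀ r → ℕ → List (Vec (ℕ × ℕ) r)
  -- The empty tuple has weight 1, so it counts for n ≥ 1 only. This gives `T r 0` = 0, as the
  -- inversion of `Op` requires.
  tuples zero    zero    = []
  tuples zero    (suc _) = [ [] ]
  tuples (suc r) n = map (uncurry _∷_) (pairs (coprimePairs n) λ (d , e) → tuples r (quot n ((d * e) ^ suc r)))

  tuples-unique : ∀ r n → Unique (tuples r n)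
  tuples-unique zero    zero    = []
  tuples-unique zero    (suc _) = [] ∷ []
  tuples-unique (suc r) n = Unique.map⁺ (λ { refl → refl })
    (pairs-unique (Unique.filter⁺ (uncurry coprime?) (Unique.cartesianProduct⁺ (range-unique n) (range-unique n)))
                  (λ (d , e) → tuples-unique r (quot n ((d * e) ^ suc r))))

  m≤m^[1+r] : ∀ {m} r → 1 ≤ m → m ≤ m ^ suc r
  m≤m^[1+r] {m} r 1≤m = ℕ.m≤m*n m (m ^ r) {{ℕ.>-nonZero (1≤^ r 1≤m)}}

  ∈-tuples⁺ : ∀ {r n} {t : Vec (ℕ × ℕ) r} → Good t → weight₂ t ≤ n → t ∈ tuples r n
  ∈-tuples⁺ {n = suc n} VAll.[] _ = here refl
  ∈-tuples⁺ {suc r} {n} {(d , e) ∷ t} ((1≤d , 1≤e , c) VAll.∷ g) le = ∈-map⁺ (uncurry _∷_) (∈-pairs⁺ _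
    (∈-filter⁺ (uncurry coprime?) (∈-cartesianProduct⁺ (∈-range⁺ 1≤d (ℕ.≤-trans (ℕ.m≤m*n d e {{ℕ.>-nonZero 1≤e}}) de≤n))
                                                       (∈-range⁺ 1≤e (ℕ.≤-trans (ℕ.m≤n*m e d {{ℕ.>-nonZero 1≤d}}) de≤n))) c)
    (∈-tuples⁺ g (*≤⇒≤quot (weight₂ t) (1≤^ (suc r) 1≤de) le)))
    where
    1≤de : 1 ≤ d * e
    1≤de = ℕ.*-mono-≤ 1≤d 1≤e
    de≤n : d * e ≤ n
    de≤n = ℕ.≤-trans (m≤m^[1+r] r 1≤de) (ℕ.≤-trans (ℕ.m≤m*n ((d * e) ^ suc r) (weight₂ t) {{ℕ.>-nonZero (1≤weight₂ g)}}) le)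

  ∈-tuples⁻ : ∀ r n {t : Vec (ℕ × ℕ) r} → t ∈ tuples r n → Good t × weight₂ t ≤ n
  ∈-tuples⁻ zero (suc n) {[]} _ = VAll.[] , ℕ.z<s
  ∈-tuples⁻ (suc r) n t∈ with ∈-map⁻ (uncurry _∷_) t∈
  ... | ((d , e) , t) , p∈ , refl =
    let de∈ , t∈′ = ∈-pairs⁻ (coprimePairs n) _ p∈
        de∈′ , c = ∈-filter⁻ (uncurry coprime?) de∈
        d∈ , e∈ = ∈-cartesianProduct⁻ (range n) (range n) de∈′
        g , le = ∈-tuples⁻ r _ t∈′
    in (proj₁ (∈-range⁻ n d∈) , proj₁ (∈-range⁻ n e∈) , c) VAll.∷ g , ≤quot⇒*≤ (weight₂ t) ((d * e) ^ suc r) le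

  -- Writing a pair as (g d, g e) with d and e coprime turns the double sum over all
  -- pairs into a sum over g of the sum over coprime pairs.
  module Squares (r n : ℕ) where
    i : ℕ
    i = suc r

    coprimeList : List (ℕ × Vec (ℕ × ℕ) i)
    coprimeList = pairs (range n) λ g → tuples i (quot n (g ^ (i ℕ.+ i)))

    pairList : List (ℕ × (ℕ × Vec (ℕ × ℕ) r))
    pairList = pairs (range n) λ a → pairs (range (quot n (a ^ i))) λ b → tuples r (quot (quot n (a ^ i)) (b ^ i))

    φ : ℕ × Vec (ℕ × ℕ) i → ℕ × (ℕ × Vec (ℕ × ℕ) r)
    φ (g , (d , e) ∷ t) = g * d , g * e , t

    weights : ∀ g d e w → g ^ (i ℕ.+ i) * ((d * e) ^ i * w) ≡ (g * d) ^ i * ((g * e) ^ i * w)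
    weights g d e w = begin
      g ^ (i ℕ.+ i) * ((d * e) ^ i * w)            ≡⟨ cong₂ (λ x y → x * (y * w)) (ℕ.^-distribˡ-+-* g i i) (*-^ i d e) ⟩
      (g ^ i * g ^ i) * ((d ^ i * e ^ i) * w)      ≡⟨ solve 4 (λ g d e w → (g :* g) :* ((d :* e) :* w) := (g :* d) :* ((g :* e) :* w)) refl (g ^ i) (d ^ i) (e ^ i) w ⟩
      (g ^ i * d ^ i) * ((g ^ i * e ^ i) * w)      ≡⟨ cong₂ (λ x y → x * (y * w)) (*-^ i g d) (*-^ i g e) ⟨
      (g * d) ^ i * ((g * e) ^ i * w)              ∎
      where
      open ≡-Reasoning
      open +-*-Solver

    ∈-coprimeList⁻ : ∀ {g d e t} → (g , (d , e) ∷ t) ∈ coprimeList →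
      1 ≤ g × Good ((d , e) ∷ t) × (g * d) ^ i * ((g * e) ^ i * weight₂ t) ≤ n
    ∈-coprimeList⁻ {g} {d} {e} {t} p∈ =
      let g∈ , t∈ = ∈-pairs⁻ (range n) _ p∈
          good , le = ∈-tuples⁻ i _ t∈
      in proj₁ (∈-range⁻ n g∈) , good ,
         subst (_≤ n) (weights g d e (weight₂ t)) (≤quot⇒*≤ (weight₂ ((d , e) ∷ t)) (g ^ (i ℕ.+ i)) le)

    ∈-coprimeList⁺ : ∀ {g d e t} → 1 ≤ g → Good ((d , e) ∷ t) → (g * d) ^ i * ((g * e) ^ i * weight₂ t) ≤ n →
      (g , (d , e) ∷ t) ∈ coprimeList
    ∈-coprimeList⁺ {g} {d} {e} {t} 1≤g good le = ∈-pairs⁺ _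
      (∈-range⁺ 1≤g (ℕ.≤-trans (m≤m^[1+r] (r ℕ.+ i) 1≤g) (ℕ.≤-trans (ℕ.m≤m*n (g ^ (i ℕ.+ i)) _ {{ℕ.>-nonZero (1≤weight₂ good)}}) le′)))
      (∈-tuples⁺ good (*≤⇒≤quot (weight₂ ((d , e) ∷ t)) (1≤^ (i ℕ.+ i) 1≤g) le′))
      where
      le′ : g ^ (i ℕ.+ i) * weight₂ ((d , e) ∷ t) ≤ n
      le′ = subst (_≤ n) (sym (weights g d e (weight₂ t))) le

    ∈-pairList⁻ : ∀ {a b t} → (a , b , t) ∈ pairList → 1 ≤ a × 1 ≤ b × Good t × a ^ i * (b ^ i * weight₂ t) ≤ n
    ∈-pairList⁻ {a} {b} {t} p∈ =
      let a∈ , q∈ = ∈-pairs⁻ (range n) _ p∈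
          b∈ , t∈ = ∈-pairs⁻ (range (quot n (a ^ i))) _ q∈
          good , le = ∈-tuples⁻ r _ t∈
      in proj₁ (∈-range⁻ n a∈) , proj₁ (∈-range⁻ (quot n (a ^ i)) b∈) , good ,
         ≤quot⇒*≤ (b ^ i * weight₂ t) (a ^ i) (≤quot⇒*≤ (weight₂ t) (b ^ i) le)

    ∈-pairList⁺ : ∀ {a b t} → 1 ≤ a → 1 ≤ b → Good t → a ^ i * (b ^ i * weight₂ t) ≤ n → (a , b , t) ∈ pairList
    ∈-pairList⁺ {a} {b} {t} 1≤a 1≤b good le = ∈-pairs⁺ _
      (∈-range⁺ 1≤a (ℕ.≤-trans (m≤m^[1+r] r 1≤a) (ℕ.≤-trans (ℕ.m≤m*n (a ^ i) _ {{ℕ.>-nonZero 1≤bw}}) le)))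
      (∈-pairs⁺ _ (∈-range⁺ 1≤b (ℕ.≤-trans (m≤m^[1+r] r 1≤b) (ℕ.≤-trans (ℕ.m≤m*n (b ^ i) _ {{ℕ.>-nonZero (1≤weight₂ good)}}) le′)))
                  (∈-tuples⁺ good (*≤⇒≤quot (weight₂ t) (1≤^ i 1≤b) le′)))
      where
      1≤bw : 1 ≤ b ^ i * weight₂ t
      1≤bw = ℕ.*-mono-≤ (1≤^ i 1≤b) (1≤weight₂ good)
      le′ : b ^ i * weight₂ t ≤ quot n (a ^ i)
      le′ = *≤⇒≤quot (b ^ i * weight₂ t) (1≤^ i 1≤a) le

    gcd-scaled : ∀ g {d e} → Coprime d e → gcd (g * d) (g * e) ≡ g
    gcd-scaled g {d} {e} c = trans (sym (GCD.c*gcd[m,n]≡gcd[cm,cn] g d e))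
      (trans (cong (g *_) (Coprimality.coprime⇒gcd≡1 c)) (ℕ.*-identityʳ g))

    -- The factor g is recovered as the gcd of the two scaled entries, after which it cancels.
    φ-injective : ∀ {x y} → x ∈ coprimeList → y ∈ coprimeList → φ x ≡ φ y → x ≡ y
    φ-injective {g , (d , e) ∷ t} {g′ , (d′ , e′) ∷ t′} x∈ y∈ eq with ∈-coprimeList⁻ x∈ | ∈-coprimeList⁻ y∈
    ... | 1≤g , ((_ , _ , c) VAll.∷ _) , _ | _ , ((_ , _ , c′) VAll.∷ _) , _ = build g≡ (cong proj₁ eq) (cong (proj₁ ∘ proj₂) eq) (cong (proj₂ ∘ proj₂) eq)
      where
      g≡ : g ≡ g′
      g≡ = trans (sym (gcd-scaled g c)) (trans (cong₂ gcd (cong proj₁ eq) (cong (proj₁ ∘ proj₂) eq)) (gcd-scaled g′ c′))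
      build : g ≡ g′ → g * d ≡ g′ * d′ → g * e ≡ g′ * e′ → t ≡ t′ → (g , (d , e) ∷ t) ≡ (g′ , (d′ , e′) ∷ t′)
      build refl p q refl = cong₂ (λ d e → g , (d , e) ∷ t)
        (ℕ.*-cancelˡ-≡ d d′ g {{ℕ.>-nonZero 1≤g}} p) (ℕ.*-cancelˡ-≡ e e′ g {{ℕ.>-nonZero 1≤g}} q)

    φ-surjective : ∀ {y} → y ∈ pairList → ∃ λ x → x ∈ coprimeList × y ≡ φ x
    φ-surjective {a , b , t} y∈ =
      let 1≤a , 1≤b , good , le = ∈-pairList⁻ y∈
          g = gcd a b
          g≢0 : ℕ.NonZero g
          g≢0 = ℕ.≢-nonZero (GCD.gcd[m,n]≢0 a b (inj₁ λ { refl → contradiction 1≤a λ () }))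
          d = (a ℕ./ g) {{g≢0}}
          e = (b ℕ./ g) {{g≢0}}
          a≡ : g * d ≡ a
          a≡ = ℕ.m*[n/m]≡n {g} {a} {{g≢0}} (GCD.gcd[m,n]∣m a b)
          b≡ : g * e ≡ b
          b≡ = ℕ.m*[n/m]≡n {g} {b} {{g≢0}} (GCD.gcd[m,n]∣n a b)
      in (g , (d , e) ∷ t) ,
         ∈-coprimeList⁺ (ℕ.>-nonZero⁻¹ g {{g≢0}})
           ((1≤factor g d (subst (1 ≤_) (sym a≡) 1≤a) , 1≤factor g e (subst (1 ≤_) (sym b≡) 1≤b) , Coprimality.coprime-/gcd a b {{g≢0}}) VAll.∷ good)
           (subst₂ (λ a b → a ^ i * (b ^ i * weight₂ t) ≤ n) (sym a≡) (sym b≡) le) ,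
         cong₂ (λ a b → a , b , t) (sym a≡) (sym b≡)
      where
      1≤factor : ∀ g d → 1 ≤ g * d → 1 ≤ d
      1≤factor g zero    le = contradiction (subst (1 ≤_) (ℕ.*-zeroʳ g) le) λ ()
      1≤factor g (suc d) _  = ℕ.z<s

    φ-image : ∀ {x} → x ∈ coprimeList → φ x ∈ pairList
    φ-image {g , (d , e) ∷ t} x∈ with ∈-coprimeList⁻ x∈
    ... | 1≤g , ((1≤d , 1≤e , _) VAll.∷ good) , le = ∈-pairList⁺ (ℕ.*-mono-≤ 1≤g 1≤d) (ℕ.*-mono-≤ 1≤g 1≤e) good le

    same-length : length coprimeList ≡ length pairList
    same-length = bijection-length φ
      (pairs-unique (range-unique n) (λ g → tuples-unique i (quot n (g ^ (i ℕ.+ i)))))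
      (pairs-unique (range-unique n) (λ a → pairs-unique (range-unique (quot n (a ^ i))) (λ b → tuples-unique r (quot (quot n (a ^ i)) (b ^ i)))))
      φ-injective
      φ-image
      φ-surjective

  T : ℕ → ℕ → ℚ
  T r n = fromℕ (length (tuples r n))

  fromℕ-length-pairs : ∀ {B : Set} n (F : ℕ → List B) → fromℕ (length (pairs (range n) F)) ≡ ∑ n (λ k → fromℕ (length (F k)))
  fromℕ-length-pairs n F = trans (cong fromℕ (length-pairs (range n) F)) (fromℕ-sum-range n (length ∘ F))

  Op-T : ∀ r n → Op (suc r ℕ.+ suc r) (T (suc r)) n ≡ Op (suc r) (Op (suc r) (T r)) n
  Op-T r n = begin
    Op (i ℕ.+ i) (T i) n            ≡⟨ fromℕ-length-pairs n (λ g → tuples i (quot n (g ^ (i ℕ.+ i)))) ⟨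
    fromℕ (length coprimeList)      ≡⟨ cong fromℕ same-length ⟩
    fromℕ (length pairList)         ≡⟨ fromℕ-length-pairs n (λ a → pairs (range (quot n (a ^ i))) λ b → tuples r (quot (quot n (a ^ i)) (b ^ i))) ⟩
    ∑ n (λ a → fromℕ (length (pairs (range (quot n (a ^ i))) λ b → tuples r (quot (quot n (a ^ i)) (b ^ i)))))
      ≡⟨ ∑-cong n (λ {a} _ _ → fromℕ-length-pairs (quot n (a ^ i)) (λ b → tuples r (quot (quot n (a ^ i)) (b ^ i)))) ⟩
    Op i (Op i (T r)) n             ∎
    where
    open ≡-Reasoning
    open Squares r n

  asymptotic-cong : ∀ {f g} → (∀ n → f n ≡ g n) → Asymptotic f → Asymptotic g
  asymptotic-cong e F = record
    { c = F.c ; isConstant = F.isConstant ; B = F.B ; 0≤B = F.0≤B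
    ; bound = λ n → subst (λ x → ℚ.∣ x ℚ.- main F.c n ∣ ℚ.≤ F.B ℚ.* fromℕ n) (e n) (F.bound n)
    }
    where module F = Asymptotic F

  T-0 : ∀ r → T r 0 ≡ 0ℚ
  T-0 zero    = refl
  T-0 (suc r) = refl

  -- `T 0` is 1 at every positive argument, so one application of `Op 1` counts the k ≤ m and gives
  -- m, and a second one sums the quotients.
  Op-Op-T-0 : ∀ n → divisorSum n ≡ Op 1 (Op 1 (T 0)) n
  Op-Op-T-0 n = ∑-cong n λ {k} _ _ → trans (cong (fromℕ ∘ quot n) (sym (ℕ.^-identityʳ k))) (sym (Op-T-0 (quot n (k ^ 1))))
    where
    length-tuples-0 : ∀ {m} → 1 ≤ m → length (tuples 0 m) ≡ 1
    length-tuples-0 {suc m} _ = refl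
    Op-T-0 : ∀ m → Op 1 (T 0) m ≡ fromℕ m
    Op-T-0 m = trans (∑-cong m λ {k} 1≤k k≤m → cong fromℕ (length-tuples-0
        (*≤⇒≤quot 1 (1≤^ 1 1≤k) (subst (_≤ m) (sym (trans (ℕ.*-identityʳ (k ^ 1)) (ℕ.^-identityʳ k))) k≤m))))
      (∑-1 m)

  -- The exponent to be inverted is 2(r + 1) ≥ 2, so inversion is always available. `Op 1`, whose
  -- series of 1/k diverges, occurs only for r = 0, where the explicit divisor sum replaces it; this
  -- is where the logarithm arises.
  T-asymptotic : ∀ r → Asymptotic (T (suc r))
  T-asymptotic r = Op⁻¹-asymptotic (ℕ.+-mono-≤ {1} {suc r} ℕ.z<s ℕ.z<s) (T-0 (suc r))
    (asymptotic-cong (λ n → sym (Op-T r n)) (double r))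
    where
    double : ∀ r → Asymptotic (Op (suc r) (Op (suc r) (T r)))
    double zero    = asymptotic-cong Op-Op-T-0 divisorSum-asymptotic
    double (suc r) = Op-asymptotic 2≤ (Op-asymptotic 2≤ (T-asymptotic r))
      where
      2≤ : 2 ≤ suc (suc r)
      2≤ = ℕ.s≤s ℕ.z<s

-- Types with exponents at most r as vectors of positive integers.

module Codes where
  open ≡
  open import Data.Nat.Base using (_*_; _^_; _≤_)
  open import Data.Vec.Base using (zipWith)
  open import Data.List.Relation.Binary.Permutation.Propositional.Properties using (map⁺; ++⁺; ++⁺ˡ; shifts; ++-assoc)
  open Structure using (Type; IsType)
  open Models using (ord; ord-↭)
  open Counting using (*-^)

  primesOf : ℕ → List ℕ
  primesOf zero    = []
  primesOf (suc n) = PrimeFactorisation.factors (factorise (suc n))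

  primesOf-prime : ∀ n → All Prime (primesOf n)
  primesOf-prime zero    = []
  primesOf-prime (suc n) = PrimeFactorisation.factorsPrime (factorise (suc n))

  product-primesOf : ∀ {n} → 1 ≤ n → product (primesOf n) ≡ n
  product-primesOf {suc n} _ = sym (PrimeFactorisation.isFactorisation (factorise (suc n)))

  primes-unique : ∀ {ps qs} → All Prime ps → All Prime qs → product ps ≡ product qs → ps ↭ qs
  primes-unique {ps} {qs} pps pqs e = factorisationUnique {product ps}
    (record { factors = ps ; isFactorisation = refl ; factorsPrime = pps })
    (record { factors = qs ; isFactorisation = e ; factorsPrime = pqs })

  Positive : ∀ {r} → Vec ℕ r → Set
  Positive = VAll.All (1 ≤_)

  -- The group ⨁ ℤ/pⁱ, with one summand for each prime p of each entry nᵢ; the first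
  -- entry has the largest index i = r.
  typeOf : ∀ r → Vec ℕ r → Type
  typeOf zero    []      = []
  typeOf (suc r) (n ∷ v) = map (_, suc r) (primesOf n) ++ typeOf r v

  typeOf-isType : ∀ r v → IsType (typeOf r v)
  typeOf-isType zero    []      = []
  typeOf-isType (suc r) (n ∷ v) = All.++⁺ (All.map⁺ (All.map (λ pr → pr , ℕ.z<s) (primesOf-prime n))) (typeOf-isType r v)

  Bounded : ℕ → Type → Set
  Bounded r = All λ (_ , e) → e ≤ r

  typeOf-bounded : ∀ r v → Bounded r (typeOf r v)
  typeOf-bounded zero    []      = []
  typeOf-bounded (suc r) (n ∷ v) = All.++⁺ (All.map⁺ (All.tabulate λ _ → ℕ.≤-refl))
    (All.map ℕ.m≤n⇒m≤1+n (typeOf-bounded r v))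

  primesAt : ℕ → Type → List ℕ
  primesAt i L = map proj₁ (filter (λ (_ , e) → e ℕ.≟ i) L)

  codeOf : ∀ r → Type → Vec ℕ r
  codeOf zero    L = []
  codeOf (suc r) L = product (primesAt (suc r) L) ∷ codeOf r L

  primesAt-prime : ∀ i {L} → IsType L → All Prime (primesAt i L)
  primesAt-prime i t = All.map⁺ (All.map proj₁ (All.filter⁺ (λ (_ , e) → e ℕ.≟ i) t))

  codeOf-positive : ∀ r {L} → IsType L → Positive (codeOf r L)
  codeOf-positive zero    t = []
  codeOf-positive (suc r) t = productOfPrimes≥1 (primesAt-prime (suc r) t) ∷ codeOf-positive r t

  codeOf-↭ : ∀ r {L L′} → L ↭ L′ → codeOf r L ≡ codeOf r L′
  codeOf-↭ zero    π = refl
  codeOf-↭ (suc r) π = cong₂ _∷_ (product-↭ (map⁺ proj₁ (filter-↭ (λ (_ , e) → e ℕ.≟ suc r) π))) (codeOf-↭ r π)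

  infixl 7 _⊛_
  _⊛_ : ∀ {r} → Vec ℕ r → Vec ℕ r → Vec ℕ r
  _⊛_ = zipWith _*_

  codeOf-++ : ∀ r L L′ → codeOf r (L ++ L′) ≡ codeOf r L ⊛ codeOf r L′
  codeOf-++ zero    L L′ = refl
  codeOf-++ (suc r) L L′ = cong₂ _∷_
    (trans (cong (product ∘ map proj₁) (List.filter-++ P? L L′))
      (trans (cong product (List.map-++ proj₁ (filter P? L) (filter P? L′))) (product-++ (primesAt (suc r) L) (primesAt (suc r) L′))))
    (codeOf-++ r L L′)
    where P? = λ ((_ , e) : ℕ × ℕ) → e ℕ.≟ suc r

  exponents-≡ : ∀ (s : ℕ) (ps : List ℕ) → All (λ (_ , e) → e ≡ s) (map (_, s) ps)
  exponents-≡ s []       = []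
  exponents-≡ s (p ∷ ps) = refl ∷ exponents-≡ s ps

  -- `codeOf r` reads exponents up to r only; summands of larger exponent s leave empty products, so
  -- every entry is 1.
  codeOf-high : ∀ r {s} ps v → r ℕ.< s → codeOf r (map (_, s) ps) ⊛ v ≡ v
  codeOf-high zero    ps [] _ = refl
  codeOf-high (suc r) {s} ps (n ∷ v) r<s = cong₂ _∷_
    (trans (cong (λ xs → product (map proj₁ xs) * n) (List.filter-none (λ (_ , e) → e ℕ.≟ suc r) (All.map (λ f e → ℕ.<⇒≢ r<s (trans (sym e) f)) (exponents-≡ s ps))))
           (ℕ.+-identityʳ n))
    (codeOf-high r ps v (ℕ.<-trans (ℕ.n<1+n r) r<s))

  codeOf-typeOf : ∀ r {v} → Positive v → codeOf r (typeOf r v) ≡ v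
  codeOf-typeOf zero [] = refl
  codeOf-typeOf (suc r) {n ∷ v} (1≤n ∷ pos) = cong₂ _∷_
    (trans (cong (product ∘ map proj₁) (trans (List.filter-++ P? (map (_, suc r) ps) (typeOf r v))
        (cong₂ _++_ (List.filter-all P? (exponents-≡ (suc r) ps))
                    (List.filter-none P? (All.map (λ e≤r e → ℕ.<⇒≢ (ℕ.s≤s e≤r) e) (typeOf-bounded r v))))))
      (trans (cong (product ∘ map proj₁) (List.++-identityʳ (map (_, suc r) ps)))
      (trans (cong product (trans (sym (List.map-∘ ps)) (List.map-id ps))) (product-primesOf 1≤n))))
    (trans (codeOf-++ r (map (_, suc r) ps) (typeOf r v))
      (trans (codeOf-high r ps (codeOf r (typeOf r v)) ℕ.≤-refl) (codeOf-typeOf r pos)))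
    where
    P? = λ ((_ , e) : ℕ × ℕ) → e ℕ.≟ suc r
    ps = primesOf n

  -- Multiplication of codes is the direct sum of groups

  -- By unique factorisation the primes of n m are those of n together with those of m; the rest is
  -- a rearrangement of the summands.
  typeOf-⊛ : ∀ r {v w} → Positive v → Positive w → typeOf r (v ⊛ w) ↭ typeOf r v ++ typeOf r w
  typeOf-⊛ zero [] [] = ↭-refl
  typeOf-⊛ (suc r) {n ∷ v} {m ∷ w} (1≤n ∷ pv) (1≤m ∷ pw) = ↭-trans
    (++⁺ (↭-trans (map⁺ (_, suc r) primes) (↭-reflexive (List.map-++ (_, suc r) (primesOf n) (primesOf m)))) (typeOf-⊛ r pv pw))
    (↭-trans (++-assoc A B (V ++ W)) (↭-trans (++⁺ˡ A (shifts B V)) (↭-sym (++-assoc A V (B ++ W)))))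
    where
    A = map (_, suc r) (primesOf n)
    B = map (_, suc r) (primesOf m)
    V = typeOf r v
    W = typeOf r w
    primes : primesOf (n * m) ↭ primesOf n ++ primesOf m
    primes = primes-unique (primesOf-prime (n * m)) (All.++⁺ (primesOf-prime n) (primesOf-prime m))
      (trans (product-primesOf (ℕ.*-mono-≤ 1≤n 1≤m))
        (sym (trans (product-++ (primesOf n) (primesOf m)) (cong₂ _*_ (product-primesOf 1≤n) (product-primesOf 1≤m)))))

  primesOf-1 : primesOf 1 ↭ []
  primesOf-1 = primes-unique (primesOf-prime 1) [] (product-primesOf ℕ.≤-refl)

  primesOf-prime-↭ : ∀ {p} → Prime p → primesOf (p * 1) ↭ p ∷ []
  primesOf-prime-↭ {p} pr = primes-unique (primesOf-prime (p * 1)) (pr ∷ [])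
    (product-primesOf (ℕ.*-mono-≤ (ℕ.>-nonZero⁻¹ p {{prime⇒nonZero pr}}) (ℕ.≤-refl {1})))

  typeOf-codeOf-[] : ∀ r → typeOf r (codeOf r []) ↭ []
  typeOf-codeOf-[] zero    = ↭-refl
  typeOf-codeOf-[] (suc r) = ++⁺ (map⁺ (_, suc r) primesOf-1) (typeOf-codeOf-[] r)

  typeOf-codeOf-high : ∀ r {p s} → r ℕ.< s → typeOf r (codeOf r ((p , s) ∷ [])) ↭ []
  typeOf-codeOf-high zero _ = ↭-refl
  typeOf-codeOf-high (suc r) {p} {s} r<s = ++⁺
    (map⁺ (_, suc r) (subst (λ xs → primesOf (product (map proj₁ xs)) ↭ [])
      (sym (List.filter-reject (λ ((_ , e) : ℕ × ℕ) → e ℕ.≟ suc r) {p , s} {[]} (λ e → ℕ.<⇒≢ r<s (sym e)))) primesOf-1))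
    (typeOf-codeOf-high r (ℕ.<-trans (ℕ.n<1+n r) r<s))

  typeOf-codeOf-[x] : ∀ r {p e} → Prime p → 1 ≤ e → e ≤ r → typeOf r (codeOf r ((p , e) ∷ [])) ↭ (p , e) ∷ []
  typeOf-codeOf-[x] zero    _ 1≤e e≤0 = contradiction (ℕ.≤-trans 1≤e e≤0) λ ()
  typeOf-codeOf-[x] (suc r) {p} {e} pr 1≤e e≤r with e ℕ.≟ suc r
  ... | yes refl = ++⁺
    (map⁺ (_, suc r) (subst (λ xs → primesOf (product (map proj₁ xs)) ↭ p ∷ [])
      (sym (List.filter-accept (λ ((_ , e) : ℕ × ℕ) → e ℕ.≟ suc r) {p , suc r} {[]} refl)) (primesOf-prime-↭ pr)))
    (typeOf-codeOf-high r ℕ.≤-refl)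
  ... | no e≢ = ++⁺
    (map⁺ (_, suc r) (subst (λ xs → primesOf (product (map proj₁ xs)) ↭ [])
      (sym (List.filter-reject (λ ((_ , e) : ℕ × ℕ) → e ℕ.≟ suc r) {p , e} {[]} e≢)) primesOf-1))
    (typeOf-codeOf-[x] r pr 1≤e (ℕ.s≤s⁻¹ (ℕ.≤∧≢⇒< e≤r e≢)))

  -- Multiplicativity of codes reduces this to types with a single summand. The bound r on the
  -- exponents is essential, as higher ones are lost in the code.
  typeOf-codeOf : ∀ r {L} → IsType L → Bounded r L → typeOf r (codeOf r L) ↭ L
  typeOf-codeOf r [] [] = typeOf-codeOf-[] r
  typeOf-codeOf r {(p , e) ∷ L} ((pr , 1≤e) ∷ t) (e≤r ∷ b) = ↭-trans
    (↭-reflexive (cong (typeOf r) (codeOf-++ r ((p , e) ∷ []) L)))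
    (↭-trans (typeOf-⊛ r (codeOf-positive r ((pr , 1≤e) ∷ [])) (codeOf-positive r t))
             (++⁺ (typeOf-codeOf-[x] r pr 1≤e e≤r) (typeOf-codeOf r t b)))

  weight : ∀ {r} → Vec ℕ r → ℕ
  weight [] = 1
  weight {suc r} (n ∷ v) = n ^ suc r * weight v

  ord-++ : ∀ L L′ → ord (L ++ L′) ≡ ord L * ord L′
  ord-++ L L′ = trans (cong product (List.map-++ (λ (p , e) → p ^ e) L L′)) (product-++ (map (λ (p , e) → p ^ e) L) (map (λ (p , e) → p ^ e) L′))

  ord-homogeneous : ∀ s ps → ord (map (_, s) ps) ≡ product ps ^ s
  ord-homogeneous s []       = sym (ℕ.^-zeroˡ s)
  ord-homogeneous s (p ∷ ps) = trans (cong (p ^ s *_) (ord-homogeneous s ps)) (sym (*-^ s p (product ps)))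

  ord-typeOf : ∀ r {v} → Positive v → ord (typeOf r v) ≡ weight v
  ord-typeOf zero [] = refl
  ord-typeOf (suc r) {n ∷ v} (1≤n ∷ pos) = trans (ord-++ (map (_, suc r) (primesOf n)) (typeOf r v))
    (cong₂ _*_ (trans (ord-homogeneous (suc r) (primesOf n)) (cong (_^ suc r) (product-primesOf 1≤n))) (ord-typeOf r pos))

  ord≡weight : ∀ r {L} → IsType L → Bounded r L → ord L ≡ weight (codeOf r L)
  ord≡weight r t b = trans (ord-↭ (↭-sym (typeOf-codeOf r t b))) (ord-typeOf r (codeOf-positive r t))

-- Unitary factors as componentwise coprime factorisations of codes.

module Classification where
  open ≡ hiding ([_])
  open import Data.Nat.Base using (_*_; _^_; _≤_)
  open import Data.Integer.Base using (+_)
  open import Data.List.Base using ([_])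
  open import Data.Vec.Base using (zip)
  open import Data.List.Relation.Binary.Permutation.Propositional.Properties using (shift)
  open GroupBasics
  open Structure
  open Models
  open Invariants using (type-unique)
  open Harmonic using (1≤^)
  open Counting
  open Codes

  module _ (G : FiniteAbelianGroup) where

    type : Type
    type = proj₁ (finite-structure G)

    type-isType : IsType type
    type-isType = proj₁ (proj₂ (finite-structure G))

    type-≅ : M type ≅ group G
    type-≅ = proj₂ (proj₂ (finite-structure G))

    ↭-type : ∀ {L} → IsType L → M L ≅ group G → L ↭ type
    ↭-type {L} t i = type-unique t type-isType (≅-trans {M L} {group G} {M type} i (≅-sym {M type} {group G} type-≅))

  type-⊕ : ∀ G H K → group G ≅ group H ⊕ group K → type H ++ type K ↭ type G
  type-⊕ G H K i = ↭-type G (All.++⁺ (type-isType H) (type-isType K))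
    (≅-trans {M (type H ++ type K)} {M (type H) ⊕ M (type K)} {group G} (M-++ (type H) (type K))
      (≅-trans {M (type H) ⊕ M (type K)} {group H ⊕ group K} {group G}
        (⊕-cong {M (type H)} {group H} {M (type K)} {group K} (type-≅ H) (type-≅ K))
        (≅-sym {group G} {group H ⊕ group K} i)))

  type-≅⇒↭ : ∀ G H → group G ≅ group H → type G ↭ type H
  type-≅⇒↭ G H i = ↭-type H (type-isType G) (≅-trans {M (type G)} {group G} {group H} (type-≅ G) i)

  ↭⇒≅ : ∀ G H → type G ↭ type H → group G ≅ group H
  ↭⇒≅ G H π = ≅-trans {group G} {M (type G)} {group H} (≅-sym {M (type G)} {group G} (type-≅ G))
    (≅-trans {M (type G)} {M (type H)} {group H} (M-↭ π) (type-≅ H))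

  -- Common direct factors

  cyclicFactor : ∀ {p e} → Prime p → 1 ≤ e → FiniteAbelianGroup
  cyclicFactor pr 1≤e = finiteM ((pr , 1≤e) ∷ [])

  cyclicFactor-nontrivial : ∀ {p e} (pr : Prime p) (1≤e : 1 ≤ e) → ¬ Trivial (group (cyclicFactor pr 1≤e))
  cyclicFactor-nontrivial {p} {suc e} pr 1≤e trivial = contradiction
    (ℕ.∣1⇒≡1 (ℕ.∣-trans {p} (ℕ.m∣m*n (p ^ e)) (ℤ.∣⇒∣ᵤ {+ (p ^ suc e)} {1ℤ} (ℤ/-∣ {p ^ suc e} {1ℤ} (proj₁ (trivial (1ℤ , _)))))))
    λ { refl → ℕ.<-irrefl refl (1<prime pr) }

  cyclicFactor-factor : ∀ {p e} (pr : Prime p) (1≤e : 1 ≤ e) H → (p , e) ∈ type H → cyclicFactor pr 1≤e IsDirectFactorOf H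
  cyclicFactor-factor {p} {e} pr 1≤e H pe∈ with ∈-∃++ pe∈
  ... | as , bs , eq = finiteM (All.tail (All-resp-↭ π (type-isType H))) ,
    ≅-trans {group H} {M (type H)} {C ⊕ M (as ++ bs)} (≅-sym {M (type H)} {group H} (type-≅ H))
      (≅-trans {M (type H)} {M ((p , e) ∷ as ++ bs)} {C ⊕ M (as ++ bs)} (M-↭ π) (M-++ ((p , e) ∷ []) (as ++ bs)))
    where
    C : AbGroup
    C = M ((p , e) ∷ [])
    π : type H ↭ (p , e) ∷ as ++ bs
    π = ↭-trans (↭-reflexive eq) (shift (p , e) as bs)

  factor⇒⊆ : ∀ D H → D IsDirectFactorOf H → ∀ {x} → x ∈ type D → x ∈ type H
  factor⇒⊆ D H (E , i) x∈ = ∈-resp-↭ (type-⊕ H D E i) (∈-++⁺ˡ x∈)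

  nontrivial⇒∈ : ∀ D → ¬ Trivial (group D) → ∃ λ x → x ∈ type D
  nontrivial⇒∈ D nontrivial = go (type D) refl
    where
    module I = Iso {M (type D)} {group D} (type-≅ D)
    module D = AbelianGroup (group D)
    go : ∀ L → type D ≡ L → ∃ λ x → x ∈ type D
    go (x ∷ L) e = x , subst (x ∈_) (sym e) (here refl)
    go [] e = contradiction
      (λ y → D.trans (D.sym (I.to-from y)) (D.trans (Hom.cong I.to {I.from-fun y} {AbelianGroup.ε (M (type D))} (trivial e (I.from-fun y))) (Hom.homo-ε I.to)))
      nontrivial
      where
      trivial : ∀ {L} → L ≡ [] → Trivial (M L)
      trivial refl _ = _

  ∈⇒∣code : ∀ {p e L} → (p , e) ∈ L → p ℕ.∣ product (primesAt e L)
  ∈⇒∣code {p} {e} pe∈ = ∈⇒∣product (∈-map⁺ proj₁ (∈-filter⁺ (λ (_ , f) → f ℕ.≟ e) pe∈ refl))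

  ∣code⇒∈ : ∀ {p e L} → Prime p → IsType L → p ℕ.∣ product (primesAt e L) → (p , e) ∈ L
  ∣code⇒∈ {p} {e} {L} pr t p∣ with ∈-map⁻ proj₁ (factorisationHasAllPrimeFactors pr p∣ (primesAt-prime e t))
  ... | (_ , f) , pf∈ , refl with ∈-filter⁻ (λ (_ , f) → f ℕ.≟ e) {xs = L} pf∈
  ...   | pf∈′ , refl = pf∈′

  good⇒disjoint : ∀ r {L L′ p e} → Good (zip (codeOf r L) (codeOf r L′)) → Prime p → 1 ≤ e → e ≤ r →
    (p , e) ∈ L → ¬ (p , e) ∈ L′
  good⇒disjoint zero _ _ 1≤e e≤0 _ _ = contradiction (ℕ.≤-trans 1≤e e≤0) λ ()
  good⇒disjoint (suc r) {L} {L′} {p} {e} ((_ , _ , c) ∷ good) pr 1≤e e≤r ∈L ∈L′ with e ℕ.≟ suc r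
  ... | no e≢ = good⇒disjoint r {L} {L′} good pr 1≤e (ℕ.s≤s⁻¹ (ℕ.≤∧≢⇒< e≤r e≢)) ∈L ∈L′
  ... | yes refl = ℕ.<-irrefl (sym (c (∈⇒∣code ∈L , ∈⇒∣code ∈L′))) (1<prime pr)

  -- A prime p that divides both entries of index e would put the summand (p , e) into both types.
  disjoint⇒good : ∀ r {L L′} → IsType L → IsType L′ → (∀ {p e} → Prime p → 1 ≤ e → (p , e) ∈ L → ¬ (p , e) ∈ L′) →
    Good (zip (codeOf r L) (codeOf r L′))
  disjoint⇒good zero    t t′ disjoint = []
  disjoint⇒good (suc r) {L} {L′} t t′ disjoint with codeOf-positive (suc r) t | codeOf-positive (suc r) t′
  ... | 1≤a ∷ _ | 1≤b ∷ _ = (1≤a , 1≤b , Coprimality.gcd≡1⇒coprime gcd≡1) ∷ disjoint⇒good r t t′ disjoint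
    where
    a = product (primesAt (suc r) L)
    b = product (primesAt (suc r) L′)
    1≤gcd : 1 ≤ gcd a b
    1≤gcd = ℕ.n≢0⇒n>0 (GCD.gcd[m,n]≢0 a b (inj₁ λ e → contradiction (subst (1 ≤_) e 1≤a) λ ()))
    gcd≡1 : gcd a b ≡ 1
    gcd≡1 with gcd a b ℕ.≟ 1
    ... | yes e = e
    ... | no ≢1 with prime-factor (gcd a b) (ℕ.≤∧≢⇒< 1≤gcd (≢1 ∘ sym))
    ...   | p , pr , p∣ = contradiction (∣code⇒∈ pr t′ (ℕ.∣-trans p∣ (GCD.gcd[m,n]∣n a b)))
              (disjoint pr ℕ.z<s (∣code⇒∈ pr t (ℕ.∣-trans p∣ (GCD.gcd[m,n]∣m a b))))

  product₂ : ∀ {r} → Vec (ℕ × ℕ) r → Vec ℕ r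
  product₂ = Vec.map (uncurry _*_)

  fsts snds : ∀ {r} → Vec (ℕ × ℕ) r → Vec ℕ r
  fsts = Vec.map proj₁
  snds = Vec.map proj₂

  product₂-zip : ∀ {r} (v w : Vec ℕ r) → product₂ (zip v w) ≡ v ⊛ w
  product₂-zip []      []      = refl
  product₂-zip (m ∷ v) (n ∷ w) = cong (m * n ∷_) (product₂-zip v w)

  product₂-⊛ : ∀ {r} (t : Vec (ℕ × ℕ) r) → product₂ t ≡ fsts t ⊛ snds t
  product₂-⊛ []            = refl
  product₂-⊛ ((d , e) ∷ t) = cong (d * e ∷_) (product₂-⊛ t)

  zip-unzip : ∀ {r} (t : Vec (ℕ × ℕ) r) → zip (fsts t) (snds t) ≡ t
  zip-unzip []      = refl
  zip-unzip (x ∷ t) = cong (x ∷_) (zip-unzip t)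

  fsts-zip : ∀ {r} (v w : Vec ℕ r) → fsts (zip v w) ≡ v
  fsts-zip []      []      = refl
  fsts-zip (m ∷ v) (n ∷ w) = cong (m ∷_) (fsts-zip v w)

  weight-product₂ : ∀ {r} (t : Vec (ℕ × ℕ) r) → weight₂ t ≡ weight (product₂ t)
  weight-product₂ [] = refl
  weight-product₂ {suc r} ((d , e) ∷ t) = cong ((d * e) ^ suc r *_) (weight-product₂ t)

  fsts-positive : ∀ {r} {t : Vec (ℕ × ℕ) r} → Good t → Positive (fsts t)
  fsts-positive []                  = []
  fsts-positive ((1≤d , _ , _) ∷ g) = 1≤d ∷ fsts-positive g

  snds-positive : ∀ {r} {t : Vec (ℕ × ℕ) r} → Good t → Positive (snds t)
  snds-positive []                  = []
  snds-positive ((_ , 1≤e , _) ∷ g) = 1≤e ∷ snds-positive g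

  ⊛-positive : ∀ {r} {v w : Vec ℕ r} → Positive v → Positive w → Positive (v ⊛ w)
  ⊛-positive []         []         = []
  ⊛-positive (1≤m ∷ pv) (1≤n ∷ pw) = ℕ.*-mono-≤ 1≤m 1≤n ∷ ⊛-positive pv pw

  product₂-positive : ∀ {r} {t : Vec (ℕ × ℕ) r} → Good t → Positive (product₂ t)
  product₂-positive {t = t} g = subst Positive (sym (product₂-⊛ t)) (⊛-positive (fsts-positive g) (snds-positive g))

  ⊛-cancelˡ : ∀ {r} {u v w : Vec ℕ r} → Positive u → u ⊛ v ≡ u ⊛ w → v ≡ w
  ⊛-cancelˡ {u = []} {[]} {[]} [] e = refl
  ⊛-cancelˡ {u = m ∷ u} {n ∷ v} {k ∷ w} (1≤m ∷ p) e = cong₂ _∷_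
    (ℕ.*-cancelˡ-≡ n k m {{ℕ.>-nonZero 1≤m}} (cong Vec.head e)) (⊛-cancelˡ p (cong Vec.tail e))

  weight-positive : ∀ {r} {v : Vec ℕ r} → Positive v → 1 ≤ weight v
  weight-positive [] = ℕ.≤-refl
  weight-positive {suc r} (1≤n ∷ p) = ℕ.*-mono-≤ (1≤^ (suc r) 1≤n) (weight-positive p)

  -- This confines the codes in question to finitely many candidates, so that representatives can be
  -- listed by search.
  entries≤weight : ∀ {r} {v : Vec ℕ r} → Positive v → VAll.All (_≤ weight v) v
  entries≤weight [] = []
  entries≤weight {suc r} {n ∷ v} (1≤n ∷ p) =
    ℕ.≤-trans (m≤m^[1+r] r 1≤n) (ℕ.m≤m*n (n ^ suc r) (weight v) {{ℕ.>-nonZero (weight-positive p)}}) ∷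
    VAll.map (λ le → ℕ.≤-trans le (ℕ.m≤n*m (weight v) (n ^ suc r) {{ℕ.>-nonZero (1≤^ (suc r) 1≤n)}})) (entries≤weight p)

  module _ {A : Set} (xs : List A) where

    vecs : ∀ r → List (Vec A r)
    vecs zero    = [ [] ]
    vecs (suc r) = cartesianProductWith _∷_ xs (vecs r)

    ∈-vecs⁺ : ∀ {r} {v : Vec A r} → VAll.All (_∈ xs) v → v ∈ vecs r
    ∈-vecs⁺ []       = here refl
    ∈-vecs⁺ (x∈ ∷ v∈) = ∈-cartesianProductWith⁺ _∷_ x∈ (∈-vecs⁺ v∈)

    ∈-vecs⁻ : ∀ {r} {v : Vec A r} → v ∈ vecs r → VAll.All (_∈ xs) v
    ∈-vecs⁻ {zero}  {[]} _ = []
    ∈-vecs⁻ {suc r} v∈ with ∈-cartesianProductWith⁻ _∷_ xs (vecs r) v∈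
    ... | _ , _ , x∈ , v∈′ , refl = x∈ ∷ ∈-vecs⁻ v∈′

    vecs-unique : Unique xs → ∀ r → Unique (vecs r)
    vecs-unique xs! zero    = [] ∷ []
    vecs-unique xs! (suc r) = Unique.cartesianProductWith⁺ _∷_ (λ { refl → refl , refl }) xs! (vecs-unique xs! r)

  module _ (r : ℕ) where

    code : FiniteAbelianGroup → Vec ℕ r
    code G = codeOf r (type G)

    IsBounded : FiniteAbelianGroup → Set
    IsBounded G = Bounded r (type G)

    code-positive : ∀ G → Positive (code G)
    code-positive G = codeOf-positive r (type-isType G)

    code-≅ : ∀ G H → group G ≅ group H → code G ≡ code H
    code-≅ G H i = codeOf-↭ r (type-≅⇒↭ G H i)

    code-⊕ : ∀ G H K → group G ≅ group H ⊕ group K → code G ≡ code H ⊛ code K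
    code-⊕ G H K i = trans (codeOf-↭ r (↭-sym (type-⊕ G H K i))) (codeOf-++ r (type H) (type K))

    bounded-⊕ : ∀ G H K → group G ≅ group H ⊕ group K → IsBounded G → IsBounded H × IsBounded K
    bounded-⊕ G H K i b = All.++⁻ (type H) (All-resp-↭ (↭-sym (type-⊕ G H K i)) b)

    code-injective : ∀ G H → IsBounded G → IsBounded H → code G ≡ code H → group G ≅ group H
    code-injective G H bG bH e = ↭⇒≅ G H (↭-trans (↭-sym (typeOf-codeOf r (type-isType G) bG))
      (↭-trans (↭-reflexive (cong (typeOf r) e)) (typeOf-codeOf r (type-isType H) bH)))

    order≡weight : ∀ G → IsBounded G → order G ≡ weight (code G)
    order≡weight G b = trans (sym (order-unique (finiteM (type-isType G)) G (type-≅ G))) (ord≡weight r (type-isType G) b)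

    model : Vec ℕ r → FiniteAbelianGroup
    model v = finiteM (typeOf-isType r v)

    model-type : ∀ v → typeOf r v ↭ type (model v)
    model-type v = ↭-type (model v) (typeOf-isType r v) (≅-refl {M (typeOf r v)})

    code-model : ∀ {v} → Positive v → code (model v) ≡ v
    code-model {v} p = trans (codeOf-↭ r (↭-sym (model-type v))) (codeOf-typeOf r p)

    model-bounded : ∀ v → IsBounded (model v)
    model-bounded v = All-resp-↭ (model-type v) (typeOf-bounded r v)

    ≅-model : ∀ G {v} → IsBounded G → Positive v → code G ≡ v → group G ≅ group (model v)
    ≅-model G {v} b p e = code-injective G (model v) b (model-bounded v) (trans e (sym (code-model p)))

    model-distinct : ∀ {v w} → Positive v → Positive w → v ≢ w → ¬ group (model v) ≅ group (model w)
    model-distinct {v} {w} pv pw v≢w i = v≢w (trans (sym (code-model pv)) (trans (code-≅ (model v) (model w) i) (code-model pw)))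

    pairCode : (H K : FiniteAbelianGroup) → Vec (ℕ × ℕ) r
    pairCode H K = zip (code H) (code K)

    unitary⇒good : ∀ G H K → HaveUnitaryFactors G H K → Good (pairCode H K)
    unitary⇒good G H K (_ , no-common) = disjoint⇒good r (type-isType H) (type-isType K) λ pr 1≤e ∈H ∈K →
      no-common (cyclicFactor pr 1≤e , cyclicFactor-nontrivial pr 1≤e , cyclicFactor-factor pr 1≤e H ∈H , cyclicFactor-factor pr 1≤e K ∈K)

    unitary⇒product : ∀ G H K → HaveUnitaryFactors G H K → product₂ (pairCode H K) ≡ code G
    unitary⇒product G H K (i , _) = trans (product₂-zip (code H) (code K)) (sym (code-⊕ G H K i))

    -- A nontrivial common factor D has some summand (p , e) in its type; by uniqueness of types it
    -- lies in the types of both H and K, and p then divides two coprime entries.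
    good⇒unitary : ∀ G H K → IsBounded H → IsBounded K → group G ≅ group H ⊕ group K → Good (pairCode H K) → HaveUnitaryFactors G H K
    good⇒unitary G H K bH bK i good = i , λ (D , nontrivial , D∣H , D∣K) →
      let (p , e) , pe∈ = nontrivial⇒∈ D nontrivial
          pr , 1≤e = All.lookup (type-isType D) pe∈
          ∈H = factor⇒⊆ D H D∣H pe∈
      in good⇒disjoint r good pr 1≤e (All.lookup bH ∈H) ∈H (factor⇒⊆ D K D∣K pe∈)

    model-unitary : ∀ G {t} → IsBounded G → Good t → product₂ t ≡ code G → HaveUnitaryFactors G (model (fsts t)) (model (snds t))
    model-unitary G {t} b good e = good⇒unitary G (model v) (model w) (model-bounded v) (model-bounded w)
      (≅-trans {group G} {M (typeOf r (v ⊛ w))} {M (typeOf r v) ⊕ M (typeOf r w)}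
        (≅-model G b (⊛-positive pv pw) (trans (sym e) (product₂-⊛ t)))
        (≅-trans {M (typeOf r (v ⊛ w))} {M (typeOf r v ++ typeOf r w)} {M (typeOf r v) ⊕ M (typeOf r w)}
          (M-↭ (typeOf-⊛ r pv pw)) (M-++ (typeOf r v) (typeOf r w))))
      (subst Good (sym (trans (cong₂ zip (code-model pv) (code-model pw)) (zip-unzip t))) good)
      where
      v = fsts t
      w = snds t
      pv = fsts-positive good
      pw = snds-positive good

    module _ (G : FiniteAbelianGroup) where

      -- Each factor H is recorded with the complement K that its proof supplies. The choice does
      -- not matter, because the code of K is determined by those of G and H through `⊛-cancelˡ`.
      codes : ∀ {Hs} → All (_IsUnitaryFactorOf G) Hs → List (Vec (ℕ × ℕ) r)
      codes [] = []
      codes {H ∷ _} ((K , _) ∷ us) = pairCode H K ∷ codes us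

      length-codes : ∀ {Hs} (us : All (_IsUnitaryFactorOf G) Hs) → length (codes us) ≡ length Hs
      length-codes []       = refl
      length-codes (_ ∷ us) = cong suc (length-codes us)

      ∈-codes⁻ : ∀ {Hs} (us : All (_IsUnitaryFactorOf G) Hs) {t} → t ∈ codes us → Good t × product₂ t ≡ code G
      ∈-codes⁻ {H ∷ _} ((K , u) ∷ us) (here refl) = unitary⇒good G H K u , unitary⇒product G H K u
      ∈-codes⁻ (_ ∷ us) (there t∈) = ∈-codes⁻ us t∈

      module _ (b : IsBounded G) where

        factor-bounded : ∀ H → H IsUnitaryFactorOf G → IsBounded H
        factor-bounded H (K , i , _) = proj₁ (bounded-⊕ G H K i b)

        codes-unique : ∀ {Hs} (us : All (_IsUnitaryFactorOf G) Hs) → AllPairs (λ H H′ → ¬ group H ≅ group H′) Hs → Unique (codes us)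
        codes-unique [] [] = []
        codes-unique {H ∷ Hs} (u@(K , _) ∷ us) (≇ ∷ distinct) = fresh us ≇ ∷ codes-unique us distinct
          where
          fresh : ∀ {Hs} (us : All (_IsUnitaryFactorOf G) Hs) → All (λ H′ → ¬ group H ≅ group H′) Hs → All (pairCode H K ≢_) (codes us)
          fresh [] [] = []
          fresh {H′ ∷ _} (u′@(K′ , _) ∷ us) (≇ ∷ ≇s) = (λ e → ≇ (code-injective H H′ (factor-bounded H u) (factor-bounded H′ u′)
            (trans (sym (fsts-zip (code H) (code K))) (trans (cong fsts e) (fsts-zip (code H′) (code K′)))))) ∷ fresh us ≇s

        -- Completeness of C supplies a representative isomorphic to the model of the first
        -- components, and cancellation identifies the code of its recorded complement.
        ∈-codes⁺ : (C : Classes (_IsUnitaryFactorOf G)) → ∀ {t} → Good t → product₂ t ≡ code G → t ∈ codes (sound C)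
        ∈-codes⁺ C {t} good e = find (sound C) (complete C (model v) (model (snds t) , model-unitary G b good e))
          where
          v = fsts t
          find : ∀ {Hs} (us : All (_IsUnitaryFactorOf G) Hs) → Any (λ H → group (model v) ≅ group H) Hs → t ∈ codes us
          find {H ∷ _} ((K , u) ∷ us) (here i) = here (sym (trans (cong₂ zip H≡ K≡) (zip-unzip t)))
            where
            H≡ : code H ≡ v
            H≡ = trans (sym (code-≅ (model v) H i)) (code-model (fsts-positive good))
            K≡ : code K ≡ snds t
            K≡ = ⊛-cancelˡ (fsts-positive good) (trans (cong (_⊛ code K) (sym H≡))
              (trans (sym (code-⊕ G H K (proj₁ u))) (trans (sym e) (product₂-⊛ t))))
          find (_ ∷ us) (there i) = there (find us i)

        unitaryFactorCount : ∃ (HasUnitaryFactorCount G)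
        unitaryFactorCount = length reps , record
          { representatives = reps
          ; sound    = All.map⁺ (All.tabulate λ {t} t∈ → let good , e = members t∈ in model (snds t) , model-unitary G b good e)
          ; distinct = distinct-models ts (All.tabulate members)
              (Unique.filter⁺ P? (vecs-unique (cartesianProduct (range n) (range n)) (Unique.cartesianProduct⁺ (range-unique n) (range-unique n)) r))
          ; complete = λ H u → Any.map⁺ (Any.map (λ { refl → iso H u }) (listed H u))
          } , refl
          where
          -- No entry of the code exceeds its weight, so both members of every pair lie between 1
          -- and n.
          n = weight (code G)
          P? : ∀ t → Dec (Good t × product₂ t ≡ code G)
          P? t = VAll.all? (λ (d , e) → (1 ℕ.≤? d) ×-dec ((1 ℕ.≤? e) ×-dec coprime? d e)) t ×-dec Vec.≡-dec ℕ._≟_ (product₂ t) (code G)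
          ts : List (Vec (ℕ × ℕ) r)
          ts = filter P? (vecs (cartesianProduct (range n) (range n)) r)
          reps : List FiniteAbelianGroup
          reps = map (model ∘ fsts) ts
          members : ∀ {t} → t ∈ ts → Good t × product₂ t ≡ code G
          members t∈ = proj₂ (∈-filter⁻ P? {xs = vecs (cartesianProduct (range n) (range n)) r} t∈)
          distinct-models : ∀ ts → All (λ t → Good t × product₂ t ≡ code G) ts → Unique ts →
            AllPairs (λ H H′ → ¬ group H ≅ group H′) (map (model ∘ fsts) ts)
          distinct-models [] [] [] = []
          distinct-models (t ∷ ts) ((good , e) ∷ gs) (t∉ ∷ ts!) = All.map⁺ (fresh gs t∉) ∷ distinct-models ts gs ts!
            where
            fresh : ∀ {ts} → All (λ t → Good t × product₂ t ≡ code G) ts → All (t ≢_) ts →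
              All (λ t′ → ¬ group (model (fsts t)) ≅ group (model (fsts t′))) ts
            fresh [] [] = []
            fresh {t′ ∷ _} ((good′ , e′) ∷ gs) (t≢t′ ∷ ≢s) = model-distinct (fsts-positive good) (fsts-positive good′)
              (λ f → t≢t′ (trans (sym (zip-unzip t)) (trans (cong₂ zip f (⊛-cancelˡ (fsts-positive good)
                 (trans (sym (product₂-⊛ t)) (trans e (trans (sym e′) (trans (product₂-⊛ t′) (cong (_⊛ snds t′) (sym f)))))))) (zip-unzip t′)))) ∷ fresh gs ≢s
          entries : ∀ {r′} {t : Vec (ℕ × ℕ) r′} → Good t → VAll.All (_≤ n) (product₂ t) → VAll.All (_∈ cartesianProduct (range n) (range n)) t
          entries [] [] = []
          entries {t = (d , e) ∷ _} ((1≤d , 1≤e , _) ∷ g) (de≤n ∷ les) = ∈-cartesianProduct⁺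
            (∈-range⁺ 1≤d (ℕ.≤-trans (ℕ.m≤m*n d e {{ℕ.>-nonZero 1≤e}}) de≤n))
            (∈-range⁺ 1≤e (ℕ.≤-trans (ℕ.m≤n*m e d {{ℕ.>-nonZero 1≤d}}) de≤n)) ∷ entries g les
          listed : ∀ H (u : H IsUnitaryFactorOf G) → pairCode H (proj₁ u) ∈ ts
          listed H (K , u) = ∈-filter⁺ P?
            (∈-vecs⁺ _ (entries good (subst (VAll.All (_≤ n)) (sym e) (entries≤weight (code-positive G))))) (good , e)
            where
            good = unitary⇒good G H K u
            e = unitary⇒product G H K u
          iso : ∀ H (u : H IsUnitaryFactorOf G) → group H ≅ group (model (fsts (pairCode H (proj₁ u))))
          iso H u = ≅-model H (factor-bounded H u) (subst Positive (sym (fsts-zip (code H) (code (proj₁ u)))) (code-positive H))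
            (sym (fsts-zip (code H) (code (proj₁ u))))

-- Summation of the numbers of unitary factors over all groups.

module Total where
  open ≡
  open import Data.Nat.Base using (_≤_)
  open Counting
  open Codes
  open Classification

  ¬¬-All : ∀ {a p} {A : Set a} {P : A → Set p} {xs} → All (λ x → ¬ ¬ P x) xs → ¬ ¬ All P xs
  ¬¬-All []         k = k []
  ¬¬-All (¬¬p ∷ ps) k = ¬¬p λ p → ¬¬-All ps λ qs → k (p ∷ qs)

  -- P stands for the condition on the groups counted by the theorem. That models of weight at most
  -- n satisfy it is assumed up to double negation only, because the rank of a conjugate is known
  -- only in that form.
  module Count (r n : ℕ) (P : FiniteAbelianGroup → Set₁)
    (P⇒ : ∀ G → P G → order G ≤ n × IsBounded r G)
    (⇒P : ∀ v → Positive v → weight v ≤ n → ¬ ¬ P (model r v)) where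

    private
      bounded : ∀ {G} → P G → IsBounded r G
      bounded {G} p = proj₂ (P⇒ G p)

    allCodes : ∀ {Gs ts} → Pointwise HasUnitaryFactorCount Gs ts → List (Vec (ℕ × ℕ) r)
    allCodes [] = []
    allCodes {G ∷ _} ((C , _) ∷ counts) = codes r G (sound C) ++ allCodes counts

    length-allCodes : ∀ {Gs ts} (counts : Pointwise HasUnitaryFactorCount Gs ts) → length (allCodes counts) ≡ sum ts
    length-allCodes [] = refl
    length-allCodes {G ∷ _} ((C , e) ∷ counts) = trans (List.length-++ (codes r G (sound C)))
      (cong₂ ℕ._+_ (trans (length-codes r G (sound C)) e) (length-allCodes counts))

    ∈-allCodes⁻ : ∀ {Gs ts} (counts : Pointwise HasUnitaryFactorCount Gs ts) {t} → t ∈ allCodes counts →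
      Good t × Any (λ G → product₂ t ≡ code r G) Gs
    ∈-allCodes⁻ {G ∷ _} ((C , _) ∷ counts) t∈ with ∈-++⁻ (codes r G (sound C)) t∈
    ... | inj₁ t∈′ = let good , e = ∈-codes⁻ r G (sound C) t∈′ in good , here e
    ... | inj₂ t∈′ = let good , i = ∈-allCodes⁻ counts t∈′ in good , there i

    ∈-allCodes⁺ : ∀ {Gs ts} (counts : Pointwise HasUnitaryFactorCount Gs ts) → All P Gs → ∀ {t} → Good t →
      Any (λ G → product₂ t ≡ code r G) Gs → t ∈ allCodes counts
    ∈-allCodes⁺ {G ∷ _} ((C , _) ∷ counts) (p ∷ _) good (here e) = ∈-++⁺ˡ (∈-codes⁺ r G (bounded p) C good e)
    ∈-allCodes⁺ {G ∷ _} ((C , _) ∷ counts) (_ ∷ ps) good (there i) = ∈-++⁺ʳ (codes r G (sound C)) (∈-allCodes⁺ counts ps good i)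

    allCodes-unique : ∀ {Gs ts} (counts : Pointwise HasUnitaryFactorCount Gs ts) → All P Gs →
      AllPairs (λ G H → ¬ group G ≅ group H) Gs → Unique (allCodes counts)
    allCodes-unique [] [] [] = []
    allCodes-unique {G ∷ _} ((C , _) ∷ counts) (p ∷ ps) (≇ ∷ distinct′) = Unique.++⁺
      (codes-unique r G (bounded p) (sound C) (distinct C)) (allCodes-unique counts ps distinct′)
      λ (t∈ , t∈′) → clash (proj₂ (∈-codes⁻ r G (sound C) t∈)) ps ≇ (proj₂ (∈-allCodes⁻ counts t∈′))
      where
      clash : ∀ {t Gs} → product₂ t ≡ code r G → All P Gs → All (λ H → ¬ group G ≅ group H) Gs →
        ¬ Any (λ H → product₂ t ≡ code r H) Gs
      clash {Gs = H ∷ _} e (q ∷ _) (≇ ∷ _) (here f) = ≇ (code-injective r G H (bounded p) (bounded q) (trans (sym e) f))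
      clash e (_ ∷ qs) (_ ∷ ≇s) (there i) = clash e qs ≇s i

    total≡tuples : (C : Classes P) → ∀ {ts} → Pointwise HasUnitaryFactorCount (representatives C) ts →
      sum ts ≡ length (tuples r n)
    total≡tuples C counts = trans (sym (length-allCodes counts)) (↭-length
      (unique-↭ (allCodes-unique counts (sound C) (distinct C)) (tuples-unique r n) to from))
      where
      light : ∀ {t Gs} → All P Gs → Any (λ G → product₂ t ≡ code r G) Gs → weight₂ t ≤ n
      light {t} {G ∷ _} (p ∷ _) (here e) = subst (_≤ n)
        (trans (order≡weight r G (bounded p)) (trans (cong weight (sym e)) (sym (weight-product₂ t)))) (proj₁ (P⇒ G p))
      light (_ ∷ ps) (there i) = light ps i
      to : ∀ {t} → t ∈ allCodes counts → t ∈ tuples r n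
      to t∈ = let good , i = ∈-allCodes⁻ counts t∈ in ∈-tuples⁺ good (light (sound C) i)
      from : ∀ {t} → t ∈ tuples r n → t ∈ allCodes counts
      -- Membership in a list of tuples is decidable, which removes the double negation from `⇒P`.
      from {t} t∈ = decidable-stable (DecMembership._∈?_ (Vec.≡-dec (Product.≡-dec ℕ._≟_ ℕ._≟_)) t (allCodes counts)) λ t∉ →
        let good , le = ∈-tuples⁻ r n t∈
            pos = product₂-positive good
        in ⇒P (product₂ t) pos (subst (_≤ n) (weight-product₂ t) le) λ p →
          t∉ (∈-allCodes⁺ counts (sound C) good (Any.map
            (λ {G} i → trans (sym (code-model r pos)) (code-≅ r (model r (product₂ t)) G i)) (complete C (model r (product₂ t)) p)))

    private
      vs : List (Vec ℕ r)
      vs = filter (λ v → weight v ℕ.≤? n) (vecs (range n) r)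

      vs-members : ∀ {v} → v ∈ vs → Positive v × weight v ≤ n
      vs-members v∈ = let v∈′ , le = ∈-filter⁻ (λ v → weight v ℕ.≤? n) {xs = vecs (range n) r} v∈ in
        VAll.map (λ k∈ → proj₁ (∈-range⁻ n k∈)) (∈-vecs⁻ (range n) v∈′) , le

      distinct-models : ∀ vs → All Positive vs → Unique vs → AllPairs (λ G H → ¬ group G ≅ group H) (map (model r) vs)
      distinct-models []       []       []          = []
      distinct-models (v ∷ vs) (p ∷ ps) (v∉vs ∷ vs!) =
        All.map⁺ (All.zipWith (λ (q , v≢w) → model-distinct r p q v≢w) (ps , v∉vs)) ∷ distinct-models vs ps vs!

      code∈vs : ∀ G → P G → code r G ∈ vs
      code∈vs G p = ∈-filter⁺ (λ v → weight v ℕ.≤? n)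
        (∈-vecs⁺ (range n) (VAll.map (λ (1≤k , k≤) → ∈-range⁺ 1≤k (ℕ.≤-trans k≤ w≤n)) (VAll.zip (pos , entries≤weight pos)))) w≤n
        where
        pos = code-positive r G
        w≤n : weight (code r G) ≤ n
        w≤n = subst (_≤ n) (order≡weight r G (bounded p)) (proj₁ (P⇒ G p))

      counts : ∀ {Gs} → All P Gs → ∃ (Pointwise HasUnitaryFactorCount Gs)
      counts [] = [] , []
      counts {G ∷ _} (p ∷ ps) =
        let t , c = unitaryFactorCount r G (bounded p)
            ts , cs = counts ps
        in t ∷ ts , c ∷ cs

    -- There are finitely many candidate codes, so the double negations for their models can be
    -- collected into one; after that everything is constructed.
    total-exists : ¬ ¬ (∃ λ s → Σ (Classes P) λ C → ∃ λ ts → Pointwise HasUnitaryFactorCount (representatives C) ts × sum ts ≡ s)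
    total-exists k = ¬¬-All (All.tabulate λ {v} v∈ → let pos , le = vs-members v∈ in ⇒P v pos le) λ ps →
      let ts , cs = counts (All.map⁺ ps) in k (sum ts , record
        { representatives = map (model r) vs
        ; sound    = All.map⁺ ps
        ; distinct = distinct-models vs (All.tabulate λ v∈ → proj₁ (vs-members v∈))
            (Unique.filter⁺ (λ v → weight v ℕ.≤? n) (vecs-unique (range n) (range-unique n) r))
        ; complete = λ G p → Any.map⁺ (Any.map (λ { refl → ≅-model r G (bounded p) (code-positive r G) refl }) (code∈vs G p))
        } , ts , cs , refl)

-- Passage from a real bound x to its integer part.

open import Defs
open import Data.Nat.Base as ℕ using (ℕ)
open import Data.Product.Base using (∃)

private
  module Main (r n : ℕ) (x : ℝ) (n≤x : fromℕ n ≤ x) (x<1+n : ∀ {m} → fromℕ m ≤ x → m ℕ.≤ n) where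
    open ≡ using (sym; subst)
    open LogEstimate using (≤-transʳ; fromℕ-monoʳ)
    open Conjugate using (bounded⇒conjugateRank; conjugateRank⇒bounded)
    open Codes using (Positive; weight; typeOf-isType; typeOf-bounded; ord-typeOf)
    open Classification using (IsBounded; type-isType; type-≅; model)

    P : FiniteAbelianGroup → Set₁
    P G = fromℕ (order G) ≤ x × ConjugateRank≤ r G

    P⇒ : ∀ G → P G → order G ℕ.≤ n × IsBounded r G
    P⇒ G (order≤x , rank≤r) = x<1+n order≤x , conjugateRank⇒bounded G (type-isType G) (type-≅ G) rank≤r

    ⇒P : ∀ v → Positive v → weight v ℕ.≤ n → ¬ ¬ P (model r v)
    ⇒P v pos w≤n k = bounded⇒conjugateRank (typeOf-isType r v) (typeOf-bounded r v) λ rank≤r →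
      k (≤-transʳ {fromℕ (order (model r v))} {fromℕ n} {x}
           (fromℕ-monoʳ (subst (ℕ._≤ n) (sym (ord-typeOf r pos)) w≤n)) n≤x , rank≤r)

    open Total.Count r n P P⇒ ⇒P public using (total≡tuples; total-exists)

corollary2 : (r : ℕ) → 1 ℕ.≤ r →
    ∃ λ (K : ℝ) → UnitaryFactorTotal r ∼ (λ x → K * (x * log⁺ x))
corollary2 r@(ℕ.suc r-1) _ = K , λ ε 0<ε →
  let X , estimate = asymptotic-∼ F ε 0<ε
      0≤ : ∀ x → fromℕ X ≤ x → fromℕ 0 ≤ x
      0≤ x X≤x = ≤-transʳ {fromℕ 0} {fromℕ X} {x} (fromℕ-monoʳ ℕ.z≤n) X≤x
  in fromℕ X , λ x X≤x →
    (λ k → integerPart x (0≤ x X≤x) λ (n , n≤x , _ , x<1+n) → Main.total-exists r n x n≤x x<1+n k) ,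
    λ { s (C , ts , counts , Σts≡s) → ≤-stable {∣ fromℕ s - K * (x * log⁺ x) ∣} {ε * ∣ K * (x * log⁺ x) ∣} λ k →
          integerPart x (0≤ x X≤x) λ (n , n≤x , x≤1+n , x<1+n) → k
            (subst (λ s → ∣ fromℕ s - K * (x * log⁺ x) ∣ ≤ ε * ∣ K * (x * log⁺ x) ∣)
              (trans (sym (Main.total≡tuples r n x n≤x x<1+n C counts)) Σts≡s) (estimate x X≤x n n≤x x≤1+n)) }
  where
  open ≡ using (sym; trans; subst)
  open LogEstimate
  F : Asymptotics.Asymptotic (Counting.T r)
  F = Counting.T-asymptotic r-1
  K : ℝ
  K = constant (Asymptotics.Asymptotic.isConstant F)
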